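{- Let $d \ge c \ge 2$ and $t \ge 2$ be integers such that $d$ and $t$ are primes and $d$ is odd. Let $q = t(d-c+1)+c-1$ and $k = td$, and suppose $d < \lfloor q/2\rfloor$. Then the promise problem $\mathrm{AlmostRainbow}(k, q, q-d, c)$ is $\mathsf{NP}$-hard.
   Context: A $k$-uniform hypergraph $H=(V,E)$ has hyperedges that are $k$-element subsets of $V$. A (proper) $c$-coloring of $H$ is a map $V\to[c]$ under which no hyperedge is monochromatic. A rainbow $(q,p)$-coloring of $H$ is a map $\chi:V\to[q]$ such that every hyperedge $e$ satisfies $|\chi(e)|\ge p$; $H$ is rainbow $(q,p)$-colorable if such a coloring exists. For $p\le q\le k$ with $p>\lceil q/2\rceil$, $\mathrm{AlmostRainbow}(k,q,p,c)$ is the promise problem: given a $k$-uniform hypergraph $H$, distinguish the Yes case "$H$ is rainbow $(q,p)$-colorable" from the No case "$H$ is not (properly) $c$-colorable". -}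

module Defs where

open import Data.Bool.Base using (Bool; true; false)
open import Data.Fin.Base using (Fin; zero)
open import Data.Fin.Properties using (any?) renaming (_≟_ to _≟ᶠ_)
open import Data.Fin.Subset using (Subset; _∈_; ∣_∣)
open import Data.Fin.Subset.Properties using (_∈?_)
open import Data.List.Base as List using (List; []; _∷_; _++_; length)
open import Data.List.Membership.Propositional using () renaming (_∈_ to _∈ˡ_)
open import Data.List.Properties using (∷-injectiveʳ)
open import Data.List.Relation.Unary.All as All using (All)
open import Data.Maybe.Base as Maybe using (Maybe; just; nothing)
open import Data.Nat.Base using (ℕ; zero; suc; _+_; _*_; _≤_)
open import Data.Nat.Properties using () renaming (≡-irrelevant to ℕ-≡-irrelevant)
open import Data.Product.Base using (Σ-syntax; ∃-syntax; _×_; _,_)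
open import Data.Vec.Base as Vec using (Vec; []; _∷_)
open import Function.Base using (_∘_)
open import Function.Bundles using (_⇔_)
open import Function.Definitions using (Injective)
open import Level using (0ℓ)
open import Relation.Binary.PropositionalEquality using (_≡_; refl; cong)
open import Relation.Nullary using (¬_; does)
open import Relation.Nullary.Decidable using (_×-dec_)
open import Relation.Unary using (Pred)

------------------------------------------------------------------------
-- Deterministic multi-tape Turing machines

data Symbol (g : ℕ) : Set where
  blank : Symbol g
  bit   : Bool → Symbol g
  mark  : Fin g → Symbol g

data Move : Set where
  moveLeft stay moveRight : Move

-- A two-way infinite tape.  `left` and `right` list the cells on either
-- side of the head, nearest first; all cells beyond them are blank.

record Tape (g : ℕ) : Set where
  constructor tape
  field
    left  : List (Symbol g)
    here  : Symbol g
    right : List (Symbol g)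

open Tape

-- Write a symbol, then move the head.

act : ∀ {g} → Symbol g × Move → Tape g → Tape g
act (s , stay)      (tape ls       _ rs)       = tape ls s rs
act (s , moveLeft)  (tape []       _ rs)       = tape [] blank (s ∷ rs)
act (s , moveLeft)  (tape (l ∷ ls) _ rs)       = tape ls l (s ∷ rs)
act (s , moveRight) (tape ls       _ [])       = tape (s ∷ ls) blank []
act (s , moveRight) (tape ls       _ (r ∷ rs)) = tape (s ∷ ls) r rs

-- The transition function has a finite domain, so every Agda function of
-- this type is a finite table; `nothing` means that the machine halts.

record TM : Set where
  field
    workTapes states marks : ℕ
    start : Fin states
    δ     : Fin states → Vec (Symbol marks) (suc workTapes) →
            Maybe (Fin states × Vec (Symbol marks × Move) (suc workTapes))

record Config (M : TM) : Set where
  constructor config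
  open TM M
  field
    state : Fin states
    tapes : Vec (Tape marks) (suc workTapes)

step : (M : TM) → Config M → Maybe (Config M)
step M (config s ts) =
  Maybe.map (λ (s′ , as) → config s′ (Vec.zipWith act as ts))
            (TM.δ M s (Vec.map here ts))

data HaltsIn (M : TM) : ℕ → Config M → Config M → Set where
  halted : ∀ {a} → step M a ≡ nothing → HaltsIn M 0 a a
  next   : ∀ {n a b z} → step M a ≡ just b → HaltsIn M n b z →
           HaltsIn M (suc n) a z

-- Tape 0 is both the input tape and the output tape.  The output is the
-- maximal block of bits that starts under the head and extends rightwards.

emptyTape : ∀ {g} → Tape g
emptyTape = tape [] blank []

inputTape : ∀ {g} → List Bool → Tape g
inputTape []       = emptyTape
inputTape (b ∷ bs) = tape [] (bit b) (List.map bit bs)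

initial : (M : TM) → List Bool → Config M
initial M x = config (TM.start M) (inputTape x ∷ Vec.replicate _ emptyTape)

leadingBits : ∀ {g} → List (Symbol g) → List Bool
leadingBits (bit b ∷ ss) = b ∷ leadingBits ss
leadingBits _            = []

output : ∀ {M} → Config M → List Bool
output c with Vec.lookup (Config.tapes c) zero
... | t = leadingBits (here t ∷ right t)

------------------------------------------------------------------------
-- Polynomial time, NP and NP-hardness

-- Polynomials with natural-number coefficients, constant term first.

Poly : Set
Poly = List ℕ

eval : Poly → ℕ → ℕ
eval as n = List.foldr (λ a r → a + n * r) 0 as

PolyTime : (List Bool → List Bool) → Set
PolyTime f =
  Σ[ M ∈ TM ] Σ[ p ∈ Poly ] (∀ x →
    ∃[ n ] ∃[ c ] (n ≤ eval p (length x)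
                   × HaltsIn M n (initial M x) c
                   × output c ≡ f x))

Language : Set₁
Language = Pred (List Bool) 0ℓ

-- The bits of x are doubled, so that the first aligned block 01 ends x.

pair : List Bool → List Bool → List Bool
pair []      w = false ∷ true ∷ w
pair (b ∷ x) w = b ∷ b ∷ pair x w

-- L has a polynomial-time verifier (accepting means outputting 1) with
-- certificates of polynomial length.

NP : Language → Set
NP L =
  Σ[ verify ∈ (List Bool → List Bool) ] Σ[ p ∈ Poly ]
    (PolyTime verify
     × (∀ x → L x ⇔ (∃[ w ] (length w ≤ eval p (length x)
                             × verify (pair x w) ≡ true ∷ []))))

record PromiseProblem : Set₁ where
  field
    Instance         : Set
    encode           : Instance → List Bool
    encode-injective : Injective _≡_ _≡_ encode
    Yes No           : Pred Instance 0ℓ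

-- Every language in NP has a polynomial-time many-one reduction to P.

NPHard : PromiseProblem → Set₁
NPHard P = (L : Language) → NP L →
  Σ[ f ∈ (List Bool → Instance) ]
    (PolyTime (encode ∘ f)
     × (∀ x → L x → Yes (f x))
     × (∀ x → ¬ L x → No (f x)))
  where open PromiseProblem P

------------------------------------------------------------------------
-- Uniform hypergraphs and their colorings

-- The vertex set is Fin vertices, and the set of hyperedges is the set of
-- members of `edges` (order and repetitions have no bearing on colorings).

record Hypergraph (k : ℕ) : Set where
  field
    vertices : ℕ
    edges    : List (Subset vertices)
    uniform  : All (λ e → ∣ e ∣ ≡ k) edges

Monochromatic : ∀ {n c} → (Fin n → Fin c) → Subset n → Set
Monochromatic χ e = ∃[ a ] (∀ v → v ∈ e → χ v ≡ a)

Colorable : ∀ {k} → ℕ → Hypergraph k → Set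
Colorable c H =
  Σ[ χ ∈ (Fin vertices → Fin c) ] (∀ e → e ∈ˡ edges → ¬ Monochromatic χ e)
  where open Hypergraph H

image : ∀ {n q} → (Fin n → Fin q) → Subset n → Subset q
image χ e = Vec.tabulate λ a → does (any? λ v → (v ∈? e) ×-dec (χ v ≟ᶠ a))

RainbowColorable : ∀ {k} → ℕ → ℕ → Hypergraph k → Set
RainbowColorable q p H =
  Σ[ χ ∈ (Fin vertices → Fin q) ] (∀ e → e ∈ˡ edges → p ≤ ∣ image χ e ∣)
  where open Hypergraph H

-- The number n of vertices in unary, closed by 0, followed by each
-- hyperedge as a 1 and its characteristic vector of n bits.

encodeEdges : ∀ {n} → List (Subset n) → List Bool
encodeEdges []       = []
encodeEdges (e ∷ es) = true ∷ Vec.toList e ++ encodeEdges es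

encodeHypergraph : ∀ {k} → Hypergraph k → List Bool
encodeHypergraph H = List.replicate vertices true ++ false ∷ encodeEdges edges
  where open Hypergraph H

private
  toList-++-injective : ∀ {n} (u v : Subset n) {xs ys} →
    Vec.toList u ++ xs ≡ Vec.toList v ++ ys → u ≡ v × xs ≡ ys
  toList-++-injective []      []      eq = refl , eq
  toList-++-injective (a ∷ u) (b ∷ v) eq
    with refl ← cong List.head eq
    with refl , eq′ ← toList-++-injective u v (∷-injectiveʳ eq) = refl , eq′

  encodeEdges-injective : ∀ {n} (es fs : List (Subset n)) →
    encodeEdges es ≡ encodeEdges fs → es ≡ fs
  encodeEdges-injective []       []       eq = refl
  encodeEdges-injective (e ∷ es) (f ∷ fs) eq
    with refl , eq′ ← toList-++-injective e f (∷-injectiveʳ eq) =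
    cong (e ∷_) (encodeEdges-injective es fs eq′)

  unary-injective : ∀ m n {xs ys} →
    List.replicate m true ++ false ∷ xs ≡ List.replicate n true ++ false ∷ ys →
    m ≡ n × xs ≡ ys
  unary-injective zero    zero    eq = refl , ∷-injectiveʳ eq
  unary-injective (suc m) (suc n) eq
    with refl , eq′ ← unary-injective m n (∷-injectiveʳ eq) = refl , eq′

encodeHypergraph-injective : ∀ {k} → Injective _≡_ _≡_ (encodeHypergraph {k})
encodeHypergraph-injective
  {x = record { vertices = m ; edges = es ; uniform = u }}
  {y = record { vertices = n ; edges = fs ; uniform = w }} eq
  with refl , eq′ ← unary-injective m n eq
  with refl ← encodeEdges-injective es fs eq′
  with refl ← All.irrelevant ℕ-≡-irrelevant u w = refl

-- Meaningful as a promise problem when p ≤ q ≤ k, ⌈ q /2⌉ < p and 2 ≤ c: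
-- merging the q colors into two classes of size at most ⌈ q /2⌉ shows that
-- the two cases are then disjoint.

AlmostRainbow : (k q p c : ℕ) → PromiseProblem
AlmostRainbow k q p c = record
  { Instance         = Hypergraph k
  ; encode           = encodeHypergraph
  ; encode-injective = encodeHypergraph-injective
  ; Yes              = RainbowColorable q p
  ; No               = λ H → ¬ Colorable c H
  }

{-# OPTIONS --safe #-}
module Submission where

-- Let p be an odd prime.  The tuples of nonempty subsets of ℤ/p form a free
-- ℤ/p-complex on which the powers of the Bockstein class do not vanish, so its
-- skeleta admit no equivariant monotone map into a join of too few boundaries of
-- simplices.  For p = d this finds, under every c-coloring of a cloud [d]^L, d rows
-- of one color that show all d symbols in all but boundedly many of the L columns;
-- for p = t it finds t injective d-tuples of one color whose entries cover [q].
-- Hence a c-coloring of the cloud [q]^L, whose columns are the assignments to m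
-- variables of a binary constraint system, selects boundedly many candidate
-- assignments.  The hyperedges are the t × d arrays of vertices that a satisfying
-- assignment colors with at least q − d symbols.  If no two of t clouds had candidates
-- that agree, the blocks found in these clouds would form a monochromatic
-- hyperedge; so agreeing candidates are common enough to be glued to a solution.
--
-- No PCP is needed: m is a constant, but all tuples of m variables have a cloud.
-- The constraints describe the tableau of the verifier, and the instance is
-- printed by nested loops over the positions of a word of polynomial length.

-- The topology is carried out on cochains alone: `E k` pairs a cochain with a chain built from the
-- periodic resolution of ℤ/p, and the contradiction is 1 ≡ 0 mod p. The cocycles `b` live in even
-- degrees, so c(d - 1) and c(t - 1) have to be even; d is odd by assumption, and d < ⌊q/2⌋ excludes
-- t = 2. The value of q is the largest one with q + c(t - 1) < t(d + 1), the pigeonhole behind the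
-- covering of [q]. The loss of d symbols has this origin: for labels of the t clouds that respect
-- constraints and overlaps, at most one cloud has its label among its exceptional columns, since
-- two such clouds would have agreeing candidates. Every other cloud shows its whole block, so only
-- the d symbols of one block can be missing. There is no circle in the constants: the numbers of
-- exceptional columns and of types of clouds are independent of m. So m is chosen after them, and
-- the δ^m columns of a cloud then outnumber the exceptional ones. Excluded middle and finite choice
-- are used under double negation, which is enough because the No case is a negation.

-- Cochains on tuples, and a degree modulo p from the periodic resolution of ℤ/p.

module IndexTheorem where

  open import Data.Bool.Base using (true; false; if_then_else_; T)
  open import Data.Empty using (⊥-elim)
  open import Data.Integer.Base using (ℤ; +_; _+_; _-_; _*_; 0ℤ; 1ℤ)
  open import Data.Integer.Properties using (*-cancelˡ-≡; pos-+; *-zeroʳ; +-identityˡ)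
  open import Data.Integer.Tactic.RingSolver using (solve-∀)
  open import Data.Nat.Base as ℕ using (ℕ; zero; suc; _<_; _<ᵇ_; s≤s; z≤n)
  import Data.Nat.Properties as ℕₚ
  open import Data.Nat.Divisibility using (∣1⇒≡1)
  open import Data.Integer.Divisibility.Signed using (divides; ∣⇒∣ᵤ)
  open import Data.Product.Base using (∃-syntax; _×_; _,_)
  open import Data.Sum.Base using (_⊎_; inj₁; inj₂)
  open import Data.Vec.Base using (Vec; []; _∷_; map)
  open import Data.Vec.Relation.Unary.All as All using (All; []; _∷_)
  import Data.Vec.Relation.Unary.All.Properties as Allₚ
  open import Function.Base using (_∘_)
  open import Relation.Binary.PropositionalEquality
  open import Relation.Nullary using (¬_)
  open ≡-Reasoning

  double : ℕ → ℕ
  double zero    = zero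
  double (suc j) = suc (suc (double j))

  double-mono : ∀ {i j} → i ℕ.≤ j → double i ℕ.≤ double j
  double-mono z≤n     = z≤n
  double-mono (s≤s h) = s≤s (s≤s (double-mono h))

  -- Indexed by the number of vertices, one more than the simplicial degree; `Cochain X 0` is the
  -- augmentation term.
  Cochain : Set → ℕ → Set
  Cochain X n = Vec X n → ℤ

  -- The simplicial coboundary, the alternating sum over deleted entries, unfolded along the first
  -- entry so that the identities below are inductions on the tuple.
  d : ∀ {X n} → Cochain X n → Cochain X (suc n)
  d {n = zero}  φ (x ∷ []) = φ []
  d {n = suc n} φ (x ∷ xs) = φ xs - d (λ ys → φ (x ∷ ys)) xs

  -- The alternating sum of φ(P x₀, ..., P xᵢ, Q xᵢ, ..., Q xₙ), dual to the usual triangulation of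
  -- a prism.
  prism : ∀ {X Y n} (P Q : X → Y) → Cochain Y (suc n) → Cochain X n
  prism P Q φ []       = 0ℤ
  prism P Q φ (x ∷ xs) = φ (P x ∷ Q x ∷ map Q xs) - prism P Q (λ ys → φ (P x ∷ ys)) xs

  d-cong : ∀ {X n} {φ ψ : Cochain X n} → (∀ ys → φ ys ≡ ψ ys) → ∀ xs → d φ xs ≡ d ψ xs
  d-cong {n = zero}  eq (x ∷ []) = eq []
  d-cong {n = suc n} eq (x ∷ xs) = cong₂ _-_ (eq xs) (d-cong (λ ys → eq (x ∷ ys)) xs)

  d-minus : ∀ {X n} (φ ψ : Cochain X n) xs → d (λ ys → φ ys - ψ ys) xs ≡ d φ xs - d ψ xs
  d-minus {n = zero}  φ ψ (x ∷ []) = refl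
  d-minus {n = suc n} φ ψ (x ∷ xs) = trans
    (cong (λ z → (φ xs - ψ xs) - z) (d-minus (λ ys → φ (x ∷ ys)) (λ ys → ψ (x ∷ ys)) xs))
    (lemma (φ xs) (ψ xs) _ _)
    where
    lemma : ∀ a b c e → (a - b) - (c - e) ≡ (a - c) - (b - e)
    lemma = solve-∀

  d-plus : ∀ {X n} (φ ψ : Cochain X n) xs → d (λ ys → φ ys + ψ ys) xs ≡ d φ xs + d ψ xs
  d-plus {n = zero}  φ ψ (x ∷ []) = refl
  d-plus {n = suc n} φ ψ (x ∷ xs) = trans
    (cong (λ z → (φ xs + ψ xs) - z) (d-plus (λ ys → φ (x ∷ ys)) (λ ys → ψ (x ∷ ys)) xs))
    (lemma (φ xs) (ψ xs) _ _)
    where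
    lemma : ∀ a b c e → (a + b) - (c + e) ≡ (a - c) + (b - e)
    lemma = solve-∀

  d-zero : ∀ {X n} (xs : Vec X (suc n)) → d (λ _ → 0ℤ) xs ≡ 0ℤ
  d-zero {n = zero}  (x ∷ []) = refl
  d-zero {n = suc n} (x ∷ xs) = cong (λ z → 0ℤ - z) (d-zero xs)

  d-scale : ∀ {X n} k (φ : Cochain X n) xs → d (λ ys → k * φ ys) xs ≡ k * d φ xs
  d-scale {n = zero}  k φ (x ∷ []) = refl
  d-scale {n = suc n} k φ (x ∷ xs) = trans
    (cong (λ z → k * φ xs - z) (d-scale k (λ ys → φ (x ∷ ys)) xs)) (lemma k (φ xs) _)
    where
    lemma : ∀ k a b → k * a - k * b ≡ k * (a - b)
    lemma = solve-∀

  d-map : ∀ {X Y n} (f : X → Y) (φ : Cochain Y n) xs → d (φ ∘ map f) xs ≡ d φ (map f xs)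
  d-map {n = zero}  f φ (x ∷ []) = refl
  d-map {n = suc n} f φ (x ∷ xs) = cong (φ (map f xs) -_) (d-map f (λ ys → φ (f x ∷ ys)) xs)

  d∘d : ∀ {X n} (φ : Cochain X n) xs → d (d φ) xs ≡ 0ℤ
  d∘d {n = zero}  φ (x ∷ y ∷ []) = lemma (φ [])
    where
    lemma : ∀ a → a - a ≡ 0ℤ
    lemma = solve-∀
  d∘d {n = suc n} φ (x ∷ xs) = begin
    d φ xs - d (λ ys → φ ys - d (λ zs → φ (x ∷ zs)) ys) xs
      ≡⟨ cong (d φ xs -_) (d-minus φ (d (λ zs → φ (x ∷ zs))) xs) ⟩
    d φ xs - (d φ xs - d (d (λ zs → φ (x ∷ zs))) xs)
      ≡⟨ cong (λ z → d φ xs - (d φ xs - z)) (d∘d (λ zs → φ (x ∷ zs)) xs) ⟩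
    d φ xs - (d φ xs - 0ℤ) ≡⟨ lemma (d φ xs) ⟩
    0ℤ ∎
    where
    lemma : ∀ a → a - (a - 0ℤ) ≡ 0ℤ
    lemma = solve-∀

  prism-cong : ∀ {X Y n} {P Q : X → Y} {φ ψ : Cochain Y (suc n)} →
               (∀ ys → φ ys ≡ ψ ys) → ∀ xs → prism P Q φ xs ≡ prism P Q ψ xs
  prism-cong eq []       = refl
  prism-cong eq (x ∷ xs) = cong₂ _-_ (eq _) (prism-cong (λ ys → eq (_ ∷ ys)) xs)

  prism-zero : ∀ {X Y n} (P Q : X → Y) (xs : Vec X n) → prism P Q (λ _ → 0ℤ) xs ≡ 0ℤ
  prism-zero P Q []       = refl
  prism-zero P Q (x ∷ xs) = cong (λ z → 0ℤ - z) (prism-zero P Q xs)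

  prism-minus : ∀ {X Y n} (P Q : X → Y) (φ ψ : Cochain Y (suc n)) xs →
    prism P Q (λ ys → φ ys - ψ ys) xs ≡ prism P Q φ xs - prism P Q ψ xs
  prism-minus P Q φ ψ []       = refl
  prism-minus P Q φ ψ (x ∷ xs) = trans
    (cong (λ z → (φ (P x ∷ Q x ∷ map Q xs) - ψ (P x ∷ Q x ∷ map Q xs)) - z)
          (prism-minus P Q (λ ys → φ (P x ∷ ys)) (λ ys → ψ (P x ∷ ys)) xs))
    (lemma (φ (P x ∷ Q x ∷ map Q xs)) (ψ (P x ∷ Q x ∷ map Q xs)) _ _)
    where
    lemma : ∀ a b c e → (a - b) - (c - e) ≡ (a - c) - (b - e)
    lemma = solve-∀

  prism-scale : ∀ {X Y n} (P Q : X → Y) k (φ : Cochain Y (suc n)) xs →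
    prism P Q (λ ys → k * φ ys) xs ≡ k * prism P Q φ xs
  prism-scale P Q k φ []       = sym (*-zeroʳ k)
  prism-scale P Q k φ (x ∷ xs) = trans
    (cong (λ z → k * φ (P x ∷ Q x ∷ map Q xs) - z) (prism-scale P Q k (λ ys → φ (P x ∷ ys)) xs))
    (lemma k _ _)
    where
    lemma : ∀ k a b → k * a - k * b ≡ k * (a - b)
    lemma = solve-∀

  -- The terms in φ₂ and the shorter prisms of φ cancel. What is left is the claim for φ₁, which has
  -- `P x` fixed in front, plus two end values, so the whole sum telescopes from P to Q.
  prism-homotopy : ∀ {X Y n} (P Q : X → Y) (φ : Cochain Y (suc n)) xs →
    d (prism P Q φ) xs + prism P Q (d φ) xs ≡ φ (map Q xs) - φ (map P xs)
  prism-homotopy {n = zero}  P Q φ (x ∷ []) = lemma (φ (Q x ∷ [])) (φ (P x ∷ []))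
    where
    lemma : ∀ a b → 0ℤ + ((a - b) - 0ℤ) ≡ a - b
    lemma = solve-∀
  prism-homotopy {n = suc n} P Q φ (x ∷ xs) = begin
    (prism P Q φ xs - d (λ ys → φ₂ (map Q ys) - prism P Q φ₁ ys) xs) +
    ((φ (Q x ∷ map Q xs) - (φ₁ (map Q xs) - d φ₂ (map Q xs)))
     - prism P Q (λ ys → φ ys - d φ₁ ys) xs)
      ≡⟨ cong₂ (λ u v → (prism P Q φ xs - u) + ((φ (Q x ∷ map Q xs) - (φ₁ (map Q xs) - d φ₂ (map Q xs))) - v))
           (trans (d-minus (φ₂ ∘ map Q) (prism P Q φ₁) xs) (cong (_- d (prism P Q φ₁) xs) (d-map Q φ₂ xs)))
           (prism-minus P Q φ (d φ₁) xs) ⟩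
    (prism P Q φ xs - (d φ₂ (map Q xs) - d (prism P Q φ₁) xs)) +
    ((φ (Q x ∷ map Q xs) - (φ₁ (map Q xs) - d φ₂ (map Q xs)))
     - (prism P Q φ xs - prism P Q (d φ₁) xs))
      ≡⟨ lemma (prism P Q φ xs) (d φ₂ (map Q xs)) _ (φ (Q x ∷ map Q xs)) (φ₁ (map Q xs)) _ ⟩
    φ (Q x ∷ map Q xs) - φ₁ (map Q xs) + (d (prism P Q φ₁) xs + prism P Q (d φ₁) xs)
      ≡⟨ cong (λ z → φ (Q x ∷ map Q xs) - φ₁ (map Q xs) + z) (prism-homotopy P Q φ₁ xs) ⟩
    φ (Q x ∷ map Q xs) - φ₁ (map Q xs) + (φ₁ (map Q xs) - φ₁ (map P xs))
      ≡⟨ lemma′ (φ (Q x ∷ map Q xs)) (φ₁ (map Q xs)) _ ⟩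
    φ (Q x ∷ map Q xs) - φ₁ (map P xs) ∎
    where
    φ₁ = λ ys → φ (P x ∷ ys)
    φ₂ = λ ys → φ (P x ∷ Q x ∷ ys)
    lemma : ∀ a b c e f g → (a - (b - c)) + ((e - (f - b)) - (a - g)) ≡ e - f + (c + g)
    lemma = solve-∀
    lemma′ : ∀ a b c → a - b + (b - c) ≡ a - c
    lemma′ = solve-∀

  -- Taken over a relation because it is used twice: with equality it singles out the degenerate
  -- tuples, and with equality of residues the tuples on which the cocycles `b` vanish.
  data Repeats {X : Set} (_~_ : X → X → Set) : ∀ {n} → Vec X n → Set where
    here  : ∀ {n x y} {xs : Vec X n} → x ~ y → Repeats _~_ (x ∷ y ∷ xs)
    there : ∀ {n x} {xs : Vec X n} → Repeats _~_ xs → Repeats _~_ (x ∷ xs)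

  Normalized : ∀ {X n} → Cochain X n → Set
  Normalized φ = ∀ xs → Repeats _≡_ xs → φ xs ≡ 0ℤ

  Repeats-map : ∀ {X Y : Set} {n} (f : X → Y) {xs : Vec X n} → Repeats _≡_ xs → Repeats _≡_ (map f xs)
  Repeats-map f (here eq) = here (cong f eq)
  Repeats-map f (there r) = there (Repeats-map f r)

  prism-normalized : ∀ {X Y n} (P Q : X → Y) {φ : Cochain Y (suc n)} →
                     Normalized φ → Normalized (prism P Q φ)
  prism-normalized P Q {φ} nφ (x ∷ y ∷ xs) (here refl) = cong₂ _-_
    (nφ _ (there (here refl)))
    (cong₂ _-_ (nφ _ (here refl))
      (trans (prism-cong (λ ys → nφ (P x ∷ P x ∷ ys) (here refl)) xs) (prism-zero P Q xs)))
  prism-normalized P Q {φ} nφ (x ∷ xs) (there r) = cong₂ _-_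
    (nφ _ (there (there (Repeats-map Q r))))
    (prism-normalized P Q (λ ys r′ → nφ _ (there r′)) xs r)

  -- A contraction of the augmented complex of tuples onto the vertex `base`.
  record Contraction (X : Set) : Set where
    field
      base      : X
      K         : ∀ {n} → Cochain X (suc n) → Cochain X n
      K-cong    : ∀ {n} {φ ψ : Cochain X (suc n)} → (∀ ys → φ ys ≡ ψ ys) → ∀ xs → K φ xs ≡ K ψ xs
      K-minus   : ∀ {n} (φ ψ : Cochain X (suc n)) xs → K (λ ys → φ ys - ψ ys) xs ≡ K φ xs - K ψ xs
      K-scale   : ∀ {n} k (φ : Cochain X (suc n)) xs → K (λ ys → k * φ ys) xs ≡ k * K φ xs
      K-norm    : ∀ {n} {φ : Cochain X (suc n)} → Normalized φ → Normalized (K φ)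
      contracts : ∀ {n} (φ : Cochain X (suc n)) xs →
                  d (K φ) xs + K (d φ) xs ≡ φ xs - φ (map (λ _ → base) xs)

  module Resolution {X : Set} (C : Contraction X) (g : X → X) (p : ℕ) where
    open Contraction C

    turn : ∀ {n} → ℕ → Vec X n → Vec X n
    turn zero    xs = xs
    turn (suc m) xs = turn m (map g xs)

    difference : ∀ {n} → Cochain X n → Cochain X n
    difference φ xs = φ (map g xs) - φ xs

    orbitSum : ∀ {n} → ℕ → Cochain X n → Cochain X n
    orbitSum zero    φ xs = 0ℤ
    orbitSum (suc m) φ xs = φ xs + orbitSum m φ (map g xs)

    -- The differentials of the periodic resolution of ℤ over the group ring of ℤ/p: g - 1 and the
    -- norm in alternation.
    D : ∀ {n} → ℕ → Cochain X n → Cochain X n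
    D zero          = difference
    D (suc zero)    = orbitSum p
    D (suc (suc k)) = D k

    -- Evaluation on a k-chain: the next chain is the cone, by the dual of `K`, over `D k` applied
    -- to the current one. These chains are the images of the generators of the periodic resolution;
    -- only their pairing with cochains is recorded.
    E : ∀ k → Cochain X (suc k) → ℤ
    E zero    φ = φ (base ∷ [])
    E (suc k) φ = E k (D k (K φ))

    orbitSum-cong : ∀ {n} m {φ ψ : Cochain X n} → (∀ ys → φ ys ≡ ψ ys) → ∀ xs → orbitSum m φ xs ≡ orbitSum m ψ xs
    orbitSum-cong zero    eq xs = refl
    orbitSum-cong (suc m) eq xs = cong₂ _+_ (eq xs) (orbitSum-cong m eq _)

    orbitSum-minus : ∀ {n} m (φ ψ : Cochain X n) xs →
      orbitSum m (λ ys → φ ys - ψ ys) xs ≡ orbitSum m φ xs - orbitSum m ψ xs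
    orbitSum-minus zero    φ ψ xs = refl
    orbitSum-minus (suc m) φ ψ xs =
      trans (cong (λ z → φ xs - ψ xs + z) (orbitSum-minus m φ ψ _)) (lemma (φ xs) (ψ xs) _ _)
      where
      lemma : ∀ a b c e → (a - b) + (c - e) ≡ (a + c) - (b + e)
      lemma = solve-∀

    orbitSum-scale : ∀ {n} m k (φ : Cochain X n) xs → orbitSum m (λ ys → k * φ ys) xs ≡ k * orbitSum m φ xs
    orbitSum-scale zero    k φ xs = sym (*-zeroʳ k)
    orbitSum-scale (suc m) k φ xs = trans (cong (λ z → k * φ xs + z) (orbitSum-scale m k φ _)) (lemma k _ _)
      where
      lemma : ∀ k a b → k * a + k * b ≡ k * (a + b)
      lemma = solve-∀

    D-cong : ∀ {n} k {φ ψ : Cochain X n} → (∀ ys → φ ys ≡ ψ ys) → ∀ xs → D k φ xs ≡ D k ψ xs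
    D-cong zero          eq xs = cong₂ _-_ (eq _) (eq _)
    D-cong (suc zero)    eq xs = orbitSum-cong p eq xs
    D-cong (suc (suc k)) eq xs = D-cong k eq xs

    D-minus : ∀ {n} k (φ ψ : Cochain X n) xs → D k (λ ys → φ ys - ψ ys) xs ≡ D k φ xs - D k ψ xs
    D-minus zero          φ ψ xs = lemma (φ (map g xs)) (ψ (map g xs)) (φ xs) (ψ xs)
      where
      lemma : ∀ a b c e → (a - b) - (c - e) ≡ (a - c) - (b - e)
      lemma = solve-∀
    D-minus (suc zero)    φ ψ xs = orbitSum-minus p φ ψ xs
    D-minus (suc (suc k)) φ ψ xs = D-minus k φ ψ xs

    D-scale : ∀ {n} j k (φ : Cochain X n) xs → D j (λ ys → k * φ ys) xs ≡ k * D j φ xs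
    D-scale zero          k φ xs = lemma k (φ (map g xs)) (φ xs)
      where
      lemma : ∀ k a b → k * a - k * b ≡ k * (a - b)
      lemma = solve-∀
    D-scale (suc zero)    k φ xs = orbitSum-scale p k φ xs
    D-scale (suc (suc j)) k φ xs = D-scale j k φ xs

    D-d : ∀ {n} k (φ : Cochain X n) xs → D k (d φ) xs ≡ d (D k φ) xs
    D-d zero φ xs = sym (trans (d-minus (φ ∘ map g) φ xs) (cong (_- d φ xs) (d-map g φ xs)))
    D-d (suc zero) φ xs = go p xs
      where
      go : ∀ m xs → orbitSum m (d φ) xs ≡ d (orbitSum m φ) xs
      go zero    xs = sym (d-zero xs)
      go (suc m) xs = sym (trans (d-plus φ (orbitSum m φ ∘ map g) xs)
        (cong (λ z → d φ xs + z) (trans (d-map g (orbitSum m φ) xs) (sym (go m (map g xs))))))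
    D-d (suc (suc k)) φ xs = D-d k φ xs

    D-norm : ∀ {n} k {φ : Cochain X n} → Normalized φ → Normalized (D k φ)
    D-norm zero nφ xs r = cong₂ _-_ (nφ _ (Repeats-map g r)) (nφ _ r)
    D-norm (suc zero) {φ} nφ xs r = go p xs r
      where
      go : ∀ m → Normalized (orbitSum m φ)
      go zero    xs r = refl
      go (suc m) xs r = cong₂ _+_ (nφ _ r) (go m _ (Repeats-map g r))
    D-norm (suc (suc k)) nφ xs r = D-norm k nφ xs r

    E-cong : ∀ k {φ ψ} → (∀ ys → φ ys ≡ ψ ys) → E k φ ≡ E k ψ
    E-cong zero    eq = eq _
    E-cong (suc k) eq = E-cong k (D-cong k (K-cong eq))

    E-minus : ∀ k φ ψ → E k (λ ys → φ ys - ψ ys) ≡ E k φ - E k ψ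
    E-minus zero    φ ψ = refl
    E-minus (suc k) φ ψ = trans
      (E-cong k (λ ys → trans (D-cong k (K-minus φ ψ) ys) (D-minus k _ _ ys))) (E-minus k _ _)

    E-scale : ∀ j k φ → E j (λ ys → k * φ ys) ≡ k * E j φ
    E-scale zero    k φ = refl
    E-scale (suc j) k φ = trans
      (E-cong j (λ ys → trans (D-cong j (K-scale k φ) ys) (D-scale j k _ ys))) (E-scale j k _)

    module _ (turn-id : ∀ {n} (xs : Vec X n) → turn p xs ≡ xs) where

      telescope : ∀ {n} m (φ : Cochain X n) xs →
                  orbitSum m φ (map g xs) - orbitSum m φ xs ≡ φ (turn m xs) - φ xs
      telescope zero    φ xs = sym (lemma (φ xs))
        where
        lemma : ∀ a → a - a ≡ 0ℤ
        lemma = solve-∀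
      telescope (suc m) φ xs = trans
        (lemma (φ (map g xs)) _ (φ xs) _)
        (trans (cong (λ z → φ (map g xs) - φ xs + z) (telescope m φ (map g xs))) (lemma′ (φ (map g xs)) (φ xs) (φ (turn m (map g xs)))))
        where
        lemma : ∀ a b c e → (a + b) - (c + e) ≡ a - c + (b - e)
        lemma = solve-∀
        lemma′ : ∀ a b c → a - b + (c - a) ≡ c - b
        lemma′ = solve-∀

      difference-orbitSum : ∀ {n} (φ : Cochain X n) xs → difference (orbitSum p φ) xs ≡ 0ℤ
      difference-orbitSum φ xs = trans (telescope p φ xs)
        (trans (cong (λ ys → φ ys - φ xs) (turn-id xs)) (lemma (φ xs)))
        where
        lemma : ∀ a → a - a ≡ 0ℤ
        lemma = solve-∀

      D∘D : ∀ {n} k (φ : Cochain X n) xs → D k (D (suc k) φ) xs ≡ 0ℤ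
      D∘D zero          φ xs = difference-orbitSum φ xs
      D∘D (suc zero)    φ xs = trans (orbitSum-minus p (φ ∘ map g) φ xs)
        (trans (cong (_- orbitSum p φ xs) (go p xs)) (difference-orbitSum φ xs))
        where
        go : ∀ m xs → orbitSum m (φ ∘ map g) xs ≡ orbitSum m φ (map g xs)
        go zero    xs = refl
        go (suc m) xs = cong (λ z → φ (map g xs) + z) (go m (map g xs))
      D∘D (suc (suc k)) φ xs = D∘D k φ xs

      E-zero : ∀ k {φ} → (∀ ys → φ ys ≡ 0ℤ) → E k φ ≡ 0ℤ
      E-zero k {φ} eq = trans (E-cong k (λ ys → trans (eq ys) (sym (lemma (φ ys)))))
        (trans (E-minus k φ φ) (lemma (E k φ)))
        where
        lemma : ∀ a → a - a ≡ 0ℤ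
        lemma = solve-∀

      -- Dually, the boundary of chain k + 1 is `D k` of chain k. Rewriting K ∘ d by `contracts`
      -- leaves two error terms. The constant one is killed by normalization, or by the difference
      -- when k = 0; the exact one by induction, because `D k` commutes with d and consecutive `D`
      -- compose to zero.
      boundary : ∀ k (φ : Cochain X (suc k)) → Normalized φ → E (suc k) (d φ) ≡ E k (D k φ)
      boundary k φ nφ = begin
        E k (D k (K (d φ)))
          ≡⟨ E-cong k (D-cong k (λ xs → trans (lemma _ (d (K φ) xs)) (cong (_- d (K φ) xs) (contracts φ xs)))) ⟩
        E k (D k (λ xs → φ xs - φ₀ xs - d (K φ) xs))
          ≡⟨ E-cong k (λ xs → trans (D-minus k _ _ xs) (cong (_- D k (d (K φ)) xs) (D-minus k φ φ₀ xs))) ⟩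
        E k (λ xs → D k φ xs - D k φ₀ xs - D k (d (K φ)) xs)
          ≡⟨ trans (E-minus k _ _) (cong (_- E k (D k (d (K φ)))) (E-minus k _ _)) ⟩
        E k (D k φ) - E k (D k φ₀) - E k (D k (d (K φ)))
          ≡⟨ cong₂ (λ u v → E k (D k φ) - u - v) (constant k φ nφ) (exact k φ nφ) ⟩
        E k (D k φ) - 0ℤ - 0ℤ ≡⟨ lemma′ (E k (D k φ)) ⟩
        E k (D k φ) ∎
        where
        φ₀ = λ xs → φ (map (λ _ → base) xs)
        lemma : ∀ a b → a ≡ b + a - b
        lemma = solve-∀
        lemma′ : ∀ a → a - 0ℤ - 0ℤ ≡ a
        lemma′ = solve-∀
        self : ∀ a → a - a ≡ 0ℤ
        self = solve-∀
        constant : ∀ k φ → Normalized φ → E k (D k (λ xs → φ (map (λ _ → base) xs))) ≡ 0ℤ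
        constant zero    φ nφ = self (φ (base ∷ []))
        constant (suc k) φ nφ = E-zero (suc k) (λ xs → trans
          (D-cong (suc k) {ψ = λ _ → 0ℤ} (λ { (x ∷ y ∷ ys) → nφ _ (here refl) }) xs)
          (trans (D-minus (suc k) (λ _ → 0ℤ) (λ _ → 0ℤ) xs) (self (D (suc k) (λ _ → 0ℤ) xs))))
        exact : ∀ k φ → Normalized φ → E k (D k (d (K φ))) ≡ 0ℤ
        exact zero    φ nφ = self (K φ [])
        exact (suc k) φ nφ = begin
          E (suc k) (D (suc k) (d (K φ))) ≡⟨ E-cong (suc k) (D-d (suc k) (K φ)) ⟩
          E (suc k) (d (D (suc k) (K φ))) ≡⟨ boundary k _ (D-norm (suc k) (K-norm nφ)) ⟩
          E k (D k (D (suc k) (K φ)))     ≡⟨ E-zero k (D∘D k (K φ)) ⟩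
          0ℤ ∎

  -- The cochains `b j` represent the powers of the Bockstein of the generator of
  -- H¹(ℤ/p), which `r` pulls back to X.
  module Degree {X : Set} (C : Contraction X) (g : X → X) (p : ℕ)
    (turn-id : ∀ {n} (xs : Vec X n) → Resolution.turn C g p p xs ≡ xs)
    (1<p : 1 < p) (r : X → ℕ) (r<p : ∀ x → r x < p)
    (OK : X → Set) (OK-g : ∀ {x} → OK x → OK (g x))
    (r-g : ∀ {x} → OK x → (r (g x) ≡ suc (r x)) ⊎ (suc (r x) ≡ p × r (g x) ≡ 0))
    (Flag : ∀ k → Vec X (suc k) → Set)
    (flag-base : Flag 0 (Contraction.base C ∷ []))
    (flag-g : ∀ {k xs} → Flag k xs → Flag k (map g xs))
    (K-local : ∀ {k φ} → (∀ ys → Flag (suc k) ys → φ ys ≡ 0ℤ) →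
               ∀ xs → Flag k xs → Contraction.K C φ xs ≡ 0ℤ)
    (J : ℕ) (flag-OK : ∀ {k xs} → k ℕ.≤ double J → Flag k xs → All OK xs) where

    open Contraction C
    open Resolution C g p

    D-local : ∀ k {φ} → (∀ ys → Flag k ys → φ ys ≡ 0ℤ) → ∀ i xs → Flag k xs → D i φ xs ≡ 0ℤ
    D-local k eq zero xs f = cong₂ _-_ (eq _ (flag-g f)) (eq _ f)
    D-local k {φ} eq (suc zero) xs f = go p xs f
      where
      go : ∀ m xs → Flag k xs → orbitSum m φ xs ≡ 0ℤ
      go zero    xs f = refl
      go (suc m) xs f = cong₂ _+_ (eq _ f) (go m _ (flag-g f))
    D-local k eq (suc (suc i)) xs f = D-local k eq i xs f

    -- Flags are preserved by g, hence by every `D`, and each use of `K` passes from dimension k to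
    -- k + 1; so `E k` reads a cochain on flags of dimension k only.
    E-local : ∀ k {φ} → (∀ ys → Flag k ys → φ ys ≡ 0ℤ) → E k φ ≡ 0ℤ
    E-local zero    eq = eq _ flag-base
    E-local (suc k) eq = E-local k (D-local k (K-local eq) k)

    E-cong-local : ∀ k {φ ψ} → (∀ ys → Flag k ys → φ ys ≡ ψ ys) → E k φ ≡ E k ψ
    E-cong-local k {φ} {ψ} eq = trans (lemma (E k φ) (E k ψ)) (trans
      (cong (_+ E k ψ) (trans (sym (E-minus k φ ψ)) (E-local k λ ys f → trans (cong (_- ψ ys) (eq ys f)) (self (ψ ys)))))
      (+-identityˡ (E k ψ)))
      where
      lemma : ∀ a b → a ≡ (a - b) + b
      lemma = solve-∀
      self : ∀ a → a - a ≡ 0ℤ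
      self = solve-∀

    d-cong-OK : ∀ {n} {φ ψ : Cochain X n} → (∀ {ys} → All OK ys → φ ys ≡ ψ ys) →
                ∀ {xs} → All OK xs → d φ xs ≡ d ψ xs
    d-cong-OK {zero}  eq {x ∷ []} _ = eq []
    d-cong-OK {suc n} eq {x ∷ xs} (o ∷ os) = cong₂ _-_ (eq os) (d-cong-OK (λ os′ → eq (o ∷ os′)) os)

    -- The borrow in the subtraction r y - r x modulo p.
    c : X → X → ℤ
    c x y = if r y <ᵇ r x then 1ℤ else 0ℤ

    -- The representative of r y - r x in the range from 0 to p - 1. It is invariant under g on
    -- `OK`, which neither r nor `c` is when a residue wraps around.
    e : X → X → ℤ
    e x y = (+ r y - + r x) + + p * c x y

    c-≥ : ∀ {a b} → b ℕ.≤ a → (if a <ᵇ b then 1ℤ else 0ℤ) ≡ 0ℤ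
    c-≥ {a} {b} b≤a with a <ᵇ b in eq
    ... | false = refl
    ... | true  = ⊥-elim (ℕₚ.<⇒≱ (ℕₚ.<ᵇ⇒< a b (subst T (sym eq) _)) b≤a)

    c-< : ∀ {a b} → a < b → (if a <ᵇ b then 1ℤ else 0ℤ) ≡ 1ℤ
    c-< {a} {b} a<b with a <ᵇ b in eq
    ... | true  = refl
    ... | false = ⊥-elim (subst T eq (ℕₚ.<⇒<ᵇ a<b))

    +suc : ∀ m → + suc m ≡ + m + 1ℤ
    +suc m = trans (pos-+ 1 m) (lemma (+ m))
      where
      lemma : ∀ a → 1ℤ + a ≡ a + 1ℤ
      lemma = solve-∀

    e-g : ∀ {x y} → OK x → OK y → e (g x) (g y) ≡ e x y
    e-g {x} {y} ox oy with r-g ox | r-g oy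
    ... | inj₁ gx | inj₁ gy = trans
      (cong₂ (λ a b → + b - + a + + p * (if b <ᵇ a then 1ℤ else 0ℤ)) gx gy)
      (trans (cong₂ (λ a b → b - a + + p * c x y) (+suc (r x)) (+suc (r y)))
             (lemma (+ r x) (+ r y) (+ p * c x y)))
      where
      lemma : ∀ a b z → (b + 1ℤ) - (a + 1ℤ) + z ≡ b - a + z
      lemma = solve-∀
    ... | inj₁ gx | inj₂ (wy , gy) = trans
      (cong₂ (λ a b → + b - + a + + p * (if b <ᵇ a then 1ℤ else 0ℤ)) gx gy)
      (trans (cong₂ (λ a q → + 0 - a + q * 1ℤ) (+suc (r x)) (trans (cong +_ (sym wy)) (+suc (r y))))
      (trans (lemma (+ r x) (+ r y) (+ p))
      (cong (λ z → + r y - + r x + + p * z)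
        (sym (c-≥ {r y} {r x} (ℕₚ.≤-pred (subst (suc (r x) ℕ.≤_) (sym wy) (r<p x))))))))
      where
      lemma : ∀ a b q → 0ℤ - (a + 1ℤ) + (b + 1ℤ) * 1ℤ ≡ b - a + q * 0ℤ
      lemma = solve-∀
    ... | inj₂ (wx , gx) | inj₁ gy = trans
      (cong₂ (λ a b → + b - + a + + p * (if b <ᵇ a then 1ℤ else 0ℤ)) gx gy)
      (trans (cong (λ a → a - + 0 + + p * 0ℤ) (+suc (r y)))
      (trans (lemma (+ r x) (+ r y) (+ p))
      (cong₂ (λ q z → + r y - + r x + q * z) (trans (sym (+suc (r x))) (cong +_ wx))
        (sym (c-< {r y} {r x} (ℕₚ.≤-pred (subst₂ ℕ._<_ gy (sym wx) (r<p (g y)))))))))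
      where
      lemma : ∀ a b q → (b + 1ℤ) - 0ℤ + q * 0ℤ ≡ b - a + (a + 1ℤ) * 1ℤ
      lemma = solve-∀
    ... | inj₂ (wx , gx) | inj₂ (wy , gy) = trans
      (cong₂ (λ a b → + b - + a + + p * (if b <ᵇ a then 1ℤ else 0ℤ)) gx gy)
      (sym (trans (cong₂ (λ b z → + b - + r x + + p * z) rx≡ry (c-≥ {r y} {r x} (ℕₚ.≤-reflexive (sym rx≡ry))))
                  (lemma (+ r x) (+ p))))
      where
      rx≡ry : r y ≡ r x
      rx≡ry = ℕₚ.suc-injective (trans wy (sym wx))
      lemma : ∀ a q → a - a + q * 0ℤ ≡ 0ℤ - 0ℤ + q * 0ℤ
      lemma = solve-∀

    cup₀ : ∀ {n} → (X → ℤ) → Cochain X (suc n) → Cochain X (suc n)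
    cup₀ u φ (x ∷ xs) = u x * φ (x ∷ xs)

    cup₁ : ∀ {n} → (X → X → ℤ) → Cochain X (suc n) → Cochain X (suc (suc n))
    cup₁ u φ (x ∷ y ∷ xs) = u x y * φ (y ∷ xs)

    Closed : ∀ {n} → Cochain X n → Set
    Closed φ = ∀ xs → d φ xs ≡ 0ℤ

    -- The Leibniz rule; the summand with dφ vanishes because φ is closed.
    d-cup₀ : ∀ {n} u (φ : Cochain X (suc n)) → Closed φ → ∀ x y xs →
             d (cup₀ u φ) (x ∷ y ∷ xs) ≡ (u y - u x) * φ (y ∷ xs)
    d-cup₀ u φ cl x y xs = begin
      u y * φ (y ∷ xs) - d (λ zs → u x * φ (x ∷ zs)) (y ∷ xs)
        ≡⟨ cong (λ z → u y * φ (y ∷ xs) - z) (d-scale (u x) (λ zs → φ (x ∷ zs)) (y ∷ xs)) ⟩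
      u y * φ (y ∷ xs) - u x * D′
        ≡⟨ lemma (u y) (u x) (φ (y ∷ xs)) D′ ⟩
      (u y - u x) * φ (y ∷ xs) + u x * (φ (y ∷ xs) - D′)
        ≡⟨ cong (λ z → (u y - u x) * φ (y ∷ xs) + u x * z) (cl (x ∷ y ∷ xs)) ⟩
      (u y - u x) * φ (y ∷ xs) + u x * 0ℤ ≡⟨ lemma′ _ (u x) ⟩
      (u y - u x) * φ (y ∷ xs) ∎
      where
      D′ = d (λ zs → φ (x ∷ zs)) (y ∷ xs)
      lemma : ∀ a b f z → a * f - b * z ≡ (a - b) * f + b * (f - z)
      lemma = solve-∀
      lemma′ : ∀ a b → a + b * 0ℤ ≡ a
      lemma′ = solve-∀

    d-cup₁ : ∀ {n} u (φ : Cochain X (suc n)) → Closed φ → ∀ x y z xs →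
             d (cup₁ u φ) (x ∷ y ∷ z ∷ xs) ≡ (u y z - u x z + u x y) * φ (z ∷ xs)
    d-cup₁ u φ cl x y z xs = trans
      (cong (λ w → u y z * φ (z ∷ xs) - w)
        (trans (d-cong {φ = λ ys → cup₁ u φ (x ∷ ys)} {ψ = cup₀ (u x) φ} (λ { (y ∷ ys) → refl }) (y ∷ z ∷ xs)) (d-cup₀ (u x) φ cl y z xs)))
      (lemma (u y z) (u x z) (u x y) (φ (z ∷ xs)))
      where
      lemma : ∀ a b c f → a * f - (b - c) * f ≡ (a - b + c) * f
      lemma = solve-∀

    -- Closed at once, being a coboundary; but `c` is not invariant under g, so this does not make
    -- the class equivariantly trivial. Since p times it is the coboundary of the invariant `e∪b j`,
    -- it is an integral Bockstein.
    b : ∀ j → Cochain X (suc (double j))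
    b zero    _  = 1ℤ
    b (suc j) xs = d (cup₁ c (b j)) xs

    b-closed : ∀ j → Closed (b j)
    b-closed zero    (x ∷ y ∷ []) = refl
    b-closed (suc j) xs           = d∘d (cup₁ c (b j)) xs

    e∪b : ∀ j → Cochain X (suc (suc (double j)))
    e∪b j = cup₁ e (b j)

    r∪b : ∀ j → Cochain X (suc (double j))
    r∪b j = cup₀ (λ x → + r x) (b j)

    e-split : ∀ j xs → e∪b j xs ≡ d (r∪b j) xs + + p * cup₁ c (b j) xs
    e-split j (x ∷ y ∷ xs) = trans
      (lemma (+ r y - + r x) (+ p) (c x y) (b j (y ∷ xs)))
      (cong (λ z → z + + p * (c x y * b j (y ∷ xs))) (sym (d-cup₀ (λ x → + r x) (b j) (b-closed j) x y xs)))
      where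
      lemma : ∀ a q c f → (a + q * c) * f ≡ a * f + q * (c * f)
      lemma = solve-∀

    d-e∪b : ∀ j xs → d (e∪b j) xs ≡ + p * b (suc j) xs
    d-e∪b j xs = begin
      d (e∪b j) xs ≡⟨ d-cong (e-split j) xs ⟩
      d (λ ys → d (r∪b j) ys + + p * cup₁ c (b j) ys) xs ≡⟨ d-plus (d (r∪b j)) _ xs ⟩
      d (d (r∪b j)) xs + d (λ ys → + p * cup₁ c (b j) ys) xs
        ≡⟨ cong₂ _+_ (d∘d (r∪b j) xs) (d-scale (+ p) (cup₁ c (b j)) xs) ⟩
      0ℤ + + p * b (suc j) xs ≡⟨ +-identityˡ _ ⟩
      + p * b (suc j) xs ∎

    cancel-p : ∀ {a b} → + p * a ≡ + p * b → a ≡ b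
    cancel-p {a} {b} = *-cancelˡ-≡ (+ p) a b {{ℕ.>-nonZero (ℕₚ.<-trans ℕₚ.0<1+n 1<p)}}

    -- Invariance becomes visible after multiplication by p, which turns `b (suc j)` into the
    -- coboundary of `e∪b j`, built from the invariant `e`; then p is cancelled.
    b-g : ∀ j {xs} → All OK xs → b j (map g xs) ≡ b j xs
    e∪b-g : ∀ j {xs} → All OK xs → e∪b j (map g xs) ≡ e∪b j xs
    b-g zero    _ = refl
    b-g (suc j) {xs} os = cancel-p (begin
      + p * b (suc j) (map g xs) ≡⟨ d-e∪b j (map g xs) ⟨
      d (e∪b j) (map g xs)       ≡⟨ d-map g (e∪b j) xs ⟨
      d (e∪b j ∘ map g) xs       ≡⟨ d-cong-OK (e∪b-g j) os ⟩
      d (e∪b j) xs               ≡⟨ d-e∪b j xs ⟩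
      + p * b (suc j) xs         ∎)
    e∪b-g j {x ∷ y ∷ xs} (ox ∷ oy ∷ os) = cong₂ _*_ (e-g ox oy) (b-g j (oy ∷ os))

    _≈_ : X → X → Set
    x ≈ y = r x ≡ r y

    weaken : ∀ {n} {xs : Vec X n} → Repeats _≡_ xs → Repeats _≈_ xs
    weaken (here eq) = here (cong r eq)
    weaken (there q) = there (weaken q)

    c-≈ : ∀ {x y} → x ≈ y → c x y ≡ 0ℤ
    c-≈ {x} {y} eq = c-≥ {r y} {r x} (ℕₚ.≤-reflexive eq)

    -- The coefficient c y z - c x z + c x y depends on residues only and cancels when x ≈ y or y ≈
    -- z; a later repetition is passed on to `b j`.
    b-repeats : ∀ j {xs} → Repeats _≈_ xs → b j xs ≡ 0ℤ
    b-repeats zero    {x ∷ []} (there ())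
    b-repeats (suc j) {x ∷ y ∷ z ∷ xs} rep = trans (d-cup₁ c (b j) (b-closed j) x y z xs) (go rep)
      where
      lemma : ∀ a f → (a - a + 0ℤ) * f ≡ 0ℤ
      lemma = solve-∀
      lemma′ : ∀ a f → (0ℤ - a + a) * f ≡ 0ℤ
      lemma′ = solve-∀
      go : Repeats _≈_ (x ∷ y ∷ z ∷ xs) → (c y z - c x z + c x y) * b j (z ∷ xs) ≡ 0ℤ
      go (here eq) = trans
        (cong₂ (λ u v → (u - c x z + v) * b j (z ∷ xs))
          (cong (λ m → if r z <ᵇ m then 1ℤ else 0ℤ) (sym eq)) (c-≈ eq))
        (lemma (c x z) (b j (z ∷ xs)))
      go (there (here eq)) = trans
        (cong₂ (λ u v → (u - c x z + v) * b j (z ∷ xs))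
          (c-≈ eq) (cong (λ m → if m <ᵇ r x then 1ℤ else 0ℤ) eq))
        (lemma′ (c x z) (b j (z ∷ xs)))
      go (there (there rep)) = trans (cong ((c y z - c x z + c x y) *_) (b-repeats j rep)) (*-zeroʳ (c y z - c x z + c x y))

    r∪b-normalized : ∀ j → Normalized (r∪b j)
    r∪b-normalized j (x ∷ xs) rep = trans (cong (+ r x *_) (b-repeats j (weaken rep))) (*-zeroʳ (+ r x))

    e∪b-normalized : ∀ j → Normalized (e∪b j)
    e∪b-normalized j (x ∷ y ∷ xs) (here refl) = trans
      (cong (λ z → (+ r x - + r x + + p * z) * b j (x ∷ xs)) (c-≈ {x} {x} refl)) (lemma (+ r x) (+ p) _)
      where
      lemma : ∀ a q f → (a - a + q * 0ℤ) * f ≡ 0ℤ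
      lemma = solve-∀
    e∪b-normalized j (x ∷ y ∷ xs) (there rep) =
      trans (cong (e x y *_) (b-repeats j (weaken rep))) (*-zeroʳ (e x y))

    D-even : ∀ {n} j (φ : Cochain X n) xs → D (double j) φ xs ≡ difference φ xs
    D-even zero    φ xs = refl
    D-even (suc j) φ xs = D-even j φ xs

    D-odd : ∀ {n} j (φ : Cochain X n) xs → D (suc (double j)) φ xs ≡ orbitSum p φ xs
    D-odd zero    φ xs = refl
    D-odd (suc j) φ xs = D-odd j φ xs

    orbitSum-invariant : ∀ {n} m (φ : Cochain X n) → (∀ {ys} → All OK ys → φ (map g ys) ≡ φ ys) →
                         ∀ {xs} → All OK xs → orbitSum m φ xs ≡ + m * φ xs
    orbitSum-invariant zero    φ inv os = refl
    orbitSum-invariant (suc m) φ inv {xs} os = trans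
      (cong (λ z → φ xs + z) (trans (orbitSum-invariant m φ inv (Allₚ.map⁺ (All.map OK-g os))) (cong (+ m *_) (inv os))))
      (trans (lemma (+ m) (φ xs)) (cong (_* φ xs) (sym (+suc m))))
      where
      lemma : ∀ a f → f + a * f ≡ (a + 1ℤ) * f
      lemma = solve-∀

    wraps : X → ℤ
    wraps x = if r x <ᵇ r (g x) then 0ℤ else 1ℤ

    r-wraps : ∀ {x} → OK x → + r (g x) - + r x ≡ 1ℤ - + p * wraps x
    r-wraps {x} o with r-g o
    ... | inj₁ eq = trans (cong (λ z → + z - + r x) eq)
      (trans (cong (_- + r x) (+suc (r x))) (trans (lemma (+ r x) (+ p))
        (cong (λ z → 1ℤ - + p * z) (sym (trans (cong (λ m → if r x <ᵇ m then 0ℤ else 1ℤ) eq) (w (r x)))))))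
      where
      lemma : ∀ a q → (a + 1ℤ) - a ≡ 1ℤ - q * 0ℤ
      lemma = solve-∀
      w : ∀ m → (if m <ᵇ suc m then 0ℤ else 1ℤ) ≡ 0ℤ
      w zero    = refl
      w (suc m) = w m
    ... | inj₂ (w , eq) = trans (cong (λ z → + z - + r x) eq)
      (trans (lemma (+ r x)) (cong₂ (λ z u → 1ℤ - z * u) (trans (sym (+suc (r x))) (cong +_ w))
        (sym (cong (λ m → if r x <ᵇ m then 0ℤ else 1ℤ) eq))))
      where
      lemma : ∀ a → 0ℤ - a ≡ 1ℤ - (a + 1ℤ) * 1ℤ
      lemma = solve-∀

    -- Modulo p, `e∪b j` is the coboundary of `r∪b j`, so `boundary` leads to the difference of
    -- `r∪b j` under g. As g raises r by one modulo p, that difference is `b j` up to multiples of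
    -- p.
    odd-step : ∀ j → j ℕ.≤ J → ∃[ m ] E (suc (double j)) (e∪b j) ≡ E (double j) (b j) + + p * m
    odd-step j j≤J = E (suc (double j)) (cup₁ c (b j)) - E (double j) (cup₀ wraps (b j)) , (begin
      E k′ (e∪b j)
        ≡⟨ E-cong k′ (λ xs → trans (e-split j xs) (lemma₁ (d (r∪b j) xs) (+ p) (cup₁ c (b j) xs))) ⟩
      E k′ (λ xs → d (r∪b j) xs - (0ℤ - + p) * cup₁ c (b j) xs)
        ≡⟨ trans (E-minus k′ (d (r∪b j)) (λ xs → (0ℤ - + p) * cup₁ c (b j) xs))
             (cong₂ _-_ (boundary turn-id k (r∪b j) (r∪b-normalized j)) (E-scale k′ (0ℤ - + p) (cup₁ c (b j)))) ⟩
      E k (D k (r∪b j)) - (0ℤ - + p) * E k′ (cup₁ c (b j))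
        ≡⟨ cong (_- (0ℤ - + p) * E k′ (cup₁ c (b j)))
             (E-cong-local k λ xs f → pointwise xs (flag-OK (double-mono j≤J) f)) ⟩
      E k (λ xs → b j xs - + p * cup₀ wraps (b j) xs) - (0ℤ - + p) * E k′ (cup₁ c (b j))
        ≡⟨ cong (_- (0ℤ - + p) * E k′ (cup₁ c (b j)))
             (trans (E-minus k (b j) (λ xs → + p * cup₀ wraps (b j) xs)) (cong (E k (b j) -_) (E-scale k (+ p) (cup₀ wraps (b j))))) ⟩
      E k (b j) - + p * E k (cup₀ wraps (b j)) - (0ℤ - + p) * E k′ (cup₁ c (b j))
        ≡⟨ lemma₂ (E k (b j)) (+ p) _ _ ⟩
      E k (b j) + + p * (E k′ (cup₁ c (b j)) - E k (cup₀ wraps (b j))) ∎)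
      where
      k = double j
      k′ = suc (double j)
      lemma₁ : ∀ a q f → a + q * f ≡ a - (0ℤ - q) * f
      lemma₁ = solve-∀
      lemma₂ : ∀ a q u v → a - q * u - (0ℤ - q) * v ≡ a + q * (v - u)
      lemma₂ = solve-∀
      lemma₃ : ∀ a b f → a * f - b * f ≡ (a - b) * f
      lemma₃ = solve-∀
      lemma₄ : ∀ q w f → (1ℤ - q * w) * f ≡ f - q * (w * f)
      lemma₄ = solve-∀
      pointwise : ∀ xs → All OK xs → D k (r∪b j) xs ≡ b j xs - + p * cup₀ wraps (b j) xs
      pointwise (x ∷ xs) os@(o ∷ _) = trans (D-even j (r∪b j) (x ∷ xs))
        (trans (cong (λ z → + r (g x) * z - + r x * b j (x ∷ xs)) (b-g j os))
        (trans (lemma₃ (+ r (g x)) (+ r x) (b j (x ∷ xs)))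
        (trans (cong (_* b j (x ∷ xs)) (r-wraps o)) (lemma₄ (+ p) (wraps x) (b j (x ∷ xs))))))

    -- After multiplication by p the left side evaluates d(`e∪b j`), so `boundary` produces the norm
    -- of an invariant cochain, which is p times the cochain.
    even-step : ∀ j → suc j ℕ.≤ J → E (suc (suc (double j))) (b (suc j)) ≡ E (suc (double j)) (e∪b j)
    even-step j j<J = cancel-p (begin
      + p * E (suc k) (b (suc j)) ≡⟨ E-scale (suc k) (+ p) (b (suc j)) ⟨
      E (suc k) (λ xs → + p * b (suc j) xs) ≡⟨ E-cong (suc k) (λ xs → sym (d-e∪b j xs)) ⟩
      E (suc k) (d (e∪b j)) ≡⟨ boundary turn-id k (e∪b j) (e∪b-normalized j) ⟩
      E k (D k (e∪b j))
        ≡⟨ E-cong-local k (λ xs f → trans (D-odd j (e∪b j) xs) (orbitSum-invariant p (e∪b j) (e∪b-g j)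
             (flag-OK (ℕₚ.≤-trans (ℕₚ.n≤1+n k) (double-mono j<J)) f))) ⟩
      E k (λ xs → + p * e∪b j xs) ≡⟨ E-scale k (+ p) (e∪b j) ⟩
      + p * E k (e∪b j) ∎)
      where
      k = suc (double j)

    degree : ∀ j → j ℕ.≤ J → ∃[ m ] E (double j) (b j) ≡ 1ℤ + + p * m
    degree zero    _ = 0ℤ , sym (cong (λ z → 1ℤ + z) (*-zeroʳ (+ p)))
    degree (suc j) j<J with degree j (ℕₚ.<⇒≤ j<J) | odd-step j (ℕₚ.<⇒≤ j<J)
    ... | m , eq | m′ , eq′ = m + m′ ,
      trans (even-step j j<J) (trans eq′ (trans (cong (_+ + p * m′) eq) (lemma (+ p) m m′)))
      where
      lemma : ∀ q m m′ → 1ℤ + q * m + q * m′ ≡ 1ℤ + q * (m + m′)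
      lemma = solve-∀

    -- Otherwise `b J` would vanish on all flags that `E` reads, while `degree` gives it a value
    -- congruent to 1 modulo p.
    ¬all-repeat : ¬ (∀ xs → Flag (double J) xs → Repeats _≈_ xs)
    ¬all-repeat rep with degree J ℕₚ.≤-refl
    ... | m , eq = ℕₚ.<⇒≢ 1<p (sym (∣1⇒≡1 (∣⇒∣ᵤ (divides (0ℤ - m) (trans (lemma (+ p) m)
          (trans (cong (λ z → z + (0ℤ - m) * + p) (trans (sym eq) (E-local (double J) λ ys f → b-repeats J (rep ys f)))) (+-identityˡ _)))))))
      where
      lemma : ∀ q m → 1ℤ ≡ (1ℤ + q * m) + (0ℤ - m) * q
      lemma = solve-∀

-- Products of simplices with the rotation of ℤ/p, and their maps to tuples of proper subsets.

module EquivariantMaps where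

  open IndexTheorem
  open import Data.Bool.Base using (Bool; true; false)
  open import Data.Empty using (⊥; ⊥-elim)
  open import Data.Fin.Base using (Fin; zero; suc; toℕ; fromℕ; inject₁)
  open import Data.Fin.Properties using (toℕ-injective; toℕ-inject₁; toℕ-fromℕ; toℕ<n)
  open import Data.Fin.Subset as Subset using (Subset; ∣_∣; _⊆_)
  open import Data.Fin.Subset.Properties using (p⊆q⇒∣p∣≤∣q∣; drop-∷-⊆; ∣⊥∣≡0; ∉⊥)
  open import Data.Integer.Base as ℤ using (ℤ; 0ℤ)
  import Data.Integer.Properties as ℤₚ
  open import Data.Integer.Tactic.RingSolver using (solve-∀)
  open import Data.Nat.Base as ℕ using (ℕ; zero; suc; _+_; _*_; _∸_; _≤_; _<_; z≤n; s≤s; _%_)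
  open import Data.Nat.Coprimality using (prime⇒coprime; coprime-Bézout)
  open import Data.Nat.DivMod using (m%n<n; m<n⇒m%n≡m; [m+kn]%n≡m%n; [m+n]%n≡m%n; n%n≡0; m%n%n≡m%n; %-distribˡ-+)
  open import Data.Nat.GCD using (module Bézout)
  open import Data.Nat.Primality using (Prime)
  open import Data.Nat.Properties using (_≤?_)
  import Data.Nat.Properties as ℕₚ
  import Data.Nat.Tactic.RingSolver as ℕSolver
  open import Data.Product.Base using (∃-syntax; _×_; _,_; proj₁; proj₂)
  open import Data.Sum.Base using (_⊎_; inj₁; inj₂)
  open import Data.Unit.Base using (⊤; tt)
  open import Data.Vec.Base using (Vec; []; _∷_; map; lookup; tabulate; tail; here; there)
  open import Data.Vec.Properties using (map-cong; map-∘; map-id; lookup∘tabulate; tabulate∘lookup; tabulate-cong; lookup⇒[]=; []=⇒lookup)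
  open import Data.Vec.Relation.Binary.Pointwise.Inductive as Pointwise using (Pointwise; []; _∷_)
  open import Data.Vec.Relation.Unary.All as All using (All; []; _∷_)
  import Data.Vec.Relation.Unary.All.Properties as Allₚ
  open import Function.Base using (_∘_; id)
  open import Relation.Binary.PropositionalEquality
  open import Relation.Nullary using (yes; no)



  module Flags {X : Set} (_⊑_ : X → X → Set) where
    Below : ∀ {n} → (X → Set) → Vec X n → Set
    Below L []      = ⊤
    Below L (x ∷ _) = L x

    Flag : ∀ {n} → (X → Set) → Vec X n → Set
    Flag ok []       = ⊤
    Flag ok (x ∷ xs) = ok x × Below (x ⊑_) xs × Flag ok xs

    Flag⇒All : ∀ {n} {ok : X → Set} {xs : Vec X n} → Flag ok xs → All ok xs
    Flag⇒All {xs = []}     f           = []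
    Flag⇒All {xs = x ∷ xs} (o , _ , f) = o ∷ Flag⇒All f

  module _ {X Y : Set} {_⊑ˣ_ : X → X → Set} {_⊑ʸ_ : Y → Y → Set} where
    module FX = Flags _⊑ˣ_
    module FY = Flags _⊑ʸ_

    flag-map : ∀ {okˣ okʸ} (f : X → Y) → (∀ {x} → okˣ x → okʸ (f x)) →
               (∀ {x y} → x ⊑ˣ y → f x ⊑ʸ f y) →
               ∀ {n} {xs : Vec X n} → FX.Flag okˣ xs → FY.Flag okʸ (map f xs)
    flag-map f ok mono {xs = []}         _            = tt
    flag-map f ok mono {xs = x ∷ []}     (o , _ , _)  = ok o , tt , tt
    flag-map f ok mono {xs = x ∷ y ∷ xs} (o , le , fl) = ok o , mono le , flag-map f ok mono fl

    -- `L` carries what the prefix of P-entries demands of the next entry; the recursion replaces it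
    -- by `P x ⊑ʸ_`. The mixed tuples of the prism are flags because `P x ⊑ʸ Q x`.
    prism-local : ∀ {okˣ : X → Set} {okʸ : Y → Set} (P Q : X → Y) →
      (∀ {x} → okˣ x → okʸ (P x)) → (∀ {x} → okˣ x → okʸ (Q x)) →
      (∀ {x y} → x ⊑ˣ y → P x ⊑ʸ P y) → (∀ {x y} → x ⊑ˣ y → Q x ⊑ʸ Q y) → (∀ x → P x ⊑ʸ Q x) →
      ∀ {n} (L : Y → Set) {φ : Cochain Y (suc n)} →
      (∀ ys → FY.Flag okʸ ys → FY.Below L ys → φ ys ≡ 0ℤ) →
      ∀ xs → FX.Flag okˣ xs → FX.Below (L ∘ P) xs → prism P Q φ xs ≡ 0ℤ
    prism-local P Q okP okQ mP mQ P≤Q L eq []       _ _ = refl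
    prism-local {okˣ} {okʸ} P Q okP okQ mP mQ P≤Q L eq (x ∷ xs) fl@(o , le , fl′) l = cong₂ ℤ._-_
      (eq _ (okP o , P≤Q x , flag-map Q okQ mQ fl) l)
      (prism-local {okˣ} {okʸ} P Q okP okQ mP mQ P≤Q (P x ⊑ʸ_)
        (λ ys fl″ le″ → eq (P x ∷ ys) (okP o , le″ , fl″) l) xs fl′ (push xs le))
      where
      push : ∀ {n} (xs : Vec X n) → FX.Below (x ⊑ˣ_) xs → FX.Below ((P x ⊑ʸ_) ∘ P) xs
      push []      _  = tt
      push (_ ∷ _) le = mP le

  sumFin : ∀ n → (Fin n → ℕ) → ℕ
  sumFin zero    F = 0
  sumFin (suc n) F = F zero + sumFin n (F ∘ suc)

  sumFin-cong : ∀ n {F G : Fin n → ℕ} → (∀ i → F i ≡ G i) → sumFin n F ≡ sumFin n G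
  sumFin-cong zero    eq = refl
  sumFin-cong (suc n) eq = cong₂ _+_ (eq zero) (sumFin-cong n (eq ∘ suc))

  sumFin-last : ∀ n (F : Fin (suc n) → ℕ) → sumFin (suc n) F ≡ sumFin n (F ∘ inject₁) + F (fromℕ n)
  sumFin-last zero    F = ℕₚ.+-comm (F zero) 0
  sumFin-last (suc n) F = trans (cong (F zero +_) (sumFin-last n (F ∘ suc))) (sym (ℕₚ.+-assoc (F zero) _ _))

  sumFin-+ : ∀ n (F G : Fin n → ℕ) → sumFin n (λ i → F i + G i) ≡ sumFin n F + sumFin n G
  sumFin-+ zero    F G = refl
  sumFin-+ (suc n) F G = trans (cong (F zero + G zero +_) (sumFin-+ n (F ∘ suc) (G ∘ suc)))
    (lemma (F zero) (G zero) _ _)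
    where
    lemma : ∀ a b c e → a + b + (c + e) ≡ a + c + (b + e)
    lemma = ℕSolver.solve-∀

  val : Bool → ℕ
  val true  = 1
  val false = 0

  ∣∣-sum : ∀ {n} (s : Subset n) → ∣ s ∣ ≡ sumFin n (λ i → val (lookup s i))
  ∣∣-sum []          = refl
  ∣∣-sum (true  ∷ s) = cong suc (∣∣-sum s)
  ∣∣-sum (false ∷ s) = ∣∣-sum s

  ⊆-size⇒≡ : ∀ {n} {s t : Subset n} → s ⊆ t → ∣ t ∣ ≤ ∣ s ∣ → s ≡ t
  ⊆-size⇒≡ {s = []}        {[]}        _  _ = refl
  ⊆-size⇒≡ {s = true ∷ s}  {true ∷ t}  st (s≤s le) = cong (true ∷_) (⊆-size⇒≡ (drop-∷-⊆ st) le)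
  ⊆-size⇒≡ {s = true ∷ s}  {false ∷ t} st _ with () ← st here
  ⊆-size⇒≡ {s = false ∷ s} {true ∷ t}  st le = ⊥-elim (ℕₚ.<⇒≱ le (p⊆q⇒∣p∣≤∣q∣ (drop-∷-⊆ st)))
  ⊆-size⇒≡ {s = false ∷ s} {false ∷ t} st le = cong (false ∷_) (⊆-size⇒≡ (drop-∷-⊆ st) le)

  Family : ℕ → ℕ → Set
  Family p n = Vec (Subset p) n

  size : ∀ {p n} → Family p n → ℕ
  size []      = 0
  size (s ∷ v) = ∣ s ∣ + size v

  _⊑_ : ∀ {p n} → Family p n → Family p n → Set
  _⊑_ = Pointwise _⊆_

  size-mono : ∀ {p n} {v w : Family p n} → v ⊑ w → size v ≤ size w
  size-mono []       = z≤n
  size-mono (h ∷ hs) = ℕₚ.+-mono-≤ (p⊆q⇒∣p∣≤∣q∣ h) (size-mono hs)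

  ⊑-size⇒≡ : ∀ {p n} {v w : Family p n} → v ⊑ w → size w ≤ size v → v ≡ w
  ⊑-size⇒≡ [] _ = refl
  ⊑-size⇒≡ {v = s ∷ v} {t ∷ w} (h ∷ hs) le = cong₂ _∷_
    (⊆-size⇒≡ h (ℕₚ.+-cancelʳ-≤ (size v) _ _ (ℕₚ.≤-trans (ℕₚ.+-monoʳ-≤ ∣ t ∣ (size-mono hs)) le)))
    (⊑-size⇒≡ hs (ℕₚ.+-cancelˡ-≤ ∣ s ∣ _ _ (ℕₚ.≤-trans (ℕₚ.+-monoˡ-≤ (size w) (p⊆q⇒∣p∣≤∣q∣ h)) le)))

  module _ (q : ℕ) where
    private
      p = suc q

    Cell : ℕ → Set
    Cell = Family p

    Nonempty : ∀ {n} → Cell n → Set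
    Nonempty = All (λ s → 1 ≤ ∣ s ∣)

    -- A cell is a product of simplices; its dimension is size − n.
    Dim≤ : ∀ {n} → ℕ → Cell n → Set
    Dim≤ {n} B v = Nonempty v × size v ≤ n + B

    point : Subset p
    point = true ∷ Subset.⊥

    addPoint : Subset p → Subset p
    addPoint (_ ∷ s) = true ∷ s

    ∣point∣ : ∣ point ∣ ≡ 1
    ∣point∣ = cong suc (∣⊥∣≡0 q)

    -- The identity and `collapse` both lie below `thicken`, so two prisms that meet in `thicken`
    -- deform the first simplex to `point` monotonically.
    collapse thicken : ∀ {n} → Cell (suc n) → Cell (suc n)
    collapse (s ∷ v) = point ∷ v
    thicken  (s ∷ v) = addPoint s ∷ v

    -- One factor at a time: two prisms move the first factor to `point`, and the contraction of the
    -- remaining factors acts on the slice where the first one is `point`. A product of no factors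
    -- is a single vertex.
    contraction : ∀ n → Contraction (Cell n)
    contraction zero = record
      { base = [] ; K = λ _ _ → 0ℤ ; K-cong = λ _ _ → refl ; K-minus = λ _ _ _ → refl
      ; K-scale = λ k _ _ → sym (ℤₚ.*-zeroʳ k) ; K-norm = λ _ _ _ → refl
      ; contracts = λ φ xs → trans (cong (ℤ._+ 0ℤ) (d-zero xs))
          (sym (trans (cong (λ ys → φ xs ℤ.- φ ys) (trivial xs)) (self (φ xs)))) }
      where
      self : ∀ a → a ℤ.- a ≡ 0ℤ
      self = solve-∀
      trivial : ∀ {n} (xs : Vec (Cell 0) n) → map (λ _ → []) xs ≡ xs
      trivial []        = refl
      trivial ([] ∷ xs) = cong ([] ∷_) (trivial xs)
    contraction (suc n) = record
      { base    = point ∷ C.base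
      ; K       = K
      ; K-cong  = λ eq xs → cong₂ ℤ._+_ (cong₂ ℤ._-_ (prism-cong eq xs) (prism-cong eq xs))
                                        (C.K-cong (λ ys → eq _) (map tail xs))
      ; K-minus = λ φ ψ xs → trans
          (cong₂ ℤ._+_ (cong₂ ℤ._-_ (prism-minus collapse thicken φ ψ xs) (prism-minus id thicken φ ψ xs))
                       (C.K-minus (φ ∘ map ι) (ψ ∘ map ι) (map tail xs)))
          (lemma₁ (prism collapse thicken φ xs) (prism collapse thicken ψ xs) (prism id thicken φ xs) (prism id thicken ψ xs) _ _)
      ; K-scale = λ k φ xs → trans
          (cong₂ ℤ._+_ (cong₂ ℤ._-_ (prism-scale collapse thicken k φ xs) (prism-scale id thicken k φ xs))
                       (C.K-scale k (φ ∘ map ι) (map tail xs)))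
          (lemma₂ k (prism collapse thicken φ xs) (prism id thicken φ xs) _)
      ; K-norm  = λ nφ xs rep → cong₂ ℤ._+_
          (cong₂ ℤ._-_ (prism-normalized collapse thicken nφ xs rep) (prism-normalized id thicken nφ xs rep))
          (C.K-norm (λ ys rep′ → nφ _ (Repeats-map ι rep′)) (map tail xs) (Repeats-map tail rep))
      ; contracts = contracts }
      where
      module C = Contraction (contraction n)
      ι : Cell n → Cell (suc n)
      ι = point ∷_
      K : ∀ {m} → Cochain (Cell (suc n)) (suc m) → Cochain (Cell (suc n)) m
      K φ xs = (prism collapse thicken φ xs ℤ.- prism id thicken φ xs) ℤ.+ C.K (φ ∘ map ι) (map tail xs)
      lemma₁ : ∀ a a′ b b′ c c′ → (a ℤ.- a′ ℤ.- (b ℤ.- b′)) ℤ.+ (c ℤ.- c′) ≡ (a ℤ.- b ℤ.+ c) ℤ.- (a′ ℤ.- b′ ℤ.+ c′)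
      lemma₁ = solve-∀
      lemma₂ : ∀ k a b c → (k ℤ.* a ℤ.- k ℤ.* b) ℤ.+ k ℤ.* c ≡ k ℤ.* (a ℤ.- b ℤ.+ c)
      lemma₂ = solve-∀
      lemma₃ : ∀ a a′ b b′ c c′ → ((a ℤ.- b) ℤ.+ c) ℤ.+ ((a′ ℤ.- b′) ℤ.+ c′) ≡ ((a ℤ.+ a′) ℤ.- (b ℤ.+ b′)) ℤ.+ (c ℤ.+ c′)
      lemma₃ = solve-∀
      lemma₄ : ∀ a z i b → ((a ℤ.- z) ℤ.- (a ℤ.- i)) ℤ.+ (z ℤ.- b) ≡ i ℤ.- b
      lemma₄ = solve-∀
      contracts : ∀ {m} (φ : Cochain (Cell (suc n)) (suc m)) xs →
                  d (K φ) xs ℤ.+ K (d φ) xs ≡ φ xs ℤ.- φ (map (λ _ → point ∷ C.base) xs)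
      contracts φ xs = begin
        d (K φ) xs ℤ.+ K (d φ) xs
          ≡⟨ cong₂ ℤ._+_
               (trans (d-plus (λ ys → prism collapse thicken φ ys ℤ.- prism id thicken φ ys) (C.K (φ ∘ map ι) ∘ map tail) xs)
                 (cong₂ ℤ._+_ (d-minus (prism collapse thicken φ) (prism id thicken φ) xs)
                              (d-map tail (C.K (φ ∘ map ι)) xs)))
               (cong (λ z → (prism collapse thicken (d φ) xs ℤ.- prism id thicken (d φ) xs) ℤ.+ z)
                 (C.K-cong (λ ys → sym (d-map ι φ ys)) (map tail xs))) ⟩
        ((d (prism collapse thicken φ) xs ℤ.- d (prism id thicken φ) xs) ℤ.+ d (C.K (φ ∘ map ι)) (map tail xs)) ℤ.+
        ((prism collapse thicken (d φ) xs ℤ.- prism id thicken (d φ) xs) ℤ.+ C.K (d (φ ∘ map ι)) (map tail xs))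
          ≡⟨ lemma₃ (d (prism collapse thicken φ) xs) (prism collapse thicken (d φ) xs) (d (prism id thicken φ) xs) _ _ _ ⟩
        ((d (prism collapse thicken φ) xs ℤ.+ prism collapse thicken (d φ) xs)
          ℤ.- (d (prism id thicken φ) xs ℤ.+ prism id thicken (d φ) xs)) ℤ.+
        (d (C.K (φ ∘ map ι)) (map tail xs) ℤ.+ C.K (d (φ ∘ map ι)) (map tail xs))
          ≡⟨ cong₂ ℤ._+_ (cong₂ ℤ._-_ (prism-homotopy collapse thicken φ xs) (prism-homotopy id thicken φ xs))
                         (C.contracts (φ ∘ map ι) (map tail xs)) ⟩
        ((φ (map thicken xs) ℤ.- φ (map collapse xs)) ℤ.- (φ (map thicken xs) ℤ.- φ (map id xs))) ℤ.+
        (φ (map ι (map tail xs)) ℤ.- φ (map ι (map (λ _ → C.base) (map tail xs))))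
          ≡⟨ cong₂ (λ u v → ((φ (map thicken xs) ℤ.- φ (map collapse xs)) ℤ.- (φ (map thicken xs) ℤ.- φ (map id xs))) ℤ.+ (φ u ℤ.- φ v))
               (trans (sym (map-∘ ι tail xs)) (map-cong (λ { (s ∷ v) → refl }) xs))
               (trans (sym (map-∘ ι (λ _ → C.base) (map tail xs))) (sym (map-∘ (λ _ → point ∷ C.base) tail xs))) ⟩
        ((φ (map thicken xs) ℤ.- φ (map collapse xs)) ℤ.- (φ (map thicken xs) ℤ.- φ (map id xs))) ℤ.+
        (φ (map collapse xs) ℤ.- φ (map (λ _ → point ∷ C.base) xs))
          ≡⟨ lemma₄ (φ (map thicken xs)) (φ (map collapse xs)) _ _ ⟩
        φ (map id xs) ℤ.- φ (map (λ _ → point ∷ C.base) xs)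
          ≡⟨ cong (λ ys → φ ys ℤ.- φ (map (λ _ → point ∷ C.base) xs)) (map-id xs) ⟩
        φ xs ℤ.- φ (map (λ _ → point ∷ C.base) xs) ∎
        where open ≡-Reasoning

    module F {n} = Flags {Cell n} _⊑_

    point⊆addPoint : ∀ s → point ⊆ addPoint s
    point⊆addPoint (b ∷ s) here        = here
    point⊆addPoint (b ∷ s) (there x∈⊥) = ⊥-elim (∉⊥ x∈⊥)

    ⊆addPoint : ∀ s → s ⊆ addPoint s
    ⊆addPoint (b ∷ s) here      = here
    ⊆addPoint (b ∷ s) (there h) = there h

    addPoint-mono : ∀ {s t} → s ⊆ t → addPoint s ⊆ addPoint t
    addPoint-mono {b ∷ s} {c ∷ t} st here      = here
    addPoint-mono {b ∷ s} {c ∷ t} st (there h) = there (drop-∷-⊆ st h)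

    ∣addPoint∣ : ∀ s → ∣ addPoint s ∣ ≤ suc ∣ s ∣
    ∣addPoint∣ (true  ∷ s) = ℕₚ.n≤1+n _
    ∣addPoint∣ (false ∷ s) = ℕₚ.≤-refl

    ⊑-refl : ∀ {n} {v : Cell n} → v ⊑ v
    ⊑-refl = Pointwise.refl (λ {s} {x} h → h)

    -- Among the maps used only `thicken` can enlarge a cell, and by at most one element, so the
    -- contraction costs one dimension.
    contraction-local : ∀ n {B k} {φ : Cochain (Cell n) (suc k)} →
      (∀ ys → F.Flag (Dim≤ (suc B)) ys → φ ys ≡ 0ℤ) →
      ∀ xs → F.Flag (Dim≤ B) xs → Contraction.K (contraction n) φ xs ≡ 0ℤ
    contraction-local zero    eq xs f = refl
    contraction-local (suc n) {B} {k} {φ} eq xs f = cong₂ ℤ._+_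
      (cong₂ ℤ._-_
        (prism-local {okˣ = Dim≤ B} {okʸ = Dim≤ (suc B)} collapse thicken
          (λ {x} → dim-collapse x) (λ {x} → dim-thicken x) collapse-mono thicken-mono
          (λ { (s ∷ v) → point⊆addPoint s ∷ ⊑-refl }) (λ _ → ⊤) (λ ys fl _ → eq ys fl) xs f (anything xs))
        (prism-local {okˣ = Dim≤ B} {okʸ = Dim≤ (suc B)} id thicken
          (λ (ne , le) → ne , ℕₚ.≤-trans le (ℕₚ.+-monoʳ-≤ (suc n) (ℕₚ.n≤1+n B))) (λ {x} → dim-thicken x) id thicken-mono
          (λ { (s ∷ v) → ⊆addPoint s ∷ ⊑-refl }) (λ _ → ⊤) (λ ys fl _ → eq ys fl) xs f (anything xs)))
      (contraction-local n (λ ys fl → eq _ (flag-map {okˣ = Dim≤ (suc B)} {okʸ = Dim≤ (suc B)} (point ∷_) (λ {v} → dim-ι v) ((λ {x} h → h) ∷_) fl))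
        (map tail xs) (flag-map {okˣ = Dim≤ B} {okʸ = Dim≤ B} tail (λ {v} → dim-tail v) (λ { (h ∷ hs) → hs }) f))
      where
      anything : ∀ {m} (xs : Vec (Cell (suc n)) m) → F.Below (λ _ → ⊤) xs
      anything []      = tt
      anything (_ ∷ _) = tt
      dim-collapse : ∀ (x : Cell (suc n)) → Dim≤ B x → Dim≤ (suc B) (collapse x)
      dim-collapse (s ∷ v) (h ∷ hs , le) = ℕₚ.≤-reflexive (sym ∣point∣) ∷ hs ,
        ℕₚ.≤-trans (ℕₚ.+-monoˡ-≤ (size v) (subst (_≤ ∣ s ∣) (sym ∣point∣) h)) (ℕₚ.≤-trans le (ℕₚ.+-monoʳ-≤ (suc n) (ℕₚ.n≤1+n B)))
      dim-thicken : ∀ (x : Cell (suc n)) → Dim≤ B x → Dim≤ (suc B) (thicken x)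
      dim-thicken (s ∷ v) (h ∷ hs , le) = ℕₚ.≤-trans h (p⊆q⇒∣p∣≤∣q∣ (⊆addPoint s)) ∷ hs ,
        ℕₚ.≤-trans (ℕₚ.+-monoˡ-≤ (size v) (∣addPoint∣ s)) (ℕₚ.≤-trans (s≤s le) (ℕₚ.≤-reflexive (sym (ℕₚ.+-suc (suc n) B))))
      collapse-mono : ∀ {x y : Cell (suc n)} → x ⊑ y → collapse x ⊑ collapse y
      collapse-mono (h ∷ hs) = (λ {x} h → h) ∷ hs
      thicken-mono : ∀ {x y : Cell (suc n)} → x ⊑ y → thicken x ⊑ thicken y
      thicken-mono {s ∷ _} {t ∷ _} (h ∷ hs) = addPoint-mono {s} {t} h ∷ hs
      dim-ι : ∀ (v : Cell n) → Dim≤ (suc B) v → Dim≤ (suc B) (point ∷ v)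
      dim-ι v (hs , le) = ℕₚ.≤-reflexive (sym ∣point∣) ∷ hs , subst (λ m → m + size v ≤ suc n + suc B) (sym ∣point∣) (s≤s le)
      dim-tail : ∀ (x : Cell (suc n)) → Dim≤ B x → Dim≤ B (tail x)
      dim-tail (s ∷ v) (h ∷ hs , le) = hs , ℕ.s≤s⁻¹ (ℕₚ.≤-trans (ℕₚ.+-monoˡ-≤ (size v) h) le)

    iterate : ∀ {A : Set} → (A → A) → ℕ → A → A
    iterate f zero    x = x
    iterate f (suc m) x = iterate f m (f x)

    iterate-map : ∀ {A : Set} {n} (f : A → A) m (xs : Vec A n) → iterate (map f) m xs ≡ map (iterate f m) xs
    iterate-map f zero    xs = sym (map-id xs)
    iterate-map f (suc m) xs = trans (iterate-map f m (map f xs)) (sym (map-∘ (iterate f m) f xs))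

    iterate-comm : ∀ {A : Set} (f : A → A) m x → f (iterate f m x) ≡ iterate f m (f x)
    iterate-comm f zero    x = refl
    iterate-comm f (suc m) x = iterate-comm f m (f x)

    iterate-+ : ∀ {A : Set} (f : A → A) a b x → iterate f (a + b) x ≡ iterate f b (iterate f a x)
    iterate-+ f zero    b x = refl
    iterate-+ f (suc a) b x = iterate-+ f a b (f x)

    prev : Fin p → Fin p
    prev zero    = fromℕ q
    prev (suc i) = inject₁ i

    toℕ-iterate-prev : ∀ m i → m ≤ toℕ i → toℕ (iterate prev m i) ≡ toℕ i ∸ m
    toℕ-iterate-prev zero    i       _       = refl
    toℕ-iterate-prev (suc m) (suc i) (s≤s h) =
      trans (toℕ-iterate-prev m (inject₁ i) (subst (m ≤_) (sym (toℕ-inject₁ i)) h)) (cong (_∸ m) (toℕ-inject₁ i))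

    -- Split p as i + 1 + (q - i): down to zero, once around, and down from q to i.
    iterate-prev : ∀ i → iterate prev p i ≡ i
    iterate-prev i = toℕ-injective (begin
      toℕ (iterate prev p i)
        ≡⟨ cong (λ m → toℕ (iterate prev m i)) (sym (trans (ℕₚ.+-suc (toℕ i) _) (cong suc (ℕₚ.m+[n∸m]≡n i≤q)))) ⟩
      toℕ (iterate prev (toℕ i + suc (q ∸ toℕ i)) i)
        ≡⟨ cong toℕ (iterate-+ prev (toℕ i) (suc (q ∸ toℕ i)) i) ⟩
      toℕ (iterate prev (suc (q ∸ toℕ i)) (iterate prev (toℕ i) i))
        ≡⟨ cong (λ j → toℕ (iterate prev (suc (q ∸ toℕ i)) j))
             (toℕ-injective (trans (toℕ-iterate-prev (toℕ i) i ℕₚ.≤-refl) (ℕₚ.n∸n≡0 (toℕ i)))) ⟩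
      toℕ (iterate prev (q ∸ toℕ i) (fromℕ q))
        ≡⟨ toℕ-iterate-prev (q ∸ toℕ i) (fromℕ q) (subst (q ∸ toℕ i ≤_) (sym (toℕ-fromℕ q)) (ℕₚ.m∸n≤m q (toℕ i))) ⟩
      toℕ (fromℕ q) ∸ (q ∸ toℕ i) ≡⟨ cong (_∸ (q ∸ toℕ i)) (toℕ-fromℕ q) ⟩
      q ∸ (q ∸ toℕ i) ≡⟨ ℕₚ.m∸[m∸n]≡n i≤q ⟩
      toℕ i ∎)
      where
      open ≡-Reasoning
      i≤q : toℕ i ≤ q
      i≤q = ℕₚ.≤-pred (toℕ<n i)

    rot : Subset p → Subset p
    rot s = tabulate (λ i → lookup s (prev i))

    lookup-rot : ∀ s i → lookup (rot s) i ≡ lookup s (prev i)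
    lookup-rot s = lookup∘tabulate (λ i → lookup s (prev i))

    iterate-rot : ∀ m s → iterate rot m s ≡ tabulate (λ i → lookup s (iterate prev m i))
    iterate-rot zero    s = sym (tabulate∘lookup s)
    iterate-rot (suc m) s = trans (iterate-rot m (rot s)) (tabulate-cong λ i →
      trans (lookup-rot s (iterate prev m i)) (cong (lookup s) (iterate-comm prev m i)))

    rot-order : ∀ s → iterate rot p s ≡ s
    rot-order s = trans (iterate-rot p s)
      (trans (tabulate-cong (λ i → cong (lookup s) (iterate-prev i))) (tabulate∘lookup s))

    rot-mono : ∀ {s t} → s ⊆ t → rot s ⊆ rot t
    rot-mono {s} {t} st {i} h = lookup⇒[]= i (rot t) (trans (lookup-rot t i)
      ([]=⇒lookup (st (lookup⇒[]= (prev i) s (trans (sym (lookup-rot s i)) ([]=⇒lookup h))))))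

    ∣rot∣ : ∀ s → ∣ rot s ∣ ≡ ∣ s ∣
    ∣rot∣ s = begin
      ∣ rot s ∣ ≡⟨ ∣∣-sum (rot s) ⟩
      sumFin p (λ i → val (lookup (rot s) i)) ≡⟨ sumFin-cong p (λ i → cong val (lookup-rot s i)) ⟩
      val (lookup s (fromℕ q)) + sumFin q (λ i → val (lookup s (inject₁ i))) ≡⟨ ℕₚ.+-comm (val (lookup s (fromℕ q))) _ ⟩
      sumFin q (λ i → val (lookup s (inject₁ i))) + val (lookup s (fromℕ q)) ≡⟨ sumFin-last q (λ i → val (lookup s i)) ⟨
      sumFin p (λ i → val (lookup s i)) ≡⟨ ∣∣-sum s ⟨
      ∣ s ∣ ∎
      where open ≡-Reasoning

    weight : Subset p → ℕ
    weight s = sumFin p (λ i → toℕ i * val (lookup s i))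

    -- Rotation adds one to each element, except that q becomes 0, which accounts for the multiple
    -- of p.
    weight-rot : ∀ s → weight s + ∣ s ∣ ≡ weight (rot s) + val (lookup s (fromℕ q)) * p
    weight-rot s = begin
      weight s + ∣ s ∣ ≡⟨ cong (weight s +_) (∣∣-sum s) ⟩
      weight s + sumFin p v ≡⟨ sumFin-+ p (λ i → toℕ i * v i) v ⟨
      sumFin p (λ i → toℕ i * v i + v i) ≡⟨ sumFin-last q (λ i → toℕ i * v i + v i) ⟩
      sumFin q (λ i → toℕ (inject₁ i) * v (inject₁ i) + v (inject₁ i)) + (toℕ (fromℕ q) * v (fromℕ q) + v (fromℕ q))
        ≡⟨ cong₂ _+_ (sumFin-cong q (λ i → trans (cong (λ m → m * v (inject₁ i) + v (inject₁ i)) (toℕ-inject₁ i))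
                       (trans (ℕₚ.+-comm _ (v (inject₁ i))) (cong (λ b → suc (toℕ i) * val b) (sym (lookup-rot s (suc i)))))))
                     (trans (cong (λ m → m * v (fromℕ q) + v (fromℕ q)) (toℕ-fromℕ q)) (lemma q (v (fromℕ q)))) ⟩
      weight (rot s) + v (fromℕ q) * p ∎
      where
      open ≡-Reasoning
      v : Fin p → ℕ
      v i = val (lookup s i)
      lemma : ∀ a b → a * b + b ≡ b * suc a
      lemma = ℕSolver.solve-∀

    size-rot : ∀ {n} (v : Cell n) → size (map rot v) ≡ size v
    size-rot []      = refl
    size-rot (s ∷ v) = cong₂ _+_ (∣rot∣ s) (size-rot v)

    Dim≤-rot : ∀ {n B} {v : Cell n} → Dim≤ B v → Dim≤ B (map rot v)
    Dim≤-rot {n} {B} {v} (ne , le) =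
      Allₚ.map⁺ (All.map (λ {s} → subst (1 ≤_) (sym (∣rot∣ s))) ne) , subst (_≤ n + B) (sym (size-rot v)) le

    ⊑-rot : ∀ {n} {v w : Cell n} → v ⊑ w → map rot v ⊑ map rot w
    ⊑-rot []       = []
    ⊑-rot (h ∷ hs) = rot-mono h ∷ ⊑-rot hs

    module _ (pr : Prime p) (1<p : 1 < p) where

      inverse : ∀ k → ∃[ u ] (1 ≤ k → k < p → (u * k) % p ≡ 1 % p)
      inverse zero = 0 , λ ()
      inverse k@(suc _) with suc k ≤? p
      ... | no  k≮p = 0 , λ _ k<p → ⊥-elim (k≮p k<p)
      ... | yes k<p with coprime-Bézout (prime⇒coprime pr k<p)
      ...   | Bézout.-+ x y eq = y , λ _ _ → trans (cong (_% p) (sym eq)) ([m+kn]%n≡m%n 1 x p)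
      -- Here 1 + y k is a multiple of p, so the inverse is -y, represented by `q * y` because q = p
      -- - 1.
      ...   | Bézout.+- x y eq = q * y , λ _ _ → begin
        (q * y * k) % p         ≡⟨ [m+n]%n≡m%n (q * y * k) p ⟨
        (q * y * k + p) % p     ≡⟨ cong (_% p) (trans (lemma q y k) (cong (λ z → 1 + q * z) eq)) ⟩
        (1 + q * (x * p)) % p   ≡⟨ cong (λ z → (1 + z) % p) (ℕₚ.*-assoc q x p) ⟨
        (1 + q * x * p) % p     ≡⟨ [m+kn]%n≡m%n 1 (q * x) p ⟩
        1 % p ∎
        where
        open ≡-Reasoning
        lemma : ∀ q y k → q * y * k + suc q ≡ 1 + q * (1 + y * k)
        lemma = ℕSolver.solve-∀

      normalize : ℕ → ℕ → ℕ → ℕ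
      normalize zero      w r = r
      normalize k@(suc _) w r = (proj₁ (inverse k) * w) % p

      -- The mean modulo p of the first nonempty set of the tuple. Rotation adds |s| to the sum of s
      -- and hence one to its mean; |s| is invertible because 1 ≤ |s| < p and p is prime.
      residue : ∀ {c} → Vec (Subset p) c → ℕ
      residue []       = 0
      residue (s ∷ ss) = normalize ∣ s ∣ (weight s) (residue ss)

      residue<p : ∀ {c} (ss : Vec (Subset p) c) → residue ss < p
      residue<p []       = s≤s z≤n
      residue<p (s ∷ ss) with ∣ s ∣
      ... | suc k = m%n<n (proj₁ (inverse (suc k)) * weight s) p
      ... | zero  = residue<p ss

      residue-rot : ∀ {c} (ss : Vec (Subset p) c) → (∃[ a ] 1 ≤ ∣ lookup ss a ∣) → (∀ a → ∣ lookup ss a ∣ < p) →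
                    residue (map rot ss) ≡ (residue ss + 1) % p
      residue-rot (s ∷ ss) (a , ha) small =
        trans (cong (λ k → normalize k (weight (rot s)) (residue (map rot ss))) (∣rot∣ s)) (go ∣ s ∣ refl a ha)
        where
        open ≡-Reasoning
        l = val (lookup s (fromℕ q))
        lemma : ∀ u w l p → u * w + u * l * p ≡ u * (w + l * p)
        lemma = ℕSolver.solve-∀
        go : ∀ k → ∣ s ∣ ≡ k → ∀ a → 1 ≤ ∣ lookup (s ∷ ss) a ∣ →
             normalize k (weight (rot s)) (residue (map rot ss)) ≡ (normalize k (weight s) (residue ss) + 1) % p
        go zero    eq zero    h = ⊥-elim (ℕₚ.<⇒≢ h (sym eq))
        go zero    eq (suc a) h = residue-rot ss (a , h) (small ∘ suc)
        go k@(suc _) eq _ _ = begin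
          (u * weight (rot s)) % p ≡⟨ [m+kn]%n≡m%n (u * weight (rot s)) (u * l) p ⟨
          (u * weight (rot s) + u * l * p) % p ≡⟨ cong (_% p) (trans (lemma u (weight (rot s)) l p) (cong (u *_) (sym (weight-rot s)))) ⟩
          (u * (weight s + ∣ s ∣)) % p ≡⟨ cong (λ k → (u * (weight s + k)) % p) eq ⟩
          (u * (weight s + k)) % p ≡⟨ cong (_% p) (ℕₚ.*-distribˡ-+ u (weight s) k) ⟩
          (u * weight s + u * k) % p ≡⟨ %-distribˡ-+ (u * weight s) (u * k) p ⟩
          ((u * weight s) % p + (u * k) % p) % p
            ≡⟨ cong₂ (λ a b → (a + b) % p) (sym (m%n%n≡m%n (u * weight s) p)) (proj₂ (inverse k) (s≤s z≤n) (subst (_< p) eq (small zero))) ⟩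
          ((u * weight s) % p % p + 1 % p) % p ≡⟨ %-distribˡ-+ ((u * weight s) % p) 1 p ⟨
          ((u * weight s) % p + 1) % p ∎
          where
          u = proj₁ (inverse k)

      module _ {c n} (J : ℕ) (S : Cell n → Vec (Subset p) c)
        (equivariant : ∀ v → S (map rot v) ≡ map rot (S v))
        (some : ∀ v → Dim≤ (double J) v → ∃[ a ] 1 ≤ ∣ lookup (S v) a ∣)
        (notFull : ∀ v → Dim≤ (double J) v → ∀ a → ∣ lookup (S v) a ∣ < p) where

        -- A flag for dimension 2J has 2J + 1 cells, while their ranks are weakly increasing within
        -- 1, ..., 2J. Two neighbors then share the rank, hence the value of S, hence the residue,
        -- against `¬all-repeat`.
        noRank : (rank : Cell n → ℕ) →
          (∀ v → Dim≤ (double J) v → 1 ≤ rank v × rank v ≤ double J) →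
          (∀ {v w} → v ⊑ w → rank v ≤ rank w) →
          (∀ {v w} → Dim≤ (double J) v → Dim≤ (double J) w → v ⊑ w → rank v ≡ rank w → S v ≡ S w) → ⊥
        noRank rank range mono strict = Dg.¬all-repeat repeats
          where
          r : Cell n → ℕ
          r v = residue (S v)
          turn-map : ∀ m {k} (xs : Vec (Cell n) k) → Resolution.turn (contraction n) (map rot) p m xs ≡ map (iterate (map rot) m) xs
          turn-map zero    xs = sym (map-id xs)
          turn-map (suc m) xs = trans (turn-map m (map (map rot) xs)) (sym (map-∘ (iterate (map rot) m) (map rot) xs))
          turn-id : ∀ {k} (xs : Vec (Cell n) k) → Resolution.turn (contraction n) (map rot) p p xs ≡ xs
          turn-id xs = trans (turn-map p xs) (trans (map-cong (λ v → trans (iterate-map rot p v)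
            (trans (map-cong rot-order v) (map-id v))) xs) (map-id xs))
          r-g : ∀ {v} → Dim≤ (double J) v → (r (map rot v) ≡ suc (r v)) ⊎ (suc (r v) ≡ p × r (map rot v) ≡ 0)
          r-g {v} ok with trans (cong residue (equivariant v)) (residue-rot (S v) (some v ok) (notFull v ok))
          ... | eq with ℕₚ.m≤n⇒m<n∨m≡n (residue<p (S v))
          ...   | inj₁ lt = inj₁ (trans eq (trans (m<n⇒m%n≡m (subst (_< p) (ℕₚ.+-comm 1 (r v)) lt)) (ℕₚ.+-comm (r v) 1)))
          ...   | inj₂ sr≡p = inj₂ (sr≡p , trans eq (trans (cong (_% p) (trans (ℕₚ.+-comm (r v) 1) sr≡p)) (n%n≡0 p)))
          base-ok : ∀ n → Dim≤ 0 (Contraction.base (contraction n))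
          base-ok zero    = [] , z≤n
          base-ok (suc n) with base-ok n
          ... | ne , le = ℕₚ.≤-reflexive (sym ∣point∣) ∷ ne , subst (λ m → m + size (Contraction.base (contraction n)) ≤ suc n + 0) (sym ∣point∣) (s≤s le)
          Fl : ∀ k → Vec (Cell n) (suc k) → Set
          Fl k = F.Flag (Dim≤ k)
          module Dg = Degree (contraction n) (map rot) p turn-id 1<p r (λ v → residue<p (S v))
            (Dim≤ (double J)) (λ {v} → Dim≤-rot {v = v}) r-g Fl (base-ok n , tt , tt)
            (λ {k} → flag-map {okˣ = Dim≤ k} {okʸ = Dim≤ k} (map rot) (λ {v} → Dim≤-rot {v = v}) ⊑-rot)
            (λ {k} eq xs → contraction-local n eq xs) J
            (λ {k} k≤ fl → All.map (λ (ne , le) → ne , ℕₚ.≤-trans le (ℕₚ.+-monoʳ-≤ n k≤)) (F.Flag⇒All fl))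
          climb : ∀ k (xs : Vec (Cell n) (suc k)) → F.Flag (Dim≤ (double J)) xs →
                  Repeats Dg._≈_ xs ⊎ rank (Data.Vec.Base.head xs) + k ≤ double J
          climb zero    (x ∷ [])     (ok , _) = inj₂ (subst (_≤ double J) (sym (ℕₚ.+-identityʳ _)) (proj₂ (range x ok)))
          climb (suc k) (x ∷ y ∷ xs) (ok , le , fl) with climb k (y ∷ xs) fl
          ... | inj₁ rep = inj₁ (there rep)
          ... | inj₂ h with ℕₚ.m≤n⇒m<n∨m≡n (mono le)
          ...   | inj₁ lt = inj₂ (ℕₚ.≤-trans (ℕₚ.≤-reflexive (ℕₚ.+-suc (rank x) k)) (ℕₚ.≤-trans (ℕₚ.+-monoˡ-≤ k lt) h))
          ...   | inj₂ eq = inj₁ (here (cong residue (strict ok (proj₁ fl) le eq)))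
          repeats : ∀ xs → Fl (double J) xs → Repeats Dg._≈_ xs
          repeats xs@(x ∷ _) fl@(ok , _) with climb (double J) xs fl
          ... | inj₁ rep = rep
          ... | inj₂ h   = ⊥-elim (ℕₚ.<⇒≱ (ℕₚ.+-monoˡ-≤ (double J) (proj₁ (range x ok))) h)

        private
          size-bound : ∀ {c} (ss : Vec (Subset p) c) → (∀ a → ∣ lookup ss a ∣ < p) → size ss ≤ c * q
          size-bound []       _  = z≤n
          size-bound (s ∷ ss) sm = ℕₚ.+-mono-≤ (ℕₚ.≤-pred (sm zero)) (size-bound ss (sm ∘ suc))
          size-positive : ∀ {c} (ss : Vec (Subset p) c) a → 1 ≤ ∣ lookup ss a ∣ → 1 ≤ size ss
          size-positive (s ∷ ss) zero    h = ℕₚ.m≤n⇒m≤n+o (size ss) h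
          size-positive (s ∷ ss) (suc a) h = ℕₚ.≤-trans (size-positive ss a h) (ℕₚ.m≤n+m (size ss) ∣ s ∣)
          range : c * q ≤ double J → ∀ v → Dim≤ (double J) v → 1 ≤ size (S v) × size (S v) ≤ double J
          range cq v ok = size-positive (S v) (proj₁ (some v ok)) (proj₂ (some v ok)) ,
            ℕₚ.≤-trans (size-bound (S v) (notFull v ok)) cq

        -- Tuples of proper subsets, not all empty, are the faces of a join of c boundaries of
        -- simplices, and `size` is the rank there; it is at most c q, since a proper subset has at
        -- most q elements.
        noIncreasing : c * q ≤ double J → (∀ {v w} → v ⊑ w → S v ⊑ S w) → ⊥
        noIncreasing cq mono = noRank (size ∘ S) (range cq) (size-mono ∘ mono)
          (λ _ _ le eq → ⊑-size⇒≡ (mono le) (ℕₚ.≤-reflexive (sym eq)))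

        -- Subtracting the size from 2J + 1 reverses the order and keeps the rank within 1, ..., 2J.
        noDecreasing : c * q ≤ double J → (∀ {v w} → v ⊑ w → S w ⊑ S v) → ⊥
        noDecreasing cq mono = noRank (λ v → suc (double J) ∸ size (S v))
          (λ v ok → let (lo , hi) = range cq v ok in ℕₚ.m<n⇒0<n∸m (s≤s hi) , ℕₚ.∸-monoʳ-≤ (suc (double J)) lo)
          (λ le → ℕₚ.∸-monoʳ-≤ (suc (double J)) (size-mono (mono le)))
          (λ ov ow le eq → sym (⊑-size⇒≡ (mono le) (ℕₚ.≤-reflexive
            (ℕₚ.∸-cancelˡ-≡ (ℕₚ.m≤n⇒m≤1+n (proj₂ (range cq _ ov))) (ℕₚ.m≤n⇒m≤1+n (proj₂ (range cq _ ow))) eq))))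

-- Two coloring lemmas of Kneser type.

module KneserLemmas where

  open IndexTheorem using (double)
  open EquivariantMaps
  open import Data.Bool.Base using (true; false)
  open import Data.Empty using (⊥-elim)
  open import Data.Fin.Base using (Fin; zero; suc; toℕ; fromℕ; fromℕ<)
  open import Data.Fin.Properties using (toℕ-injective; toℕ-fromℕ; toℕ-fromℕ<; toℕ<n; any?; all?; suc-injective) renaming (_≟_ to _≟ᶠ_)
  open import Data.Fin.Subset as Subset using (Subset; ∣_∣; _∈_; _⊆_)
  open import Data.Fin.Subset.Properties using (_∈?_; ∣p∣≤n; ∣p∣≡n⇒p≡⊤; ∈⊤)
  open import Data.List.Base as List using (List; []; _∷_; length)
  open import Data.List.Membership.Propositional using () renaming (_∈_ to _∈ˡ_)
  open import Data.List.Membership.Propositional.Properties using (∈-map⁺)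
  open import Data.List.Properties using (length-map)
  import Data.List.Relation.Unary.Any as Any
  open import Data.Nat.Base as ℕ using (ℕ; zero; suc; _+_; _*_; _∸_; _≤_; _<_; z≤n; s≤s)
  open import Data.Nat.Primality using (Prime)
  open import Data.Nat.Properties using (_≤?_; _<?_)
  import Data.Nat.Properties as ℕₚ
  open import Data.Product.Base using (Σ-syntax; ∃-syntax; _×_; _,_; proj₁; proj₂)
  open import Data.Sum.Base using (_⊎_; inj₁; inj₂)
  open import Data.Vec.Base as Vec using (Vec; []; _∷_; map; lookup; tabulate; here; there)
  open import Data.Vec.Properties using (map-cong; map-∘; map-id; lookup∘tabulate; lookup⇒[]=; []=⇒lookup; lookup-map; tabulate-cong)
  open import Data.Vec.Relation.Binary.Pointwise.Inductive as Pointwise using (Pointwise; []; _∷_)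
  open import Data.Vec.Relation.Unary.All as All using (All; []; _∷_)
  open import Function.Base using (_∘_)
  open import Function.Bundles using (mk⇔)
  open import Relation.Binary.PropositionalEquality
  open import Relation.Nullary using (¬_; Dec; yes; no; does)
  open import Relation.Nullary.Decidable using (_×-dec_; _→-dec_; map′; does-⇔; dec-true)

  comprehension : ∀ {n} {P : Fin n → Set} → (∀ i → Dec (P i)) → Subset n
  comprehension P? = tabulate (λ i → does (P? i))

  ∈-comprehension⁺ : ∀ {n} {P : Fin n → Set} (P? : ∀ i → Dec (P i)) {i} → P i → i ∈ comprehension P?
  ∈-comprehension⁺ P? {i} h = lookup⇒[]= i _ (trans (lookup∘tabulate _ i) (dec-true (P? i) h))

  ∈-comprehension⁻ : ∀ {n} {P : Fin n → Set} (P? : ∀ i → Dec (P i)) {i} → i ∈ comprehension P? → P i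
  ∈-comprehension⁻ P? {i} h with P? i | trans (sym (lookup∘tabulate (λ i → does (P? i)) i)) ([]=⇒lookup h)
  ... | yes p | _ = p
  ... | no  _ | ()

  anyVec? : ∀ {n m} {P : Vec (Fin m) n → Set} → (∀ x → Dec (P x)) → Dec (∃[ x ] P x)
  anyVec? {zero}  P? = map′ (λ h → [] , h) (λ { ([] , h) → h }) (P? [])
  anyVec? {suc n} P? = map′ (λ (i , x , h) → i ∷ x , h) (λ { (i ∷ x , h) → i , x , h })
    (any? λ i → anyVec? λ x → P? (i ∷ x))

  atAll : ∀ {A : Set} {P : A → Set} {n} {xs : Vec A n} → All P xs → ∀ i → P (lookup xs i)
  atAll (h ∷ _)  zero    = h
  atAll (_ ∷ hs) (suc i) = atAll hs i

  member : ∀ {n} {s : Subset n} → 1 ≤ ∣ s ∣ → ∃[ i ] i ∈ s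
  member {s = true  ∷ s} _ = zero , here
  member {s = false ∷ s} h with member h
  ... | i , i∈s = suc i , there i∈s

  positive : ∀ {n} {s : Subset n} {i} → i ∈ s → 1 ≤ ∣ s ∣
  positive {s = true  ∷ s} _         = s≤s z≤n
  positive {s = false ∷ s} (there h) = positive h

  unique : ∀ {n} {s : Subset n} → ∣ s ∣ ≤ 1 → ∀ {i j} → i ∈ s → j ∈ s → i ≡ j
  unique {s = false ∷ s} h       (there hi) (there hj) = cong suc (unique h hi hj)
  unique {s = true  ∷ s} h       here       here       = refl
  unique {s = true  ∷ s} (s≤s h) here       (there hj) = ⊥-elim (ℕₚ.<⇒≱ (positive hj) h)
  unique {s = true  ∷ s} (s≤s h) (there hi) _          = ⊥-elim (ℕₚ.<⇒≱ (positive hi) h)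

  full : ∀ {n} {s : Subset n} → ¬ ∣ s ∣ < n → ∀ i → i ∈ s
  full {n} {s} h i = subst (i ∈_) (sym (∣p∣≡n⇒p≡⊤ (ℕₚ.≤-antisym (∣p∣≤n s) (ℕₚ.≮⇒≥ h)))) ∈⊤

  enumerate : ∀ {n} (s : Subset n) → Vec (Fin n) ∣ s ∣
  enumerate []          = []
  enumerate (true  ∷ s) = zero ∷ map suc (enumerate s)
  enumerate (false ∷ s) = map suc (enumerate s)

  Injective : ∀ {A : Set} {n} → Vec A n → Set
  Injective e = ∀ i j → lookup e i ≡ lookup e j → i ≡ j

  enumerate-injective : ∀ {n} (s : Subset n) → Injective (enumerate s)
  enumerate-injective (true ∷ s) zero    zero    _ = refl
  enumerate-injective (true ∷ s) zero    (suc j) eq with () ← trans eq (lookup-map j suc (enumerate s))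
  enumerate-injective (true ∷ s) (suc i) zero    eq with () ← trans (sym eq) (lookup-map i suc (enumerate s))
  enumerate-injective (true ∷ s) (suc i) (suc j) eq = cong suc (enumerate-injective s i j
    (suc-injective (trans (sym (lookup-map i suc (enumerate s))) (trans eq (lookup-map j suc (enumerate s))))))
  enumerate-injective (false ∷ s) i j eq = enumerate-injective s i j
    (suc-injective (trans (sym (lookup-map i suc (enumerate s))) (trans eq (lookup-map j suc (enumerate s)))))

  enumerate-onto : ∀ {n} (s : Subset n) {i} → i ∈ s → ∃[ j ] lookup (enumerate s) j ≡ i
  enumerate-onto (true ∷ s) here = zero , refl
  enumerate-onto (true ∷ s) (there h) with enumerate-onto s h
  ... | j , eq = suc j , trans (lookup-map j suc (enumerate s)) (cong suc eq)
  enumerate-onto (false ∷ s) (there h) with enumerate-onto s h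
  ... | j , eq = j , trans (lookup-map j suc (enumerate s)) (cong suc eq)

  extend : ∀ {n} (s : Subset n) d → ∣ s ∣ ≤ d → d ≤ n → Σ[ s′ ∈ Subset n ] (s ⊆ s′ × ∣ s′ ∣ ≡ d)
  extend []          zero    _       _       = [] , (λ h → h) , refl
  extend (true ∷ s)  (suc d) (s≤s h) (s≤s k) with extend s d h k
  ... | s′ , sub , eq = true ∷ s′ , (λ { here → here ; (there m) → there (sub m) }) , cong suc eq
  extend {suc n} (false ∷ s) d h k with d ≤? n
  ... | yes d≤n with extend s d h d≤n
  ...   | s′ , sub , eq = false ∷ s′ , (λ { (there m) → there (sub m) }) , eq
  extend {suc n} (false ∷ s) d h k | no d≰n with ℕₚ.≤-antisym k (ℕₚ.≰⇒> d≰n)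
  ... | refl with extend s n (∣p∣≤n s) ℕₚ.≤-refl
  ...   | s′ , sub , eq = true ∷ s′ , (λ { (there m) → there (sub m) }) , cong suc eq

  injectionOnto : ∀ {n} (s : Subset n) d → ∣ s ∣ ≤ d → d ≤ n →
    Σ[ e ∈ Vec (Fin n) d ] (Injective e × (∀ {i} → i ∈ s → ∃[ j ] lookup e j ≡ i))
  injectionOnto s d h k with extend s d h k
  ... | s′ , sub , refl = enumerate s′ , enumerate-injective s′ , λ m → enumerate-onto s′ (sub m)

  sumFin-swap : ∀ n m (F : Fin n → Fin m → ℕ) →
    sumFin n (λ i → sumFin m (F i)) ≡ sumFin m (λ j → sumFin n (λ i → F i j))
  sumFin-swap zero    m F = sym (zeros m)
    where
    zeros : ∀ m → sumFin m (λ _ → 0) ≡ 0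
    zeros zero    = refl
    zeros (suc m) = zeros m
  sumFin-swap (suc n) m F = trans (cong (sumFin m (F zero) +_) (sumFin-swap n m (F ∘ suc)))
    (sym (sumFin-+ m (F zero) (λ j → sumFin n (λ i → F (suc i) j))))

  sumFin-≥ : ∀ n (F : Fin n → ℕ) b → (∀ i → b ≤ F i) → n * b ≤ sumFin n F
  sumFin-≥ zero    F b h = z≤n
  sumFin-≥ (suc n) F b h = ℕₚ.+-mono-≤ (h zero) (sumFin-≥ n (F ∘ suc) b (h ∘ suc))

  size-sum : ∀ {p n} (v : Family p n) → size v ≡ sumFin n (λ i → ∣ lookup v i ∣)
  size-sum []      = refl
  size-sum (s ∷ v) = cong (∣ s ∣ +_) (size-sum v)

  module _ (q : ℕ) where
    private
      p = suc q

    turnBy : Fin p → Fin p → Fin p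
    turnBy g = iterate q (prev q) (toℕ g)

    -- `turnBy g i` is i - g, which does not change when both are lowered by one; at g = 0 the q
    -- turns and the one already applied make p, the identity.
    turnBy-prev : ∀ g i → turnBy (prev q g) (prev q i) ≡ turnBy g i
    turnBy-prev zero    i = trans (cong (λ m → iterate q (prev q) m (prev q i)) (toℕ-fromℕ q)) (iterate-prev q i)
    turnBy-prev (suc g) i = cong (λ m → iterate q (prev q) m (prev q i)) (Data.Fin.Properties.toℕ-inject₁ g)

    next : Fin p → Fin p
    next = iterate q (prev q) q

    prev-next : ∀ i → prev q (next i) ≡ i
    prev-next i = trans (iterate-comm q (prev q) q i) (iterate-prev q i)

    turnBy-onto : ∀ i j → ∃[ g ] turnBy g i ≡ j
    turnBy-onto i j with toℕ j ≤? toℕ i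
    ... | yes j≤i = fromℕ< m<p , toℕ-injective (trans (cong (λ m → toℕ (iterate q (prev q) m i)) (toℕ-fromℕ< m<p))
        (trans (toℕ-iterate-prev q (toℕ i ∸ toℕ j) i (ℕₚ.m∸n≤m (toℕ i) (toℕ j))) (ℕₚ.m∸[m∸n]≡n j≤i)))
      where
      m<p : toℕ i ∸ toℕ j < p
      m<p = ℕₚ.≤-<-trans (ℕₚ.m∸n≤m (toℕ i) (toℕ j)) (toℕ<n i)
    ... | no j≰i = fromℕ< m<p , toℕ-injective (begin
        toℕ (turnBy (fromℕ< m<p) i) ≡⟨ cong (λ m → toℕ (iterate q (prev q) m i)) (toℕ-fromℕ< m<p) ⟩
        toℕ (iterate q (prev q) (toℕ i + suc r) i) ≡⟨ cong toℕ (iterate-+ q (prev q) (toℕ i) (suc r) i) ⟩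
        toℕ (iterate q (prev q) (suc r) (iterate q (prev q) (toℕ i) i))
          ≡⟨ cong (λ k → toℕ (iterate q (prev q) (suc r) k))
               (toℕ-injective {j = zero} (trans (toℕ-iterate-prev q (toℕ i) i ℕₚ.≤-refl) (ℕₚ.n∸n≡0 (toℕ i)))) ⟩
        toℕ (iterate q (prev q) r (fromℕ q))
          ≡⟨ toℕ-iterate-prev q r (fromℕ q) (subst (r ≤_) (sym (toℕ-fromℕ q)) (ℕₚ.m∸n≤m q (toℕ j))) ⟩
        toℕ (fromℕ q) ∸ r ≡⟨ cong (_∸ r) (toℕ-fromℕ q) ⟩
        q ∸ r ≡⟨ ℕₚ.m∸[m∸n]≡n j≤q ⟩
        toℕ j ∎)
      where
      open ≡-Reasoning
      r = q ∸ toℕ j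
      j≤q : toℕ j ≤ q
      j≤q = ℕₚ.≤-pred (toℕ<n j)
      m<p : toℕ i + suc r < p
      m<p = s≤s (ℕₚ.≤-trans (ℕₚ.≤-reflexive (ℕₚ.+-suc (toℕ i) r))
        (ℕₚ.≤-trans (ℕₚ.+-monoˡ-≤ r (ℕₚ.≰⇒> j≰i)) (ℕₚ.≤-reflexive (ℕₚ.m+[n∸m]≡n j≤q))))

    wide : ∀ {n} → Family p n → List (Fin n)
    wide []      = []
    wide (s ∷ v) with ∣ s ∣ ≤? 1
    ... | yes _ = List.map suc (wide v)
    ... | no  _ = zero ∷ List.map suc (wide v)

    ∈-wide : ∀ {n} (v : Family p n) i → i ∈ˡ wide v ⊎ ∣ lookup v i ∣ ≤ 1
    ∈-wide (s ∷ v) i with ∣ s ∣ ≤? 1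
    ∈-wide (s ∷ v) zero    | yes h = inj₂ h
    ∈-wide (s ∷ v) zero    | no  _ = inj₁ (Any.here refl)
    ∈-wide (s ∷ v) (suc i) | yes _ with ∈-wide v i
    ... | inj₁ m = inj₁ (∈-map⁺ suc m)
    ... | inj₂ h = inj₂ h
    ∈-wide (s ∷ v) (suc i) | no _ with ∈-wide v i
    ... | inj₁ m = inj₁ (Any.there (∈-map⁺ suc m))
    ... | inj₂ h = inj₂ h

    -- Every set contributes one to the size and every wide set at least one more, so the dimension
    -- of a cell bounds its wide columns.
    length-wide : ∀ {n} (v : Family p n) → Nonempty q v → n + length (wide v) ≤ size v
    length-wide []      _        = z≤n
    length-wide {suc n} (s ∷ v) (h ∷ hs) with ∣ s ∣ ≤? 1
    ... | yes _ = ℕₚ.+-mono-≤ h (subst (λ m → n + m ≤ size v) (sym (length-map suc (wide v))) (length-wide v hs))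
    ... | no ¬h = ℕₚ.≤-trans
      (ℕₚ.≤-reflexive (trans (cong (λ m → suc (n + suc m)) (length-map suc (wide v))) (cong suc (ℕₚ.+-suc n _))))
      (ℕₚ.+-mono-≤ (ℕₚ.≰⇒> ¬h) (length-wide v hs))

    -- p rows of the color a of f that form a permutation in every column outside `bad`.
    record Rows {L c} (D : ℕ) (f : Vec (Fin p) L → Fin c) : Set where
      field
        color  : Fin c
        row    : Fin p → Vec (Fin p) L
        bad    : List (Fin L)
        few    : length bad ≤ D
        colors : ∀ g → f (row g) ≡ color
        covers : ∀ i → i ∈ˡ bad ⊎ (∀ w → ∃[ g ] lookup (row g) i ≡ w)

    module _ (pr : Prime p) (1<p : 1 < p) where

      -- `S v a` holds the shifts g such that some selection x from v satisfies f(x - g) = a; it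
      -- grows with v, so by `noIncreasing` one of these sets must be full. It provides a selection
      -- for every shift. In a column where v has a single symbol all selections agree, and the
      -- shifts of that symbol run through ℤ/p; the other columns are `wide v`.
      rows : ∀ {L c} J → c * q ≤ double J → (f : Vec (Fin p) L → Fin c) → ¬ ¬ Rows (double J) f
      rows {L} {c} J cq f none = noIncreasing q pr 1<p J S equivariant some notFull cq mono
        where
        Hit : Family p L → Fin c → Fin p → Set
        Hit v a g = ∃[ x ] (Pointwise _∈_ x v × f (map (turnBy g) x) ≡ a)
        hit? : ∀ v a g → Dec (Hit v a g)
        hit? v a g = anyVec? λ x → Pointwise.decidable _∈?_ x v ×-dec (f (map (turnBy g) x) ≟ᶠ a)
        S : Family p L → Vec (Subset p) c
        S v = tabulate (λ a → comprehension (hit? v a))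
        ∈S⁺ : ∀ v a g → Hit v a g → g ∈ lookup (S v) a
        ∈S⁺ v a g h = subst (g ∈_) (sym (lookup∘tabulate (λ a → comprehension (hit? v a)) a)) (∈-comprehension⁺ (hit? v a) h)
        ∈S⁻ : ∀ v a g → g ∈ lookup (S v) a → Hit v a g
        ∈S⁻ v a g h = ∈-comprehension⁻ (hit? v a) (subst (g ∈_) (lookup∘tabulate (λ a → comprehension (hit? v a)) a) h)
        rot∈ : ∀ {s : Subset p} {i} → i ∈ rot q s → prev q i ∈ s
        rot∈ {s} {i} h = lookup⇒[]= _ s (trans (sym (lookup-rot q s i)) ([]=⇒lookup h))
        ∈rot : ∀ {s : Subset p} {i} → prev q i ∈ s → i ∈ rot q s
        ∈rot {s} {i} h = lookup⇒[]= i _ (trans (lookup-rot q s i) ([]=⇒lookup h))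
        pull : ∀ {n} {x : Vec (Fin p) n} {v : Family p n} → Pointwise _∈_ x (map (rot q) v) → Pointwise _∈_ (map (prev q) x) v
        pull {x = []}    {[]}    []       = []
        pull {x = _ ∷ _} {_ ∷ _} (h ∷ hs) = rot∈ h ∷ pull hs
        push : ∀ {n} {x : Vec (Fin p) n} {v : Family p n} → Pointwise _∈_ x v → Pointwise _∈_ (map next x) (map (rot q) v)
        push []                       = []
        push (_∷_ {y = s} h hs) = ∈rot {s} (subst (_∈ s) (sym (prev-next _)) h) ∷ push hs
        turned : ∀ g x → map (turnBy (prev q g)) (map (prev q) x) ≡ map (turnBy g) x
        turned g x = trans (sym (map-∘ (turnBy (prev q g)) (prev q) x)) (map-cong (turnBy-prev g) x)
        equivariant : ∀ v → S (map (rot q) v) ≡ map (rot q) (S v)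
        equivariant v = trans (tabulate-cong eq) (Data.Vec.Properties.tabulate-∘ (rot q) (λ a → comprehension (hit? v a)))
          where
          eq : ∀ a → comprehension (hit? (map (rot q) v) a) ≡ rot q (comprehension (hit? v a))
          eq a = tabulate-cong λ g → trans
            (does-⇔ (mk⇔ (pulled a g) (pushed a g)) (hit? (map (rot q) v) a g) (hit? v a (prev q g)))
            (sym (lookup∘tabulate (λ g → does (hit? v a g)) (prev q g)))
            where
            pulled : ∀ a g → Hit (map (rot q) v) a g → Hit v a (prev q g)
            pulled a g (x , h , fx) = map (prev q) x , pull h , trans (cong f (turned g x)) fx
            pushed : ∀ a g → Hit v a (prev q g) → Hit (map (rot q) v) a g
            pushed a g (x , h , fx) = map next x , push h , trans (cong f (trans (sym (turned g (map next x)))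
              (cong (map (turnBy (prev q g))) (trans (sym (map-∘ (prev q) next x)) (trans (map-cong prev-next x) (map-id x)))))) fx
        pick : ∀ {n} {v : Family p n} → Nonempty q v → Σ[ x ∈ Vec (Fin p) n ] Pointwise _∈_ x v
        pick []       = [] , []
        pick (h ∷ hs) = let (i , m) = member h ; (x , ms) = pick hs in i ∷ x , m ∷ ms
        some : ∀ v → Dim≤ q (double J) v → ∃[ a ] 1 ≤ ∣ lookup (S v) a ∣
        some v (ne , _) = let (x , m) = pick ne in
          f (map (turnBy zero) x) , positive (∈S⁺ v _ zero (x , m , refl))
        notFull : ∀ v → Dim≤ q (double J) v → ∀ a → ∣ lookup (S v) a ∣ < p
        notFull v (ne , le) a with ∣ lookup (S v) a ∣ <? p
        ... | yes h = h
        ... | no  h = ⊥-elim (none record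
          { color = a ; row = λ g → map (turnBy g) (proj₁ (hit g)) ; bad = wide v
          ; few = ℕₚ.+-cancelˡ-≤ L _ _ (ℕₚ.≤-trans (length-wide v ne) le)
          ; colors = λ g → proj₂ (proj₂ (hit g)) ; covers = covers })
          where
          hit : ∀ g → Hit v a g
          hit g = ∈S⁻ v a g (full {s = lookup (S v) a} h g)
          at : ∀ {n} {x : Vec (Fin p) n} {v : Family p n} → Pointwise _∈_ x v → ∀ i → lookup x i ∈ lookup v i
          at = Pointwise.lookup
          covers : ∀ i → i ∈ˡ wide v ⊎ (∀ w → ∃[ g ] lookup (map (turnBy g) (proj₁ (hit g))) i ≡ w)
          covers i with ∈-wide v i
          ... | inj₁ m = inj₁ m
          ... | inj₂ h = inj₂ λ w → let (g , eq) = turnBy-onto (lookup (proj₁ (hit zero)) i) w in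
            g , trans (lookup-map i (turnBy g) (proj₁ (hit g)))
                 (trans (cong (turnBy g) (unique h (at (proj₁ (proj₂ (hit g))) i) (at (proj₁ (proj₂ (hit zero))) i))) eq)
        mono : ∀ {v w} → v ⊑ w → S v ⊑ S w
        mono {v} {w} le = Pointwise.tabulate⁺ λ a {g} h → ∈-comprehension⁺ (hit? w a) {g}
          (let (x , m , fx) = ∈-comprehension⁻ (hit? v a) h in x , Pointwise.trans (λ m s → s m) m le , fx)

      -- t = p color classes; every symbol of Fin m lies in some e g.
      record Cover {m d c} (col : Vec (Fin m) d → Fin c) : Set where
        field
          color     : Fin c
          e         : Fin p → Vec (Fin m) d
          injective : ∀ g → Injective (e g)
          colors    : ∀ g → col (e g) ≡ color
          covers    : ∀ i → ∃[ g ] ∃[ j ] lookup (e g) j ≡ i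

      -- Here v puts each symbol i into the classes g ∈ vᵢ, and `S v a` holds the g whose class lies
      -- in an injective d-tuple of color a, so it shrinks as v grows. The class sizes add up to at
      -- most m + c q < p (d + 1); hence some class has at most d members and extends to such a
      -- tuple. A full set yields one tuple for each class, and the classes exhaust the symbols
      -- because the sets vᵢ are nonempty.
      cover : ∀ {m d c} J → c * q ≡ double J → d ≤ m → m + c * q < p * suc d →
              (col : Vec (Fin m) d → Fin c) → ¬ ¬ Cover col
      cover {m} {d} {c} J cq d≤m bound col none =
        noDecreasing q pr 1<p J S equivariant some notFull (ℕₚ.≤-reflexive cq) mono
        where
        Hit : Family p m → Fin c → Fin p → Set
        Hit v a g = ∃[ e ] ((∀ i j → lookup e i ≡ lookup e j → i ≡ j) × col e ≡ a ×
                            (∀ i → g ∈ lookup v i → ∃[ j ] lookup e j ≡ i))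
        hit? : ∀ v a g → Dec (Hit v a g)
        hit? v a g = anyVec? λ e →
          (all? λ i → all? λ j → (lookup e i ≟ᶠ lookup e j) →-dec (i ≟ᶠ j)) ×-dec
          ((col e ≟ᶠ a) ×-dec (all? λ i → (g ∈? lookup v i) →-dec any? λ j → lookup e j ≟ᶠ i))
        S : Family p m → Vec (Subset p) c
        S v = tabulate (λ a → comprehension (hit? v a))
        rot∈ : ∀ {v : Family p m} {g i} → g ∈ lookup (map (rot q) v) i → prev q g ∈ lookup v i
        rot∈ {v} {g} {i} h = lookup⇒[]= _ _ (trans (sym (lookup-rot q (lookup v i) g))
          (trans (cong (λ s → lookup s g) (sym (lookup-map i (rot q) v))) ([]=⇒lookup h)))
        ∈rot : ∀ {v : Family p m} {g i} → prev q g ∈ lookup v i → g ∈ lookup (map (rot q) v) i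
        ∈rot {v} {g} {i} h = lookup⇒[]= _ _ (trans (cong (λ s → lookup s g) (lookup-map i (rot q) v))
          (trans (lookup-rot q (lookup v i) g) ([]=⇒lookup h)))
        equivariant : ∀ v → S (map (rot q) v) ≡ map (rot q) (S v)
        equivariant v = trans (tabulate-cong eq) (Data.Vec.Properties.tabulate-∘ (rot q) (λ a → comprehension (hit? v a)))
          where
          eq : ∀ a → comprehension (hit? (map (rot q) v) a) ≡ rot q (comprehension (hit? v a))
          eq a = tabulate-cong λ g → trans
            (does-⇔ (mk⇔ (pulled a g) (pushed a g)) (hit? (map (rot q) v) a g) (hit? v a (prev q g)))
            (sym (lookup∘tabulate (λ g → does (hit? v a g)) (prev q g)))
            where
            pulled : ∀ a g → Hit (map (rot q) v) a g → Hit v a (prev q g)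
            pulled a g (e , inj , ce , cov) = e , inj , ce , λ i h → cov i (∈rot {v} h)
            pushed : ∀ a g → Hit v a (prev q g) → Hit (map (rot q) v) a g
            pushed a g (e , inj , ce , cov) = e , inj , ce , λ i h → cov i (rot∈ {v} h)
        class : Family p m → Fin p → Subset m
        class v g = comprehension (λ i → g ∈? lookup v i)
        val∈ : ∀ (s : Subset p) g → val (does (g ∈? s)) ≡ val (lookup s g)
        val∈ s g with g ∈? s | lookup s g in eq
        ... | yes h | b     = cong val (trans (sym ([]=⇒lookup h)) eq)
        ... | no  h | true  = ⊥-elim (h (lookup⇒[]= g s eq))
        ... | no  h | false = refl
        classes : ∀ v → sumFin p (λ g → ∣ class v g ∣) ≡ size v
        classes v = begin
          sumFin p (λ g → ∣ class v g ∣)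
            ≡⟨ sumFin-cong p (λ g → trans (∣∣-sum (class v g)) (sumFin-cong m λ i →
                 trans (cong val (lookup∘tabulate _ i)) (val∈ (lookup v i) g))) ⟩
          sumFin p (λ g → sumFin m (λ i → val (lookup (lookup v i) g)))
            ≡⟨ sumFin-swap p m (λ g i → val (lookup (lookup v i) g)) ⟩
          sumFin m (λ i → sumFin p (λ g → val (lookup (lookup v i) g)))
            ≡⟨ sumFin-cong m (λ i → sym (∣∣-sum (lookup v i))) ⟩
          sumFin m (λ i → ∣ lookup v i ∣) ≡⟨ size-sum v ⟨
          size v ∎
          where open ≡-Reasoning
        small : ∀ v → Dim≤ q (double J) v → ∃[ g ] ∣ class v g ∣ ≤ d
        small v (_ , le) with any? (λ g → ∣ class v g ∣ ≤? d)
        ... | yes h = h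
        ... | no ¬h = ⊥-elim (ℕₚ.<⇒≱ bound (ℕₚ.≤-trans (sumFin-≥ p _ (suc d) λ g → ℕₚ.≰⇒> (λ h → ¬h (g , h)))
          (ℕₚ.≤-trans (ℕₚ.≤-reflexive (classes v)) (subst (λ D → size v ≤ m + D) (sym cq) le))))
        some : ∀ v → Dim≤ q (double J) v → ∃[ a ] 1 ≤ ∣ lookup (S v) a ∣
        some v ok with small v ok
        ... | g , h with injectionOnto (class v g) d h d≤m
        ...   | e , inj , onto = col e , positive (subst (g ∈_) (sym (lookup∘tabulate _ (col e)))
          (∈-comprehension⁺ (hit? v (col e)) (e , inj , refl , λ i m → onto (∈-comprehension⁺ (λ i → g ∈? lookup v i) m))))
        notFull : ∀ v → Dim≤ q (double J) v → ∀ a → ∣ lookup (S v) a ∣ < p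
        notFull v (ne , le) a with ∣ lookup (S v) a ∣ <? p
        ... | yes h = h
        ... | no  h = ⊥-elim (none record
          { color = a ; e = λ g → proj₁ (hit g) ; injective = λ g → proj₁ (proj₂ (hit g))
          ; colors = λ g → proj₁ (proj₂ (proj₂ (hit g)))
          ; covers = λ i → let (g , m) = member (atAll ne i) in g , proj₂ (proj₂ (proj₂ (hit g))) i m })
          where
          hit : ∀ g → Hit v a g
          hit g = ∈-comprehension⁻ (hit? v a) (subst (g ∈_) (lookup∘tabulate _ a) (full {s = lookup (S v) a} h g))
        mono : ∀ {v w} → v ⊑ w → S w ⊑ S v
        mono {v} {w} le = Pointwise.tabulate⁺ λ a {g} h → ∈-comprehension⁺ (hit? v a) {g}
          (let (e , inj , ce , cov) = ∈-comprehension⁻ (hit? w a) h in e , inj , ce , λ i m → cov i (Pointwise.lookup le i m))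

-- Gluing candidate assignments over cofinal families of clouds.

module AgreementGap where

  open import Data.Bool.Base using (Bool; true; false)
  open import Data.Empty using (⊥; ⊥-elim)
  open import Data.Fin.Base using (Fin; zero; suc)
  open import Data.Fin.Properties using () renaming (_≟_ to _≟ᶠ_)
  open import Data.List.Base as List using (List; []; _∷_; _++_; length)
  open import Data.List.Membership.Propositional using () renaming (_∈_ to _∈ˡ_; _∉_ to _∉ˡ_)
  open import Data.List.Membership.Propositional.Properties using (∈-++⁺ˡ; ∈-++⁺ʳ; ∈-cartesianProduct⁺; ∈-allFin)
  open import Data.List.Properties using (length-++; length-map; length-tabulate)
  open import Data.List.Relation.Unary.Any as Any using ()
  open import Data.Nat.Base as ℕ using (ℕ; zero; suc; _+_; _*_; _≤_; z≤n; s≤s; _^_)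
  import Data.Nat.Properties as ℕₚ
  open import Data.Product.Base using (Σ-syntax; ∃-syntax; _×_; _,_; proj₁; proj₂)
  open import Data.Unit.Base using (⊤; tt)
  open import Data.Vec.Base as Vec using (Vec; []; _∷_; lookup; toList)
  open import Data.Vec.Properties using (length-toList)
  open import Function.Base using (_∘_; id)
  open import Relation.Binary.PropositionalEquality
  open import Relation.Nullary using (¬_; Dec; yes; no; contradiction)

  em : ∀ {P : Set} → (P → ⊥) → (¬ P → ⊥) → ⊥
  em f g = g f

  finChoice : ∀ n {P : Fin n → Set} → (∀ i → ¬ ¬ P i) → ¬ ¬ (∀ i → P i)
  finChoice zero    h k = k (λ ())
  finChoice (suc n) h k = h zero λ p → finChoice n (h ∘ suc) λ ps → k λ { zero → p ; (suc i) → ps i }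

  module _ {V : Set} {m : ℕ} where

    _∈ᵛ_ : V → Vec V m → Set
    v ∈ᵛ w = ∃[ a ] lookup w a ≡ v

    Region : Set₁
    Region = Vec V m → Set

    Avoidable : ℕ → Region → Set
    Avoidable N Z = Σ[ e ∈ List V ] (length e ≤ N × (∀ w → Z w → ¬ (∀ {v} → v ∈ˡ e → v ∈ᵛ w)))

    -- The positive form, a cloud of Z around each short list, holds only under double negation. The
    -- negated form is what a refutation by avoiding lists needs.
    record Cofinal (N : ℕ) (Z : Region) : Set where
      constructor cofinal
      field unavoidable : ¬ Avoidable N Z

    cofinal-mono : ∀ {N N′} {Z Z′ : Region} → N′ ≤ N → (∀ w → Z w → Z′ w) → Cofinal N Z → Cofinal N′ Z′
    cofinal-mono le sub (cofinal cof) = cofinal λ (e , len , av) → cof (e , ℕₚ.≤-trans len le , λ w z → av w (sub w z))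

    cofinal-∋ : ∀ {N} {Z : Region} v → Cofinal (suc N) Z → Cofinal N (λ w → Z w × v ∈ᵛ w)
    cofinal-∋ v (cofinal cof) = cofinal λ (e , len , av) → cof (v ∷ e , s≤s len , λ w z sub → av w (z , sub (Any.here refl)) (sub ∘ Any.there))

    cofinal-witness : ∀ {N} {Z : Region} → Cofinal N Z → ¬ ¬ (∃[ w ] Z w)
    cofinal-witness (cofinal cof) k = cof ([] , z≤n , λ w z _ → k (w , z))

    -- If each part had an avoiding list, their concatenation would be avoided by all of Z: a cloud
    -- containing it would contain the list of its own part.
    cofinal-split : ∀ k {N} {Z : Region} (R : Fin k → Region) → (∀ w → Z w → ¬ ¬ (∃[ i ] R i w)) →
                    Cofinal (k * N) Z → ¬ ¬ (∃[ i ] Cofinal N (λ w → Z w × R i w))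
    cofinal-split k {N} {Z} R total (cofinal cof) none =
      finChoice k {P = λ i → Avoidable N (λ w → Z w × R i w)} (λ i c → none (i , cofinal c)) λ av →
      cof (gather k (proj₁ ∘ av) , gather-length k (proj₁ ∘ av) (λ i → proj₁ (proj₂ (av i))) ,
           λ w z sub → total w z λ (i , r) → proj₂ (proj₂ (av i)) w (z , r) (λ h → sub (∈-gather k (proj₁ ∘ av) i h)))
      where
      gather : ∀ k → (Fin k → List V) → List V
      gather zero    es = []
      gather (suc k) es = es zero ++ gather k (es ∘ suc)
      gather-length : ∀ k es → (∀ i → length (es i) ≤ N) → length (gather k es) ≤ k * N
      gather-length zero    es h = z≤n
      gather-length (suc k) es h = subst (_≤ N + k * N) (sym (length-++ (es zero)))
        (ℕₚ.+-mono-≤ (h zero) (gather-length k (es ∘ suc) (h ∘ suc)))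
      ∈-gather : ∀ k es i {v} → v ∈ˡ es i → v ∈ˡ gather k es
      ∈-gather (suc k) es zero    h = ∈-++⁺ˡ h
      ∈-gather (suc k) es (suc i) h = ∈-++⁺ʳ (es zero) (∈-gather k (es ∘ suc) i h)

    cofinal-all : V → Cofinal m (λ _ → ⊤)
    cofinal-all v₀ = cofinal λ (e , len , av) → av (pad m e) tt λ h → ∈-pad m e len h
      where
      pad : ∀ n → List V → Vec V n
      pad zero    _       = []
      pad (suc n) []      = v₀ ∷ pad n []
      pad (suc n) (x ∷ e) = x ∷ pad n e
      ∈-pad : ∀ n e → length e ≤ n → ∀ {v} → v ∈ˡ e → ∃[ a ] lookup (pad n e) a ≡ v
      ∈-pad (suc n) (x ∷ e) (s≤s le) (Any.here refl) = zero , refl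
      ∈-pad (suc n) (x ∷ e) (s≤s le) (Any.there h) with ∈-pad n e le h
      ... | a , eq = suc a , eq

  -- How cofinal a family must be for one half of each splitting to be K-cofinal.
  step : ℕ → ℕ → ℕ
  step δ K = K + (2 + δ * (δ * K))

  steps : ℕ → ℕ → ℕ → ℕ
  steps δ zero    K = K
  steps δ (suc n) K = step δ (steps δ n K)

  -- Each further family is split off after one separation for every pair of the M candidates.
  families : ℕ → ℕ → ℕ → ℕ
  families δ M zero    = 1
  families δ M (suc r) = steps δ (M * M) (families δ M r)

  -- Before the separations the clouds are split by their Γ types and by the 2^M patterns of which
  -- candidates respect the constraints.
  cloudSize : (δ M Γ t : ℕ) → ℕ
  cloudSize δ M Γ t = Γ * (2 ^ M * families δ M t)

  steps-≥ : ∀ δ n K → K ≤ steps δ n K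
  steps-≥ δ zero    K = ℕₚ.≤-refl
  steps-≥ δ (suc n) K = ℕₚ.≤-trans (steps-≥ δ n K) (ℕₚ.m≤m+n (steps δ n K) _)

  families-≥ : ∀ δ M t → 1 ≤ families δ M t
  families-≥ δ M zero    = ℕₚ.≤-refl
  families-≥ δ M (suc t) = ℕₚ.≤-trans (families-≥ δ M t) (steps-≥ δ (M * M) _)

  -- Clouds are m-tuples w of variables, and s j w is the j-th of M candidate
  -- assignments to the entries of w.
  module _ {V : Set} {δ m M : ℕ}
    (choice : ∀ {P : V → Set} → (∀ v → ¬ ¬ P v) → ¬ ¬ (∀ v → P v))
    (Rel : V → V → Fin δ → Fin δ → Set)
    (stable : ∀ {u v x y} → ¬ ¬ Rel u v x y → Rel u v x y)
    (s : Fin M → Vec V m → Vec (Fin δ) m) where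

    Reg : Set₁
    Reg = Vec V m → Set

    Satisfiable : Set
    Satisfiable = Σ[ A ∈ (V → Fin δ) ] (∀ u v → Rel u v (A u) (A v))

    Good : Vec V m → Vec (Fin δ) m → Set
    Good w ℓ = ∀ a b → Rel (lookup w a) (lookup w b) (lookup ℓ a) (lookup ℓ b)

    Compatible : (w : Vec V m) → Vec (Fin δ) m → (w′ : Vec V m) → Vec (Fin δ) m → Set
    Compatible w ℓ w′ ℓ′ = ∀ a b → lookup w a ≡ lookup w′ b → lookup ℓ a ≡ lookup ℓ′ b

    Agree : Fin M → Fin M → Vec V m → Vec V m → Set
    Agree i j w w′ = Good w (s i w) × Good w′ (s j w′) × Compatible w (s i w) w′ (s j w′)

    Value : Fin M → V → Fin δ → Reg
    Value j v x w = ∃[ a ] (lookup w a ≡ v × lookup (s j w) a ≡ x)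

    value-total : ∀ j v w → v ∈ᵛ w → ∃[ x ] Value j v x w
    value-total j v w (a , eq) = lookup (s j w) a , a , eq , refl

    Decided : Reg → Set
    Decided Z = Σ[ g ∈ (Fin M → Bool) ] ((∀ j → g j ≡ true → ∀ {w} → Z w → Good w (s j w)) ×
                                           (∀ j → g j ≡ false → ∀ {w} → Z w → ¬ Good w (s j w)))

    decided-mono : ∀ {Z Z′ : Reg} → (∀ w → Z′ w → Z w) → Decided Z → Decided Z′
    decided-mono sub (g , y , n) = g , (λ j eq {w} z → y j eq (sub w z)) , (λ j eq {w} z → n j eq (sub w z))

    module _ (unsat : ¬ Satisfiable) where

      -- Otherwise each variable has exactly one value that candidate j takes K-cofinally, and these
      -- values solve the constraints: by pigeonhole on the joint value at u and v there is a
      -- K-cofinal family where both are constant, and any cloud in it verifies the constraint. The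
      -- 2 makes room for u and v, and δ (δ K) for their values.
      undetermined : ∀ {K} {Z : Reg} j → (∀ {w} → Z w → Good w (s j w)) → Cofinal (2 + δ * (δ * K)) Z →
        ¬ ¬ (∃[ v ] ∃[ x ] ∃[ y ] (x ≢ y × Cofinal K (λ w → Z w × Value j v x w) × Cofinal K (λ w → Z w × Value j v y w)))
      undetermined {K} {Z} j good cof none = choice common λ A → unsat (proj₁ ∘ A , λ u v → stable (solves A u v))
        where
        Common : V → Fin δ → Set
        Common v x = Cofinal K (λ w → Z w × Value j v x w)
        atMostOne : ∀ v {x y} → Common v x → Common v y → x ≡ y
        atMostOne v {x} {y} cx cy with x ≟ᶠ y
        ... | yes eq = eq
        ... | no ne  = ⊥-elim (none (v , x , y , ne , cx , cy))
        pairs : ∀ u v → ¬ ¬ (∃[ x ] ∃[ y ] Cofinal K (λ w → (((Z w × u ∈ᵛ w) × v ∈ᵛ w) × Value j u x w) × Value j v y w))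
        pairs u v k =
          cofinal-split δ (Value j u) (λ { w ((_ , mu) , _) k → k (value-total j u w mu) }) (cofinal-∋ v (cofinal-∋ u cof)) λ (x , cx) →
          cofinal-split δ (Value j v) (λ { w ((_ , mv) , _) k → k (value-total j v w mv) }) cx λ (y , cy) → k (x , y , cy)
        common : ∀ v → ¬ ¬ (∃[ x ] Common v x)
        common v k = pairs v v λ (x , _ , c) → k (x , cofinal-mono ℕₚ.≤-refl (λ { _ ((((z , _) , _) , vx) , _) → z , vx }) c)
        solves : ∀ (A : ∀ v → ∃[ x ] Common v x) u v → ¬ ¬ Rel u v (proj₁ (A u)) (proj₁ (A v))
        solves A u v k = pairs u v λ (x , y , c) → cofinal-witness c
          λ { (w , (((z , _) , _) , (a , refl , refl)) , (b , refl , refl)) →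
            k (subst₂ (Rel u v)
              (atMostOne u (cofinal-mono ℕₚ.≤-refl (λ { _ ((((z , _) , _) , vx) , _) → z , vx }) c) (proj₂ (A u)))
              (atMostOne v (cofinal-mono ℕₚ.≤-refl (λ { _ ((((z , _) , _) , _) , vy) → z , vy }) c) (proj₂ (A v)))
              (good z a b)) }

      Separated : Fin M → Fin M → Reg → Reg → Set
      Separated i j Z Z′ = ∀ w w′ → Z w → Z′ w′ → ¬ Agree i j w w′

      Refinement : ℕ → (Reg → Reg → Set) → Reg → Reg → Set₁
      Refinement K P Z Z′ = Σ[ Y ∈ Reg ] Σ[ Y′ ∈ Reg ]
        ((∀ w → Y w → Z w) × (∀ w → Y′ w → Z′ w) × Cofinal K Y × Cofinal K Y′ × P Y Y′)

      -- When both candidates respect the constraints, candidate j has two cofinal values a ≠ b at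
      -- some v on Z′. On Z, candidate i has a cofinal value x at the same v. Restricting to x on
      -- one side and to whichever of a and b differs from x on the other makes agreement
      -- impossible.
      separate : ∀ {K} {Z Z′ : Reg} i j → Decided Z → Decided Z′ → Cofinal (step δ K) Z → Cofinal (step δ K) Z′ →
                 (Refinement K (Separated i j) Z Z′ → ⊥) → ⊥
      separate {K} {Z} {Z′} i j (g , y , n) (g′ , y′ , n′) cof cof′ k with g i in eq | g′ j in eq′
      ... | false | _ = k (Z , Z′ , (λ _ → id) , (λ _ → id) , weaken cof , weaken cof′ , λ _ _ z _ (gd , _) → n i eq z gd)
        where
        weaken : ∀ {Y : Reg} → Cofinal (step δ K) Y → Cofinal K Y
        weaken = cofinal-mono (ℕₚ.m≤m+n K _) (λ _ → id)
      ... | true | false = k (Z , Z′ , (λ _ → id) , (λ _ → id) , weaken cof , weaken cof′ , λ _ _ _ z (_ , gd , _) → n′ j eq′ z gd)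
        where
        weaken : ∀ {Y : Reg} → Cofinal (step δ K) Y → Cofinal K Y
        weaken = cofinal-mono (ℕₚ.m≤m+n K _) (λ _ → id)
      ... | true | true = undetermined {K} j (y′ j eq′) (cofinal-mono (ℕₚ.m≤n+m _ K) (λ _ → id) cof′) λ (v , a , b , a≢b , ca , cb) →
        cofinal-split δ {N = K} (Value i v) (λ { w (_ , mv) k → k (value-total i v w mv) })
          (cofinal-mono (ℕₚ.≤-trans (δK≤ δ) (ℕₚ.≤-trans (ℕₚ.n≤1+n _) (ℕₚ.≤-reflexive refl))) (λ _ → id) (cofinal-∋ v (cofinal-mono (ℕₚ.m≤n+m _ K) (λ _ → id) cof)))
          λ (x , cx) → finish v x a b a≢b ca cb cx (x ≟ᶠ a)
        where
        δK≤ : ∀ δ → δ * K ≤ δ * (δ * K)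
        δK≤ zero    = z≤n
        δK≤ (suc δ) = ℕₚ.m≤m+n _ _
        different : ∀ v {x a} → x ≢ a → Separated i j (λ w → (Z w × v ∈ᵛ w) × Value i v x w) (λ w → Z′ w × Value j v a w)
        different v x≢a _ _ (_ , p , wp , sp) (_ , p′ , wp′ , sp′) (_ , _ , compat) =
          x≢a (trans (sym sp) (trans (compat p p′ (trans wp (sym wp′))) sp′))
        finish : ∀ v x a b → a ≢ b → Cofinal K (λ w → Z′ w × Value j v a w) → Cofinal K (λ w → Z′ w × Value j v b w) →
                 Cofinal K (λ w → (Z w × v ∈ᵛ w) × Value i v x w) → Dec (x ≡ a) → ⊥
        finish v x a b a≢b ca cb cx (no x≢a)   = k (_ , _ , (λ _ → proj₁ ∘ proj₁) , (λ _ → proj₁) , cx , ca , different v x≢a)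
        finish v x a b a≢b ca cb cx (yes refl) = k (_ , _ , (λ _ → proj₁ ∘ proj₁) , (λ _ → proj₁) , cx , cb , different v a≢b)

      SeparatedAll : List (Fin M × Fin M) → Reg → Reg → Set
      SeparatedAll ps Z Z′ = ∀ {i j} → (i , j) ∈ˡ ps → Separated i j Z Z′

      separateAll : ∀ {K} ps {Z Z′ : Reg} → Decided Z → Decided Z′ →
        Cofinal (steps δ (length ps) K) Z → Cofinal (steps δ (length ps) K) Z′ →
        (Refinement K (SeparatedAll ps) Z Z′ → ⊥) → ⊥
      separateAll []             dz dz′ cof cof′ k = k (_ , _ , (λ _ → id) , (λ _ → id) , cof , cof′ , λ ())
      separateAll ((i , j) ∷ ps) dz dz′ cof cof′ k = separate i j dz dz′ cof cof′ λ (Y , Y′ , sub , sub′ , c , c′ , sep) →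
        separateAll ps (decided-mono sub dz) (decided-mono sub′ dz′) c c′ λ (X , X′ , sb , sb′ , d , d′ , seps) →
        k (X , X′ , (λ w → sub w ∘ sb w) , (λ w → sub′ w ∘ sb′ w) , d , d′ ,
           λ { (Any.here refl) w w′ z z′ → sep w w′ (sb w z) (sb′ w′ z′) ; (Any.there h) → seps h })

      allPairs : List (Fin M × Fin M)
      allPairs = List.cartesianProduct (List.allFin M) (List.allFin M)

      Spread : ℕ → Reg → Set₁
      Spread r Z = Σ[ Y ∈ (Fin r → Reg) ]
        ((∀ i w → Y i w → Z w) × (∀ i → Cofinal 1 (Y i)) ×
         (∀ i j → i ≢ j → ∀ a b → Separated a b (Y i) (Y j)))

      agree-sym : ∀ {i j w w′} → Agree i j w w′ → Agree j i w′ w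
      agree-sym (g , g′ , c) = g′ , g , λ a b eq → sym (c b a (sym eq))

      -- Z is separated from itself for all pairs of candidates. One part becomes the first family,
      -- and the others are found inside the second part, from which they inherit the separation.
      spread : ∀ r {Z : Reg} → Decided Z → Cofinal (families δ M r) Z → (Spread r Z → ⊥) → ⊥
      spread zero    dz cof k = k ((λ ()) , (λ ()) , (λ ()) , λ ())
      spread (suc r) {Z} dz cof k = separateAll {families δ M r} allPairs dz dz cof′ cof′ λ (X , X′ , sub , sub′ , c , c′ , sep) →
        spread r (decided-mono sub′ dz) c′ λ (Y , subY , cofY , sepY) →
        k ((λ { zero → X ; (suc i) → Y i }) , (λ { zero → sub ; (suc i) w → sub′ w ∘ subY i w }) ,
           (λ { zero → cofinal-mono (families-≥ δ M r) (λ _ → id) c ; (suc i) → cofY i }) ,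
           λ { zero    zero    ne _ _ → contradiction refl ne
             ; zero    (suc j) ne a b w w′ z z′ → sep (pair∈ a b) w w′ z (subY j w′ z′)
             ; (suc i) zero    ne a b w w′ z z′ ag → sep (pair∈ b a) w′ w z′ (subY i w z) (agree-sym ag)
             ; (suc i) (suc j) ne → sepY i j (ne ∘ cong suc) })
        where
        pair∈ : ∀ a b → (a , b) ∈ˡ allPairs
        pair∈ a b = ∈-cartesianProduct⁺ (∈-allFin a) (∈-allFin b)
        cof′ : Cofinal (steps δ (length allPairs) (families δ M r)) Z
        cof′ = subst (λ n → Cofinal (steps δ n (families δ M r)) Z) (sym lengthPairs) cof
          where
          product-length : ∀ (xs ys : List (Fin M)) → length (List.cartesianProduct xs ys) ≡ length xs * length ys
          product-length []       ys = refl
          product-length (x ∷ xs) ys = trans (length-++ (List.map (x ,_) ys))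
            (cong₂ _+_ (length-map (x ,_) ys) (product-length xs ys))
          lengthPairs : length allPairs ≡ M * M
          lengthPairs = trans (product-length (List.allFin M) (List.allFin M))
            (cong (λ n → n * n) (length-tabulate {n = M} id))

      -- M halvings, one for each candidate, by excluded middle on whether it respects the
      -- constraints on a cloud.
      decide : ∀ {N} {Z : Reg} → Cofinal (2 ^ M * N) Z →
        ((Σ[ Y ∈ Reg ] ((∀ w → Y w → Z w) × Cofinal N Y × Decided Y)) → ⊥) → ⊥
      decide {N} = go M id
        where
        go : ∀ n (f : Fin n → Fin M) {Z : Reg} → Cofinal (2 ^ n * N) Z →
          ((Σ[ Y ∈ Reg ] ((∀ w → Y w → Z w) × Cofinal N Y × (Σ[ g ∈ (Fin n → Bool) ]
             ((∀ j → g j ≡ true → ∀ {w} → Y w → Good w (s (f j) w)) × (∀ j → g j ≡ false → ∀ {w} → Y w → ¬ Good w (s (f j) w)))))) → ⊥) → ⊥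
        go zero    f cof k = k (_ , (λ _ → id) , cofinal-mono (ℕₚ.≤-reflexive (sym (ℕₚ.+-identityʳ N))) (λ _ → id) cof , (λ ()) , (λ ()) , λ ())
        go (suc n) f {Z} cof k = cofinal-split 2 {N = 2 ^ n * N} R total (cofinal-mono (ℕₚ.≤-reflexive (sym (ℕₚ.*-assoc 2 (2 ^ n) N))) (λ _ → id) cof)
          λ { (zero , c) → go n (f ∘ suc) c λ (Y , sub , cY , g , y , ng) →
                k (Y , (λ w → proj₁ ∘ sub w) , cY , (λ { zero → true ; (suc j) → g j }) ,
                   (λ { zero _ z → proj₂ (sub _ z) ; (suc j) → y j }) , λ { zero () ; (suc j) → ng j })
            ; (suc zero , c) → go n (f ∘ suc) c λ (Y , sub , cY , g , y , ng) →
                k (Y , (λ w → proj₁ ∘ sub w) , cY , (λ { zero → false ; (suc j) → g j }) ,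
                   (λ { zero () ; (suc j) → y j }) , λ { zero _ z → proj₂ (sub _ z) ; (suc j) → ng j }) }
          where
          R : Fin 2 → Reg
          R zero    w = Good w (s (f zero) w)
          R (suc _) w = ¬ Good w (s (f zero) w)
          total : ∀ w → Z w → ¬ ¬ (∃[ i ] R i w)
          total w _ k = em (λ g → k (zero , g)) (λ ng → k (suc zero , ng))

    -- If a candidate is decided on a cofinal family, its values solve all constraints.
    -- Otherwise t − 1 splittings give t cofinal families of one type any two of
    -- which disagree for all pairs of candidates.
    gap : ∀ {Γ t} (γ : Vec V m → Fin Γ) → cloudSize δ M Γ t ≡ m →
      (∀ (xs : List V) → length xs ≤ t * m → ∃[ v ] v ∉ˡ xs) →
      (∀ (w : Fin t → Vec V m) → (∀ i j → w i ≡ w j → i ≡ j) → (∀ i j → γ (w i) ≡ γ (w j)) →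
         ¬ (∀ i j → i ≢ j → ∀ a b → ¬ Agree a b (w i) (w j))) →
      ¬ ¬ Satisfiable
    gap {Γ} {t} γ size fresh linked unsat =
      cofinal-split Γ {N = 2 ^ M * families δ M t} (λ c w → γ w ≡ c) (λ w _ k → k (γ w , refl))
        (cofinal-mono (ℕₚ.≤-reflexive size) (λ _ → id) (cofinal-all {m = m} (proj₁ (fresh [] z≤n)))) λ (c , cof) →
      decide unsat cof λ (Z , sub , cofZ , dz) →
      spread unsat t dz cofZ λ (Y , subY , cofY , sep) →
      choose t Y [] (ℕₚ.≤-refl) cofY λ (w , w∈ , inj , _) →
      linked w inj (λ i j → trans (proj₂ (sub _ (subY i _ (w∈ i)))) (sym (proj₂ (sub _ (subY j _ (w∈ j))))))
        λ i j ne a b → sep i j ne a b _ _ (w∈ i) (w∈ j)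
      where
      -- 1-cofinality allows the next cloud to contain a variable outside all earlier ones, which
      -- makes the chosen clouds distinct.
      choose : ∀ r (Y : Fin r → Reg) (used : List V) → length used + r * m ≤ t * m → (∀ i → Cofinal 1 (Y i)) →
        ((Σ[ w ∈ (Fin r → Vec V m) ] ((∀ i → Y i (w i)) × (∀ i j → w i ≡ w j → i ≡ j) ×
           (∀ i → ∃[ v ] (v ∈ᵛ w i × v ∉ˡ used)))) → ⊥) → ⊥
      choose zero    Y used le cof k = k ((λ ()) , (λ ()) , (λ ()) , λ ())
      choose (suc r) Y used le cof k with fresh used (ℕₚ.≤-trans (ℕₚ.m≤m+n _ _) le)
      ... | v , v∉ = cofinal-witness (cofinal-∋ v (cof zero)) λ (w₀ , y₀ , v∈) →
        choose r (Y ∘ suc) (used ++ toList w₀)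
          (ℕₚ.≤-trans (ℕₚ.≤-reflexive (trans (cong (_+ r * m) (trans (length-++ used) (cong (length used +_) (length-toList w₀))))
            (ℕₚ.+-assoc (length used) m (r * m)))) le) (cof ∘ suc) λ (w , y , inj , new) →
        k ((λ { zero → w₀ ; (suc i) → w i }) , (λ { zero → y₀ ; (suc i) → y i }) ,
           (λ { zero    zero    _  → refl
              ; zero    (suc j) eq → ⊥-elim (old w₀ (w j) used eq (new j))
              ; (suc i) zero    eq → ⊥-elim (old w₀ (w i) used (sym eq) (new i))
              ; (suc i) (suc j) eq → cong suc (inj i j eq) }) ,
           (λ { zero → v , v∈ , v∉ ; (suc i) → let (v′ , m , n) = new i in v′ , m , n ∘ ∈-++⁺ˡ }))
        where
        ∈-toList : ∀ {n} (w : Vec V n) a → lookup w a ∈ˡ toList w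
        ∈-toList (x ∷ w) zero    = Any.here refl
        ∈-toList (x ∷ w) (suc a) = Any.there (∈-toList w a)
        old : ∀ w₀ w used → w₀ ≡ w → ¬ (∃[ v ] (v ∈ᵛ w × v ∉ˡ (used ++ toList w₀)))
        old w₀ _ used refl (v , (a , refl) , v∉) = v∉ (∈-++⁺ʳ used (∈-toList w₀ a))

-- Numbering of vectors over a finite set.

module Packing where

  open import Data.Bool.Base using (Bool; true; false)
  open import Data.Fin.Base using (Fin; zero; suc; combine; remQuot)
  open import Data.Fin.Properties using (remQuot-combine)
  open import Data.Nat.Base using (zero; suc; _^_)
  open import Data.Product.Base using (proj₁; proj₂)
  open import Data.Vec.Base using (Vec; []; _∷_; map)
  open import Data.Vec.Properties using (map-∘; map-cong; map-id)
  open import Relation.Binary.PropositionalEquality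

  pack : ∀ {a n} → Vec (Fin a) n → Fin (a ^ n)
  pack []      = zero
  pack (i ∷ v) = combine i (pack v)

  unpack : ∀ {a} n → Fin (a ^ n) → Vec (Fin a) n
  unpack     zero    _ = []
  unpack {a} (suc n) i = proj₁ (remQuot {a} (a ^ n) i) ∷ unpack n (proj₂ (remQuot {a} (a ^ n) i))

  unpack-pack : ∀ {a n} (v : Vec (Fin a) n) → unpack n (pack v) ≡ v
  unpack-pack []                  = refl
  unpack-pack {a} {suc n} (i ∷ v) = trans
    (cong (λ r → proj₁ r ∷ unpack n (proj₂ r)) (remQuot-combine {a} {a ^ n} i (pack v)))
    (cong (i ∷_) (unpack-pack v))

  fromBool : Bool → Fin 2
  fromBool false = zero
  fromBool true  = suc zero

  toBool : Fin 2 → Bool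
  toBool zero    = false
  toBool (suc _) = true

  packBits : ∀ {n} → Vec Bool n → Fin (2 ^ n)
  packBits bs = pack (map fromBool bs)

  unpackBits : ∀ n → Fin (2 ^ n) → Vec Bool n
  unpackBits n i = map toBool (unpack n i)

  unpackBits-packBits : ∀ {n} (bs : Vec Bool n) → unpackBits n (packBits bs) ≡ bs
  unpackBits-packBits bs = trans (cong (map toBool) (unpack-pack (map fromBool bs)))
    (trans (sym (map-∘ toBool fromBool bs)) (trans (map-cong (λ { false → refl ; true → refl }) bs) (map-id bs)))

-- Structured programs and their translation to multi-tape machines.

module TapePrograms where

  open import Defs
  open import Data.Bool.Base using (Bool; true; false; if_then_else_)
  open import Data.Fin.Base using (Fin; zero; suc; splitAt; _↑ˡ_; _↑ʳ_)
  open import Data.Fin.Properties using (splitAt-↑ˡ; splitAt-↑ʳ)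
  open import Data.Maybe.Base as Maybe using (Maybe; just; nothing)
  open import Data.Nat.Base as ℕ using (ℕ; zero; suc; _+_; _≤_; s≤s)
  import Data.Nat.Properties as ℕₚ
  open import Data.Product.Base as Product using (∃-syntax; _×_; _,_; map₁)
  open import Data.Sum.Base using (_⊎_; inj₁; inj₂; [_,_]′)
  open import Data.Unit.Base using (⊤; tt)
  open import Data.Vec.Base as Vec using (Vec; []; _∷_)
  open import Function.Base using (_∘_)
  open import Relation.Binary.PropositionalEquality

  module _ {g w : ℕ} where

    Reads Act Tapes : Set
    Reads = Vec (Symbol g) (suc w)
    Act   = Vec (Symbol g × Move) (suc w)
    Tapes = Vec (Tape g) (suc w)

    data Prog : Set where
      instr : (Reads → Act) → Prog
      _⨾_   : Prog → Prog → Prog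
      cond  : (Reads → Bool) → Prog → Prog → Prog
      while : (Reads → Bool) → Prog → Prog

    infixr 5 _⨾_

    heads : ∀ {n} → Vec (Tape g) n → Vec (Symbol g) n
    heads = Vec.map Tape.here

    idle : ∀ {n} → Vec (Symbol g) n → Vec (Symbol g × Move) n
    idle = Vec.map (_, stay)

    apply : ∀ {n} → Vec (Symbol g × Move) n → Vec (Tape g) n → Vec (Tape g) n
    apply = Vec.zipWith act

    apply-idle : ∀ {n} (ts : Vec (Tape g) n) → apply (idle (heads ts)) ts ≡ ts
    apply-idle []                   = refl
    apply-idle (tape ls x rs ∷ ts) = cong (tape ls x rs ∷_) (apply-idle ts)

    -- States follow the shape of the program, so that components embed by constructors; numbers are
    -- given to them only for the final machine.
    St : Prog → Set
    St (instr f)     = ⊤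
    St (P ⨾ Q)      = St P ⊎ St Q
    St (cond b P Q) = ⊤ ⊎ (St P ⊎ St Q)
    St (while b P)  = ⊤ ⊎ St P

    entry : ∀ P → St P
    entry (instr f)     = tt
    entry (P ⨾ Q)      = inj₁ (entry P)
    entry (cond b P Q) = inj₁ tt
    entry (while b P)  = inj₁ tt

    next-state : ∀ {A B : Set} → (A → B) → Maybe B → Maybe A → Maybe B
    next-state f exit (just s) = just (f s)
    next-state f exit nothing  = exit

    transition : ∀ P → St P → Reads → Maybe (St P) × Act
    transition (instr f)     _               r = nothing , f r
    transition (P ⨾ Q)      (inj₁ s)        r = map₁ (next-state inj₁ (just (inj₂ (entry Q)))) (transition P s r)
    transition (P ⨾ Q)      (inj₂ s)        r = map₁ (next-state inj₂ nothing) (transition Q s r)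
    transition (cond b P Q) (inj₁ _)        r = just (inj₂ (if b r then inj₁ (entry P) else inj₂ (entry Q))) , idle r
    transition (cond b P Q) (inj₂ (inj₁ s)) r = map₁ (next-state (inj₂ ∘ inj₁) nothing) (transition P s r)
    transition (cond b P Q) (inj₂ (inj₂ s)) r = map₁ (next-state (inj₂ ∘ inj₂) nothing) (transition Q s r)
    transition (while b P)  (inj₁ _)        r = (if b r then just (inj₂ (entry P)) else nothing) , idle r
    transition (while b P)  (inj₂ s)        r = map₁ (next-state inj₂ (just (inj₁ tt))) (transition P s r)

    -- `last` counts the step by which control leaves P. In a larger program that same step enters
    -- the next component, so lengths simply add up.
    data Reach (P : Prog) : St P → Tapes → ℕ → Tapes → Set where
      last : ∀ {s ts a} → transition P s (heads ts) ≡ (nothing , a) → Reach P s ts 1 (apply a ts)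
      more : ∀ {s s′ ts a n ts′} → transition P s (heads ts) ≡ (just s′ , a) →
             Reach P s′ (apply a ts) n ts′ → Reach P s ts (suc n) ts′

    Run : Prog → Tapes → ℕ → Tapes → Set
    Run P ts B ts′ = ∃[ n ] (n ≤ B × Reach P (entry P) ts n ts′)

    module _ {P R : Prog} (f : St P → St R) where

      continue : ∀ {exit} → (∀ s r → transition R (f s) r ≡ map₁ (next-state f (just exit)) (transition P s r)) →
        ∀ {s ts n ts′ m ts″} → Reach P s ts n ts′ → Reach R exit ts′ m ts″ → Reach R (f s) ts (n + m) ts″
      continue eq (last e)   k = more (trans (eq _ _) (cong (map₁ (next-state f _)) e)) k
      continue eq (more e r) k = more (trans (eq _ _) (cong (map₁ (next-state f _)) e)) (continue eq r k)

      finish : (∀ s r → transition R (f s) r ≡ map₁ (next-state f nothing) (transition P s r)) →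
        ∀ {s ts n ts′} → Reach P s ts n ts′ → Reach R (f s) ts n ts′
      finish eq (last e)   = last (trans (eq _ _) (cong (map₁ (next-state f nothing)) e))
      finish eq (more e r) = more (trans (eq _ _) (cong (map₁ (next-state f nothing)) e)) (finish eq r)

    run-weaken : ∀ {P ts B B′ ts′} → B ≤ B′ → Run P ts B ts′ → Run P ts B′ ts′
    run-weaken le (n , h , r) = n , ℕₚ.≤-trans h le , r

    run-begin : ∀ {P ts₀ ts B ts′} → ts₀ ≡ ts → Run P ts B ts′ → Run P ts₀ B ts′
    run-begin refl r = r

    run-end : ∀ {P ts B ts′ ts″} → ts′ ≡ ts″ → Run P ts B ts′ → Run P ts B ts″
    run-end refl r = r

    run-instr : ∀ {f ts} → Run (instr f) ts 1 (apply (f (heads ts)) ts)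
    run-instr = 1 , ℕₚ.≤-refl , last refl

    run-⨾ : ∀ {P Q ts B ts′ B′ ts″} → Run P ts B ts′ → Run Q ts′ B′ ts″ → Run (P ⨾ Q) ts (B + B′) ts″
    run-⨾ {P} {Q} (n , h , r) (n′ , h′ , r′) = n + n′ , ℕₚ.+-mono-≤ h h′ ,
      continue {P} {P ⨾ Q} inj₁ (λ _ _ → refl) r (finish {Q} {P ⨾ Q} inj₂ (λ _ _ → refl) r′)

    -- A test rewrites the scanned symbols without moving; the tapes are then the same only up to
    -- `apply-idle`, hence the transport.
    idle-step : ∀ {R : Prog} {s s′ : St R} {ts : Tapes} {n ts′} →
      transition R s (heads ts) ≡ (just s′ , idle (heads ts)) → Reach R s′ ts n ts′ → Reach R s ts (suc n) ts′
    idle-step {R} {s′ = s′} {ts} {n} {ts′} eq r =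
      more eq (subst (λ us → Reach R s′ us n ts′) (sym (apply-idle ts)) r)

    run-true : ∀ {b P Q ts B ts′} → b (heads ts) ≡ true → Run P ts B ts′ → Run (cond b P Q) ts (suc B) ts′
    run-true {b} {P} {Q} eq (n , h , r) = suc n , s≤s h ,
      idle-step {cond b P Q} (cong (λ z → just (inj₂ (if z then inj₁ (entry P) else inj₂ (entry Q))) , _) eq)
        (finish {P} {cond b P Q} (inj₂ ∘ inj₁) (λ _ _ → refl) r)

    run-false : ∀ {b P Q ts B ts′} → b (heads ts) ≡ false → Run Q ts B ts′ → Run (cond b P Q) ts (suc B) ts′
    run-false {b} {P} {Q} eq (n , h , r) = suc n , s≤s h ,
      idle-step {cond b P Q} (cong (λ z → just (inj₂ (if z then inj₁ (entry P) else inj₂ (entry Q))) , _) eq)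
        (finish {Q} {cond b P Q} (inj₂ ∘ inj₂) (λ _ _ → refl) r)

    run-stop : ∀ {b P ts} → b (heads ts) ≡ false → Run (while b P) ts 1 ts
    run-stop {b} {P} {ts} eq = 1 , ℕₚ.≤-refl ,
      subst (Reach (while b P) _ ts 1) (apply-idle ts)
        (last (cong (λ z → (if z then just (inj₂ (entry P)) else nothing) , idle (heads ts)) eq))

    run-again : ∀ {b P ts B ts′ B′ ts″} → b (heads ts) ≡ true → Run P ts B ts′ →
                Run (while b P) ts′ B′ ts″ → Run (while b P) ts (suc (B + B′)) ts″
    run-again {b} {P} eq (n , h , r) (n′ , h′ , r′) = suc (n + n′) , s≤s (ℕₚ.+-mono-≤ h h′) ,
      idle-step {while b P} (cong (λ z → (if z then just (inj₂ (entry P)) else nothing) , _) eq)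
        (continue {P} {while b P} inj₂ (λ _ _ → refl) r r′)

    size : Prog → ℕ
    size (instr f)     = 1
    size (P ⨾ Q)      = size P + size Q
    size (cond b P Q) = suc (size P + size Q)
    size (while b P)  = suc (size P)

    encode : ∀ P → St P → Fin (size P)
    encode (instr f)     _               = zero
    encode (P ⨾ Q)      (inj₁ s)        = encode P s ↑ˡ size Q
    encode (P ⨾ Q)      (inj₂ s)        = size P ↑ʳ encode Q s
    encode (cond b P Q) (inj₁ _)        = zero
    encode (cond b P Q) (inj₂ (inj₁ s)) = suc (encode P s ↑ˡ size Q)
    encode (cond b P Q) (inj₂ (inj₂ s)) = suc (size P ↑ʳ encode Q s)
    encode (while b P)  (inj₁ _)        = zero
    encode (while b P)  (inj₂ s)        = suc (encode P s)

    decode : ∀ P → Fin (size P) → St P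
    decode (instr f)     _       = tt
    decode (P ⨾ Q)      i       = [ inj₁ ∘ decode P , inj₂ ∘ decode Q ]′ (splitAt (size P) i)
    decode (cond b P Q) zero    = inj₁ tt
    decode (cond b P Q) (suc i) = inj₂ ([ inj₁ ∘ decode P , inj₂ ∘ decode Q ]′ (splitAt (size P) i))
    decode (while b P)  zero    = inj₁ tt
    decode (while b P)  (suc i) = inj₂ (decode P i)

    decode-encode : ∀ P s → decode P (encode P s) ≡ s
    decode-encode (instr f) _ = refl
    decode-encode (P ⨾ Q) (inj₁ s) rewrite splitAt-↑ˡ (size P) (encode P s) (size Q) = cong inj₁ (decode-encode P s)
    decode-encode (P ⨾ Q) (inj₂ s) rewrite splitAt-↑ʳ (size P) (size Q) (encode Q s) = cong inj₂ (decode-encode Q s)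
    decode-encode (cond b P Q) (inj₁ _) = refl
    decode-encode (cond b P Q) (inj₂ (inj₁ s)) rewrite splitAt-↑ˡ (size P) (encode P s) (size Q) = cong (inj₂ ∘ inj₁) (decode-encode P s)
    decode-encode (cond b P Q) (inj₂ (inj₂ s)) rewrite splitAt-↑ʳ (size P) (size Q) (encode Q s) = cong (inj₂ ∘ inj₂) (decode-encode Q s)
    decode-encode (while b P) (inj₁ _) = refl
    decode-encode (while b P) (inj₂ s) = cong inj₂ (decode-encode P s)

    -- State 0 is the halting state.
    compiled : ∀ P → Fin (suc (size P)) → Reads → Maybe (Fin (suc (size P)) × Act)
    compiled P zero    r = nothing
    compiled P (suc i) r = just (map₁ resume (transition P (decode P i) r))
      where
      resume : Maybe (St P) → Fin (suc (size P))
      resume (just s) = suc (encode P s)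
      resume nothing  = zero

    machine : Prog → TM
    machine P = record
      { workTapes = w ; states = suc (size P) ; marks = g ; start = suc (encode P (entry P)) ; δ = compiled P }

    halts : ∀ P {s ts n ts′} → Reach P s ts n ts′ →
            HaltsIn (machine P) n (config (suc (encode P s)) ts) (config zero ts′)
    halts P {s} {ts} (last e) = next (lemma e) (halted refl)
      where
      lemma : ∀ {a} → transition P s (heads ts) ≡ (nothing , a) →
        Defs.step (machine P) (config (suc (encode P s)) ts) ≡ just (config zero (apply a ts))
      lemma e rewrite decode-encode P s | e = refl
    halts P {s} {ts} (more {s′ = s′} e r) = next (lemma e) (halts P r)
      where
      lemma : ∀ {a} → transition P s (heads ts) ≡ (just s′ , a) →
        Defs.step (machine P) (config (suc (encode P s)) ts) ≡ just (config (suc (encode P s′)) (apply a ts))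
      lemma e rewrite decode-encode P s | e = refl

-- A language of nested loops over the positions of a word.

module LoopPrograms where

  open import Data.Bool.Base using (Bool; true; false; if_then_else_; _∧_)
  open import Data.Fin.Base using (Fin; zero; suc)
  open import Data.Fin.Properties using () renaming (_≟_ to _≟ᶠ_)
  open import Data.List.Base as List using (List; []; _∷_; _++_; length; foldl)
  open import Data.Nat.Base as ℕ using (_≡ᵇ_; ℕ; zero; suc; _+_; _*_)
  open import Data.Product.Base using (_×_; _,_)
  open import Data.Unit.Base using (⊤)
  open import Data.Vec.Base as Vec using (Vec; []; _∷_; lookup; _[_]≔_)
  open import Relation.Binary.PropositionalEquality
  open import Relation.Nullary using (does)

  -- Letters of the intermediate words: the bits 0 and 1, a cell of the
  -- certificate, and padding.
  Letter : Set
  Letter = Fin 4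

  pattern bit0 = zero
  pattern bit1 = suc zero
  pattern free = suc (suc zero)
  pattern pad  = suc (suc (suc zero))

  data Atom (n : ℕ) : Set where
    same succ  : Fin n → Fin n → Atom n
    first      : Fin n → Atom n
    letter     : Fin n → Letter → Atom n

  data Mode : Set where
    pending off on : Mode

  isOn : Mode → Bool
  isOn on = true
  isOn _  = false

  loop : {A : Set} → ℕ → ℕ → (ℕ → List A) → List A
  loop zero    i f = []
  loop (suc n) i f = f i ++ loop n (suc i) f

  module _ {h : ℕ} where

    -- A letter, with a flag for each loop variable that stands on it.
    Column : Set
    Column = Letter × Vec Bool h

    columns : ℕ → List Letter → Vec ℕ h → List Column
    columns n []      ρ = []
    columns n (ι ∷ u) ρ = (ι , Vec.map (n ≡ᵇ_) ρ) ∷ columns (suc n) u ρ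

    start : Atom h → Mode
    start (first i) = pending
    start _         = off

    -- A one-pass automaton. For `succ`, `pending` means that i stood on the preceding column; for
    -- `first`, that no column has been read yet.
    advance : Atom h → Mode → Column → Mode
    advance (same i j)    m       (_ , bs) = if lookup bs i ∧ lookup bs j then on else m
    advance (succ i j)    on      _        = on
    advance (succ i j)    pending (_ , bs) = if lookup bs j then on else if lookup bs i then pending else off
    advance (succ i j)    off     (_ , bs) = if lookup bs i then pending else off
    advance (first i)     pending (_ , bs) = if lookup bs i then on else off
    advance (first i)     m       _        = m
    advance (letter i ι′) m       (ι , bs) = if lookup bs i then (if does (ι ≟ᶠ ι′) then on else off) else m

    holds : Atom h → List Letter → Vec ℕ h → Bool
    holds a u ρ = isOn (foldl (advance a) (start a) (columns 0 u ρ))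

    -- Programs that print a word; the variables of `for` loops range over the
    -- positions of the input word.
    data Gen : Set where
      nil    : Gen
      emit   : Letter → Gen
      _⨟_    : Gen → Gen → Gen
      branch : Atom h → Gen → Gen → Gen
      for    : Fin h → Gen → Gen

    infixr 5 _⨟_

    ⟦_⟧ : Gen → List Letter → Vec ℕ h → List Letter
    ⟦ nil ⟧          u ρ = []
    ⟦ emit ι ⟧       u ρ = ι ∷ []
    ⟦ G ⨟ H ⟧        u ρ = ⟦ G ⟧ u ρ ++ ⟦ H ⟧ u ρ
    ⟦ branch a G H ⟧ u ρ = if holds a u ρ then ⟦ G ⟧ u ρ else ⟦ H ⟧ u ρ
    ⟦ for j G ⟧      u ρ = loop (length u) 0 (λ i → ⟦ G ⟧ u (ρ [ j ]≔ i))

    -- Loop variables hold the value length u outside of their loop.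
    Scoped : Gen → List Letter → Vec ℕ h → Set
    Scoped nil            u ρ = ⊤
    Scoped (emit ι)       u ρ = ⊤
    Scoped (G ⨟ H)        u ρ = Scoped G u ρ × Scoped H u ρ
    Scoped (branch a G H) u ρ = Scoped G u ρ × Scoped H u ρ
    Scoped (for j G)      u ρ = lookup ρ j ≡ length u × (∀ i → Scoped G u (ρ [ j ]≔ i))

    -- The constants are generous, so that the same polynomial bounds the running time of the
    -- compiled program and the length of the word it prints.
    cost : Gen → ℕ → ℕ
    cost nil            n = 1
    cost (emit ι)       n = 1
    cost (G ⨟ H)        n = cost G n + cost H n
    cost (branch a G H) n = (4 * n + 20) + (cost G n + cost H n)
    cost (for j G)      n = 10 + n * (cost G n + (4 * n + 20))

-- Compilation of loops to pebbles on a track.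

module Compilation where

  open import Defs
  open TapePrograms
  open LoopPrograms
  open Packing
  open import Data.Bool.Base using (Bool; true; false; if_then_else_; not)
  open import Data.Empty using (⊥-elim)
  open import Data.Fin.Base using (Fin; zero; suc; combine; remQuot; _↑ʳ_)
  open import Data.Fin.Properties using (remQuot-combine)
  open import Data.List.Base as List using (List; []; _∷_; _++_; length; foldl; map; replicate; _ʳ++_)
  open import Data.List.Properties using (map-++; length-++; ʳ++-ʳ++; map-ʳ++; ʳ++-defn; ++-assoc; length-reverse; ++-ʳ++)
  open import Data.Nat.Base as ℕ using (ℕ; zero; suc; _+_; _*_; _^_; _≤_; _<_; _≡ᵇ_; z≤n; s≤s)
  import Data.Nat.Properties as ℕₚ
  import Data.Nat.Tactic.RingSolver as ℕSolver
  open import Data.Product.Base using (∃-syntax; _×_; _,_; proj₁; proj₂)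
  open import Data.Unit.Base using (⊤; tt)
  open import Data.Vec.Base as Vec using (Vec; []; _∷_; lookup; _[_]≔_)
  open import Data.Vec.Properties using (map-[]≔; []≔-idempotent; []≔-lookup; lookup∘update; lookup-map)
  open import Function.Base using (_∘_)
  open import Relation.Binary.PropositionalEquality

  module _ {h : ℕ} where

    -- Two marks for the letters `free` and `pad`, and one for each column, that is, a letter with a
    -- set of pebbles.
    marks : ℕ
    marks = 2 + 4 * 2 ^ h

    Sym : Set
    Sym = Symbol marks

    letterSym : Letter → Sym
    letterSym bit0 = bit false
    letterSym bit1 = bit true
    letterSym free = mark zero
    letterSym pad  = mark (suc zero)

    symLetter : Sym → Letter
    symLetter (bit false) = bit0
    symLetter (bit true)  = bit1
    symLetter (mark zero) = free
    symLetter _           = pad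

    symLetter-letterSym : ∀ ι → symLetter (letterSym ι) ≡ ι
    symLetter-letterSym bit0 = refl
    symLetter-letterSym bit1 = refl
    symLetter-letterSym free = refl
    symLetter-letterSym pad  = refl

    colSym : Column {h} → Sym
    colSym (ι , bs) = mark (2 ↑ʳ combine ι (packBits bs))

    symCol : Sym → Column {h}
    symCol (mark (suc (suc i))) = proj₁ (remQuot {4} (2 ^ h) i) , unpackBits h (proj₂ (remQuot {4} (2 ^ h) i))
    symCol _                    = pad , Vec.replicate h false

    symCol-colSym : ∀ c → symCol (colSym c) ≡ c
    symCol-colSym (ι , bs) = trans
      (cong (λ r → proj₁ r , unpackBits h (proj₂ r)) (remQuot-combine {4} {2 ^ h} ι (packBits bs)))
      (cong (ι ,_) (unpackBits-packBits bs))

    modeSym : Mode → Sym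
    modeSym pending = blank
    modeSym off     = bit false
    modeSym on      = bit true

    symMode : Sym → Mode
    symMode (bit true) = on
    symMode blank      = pending
    symMode _          = off

    symMode-modeSym : ∀ m → symMode (modeSym m) ≡ m
    symMode-modeSym pending = refl
    symMode-modeSym off     = refl
    symMode-modeSym on      = refl

    written : Sym → Bool
    written blank = false
    written _     = true

    written-letter : ∀ ι → written (letterSym ι) ≡ true
    written-letter bit0 = refl
    written-letter bit1 = refl
    written-letter free = refl
    written-letter pad  = refl

    mkTape : List Sym → List Sym → Tape marks
    mkTape ls []       = tape ls blank []
    mkTape ls (x ∷ xs) = tape ls x xs

    act-right : ∀ s ls x rs → act (s , moveRight) (tape ls x rs) ≡ mkTape (s ∷ ls) rs
    act-right s ls x []       = refl
    act-right s ls x (_ ∷ rs) = refl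

    P : Set
    P = Prog {marks} {2}

    -- The tapes are the input/output tape, the track and a one-symbol register.
    onTrack : (Sym → Sym × Move) → P
    onTrack f = instr λ { (x ∷ y ∷ z ∷ []) → (x , stay) ∷ f y ∷ (z , stay) ∷ [] }

    trackWritten : Reads {marks} {2} → Bool
    trackWritten (x ∷ y ∷ z ∷ []) = written y

    registerOn : Reads {marks} {2} → Bool
    registerOn (x ∷ y ∷ z ∷ []) = isOn (symMode z)

    -- The blank to the left of the track is the sentinel. The first move to the left takes the head
    -- off the blank at the right end when it starts there.
    goHome : P
    goHome = onTrack (_, moveLeft) ⨾ while trackWritten (onTrack (_, moveLeft)) ⨾ onTrack (_, moveRight)

    cells : List (Column {h}) → List Sym
    cells = map colSym

    reg : Sym → Tape marks
    reg z = tape [] z []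

    home : List Sym → List (Column {h}) → Tape marks
    home tl cs = mkTape (blank ∷ tl) (cells cs ++ blank ∷ [])

    lefts : ∀ {io z tl} seen y rs → written y ≡ true →
      Run (while trackWritten (onTrack (_, moveLeft))) (io ∷ tape (cells seen ++ blank ∷ tl) y rs ∷ reg z ∷ [])
          (2 * length seen + 3) (io ∷ tape tl blank (cells seen ʳ++ (y ∷ rs)) ∷ reg z ∷ [])
    lefts {tape _ _ _} []         y rs wy = run-again wy run-instr (run-stop refl)
    lefts {tape _ _ _} (c ∷ seen) y rs wy = run-weaken (ℕₚ.≤-reflexive (lemma (length seen)))
      (run-again wy run-instr (lefts seen (colSym c) (y ∷ rs) refl))
      where
      lemma : ∀ n → suc (1 + (2 * n + 3)) ≡ 2 * suc n + 3
      lemma = ℕSolver.solve-∀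

    goHome-run : ∀ {io z tl} seen y rs →
      Run goHome (io ∷ tape (cells seen ++ blank ∷ tl) y rs ∷ reg z ∷ []) (2 * length seen + 4)
          (io ∷ mkTape (blank ∷ tl) (cells seen ʳ++ (y ∷ rs)) ∷ reg z ∷ [])
    goHome-run {tape _ _ _} {z} {tl} []         y rs = run-weaken (s≤s (s≤s (s≤s z≤n))) (run-⨾ run-instr (run-⨾ (run-stop refl) run-instr))
    goHome-run {io@(tape _ _ _)} {z} {tl} (c ∷ seen) y rs = subst
      (λ t → Run goHome (io ∷ tape (cells (c ∷ seen) ++ blank ∷ tl) y rs ∷ reg z ∷ []) (2 * suc (length seen) + 4) (io ∷ t ∷ reg z ∷ [])) (act-right blank tl blank (cells (c ∷ seen) ʳ++ (y ∷ rs)))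
      (run-weaken (ℕₚ.≤-trans (ℕₚ.n≤1+n _) (ℕₚ.≤-reflexive (lemma (length seen))))
        (run-⨾ run-instr (run-⨾ (lefts seen (colSym c) (y ∷ rs) refl) run-instr)))
      where
      lemma : ∀ n → suc (1 + (2 * n + 3 + 1)) ≡ 2 * suc n + 4
      lemma = ℕSolver.solve-∀

    sweep : (Sym → Sym → Sym × Sym) → P
    sweep f = while trackWritten (instr λ { (x ∷ y ∷ z ∷ []) → (x , stay) ∷ (proj₁ (f y z) , moveRight) ∷ (proj₂ (f y z) , stay) ∷ [] })

    scan-run : ∀ {io tl} (a : Atom h) m seen cs →
      Run (sweep λ y z → y , modeSym (advance a (symMode z) (symCol y)))
          (io ∷ mkTape (cells seen ++ blank ∷ tl) (cells cs ++ blank ∷ []) ∷ reg (modeSym m) ∷ [])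
          (2 * length cs + 1)
          (io ∷ tape (cells (cs ʳ++ seen) ++ blank ∷ tl) blank [] ∷ reg (modeSym (foldl (advance a) m cs)) ∷ [])
    scan-run {tape _ _ _} a m seen []       = run-stop refl
    scan-run {io@(tape _ _ _)} {tl} a m seen (c ∷ cs) = run-weaken (ℕₚ.≤-reflexive (lemma (length cs)))
      (run-again refl (run-end eq run-instr) (scan-run a (advance a m c) (c ∷ seen) cs))
      where
      lemma : ∀ n → suc (1 + (2 * n + 1)) ≡ 2 * suc n + 1
      lemma = ℕSolver.solve-∀
      eq : io ∷ act (colSym c , moveRight) (tape (cells seen ++ blank ∷ tl) (colSym c) (cells cs ++ blank ∷ [])) ∷
             reg (modeSym (advance a (symMode (modeSym m)) (symCol (colSym c)))) ∷ [] ≡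
           io ∷ mkTape (cells (c ∷ seen) ++ blank ∷ tl) (cells cs ++ blank ∷ []) ∷ reg (modeSym (advance a m c)) ∷ []
      eq = cong₂ (λ t s → io ∷ t ∷ reg s ∷ []) (act-right (colSym c) (cells seen ++ blank ∷ tl) (colSym c) (cells cs ++ blank ∷ []))
        (cong₂ (λ m′ c′ → modeSym (advance a m′ c′)) (symMode-modeSym m) (symCol-colSym c))

    home-end : ∀ {io z tl} cs →
      Run goHome (io ∷ tape (cells (cs ʳ++ []) ++ blank ∷ tl) blank [] ∷ reg z ∷ []) (2 * length cs + 4)
          (io ∷ home tl cs ∷ reg z ∷ [])
    home-end {io} {z} {tl} cs = subst₂ (λ n t → Run goHome (io ∷ tape (cells (cs ʳ++ []) ++ blank ∷ tl) blank [] ∷ reg z ∷ []) (2 * n + 4) (io ∷ mkTape (blank ∷ tl) t ∷ reg z ∷ []))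
      (trans (cong length (ʳ++-defn cs)) (trans (length-++ (List.reverse cs)) (trans (ℕₚ.+-identityʳ _) (length-reverse cs))))
      (trans (cong (_ʳ++ (blank ∷ [])) (map-ʳ++ colSym cs)) (ʳ++-ʳ++ (cells cs)))
      (goHome-run (cs ʳ++ []) blank [])

    setCol : Fin h → Bool → Column {h} → Column {h}
    setCol j b (ι , bs) = ι , bs [ j ]≔ b

    place : Fin h → ℕ → List (Column {h}) → List (Column {h})
    place j k       []       = []
    place j zero    (c ∷ cs) = setCol j true c ∷ cs
    place j (suc k) (c ∷ cs) = c ∷ place j k cs

    Bare : Fin h → List (Column {h}) → Set
    Bare j []       = ⊤
    Bare j (c ∷ cs) = lookup (proj₂ c) j ≡ false × Bare j cs

    ≡ᵇ-false : ∀ {m n} → m ≢ n → (m ≡ᵇ n) ≡ false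
    ≡ᵇ-false {m} {n} ne with m ≡ᵇ n in eq
    ... | false = refl
    ... | true  = ⊥-elim (ne (ℕₚ.≡ᵇ⇒≡ m n (subst (λ b → Data.Bool.Base.T b) (sym eq) tt)))

    ≡ᵇ-refl : ∀ n → (n ≡ᵇ n) ≡ true
    ≡ᵇ-refl zero    = refl
    ≡ᵇ-refl (suc n) = ≡ᵇ-refl n

    module _ {j : Fin h} {ρ : Vec ℕ h} where

      absent : ∀ n {m} → suc (n + m) ≤ lookup ρ j → lookup (Vec.map (n ≡ᵇ_) ρ) j ≡ false
      absent n {m} le = trans (lookup-map j (n ≡ᵇ_) ρ)
        (≡ᵇ-false (λ eq → ℕₚ.<⇒≱ le (ℕₚ.≤-trans (ℕₚ.≤-reflexive (sym eq)) (ℕₚ.m≤m+n n m))))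

      shifted : ∀ n (u : List Letter) {ι : Letter} → n + length (ι ∷ u) ≤ lookup ρ j → suc (n + length u) ≤ lookup ρ j
      shifted n u = subst (_≤ lookup ρ j) (ℕₚ.+-suc n (length u))

      columns-bare : ∀ n u → n + length u ≤ lookup ρ j → Bare j (columns n u ρ)
      columns-bare n []      le = tt
      columns-bare n (ι ∷ u) le = absent n (shifted n u {ι} le) , columns-bare (suc n) u (shifted n u {ι} le)

      head-other : ∀ n {m} x → n ≢ x → suc (n + m) ≤ lookup ρ j →
                   Vec.map (n ≡ᵇ_) (ρ [ j ]≔ x) ≡ Vec.map (n ≡ᵇ_) ρ
      head-other n x ne le = trans (map-[]≔ (n ≡ᵇ_) ρ j) (trans
        (cong (Vec.map (n ≡ᵇ_) ρ [ j ]≔_) (trans (≡ᵇ-false ne) (sym (absent n le))))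
        ([]≔-lookup (Vec.map (n ≡ᵇ_) ρ) j))

      columns-other : ∀ n u x → x < n → n + length u ≤ lookup ρ j → columns n u (ρ [ j ]≔ x) ≡ columns n u ρ
      columns-other n []      x lt le = refl
      columns-other n (ι ∷ u) x lt le = cong₂ (λ bs cs → (ι , bs) ∷ cs)
        (head-other n x (λ eq → ℕₚ.<⇒≢ lt (sym eq)) (shifted n u {ι} le))
        (columns-other (suc n) u x (ℕₚ.m≤n⇒m≤1+n lt) (shifted n u {ι} le))

      -- By the hypothesis the old value of j lies beyond the word, so no column carries the flag j
      -- before the update, and at most the flag at k is added.
      columns-place : ∀ n u k → n + length u ≤ lookup ρ j →
                      columns n u (ρ [ j ]≔ (n + k)) ≡ place j k (columns n u ρ)
      columns-place n []      k       le = refl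
      columns-place n (ι ∷ u) zero    le rewrite ℕₚ.+-identityʳ n = cong₂ (λ bs cs → (ι , bs) ∷ cs)
        (trans (map-[]≔ (n ≡ᵇ_) ρ j) (cong (Vec.map (n ≡ᵇ_) ρ [ j ]≔_) (≡ᵇ-refl n)))
        (columns-other (suc n) u n ℕₚ.≤-refl (shifted n u {ι} le))
      columns-place n (ι ∷ u) (suc k) le rewrite ℕₚ.+-suc n k = cong₂ (λ bs cs → (ι , bs) ∷ cs)
        (head-other n (suc (n + k)) (ℕₚ.m≢1+m+n n) (shifted n u {ι} le))
        (columns-place (suc n) u k (shifted n u {ι} le))

    length-columns : ∀ n u (ρ : Vec ℕ h) → length (columns n u ρ) ≡ length u
    length-columns n []      ρ = refl
    length-columns n (ι ∷ u) ρ = cong suc (length-columns (suc n) u ρ)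

    place-beyond : ∀ j k cs → length cs ≤ k → place j k cs ≡ cs
    place-beyond j zero    []       _        = refl
    place-beyond j (suc k) []       _        = refl
    place-beyond j (suc k) (c ∷ cs) (s≤s le) = cong (c ∷_) (place-beyond j k cs le)

    record Split (j : Fin h) (i n : ℕ) (cs : List (Column {h})) : Set where
      field
        pre post : List (Column {h})
        c        : Column {h}
        whole    : cs ≡ pre ++ c ∷ post
        bare     : Bare j pre
        bare-c   : lookup (proj₂ c) j ≡ false
        length-pre  : length pre ≡ i
        length-post : length post ≡ n

    split : ∀ j i n cs → Bare j cs → i + suc n ≡ length cs → Split j i n cs
    split j zero    n (c ∷ cs) (b , bs) eq = record
      { pre = [] ; post = cs ; c = c ; whole = refl ; bare = tt ; bare-c = b
      ; length-pre = refl ; length-post = sym (ℕₚ.suc-injective eq) }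
    split j (suc i) n (c ∷ cs) (b , bs) eq = let open Split (split j i n cs bs (ℕₚ.suc-injective eq)) renaming (c to c′) in record
      { pre = c ∷ pre ; post = post ; c = c′ ; whole = cong (c ∷_) whole ; bare = b , bare ; bare-c = bare-c
      ; length-pre = cong suc length-pre ; length-post = length-post }

    place-split : ∀ j pre c post → place j (length pre) (pre ++ c ∷ post) ≡ pre ++ setCol j true c ∷ post
    place-split j []        c post = refl
    place-split j (x ∷ pre) c post = cong (x ∷_) (place-split j pre c post)

    place-next : ∀ j pre c post → place j (suc (length pre)) (pre ++ c ∷ post) ≡ pre ++ c ∷ place j 0 post
    place-next j []        c post = refl
    place-next j (x ∷ pre) c post = cong (x ∷_) (place-next j pre c post)

    hasPebble : Fin h → Sym → Bool
    hasPebble j y = lookup (proj₂ (symCol y)) j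

    seek : Fin h → P
    seek j = while (λ { (x ∷ y ∷ z ∷ []) → not (hasPebble j y) }) (onTrack (_, moveRight))

    pebbleOff pebbleOn : Fin h → Sym → Sym
    pebbleOff j y = colSym (setCol j false (symCol y))
    pebbleOn  j y = colSym (setCol j true (symCol y))

    land : Fin h → P
    land j = instr λ { (x ∷ y ∷ z ∷ []) → (x , stay) ∷
      ((if written y then pebbleOn j y else y) , stay) ∷ (modeSym (if written y then on else off) , stay) ∷ [] }

    -- Stepping onto the blank behind the track loses the pebble and turns the register off; this
    -- ends the loop and restores the value of an inactive variable.
    push : Fin h → P
    push j = seek j ⨾ onTrack (λ y → pebbleOff j y , moveRight) ⨾ land j ⨾ goHome

    seek-run : ∀ {io z tl} j seen pre c post → Bare j pre → lookup (proj₂ c) j ≡ true →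
      Run (seek j) (io ∷ mkTape (cells seen ++ blank ∷ tl) (cells (pre ++ c ∷ post) ++ blank ∷ []) ∷ reg z ∷ [])
          (2 * length pre + 1)
          (io ∷ mkTape (cells (pre ʳ++ seen) ++ blank ∷ tl) (cells (c ∷ post) ++ blank ∷ []) ∷ reg z ∷ [])
    seek-run {tape _ _ _} j seen []        c post _        pc = run-stop (cong not (trans (cong (λ c → lookup (proj₂ c) j) (symCol-colSym c)) pc))
    seek-run {io@(tape _ _ _)} {z} {tl} j seen (x ∷ pre) c post (b , bs) pc = run-weaken (ℕₚ.≤-reflexive (lemma (length pre)))
      (run-again (cong not (trans (cong (λ c → lookup (proj₂ c) j) (symCol-colSym x)) b))
        (subst (λ t → Run (onTrack (_, moveRight)) (io ∷ tape (cells seen ++ blank ∷ tl) (colSym x) (cells (pre ++ c ∷ post) ++ blank ∷ []) ∷ reg z ∷ []) 1 (io ∷ t ∷ reg z ∷ []))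
          (act-right (colSym x) _ (colSym x) _) run-instr)
        (seek-run j (x ∷ seen) pre c post bs pc))
      where
      lemma : ∀ n → suc (1 + (2 * n + 1)) ≡ 2 * suc n + 1
      lemma = ℕSolver.solve-∀

    flag : ℕ → Mode
    flag zero    = off
    flag (suc _) = on

    unwind : ∀ pre c R → cells (c ∷ (pre ʳ++ [])) ʳ++ R ≡ cells pre ++ colSym c ∷ R
    unwind pre c R = trans (cong (λ l → l ʳ++ (colSym c ∷ R)) (map-ʳ++ colSym pre)) (ʳ++-ʳ++ (cells pre))

    cells-++ : ∀ pre c post → cells (pre ++ c ∷ post) ++ blank ∷ [] ≡ cells pre ++ colSym c ∷ cells post ++ blank ∷ []
    cells-++ pre c post = trans (cong (_++ blank ∷ []) (map-++ colSym pre (c ∷ post))) (++-assoc (cells pre) _ _)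

    push-run : ∀ {io z tl} j i n cs → Bare j cs → i + suc n ≡ length cs →
      Run (push j) (io ∷ home tl (place j i cs) ∷ reg z ∷ []) (4 * i + 10)
          (io ∷ home tl (place j (suc i) cs) ∷ reg (modeSym (flag n)) ∷ [])
    push-run {io@(tape _ _ _)} {z} {tl} j i n cs bs eq with split j i n cs bs eq
    ... | record { pre = pre ; post = post ; c = c ; whole = refl ; bare = bare ; bare-c = bare-c ; length-pre = refl ; length-post = refl } =
      run-weaken (ℕₚ.≤-trans (ℕₚ.≤-reflexive (trans (cong (λ m → 2 * length pre + 1 + (1 + (1 + (2 * suc m + 4)))) seen-length) (lemma (length pre))))
          (ℕₚ.+-monoʳ-≤ (4 * length pre) (ℕₚ.n≤1+n 9)))
        (run-⨾ seekRun (run-⨾ offRun (landing post)))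
      where
      lemma : ∀ i → 2 * i + 1 + (1 + (1 + (2 * suc i + 4))) ≡ 4 * i + 9
      lemma = ℕSolver.solve-∀
      seen-length : length (pre ʳ++ []) ≡ length pre
      seen-length = trans (cong length (ʳ++-defn pre)) (trans (length-++ (List.reverse pre)) (trans (ℕₚ.+-identityʳ _) (length-reverse pre)))
      L = cells (pre ʳ++ []) ++ blank ∷ tl
      seekRun : Run (seek j) (io ∷ home tl (place j (length pre) (pre ++ c ∷ post)) ∷ reg z ∷ []) (2 * length pre + 1)
        (io ∷ mkTape L (cells (setCol j true c ∷ post) ++ blank ∷ []) ∷ reg z ∷ [])
      seekRun = run-begin (cong (λ l → io ∷ home tl l ∷ reg z ∷ []) (place-split j pre c post))
        (seek-run j [] pre (setCol j true c) post bare (lookup∘update j (proj₂ c) true))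
      cleared : pebbleOff j (colSym (setCol j true c)) ≡ colSym c
      cleared = trans (cong (colSym ∘ setCol j false) (symCol-colSym (setCol j true c)))
        (cong (λ bs → colSym (proj₁ c , bs)) (trans ([]≔-idempotent (proj₂ c) j)
          (trans (cong (proj₂ c [ j ]≔_) (sym bare-c)) ([]≔-lookup (proj₂ c) j))))
      offRun : Run (onTrack (λ y → pebbleOff j y , moveRight))
        (io ∷ mkTape L (cells (setCol j true c ∷ post) ++ blank ∷ []) ∷ reg z ∷ []) 1
        (io ∷ mkTape (colSym c ∷ L) (cells post ++ blank ∷ []) ∷ reg z ∷ [])
      offRun = run-end (cong (λ t → io ∷ t ∷ reg z ∷ [])
        (trans (cong (λ s → act (s , moveRight) (tape L (colSym (setCol j true c)) (cells post ++ blank ∷ []))) cleared)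
               (act-right (colSym c) L (colSym (setCol j true c)) (cells post ++ blank ∷ [])))) run-instr
      landing : ∀ post → Run (land j ⨾ goHome) (io ∷ mkTape (colSym c ∷ L) (cells post ++ blank ∷ []) ∷ reg z ∷ [])
        (1 + (2 * suc (length (pre ʳ++ [])) + 4))
        (io ∷ home tl (place j (suc (length pre)) (pre ++ c ∷ post)) ∷ reg (modeSym (flag (length post))) ∷ [])
      landing [] = run-⨾ run-instr (run-end (cong (λ l → io ∷ mkTape (blank ∷ tl) l ∷ reg (modeSym off) ∷ [])
        (trans (unwind pre c (blank ∷ [])) (trans (sym (cells-++ pre c [])) (cong (λ l → cells l ++ blank ∷ []) (sym (place-next j pre c []))))))
        (goHome-run (c ∷ (pre ʳ++ [])) blank []))
      landing (x ∷ post) = run-⨾ run-instr (subst₂ (λ s l → Run goHome (io ∷ tape (colSym c ∷ L) s (cells post ++ blank ∷ []) ∷ reg (modeSym on) ∷ []) (2 * suc (length (pre ʳ++ [])) + 4) (io ∷ mkTape (blank ∷ tl) l ∷ reg (modeSym on) ∷ []))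
        (sym (cong (colSym ∘ setCol j true) (symCol-colSym x)))
        (trans (unwind pre c _) (trans (sym (cells-++ pre c (setCol j true x ∷ post))) (cong (λ l → cells l ++ blank ∷ []) (sym (place-next j pre c (x ∷ post))))))
        (goHome-run (c ∷ (pre ʳ++ [])) (colSym (setCol j true x)) (cells post ++ blank ∷ [])))

    setRegister : Mode → P
    setRegister m = instr λ { (x ∷ y ∷ z ∷ []) → (x , stay) ∷ (y , stay) ∷ (modeSym m , stay) ∷ [] }

    dropPebble : Fin h → P
    dropPebble j = instr λ { (x ∷ y ∷ z ∷ []) → (x , stay) ∷ (pebbleOn j y , stay) ∷ (modeSym on , stay) ∷ [] }

    compile : Gen {h} → P
    compile nil            = instr (idle {marks} {2})
    compile (emit ι)       = instr λ { (x ∷ y ∷ z ∷ []) → (letterSym ι , moveRight) ∷ (y , stay) ∷ (z , stay) ∷ [] }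
    compile (G ⨟ H)        = compile G ⨾ compile H
    compile (branch a G H) =
      setRegister (start a) ⨾ (sweep (λ y z → y , modeSym (advance a (symMode z) (symCol y)))) ⨾ goHome ⨾
      cond registerOn (compile G) (compile H)
    compile (for j G)      = dropPebble j ⨾ while registerOn (compile G ⨾ push j)

    printed : List Letter → List Sym → Tape marks
    printed o ls = tape (map letterSym o ʳ++ ls) blank []

    printed-++ : ∀ o o′ ls → printed o′ (map letterSym o ʳ++ ls) ≡ printed (o ++ o′) ls
    printed-++ o o′ ls = cong (λ l → tape l blank [])
      (sym (trans (cong (_ʳ++ ls) (map-++ letterSym o o′)) (++-ʳ++ (map letterSym o))))

    -- The word is nonempty because a loop begins by setting its pebble on the first column
    -- untested. The track is restored at the end, so programs compose; the register is scratch, and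
    -- only some final content is asserted.
    gen-run : ∀ G ι v (ρ : Vec ℕ h) → Scoped G (ι ∷ v) ρ → ∀ ls tl z →
      ∃[ z′ ] Run (compile G) (printed [] ls ∷ home tl (columns 0 (ι ∷ v) ρ) ∷ reg z ∷ []) (cost G (suc (length v)))
                  (printed (⟦ G ⟧ (ι ∷ v) ρ) ls ∷ home tl (columns 0 (ι ∷ v) ρ) ∷ reg z′ ∷ [])
    gen-run nil      ι v ρ _ ls tl z = z , run-instr
    gen-run (emit _) ι v ρ _ ls tl z = z , run-instr
    gen-run (G ⨟ H)  ι v ρ (sG , sH) ls tl z =
      let (z₁ , r₁) = gen-run G ι v ρ sG ls tl z
          (z₂ , r₂) = gen-run H ι v ρ sH (map letterSym (⟦ G ⟧ (ι ∷ v) ρ) ʳ++ ls) tl z₁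
      in z₂ , run-end (cong (λ t → t ∷ home tl (columns 0 (ι ∷ v) ρ) ∷ reg z₂ ∷ []) (printed-++ (⟦ G ⟧ (ι ∷ v) ρ) (⟦ H ⟧ (ι ∷ v) ρ) ls)) (run-⨾ r₁ r₂)
    gen-run (branch a G H) ι v ρ (sG , sH) ls tl z = choose (holds a u ρ) refl
      where
      u = ι ∷ v
      cs = columns 0 u ρ
      N = suc (length v)
      m = foldl (advance a) (start a) cs
      testing : ∀ {B ts′} → Run (cond registerOn (compile G) (compile H)) (printed [] ls ∷ home tl cs ∷ reg (modeSym m) ∷ []) (suc B) ts′ →
        B ≤ cost G N + cost H N → Run (compile (branch a G H)) (printed [] ls ∷ home tl cs ∷ reg z ∷ []) (cost (branch a G H) N) ts′
      testing {B} r le = run-weaken (ℕₚ.≤-trans (ℕₚ.+-monoʳ-≤ 1 (ℕₚ.+-mono-≤ (ℕₚ.≤-reflexive (cong (λ l → 2 * l + 1) (length-columns 0 u ρ)))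
          (ℕₚ.+-mono-≤ (ℕₚ.≤-reflexive (cong (λ l → 2 * l + 4) (length-columns 0 u ρ))) (s≤s le))))
          (ℕₚ.≤-trans (ℕₚ.≤-reflexive (lemma N (cost G N + cost H N))) (ℕₚ.+-monoˡ-≤ (cost G N + cost H N) (ℕₚ.+-monoʳ-≤ (4 * N) (ℕₚ.m≤m+n 7 13)))))
        (run-⨾ run-instr (run-⨾ (scan-run a (start a) [] cs) (run-⨾ (home-end cs) r)))
        where
        lemma : ∀ n c → 1 + (2 * n + 1 + (2 * n + 4 + suc c)) ≡ 4 * n + 7 + c
        lemma = ℕSolver.solve-∀
      choose : ∀ b → holds a u ρ ≡ b → ∃[ z′ ] Run (compile (branch a G H)) (printed [] ls ∷ home tl cs ∷ reg z ∷ []) (cost (branch a G H) N)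
        (printed (if b then ⟦ G ⟧ u ρ else ⟦ H ⟧ u ρ) ls ∷ home tl cs ∷ reg z′ ∷ [])
      choose true  eq = let (z′ , r) = gen-run G ι v ρ sG ls tl (modeSym m) in
        z′ , testing (run-true (trans (cong isOn (symMode-modeSym m)) eq) r) (ℕₚ.m≤m+n _ _)
      choose false eq = let (z′ , r) = gen-run H ι v ρ sH ls tl (modeSym m) in
        z′ , testing (run-false (trans (cong isOn (symMode-modeSym m)) eq) r) (ℕₚ.m≤n+m _ _)
    gen-run (for j G) ι v ρ (sj , sG) ls tl z = _ , run-weaken bound (run-⨾ initial-pebble (iterate N 0 ls refl))
      where
      u = ι ∷ v
      cs = columns 0 u ρ
      N = suc (length v)
      bare : Bare j cs
      bare = columns-bare 0 u (ℕₚ.≤-reflexive (sym sj))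
      f : ℕ → List Letter
      f i = ⟦ G ⟧ u (ρ [ j ]≔ i)
      moved : ∀ i → columns 0 u (ρ [ j ]≔ i) ≡ place j i cs
      moved i = columns-place {j} {ρ} 0 u i (ℕₚ.≤-reflexive (sym sj))
      K = cost G N + (4 * N + 10)
      bound : 1 + (N * suc K + 1) ≤ cost (for j G) N
      bound = ℕₚ.≤-trans (ℕₚ.≤-reflexive (cong suc (ℕₚ.+-comm _ 1))) (ℕₚ.+-mono-≤ (ℕₚ.m≤m+n 2 8)
        (ℕₚ.*-monoʳ-≤ N (ℕₚ.≤-trans (ℕₚ.≤-reflexive (lemma (cost G N) (4 * N))) (ℕₚ.+-monoʳ-≤ (cost G N) (ℕₚ.+-monoʳ-≤ (4 * N) (ℕₚ.m≤m+n 11 9))))))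
        where
        lemma : ∀ a b → suc (a + (b + 10)) ≡ a + (b + 11)
        lemma = ℕSolver.solve-∀
      initial-pebble : Run (dropPebble j)
        (printed [] ls ∷ home tl cs ∷ reg z ∷ []) 1 (printed [] ls ∷ home tl (place j 0 cs) ∷ reg (modeSym (flag N)) ∷ [])
      initial-pebble = run-end (cong (λ s → printed [] ls ∷ tape (blank ∷ tl) s (cells (columns 1 v ρ) ++ blank ∷ []) ∷ reg (modeSym on) ∷ [])
        (cong (colSym ∘ setCol j true) (symCol-colSym (ι , Vec.map (0 ≡ᵇ_) ρ)))) run-instr
      iterate : ∀ n i ls → i + n ≡ N →
        Run (while registerOn (compile G ⨾ push j)) (printed [] ls ∷ home tl (place j i cs) ∷ reg (modeSym (flag n)) ∷ [])
            (n * suc K + 1) (printed (loop n i f) ls ∷ home tl cs ∷ reg (modeSym off) ∷ [])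
      iterate zero i ls eq = run-begin (cong (λ l → printed [] ls ∷ home tl l ∷ reg (modeSym off) ∷ [])
        (place-beyond j i cs (ℕₚ.≤-reflexive (trans (length-columns 0 u ρ) (trans (sym eq) (ℕₚ.+-identityʳ i))))))
        (run-stop refl)
      iterate (suc n) i ls eq with gen-run G ι v (ρ [ j ]≔ i) (sG i) ls tl (modeSym on)
      ... | z′ , r = run-weaken (ℕₚ.≤-reflexive (cong suc (sym (ℕₚ.+-assoc K (n * suc K) 1))))
        (run-end (cong (λ t → t ∷ home tl cs ∷ reg (modeSym off) ∷ []) (printed-++ (f i) (loop n (suc i) f) ls))
          (run-again refl
            (run-weaken (ℕₚ.+-monoʳ-≤ (cost G N) (ℕₚ.+-monoˡ-≤ 10 (ℕₚ.*-monoʳ-≤ 4 (ℕₚ.≤-trans (ℕₚ.m≤m+n i (suc n)) (ℕₚ.≤-reflexive eq)))))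
              (run-⨾ (run-begin (cong (λ l → printed [] ls ∷ home tl l ∷ reg (modeSym on) ∷ []) (sym (moved i)))
                         (run-end (cong (λ l → printed (f i) ls ∷ home tl l ∷ reg z′ ∷ []) (moved i)) r))
                     (push-run j i n cs bare (trans eq (sym (length-columns 0 u ρ))))))
            (iterate n (suc i) _ (trans (sym (ℕₚ.+-suc i n)) eq))))

-- Arithmetic of polynomial bounds.

module Polynomials where

  open import Defs using (Poly; eval)
  open import Data.List.Base using ([]; _∷_; map)
  open import Data.Nat.Base using (ℕ; _+_; _*_; _≤_; z≤n)
  import Data.Nat.Properties as ℕₚ
  open import Data.Nat.Tactic.RingSolver using (solve-∀)
  open import Relation.Binary.PropositionalEquality

  infixl 6 _⊕_
  infixl 7 _⊗_

  _⊕_ _⊗_ _∘ᵖ_ : Poly → Poly → Poly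
  []      ⊕ q       = q
  (a ∷ p) ⊕ []      = a ∷ p
  (a ∷ p) ⊕ (b ∷ q) = (a + b) ∷ p ⊕ q

  []      ⊗ q = []
  (a ∷ p) ⊗ q = map (a *_) q ⊕ (0 ∷ p ⊗ q)

  []      ∘ᵖ q = []
  (a ∷ p) ∘ᵖ q = (a ∷ []) ⊕ q ⊗ (p ∘ᵖ q)

  constant : ℕ → Poly
  constant a = a ∷ []

  variableᵖ : Poly
  variableᵖ = 0 ∷ 1 ∷ []

  eval-constant : ∀ a n → eval (constant a) n ≡ a
  eval-constant = lemma
    where
    lemma : ∀ a n → a + n * 0 ≡ a
    lemma = solve-∀

  eval-variable : ∀ n → eval variableᵖ n ≡ n
  eval-variable = lemma
    where
    lemma : ∀ n → n * (1 + n * 0) ≡ n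
    lemma = solve-∀

  eval-⊕ : ∀ p q n → eval (p ⊕ q) n ≡ eval p n + eval q n
  eval-⊕ []      q       n = refl
  eval-⊕ (a ∷ p) []      n = sym (ℕₚ.+-identityʳ _)
  eval-⊕ (a ∷ p) (b ∷ q) n = trans (cong (λ r → a + b + n * r) (eval-⊕ p q n)) (lemma a b n (eval p n) (eval q n))
    where
    lemma : ∀ a b n x y → a + b + n * (x + y) ≡ (a + n * x) + (b + n * y)
    lemma = solve-∀

  eval-scale : ∀ k p n → eval (map (k *_) p) n ≡ k * eval p n
  eval-scale k []      n = sym (ℕₚ.*-zeroʳ k)
  eval-scale k (a ∷ p) n = trans (cong (λ r → k * a + n * r) (eval-scale k p n)) (lemma k a n (eval p n))
    where
    lemma : ∀ k a n x → k * a + n * (k * x) ≡ k * (a + n * x)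
    lemma = solve-∀

  eval-⊗ : ∀ p q n → eval (p ⊗ q) n ≡ eval p n * eval q n
  eval-⊗ []      q n = refl
  eval-⊗ (a ∷ p) q n = trans (eval-⊕ (map (a *_) q) (0 ∷ p ⊗ q) n)
    (trans (cong₂ (λ x y → x + n * y) (eval-scale a q n) (eval-⊗ p q n)) (lemma a n (eval p n) (eval q n)))
    where
    lemma : ∀ a n x y → a * y + n * (x * y) ≡ (a + n * x) * y
    lemma = solve-∀

  eval-∘ : ∀ p q n → eval (p ∘ᵖ q) n ≡ eval p (eval q n)
  eval-∘ []      q n = refl
  eval-∘ (a ∷ p) q n = trans (eval-⊕ (a ∷ []) (q ⊗ (p ∘ᵖ q)) n)
    (cong₂ _+_ (eval-constant a n) (trans (eval-⊗ q (p ∘ᵖ q) n) (cong (eval q n *_) (eval-∘ p q n))))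

  eval-mono : ∀ p {m n} → m ≤ n → eval p m ≤ eval p n
  eval-mono []      le = z≤n
  eval-mono (a ∷ p) le = ℕₚ.+-monoʳ-≤ a (ℕₚ.*-mono-≤ le (eval-mono p le))

-- Two loop programs in sequence as one polynomial-time machine.

module Pipeline where

  open import Defs
  open TapePrograms
  open LoopPrograms
  open Compilation
  open Polynomials
  open import Data.Bool.Base using (Bool; true; false)
  open import Data.Fin.Base using (zero; suc)
  open import Data.List.Base as List using (List; []; _∷_; _++_; length; map; replicate; _ʳ++_; reverse)
  open import Data.List.Properties using (map-++; length-map; length-++; ʳ++-ʳ++; ++-ʳ++; ʳ++-defn; length-reverse; reverse-map)
  open import Data.Nat.Base as ℕ using (_≡ᵇ_; ℕ; zero; suc; pred; _+_; _*_; _≤_; z≤n; s≤s)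
  import Data.Nat.Properties as ℕₚ
  import Data.Nat.Tactic.RingSolver as ℕSolver
  open import Data.Product.Base using (∃-syntax; _×_; _,_)
  open import Data.Vec.Base as Vec using (Vec; []; _∷_)
  open import Data.Vec.Properties using (map-replicate)
  open import Function.Base using (_∘_)
  open import Relation.Binary.PropositionalEquality

  bitLetter : Bool → Letter
  bitLetter false = bit0
  bitLetter true  = bit1

  length-loop : ∀ {A : Set} n i (f : ℕ → List A) c → (∀ i → length (f i) ≤ c) → length (loop n i f) ≤ n * c
  length-loop zero    i f c le = z≤n
  length-loop (suc n) i f c le = ℕₚ.≤-trans (ℕₚ.≤-reflexive (length-++ (f i))) (ℕₚ.+-mono-≤ (le i) (length-loop n (suc i) f c le))

  module _ {h : ℕ} where

    none : Vec Bool h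
    none = Vec.replicate h false

    ground : List Letter → Vec ℕ h
    ground u = Vec.replicate h (length u)

    bare : List Letter → List (Column {h})
    bare = map (_, none)

    columns-ground : ∀ n u A → n + length u ≤ A → columns n u (Vec.replicate h A) ≡ bare u
    columns-ground n []      A le = refl
    columns-ground n (ι ∷ u) A le = cong₂ (λ bs cs → (ι , bs) ∷ cs)
      (trans (map-replicate (n ≡ᵇ_) A h) (cong (Vec.replicate h)
        (≡ᵇ-false {h} (ℕₚ.<⇒≢ (ℕₚ.≤-trans (ℕₚ.m<m+n n {length (ι ∷ u)} (s≤s z≤n)) le)))))
      (columns-ground (suc n) u A (subst (_≤ A) (ℕₚ.+-suc n (length u)) le))

    onInput : (Sym {h} → Sym {h} × Move) → P {h}
    onInput f = instr λ { (x ∷ y ∷ z ∷ []) → f x ∷ (y , stay) ∷ (z , stay) ∷ [] }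

    inputWritten : Reads {marks {h}} {2} → Bool
    inputWritten (x ∷ y ∷ z ∷ []) = (written {h}) x

    -- Erasing while copying leaves only blanks to the left of what is printed next, so `rewind`
    -- finds the beginning of the new word.
    copyCell : P {h}
    copyCell = instr λ { (x ∷ y ∷ z ∷ []) → (blank , moveRight) ∷ (colSym (symLetter {h} x , none) , moveRight) ∷ (z , stay) ∷ [] }

    setup clear rewind : P {h}
    setup  = (onTrack {h}) (λ _ → blank , moveRight) ⨾ while inputWritten copyCell ⨾ (onTrack {h}) (λ _ → colSym (pad , none) , moveRight) ⨾ (goHome {h})
    clear  = while (trackWritten {h}) (onTrack {h} (λ _ → blank , moveRight))
    rewind = onInput (_, moveLeft) ⨾ while inputWritten (onInput (_, moveLeft)) ⨾ onInput (_, moveRight)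

    stage : Gen {h} → P {h}
    stage G = setup ⨾ compile G ⨾ clear ⨾ rewind

    blanks : ℕ → List (Sym {h})
    blanks k = replicate k blank

    letters : List Letter → List (Sym {h})
    letters = map (letterSym {h})

    -- Whether the tape lists a blank behind the word: it does after a rewind, but not on the
    -- initial input tape. One statement about a stage covers both.
    trail : Bool → List (Sym {h})
    trail true  = blank ∷ []
    trail false = []

    copy-run : ∀ b k tl z u (seen : List (Column {h})) → ∃[ k′ ]
      Run (while inputWritten copyCell)
          (mkTape {h} (blanks k) (letters u ++ trail b) ∷ tape (cells seen ++ blank ∷ tl) blank [] ∷ (reg {h}) z ∷ []) (2 * length u + 1)
          (tape (blanks k′) blank [] ∷ tape (cells (bare u ʳ++ seen) ++ blank ∷ tl) blank [] ∷ (reg {h}) z ∷ [])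
    copy-run true  k tl z []      seen = k , run-stop refl
    copy-run false k tl z []      seen = k , run-stop refl
    copy-run b     k tl z (ι ∷ u) seen with copy-run b (suc k) tl z u ((ι , none) ∷ seen)
    ... | k′ , r = k′ , run-weaken (ℕₚ.≤-reflexive (lemma (length u)))
      (run-again (written-letter {h} ι)
        (run-end (cong₂ (λ t s → t ∷ tape (s ∷ cells seen ++ blank ∷ tl) blank [] ∷ (reg {h}) z ∷ [])
          (act-right {h} blank (blanks k) (letterSym {h} ι) (letters u ++ trail b)) (cong (λ ι → colSym (ι , none)) (symLetter-letterSym ι)))
          run-instr) r)
      where
      lemma : ∀ n → suc (1 + (2 * n + 1)) ≡ 2 * suc n + 1
      lemma = ℕSolver.solve-∀

    setup-run : ∀ b k tl z u → ∃[ k′ ]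
      Run setup (mkTape {h} (blanks k) (letters u ++ trail b) ∷ tape tl blank [] ∷ (reg {h}) z ∷ []) (4 * suc (length u) + 5)
          (tape (blanks k′) blank [] ∷ (home {h}) tl (columns 0 (u ++ pad ∷ []) (ground (u ++ pad ∷ []))) ∷ (reg {h}) z ∷ [])
    setup-run b k tl z u with copy-run b k tl z u []
    ... | k′ , r = k′ , run-end (cong (λ cs → tape (blanks k′) blank [] ∷ (home {h}) tl cs ∷ (reg {h}) z ∷ []) (sym (columns-ground 0 v (length v) ℕₚ.≤-refl)))
      (run-weaken (ℕₚ.≤-reflexive (trans (cong (λ m → 1 + (2 * length u + 1 + (1 + (2 * m + 4)))) length-v) (lemma (length u))))
        (run-⨾ (start-run (mkTape {h} (blanks k) (letters u ++ trail b))) (run-⨾ r (run-⨾ (run-end sealed run-instr) (home-end {h} (bare v))))))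
      where
      v = u ++ pad ∷ []
      start-run : ∀ t → Run (onTrack {h} (λ _ → blank , moveRight)) (t ∷ tape tl blank [] ∷ (reg {h}) z ∷ []) 1 (t ∷ tape (blank ∷ tl) blank [] ∷ (reg {h}) z ∷ [])
      start-run (tape _ _ _) = run-instr
      length-v : length (bare v) ≡ suc (length u)
      length-v = trans (length-map (_, none) v) (trans (length-++ u) (ℕₚ.+-comm (length u) 1))
      sealed : tape (blanks k′) blank [] ∷ tape (colSym (pad , none) ∷ cells (bare u ʳ++ []) ++ blank ∷ tl) blank [] ∷ (reg {h}) z ∷ []
             ≡ tape (blanks k′) blank [] ∷ tape (cells (bare v ʳ++ []) ++ blank ∷ tl) blank [] ∷ (reg {h}) z ∷ []
      sealed = cong (λ l → tape (blanks k′) blank [] ∷ tape (cells l ++ blank ∷ tl) blank [] ∷ (reg {h}) z ∷ [])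
        (sym (trans (cong (_ʳ++ []) (map-++ (_, none) u (pad ∷ []))) (++-ʳ++ (bare u))))
      lemma : ∀ n → 1 + (2 * n + 1 + (1 + (2 * suc n + 4))) ≡ 4 * suc n + 5
      lemma = ℕSolver.solve-∀

    clear-run : ∀ tl io z (cs : List (Column {h})) → ∃[ tl′ ]
      Run clear (io ∷ mkTape {h} tl (cells cs ++ blank ∷ []) ∷ (reg {h}) z ∷ []) (2 * length cs + 1) (io ∷ tape tl′ blank [] ∷ (reg {h}) z ∷ [])
    clear-run tl (tape _ _ _) z []       = tl , run-stop refl
    clear-run tl io@(tape _ _ _) z (c ∷ cs) with clear-run (blank ∷ tl) io z cs
    ... | tl′ , r = tl′ , run-weaken (ℕₚ.≤-reflexive (lemma (length cs)))
      (run-again refl (run-end (cong (λ t → io ∷ t ∷ (reg {h}) z ∷ []) (act-right {h} blank tl (colSym c) (cells cs ++ blank ∷ []))) run-instr) r)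
      where
      lemma : ∀ n → suc (1 + (2 * n + 1)) ≡ 2 * suc n + 1
      lemma = ℕSolver.solve-∀

    blank-left : ∀ k y rs → act (y , moveLeft) (tape (blanks k) y rs) ≡ tape (blanks (pred k)) blank (y ∷ rs)
    blank-left zero    y rs = refl
    blank-left (suc k) y rs = refl

    back-run : ∀ k tr z r y rs → (written {h}) y ≡ true →
      Run (while inputWritten (onInput (_, moveLeft))) (tape (letters r ++ blanks k) y rs ∷ tr ∷ (reg {h}) z ∷ []) (2 * length r + 3)
          (tape (blanks (pred k)) blank (letters r ʳ++ (y ∷ rs)) ∷ tr ∷ (reg {h}) z ∷ [])
    back-run k tr@(tape _ _ _) z []      y rs wy = run-again wy (run-end (cong (λ t → t ∷ tr ∷ (reg {h}) z ∷ []) (blank-left k y rs)) run-instr) (run-stop refl)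
    back-run k tr@(tape _ _ _) z (ι ∷ r) y rs wy = run-weaken (ℕₚ.≤-reflexive (lemma (length r)))
      (run-again wy run-instr (back-run k tr z r (letterSym {h} ι) (y ∷ rs) (written-letter {h} ι)))
      where
      lemma : ∀ n → suc (1 + (2 * n + 3)) ≡ 2 * suc n + 3
      lemma = ℕSolver.solve-∀

    rewind-run′ : ∀ k tr z r → Run rewind (tape (letters r ++ blanks k) blank [] ∷ tr ∷ (reg {h}) z ∷ []) (2 * length r + 5)
      (mkTape {h} (blanks (suc (pred k))) (letters r ʳ++ (blank ∷ [])) ∷ tr ∷ (reg {h}) z ∷ [])
    rewind-run′ k tr@(tape _ _ _) z []      = run-weaken (s≤s (s≤s (s≤s z≤n))) (run-⨾ (run-end (cong (λ t → t ∷ tr ∷ (reg {h}) z ∷ []) (blank-left k blank [])) run-instr) (run-⨾ (run-stop refl) run-instr))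
    rewind-run′ k tr@(tape _ _ _) z (ι ∷ r) = run-weaken (ℕₚ.≤-trans (ℕₚ.m≤m+n _ 2) (ℕₚ.≤-reflexive (lemma (length r))))
      (run-⨾ run-instr (run-⨾ (back-run k tr z r (letterSym {h} ι) (blank ∷ []) (written-letter {h} ι))
        (run-end (cong (λ t → t ∷ tr ∷ (reg {h}) z ∷ []) (act-right {h} blank (blanks (pred k)) blank (letters r ʳ++ (letterSym {h} ι ∷ blank ∷ [])))) run-instr)))
      where
      lemma : ∀ n → 1 + (2 * n + 3 + 1) + 2 ≡ 2 * suc n + 5
      lemma = ℕSolver.solve-∀

    rewind-run : ∀ k tr z o → Run rewind (printed {h} o (blanks k) ∷ tr ∷ (reg {h}) z ∷ []) (2 * length o + 5)
      (mkTape {h} (blanks (suc (pred k))) (letters o ++ trail true) ∷ tr ∷ (reg {h}) z ∷ [])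
    rewind-run k tr z o = run-begin (cong (λ l → tape l blank [] ∷ tr ∷ (reg {h}) z ∷ []) flipped)
      (run-weaken (ℕₚ.≤-reflexive (cong (λ n → 2 * n + 5) (length-reverse o)))
      (run-end (cong (λ l → mkTape {h} (blanks (suc (pred k))) l ∷ tr ∷ (reg {h}) z ∷ [])
        (trans (cong (λ l → l ʳ++ (blank ∷ [])) (reverse-map (letterSym {h}) o)) (ʳ++-ʳ++ (letters o))))
      (rewind-run′ k tr z (reverse o))))
      where
      flipped : letters o ʳ++ blanks k ≡ letters (reverse o) ++ blanks k
      flipped = trans (ʳ++-defn (letters o)) (cong (_++ blanks k) (sym (reverse-map (letterSym {h}) o)))

    length-gen : ∀ (G : Gen {h}) u ρ → length (⟦ G ⟧ u ρ) ≤ cost G (length u)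
    length-gen nil            u ρ = z≤n
    length-gen (emit ι)       u ρ = ℕₚ.≤-refl
    length-gen (G ⨟ H)        u ρ = ℕₚ.≤-trans (ℕₚ.≤-reflexive (length-++ (⟦ G ⟧ u ρ))) (ℕₚ.+-mono-≤ (length-gen G u ρ) (length-gen H u ρ))
    length-gen (branch a G H) u ρ with holds a u ρ
    ... | true  = ℕₚ.≤-trans (length-gen G u ρ) (ℕₚ.≤-trans (ℕₚ.m≤m+n _ _) (ℕₚ.m≤n+m _ (4 * length u + 20)))
    ... | false = ℕₚ.≤-trans (length-gen H u ρ) (ℕₚ.≤-trans (ℕₚ.m≤n+m _ _) (ℕₚ.m≤n+m _ (4 * length u + 20)))
    length-gen (for j G)      u ρ = ℕₚ.≤-trans
      (length-loop (length u) 0 _ (cost G (length u) + (4 * length u + 20)) λ i → ℕₚ.≤-trans (length-gen G u _) (ℕₚ.m≤m+n _ _))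
      (ℕₚ.m≤n+m _ 10)

    -- The `pad` written by `setup` keeps the word nonempty, as `gen-run` requires; counting loops
    -- have to skip it.
    output-of : Gen {h} → List Letter → List Letter
    output-of G u = ⟦ G ⟧ (u ++ pad ∷ []) (ground (u ++ pad ∷ []))

    stageCost : Gen {h} → ℕ → ℕ
    stageCost G N = 11 + (6 * N + 3 * cost G N)

    stage-run : ∀ G b k tl z u → Scoped G (u ++ pad ∷ []) (ground (u ++ pad ∷ [])) →
      ∃[ k′ ] ∃[ tl′ ] ∃[ z′ ]
      Run (stage G) (mkTape {h} (blanks k) (letters u ++ trail b) ∷ tape tl blank [] ∷ (reg {h}) z ∷ []) (stageCost G (suc (length u)))
          (mkTape {h} (blanks k′) (letters (output-of G u) ++ trail true) ∷ tape tl′ blank [] ∷ (reg {h}) z′ ∷ [])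
    stage-run G b k tl z u sc with u ++ pad ∷ [] in eq | length-++ u {pad ∷ []} | setup-run b k tl z u
    ... | []    | len | _ with () ← trans len (ℕₚ.+-comm (length u) 1)
    ... | ι ∷ v | len | k′ , r with gen-run G ι v (ground (ι ∷ v)) sc (blanks k′) tl z
    ...   | z′ , r′ with clear-run (blank ∷ tl) (printed {h} (⟦ G ⟧ (ι ∷ v) (ground (ι ∷ v))) (blanks k′)) z′ (columns 0 (ι ∷ v) (ground (ι ∷ v)))
    ...     | tl′ , r″ = suc (pred k′) , tl′ , z′ , run-weaken bound
              (run-⨾ r (run-⨾ r′ (run-⨾ r″ (rewind-run k′ (tape tl′ blank []) z′ _))))
      where
      N = suc (length u)
      eqN : length v ≡ length u
      eqN = ℕₚ.suc-injective (trans len (ℕₚ.+-comm (length u) 1))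
      out = ⟦ G ⟧ (ι ∷ v) (ground (ι ∷ v))
      bound : (4 * N + 5) + (cost G (suc (length v)) + ((2 * length (columns 0 (ι ∷ v) (ground (ι ∷ v))) + 1) + (2 * length out + 5))) ≤ stageCost G N
      bound = ℕₚ.≤-trans (ℕₚ.+-monoʳ-≤ (4 * N + 5) (ℕₚ.+-mono-≤ (ℕₚ.≤-reflexive (cong (cost G ∘ suc) eqN))
        (ℕₚ.+-mono-≤ (ℕₚ.≤-reflexive (cong (λ m → 2 * m + 1) (trans (length-columns 0 (ι ∷ v) (ground (ι ∷ v))) (cong suc eqN))))
          (ℕₚ.+-monoˡ-≤ 5 (ℕₚ.*-monoʳ-≤ 2 (ℕₚ.≤-trans (length-gen G (ι ∷ v) (ground (ι ∷ v))) (ℕₚ.≤-reflexive (cong (cost G ∘ suc) eqN))))))))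
        (ℕₚ.≤-reflexive (lemma N (cost G N)))
        where
        lemma : ∀ n c → (4 * n + 5) + (c + ((2 * n + 1) + (2 * c + 5))) ≡ 11 + (6 * n + 3 * c)
        lemma = ℕSolver.solve-∀

    costᵖ : Gen {h} → Poly
    costᵖ nil            = constant 1
    costᵖ (emit ι)       = constant 1
    costᵖ (G ⨟ H)        = costᵖ G ⊕ costᵖ H
    costᵖ (branch a G H) = (20 ∷ 4 ∷ []) ⊕ (costᵖ G ⊕ costᵖ H)
    costᵖ (for j G)      = constant 10 ⊕ variableᵖ ⊗ (costᵖ G ⊕ (20 ∷ 4 ∷ []))

    linear : ∀ n → eval (20 ∷ 4 ∷ []) n ≡ 4 * n + 20
    linear = lemma
      where
      lemma : ∀ n → 20 + n * (4 + n * 0) ≡ 4 * n + 20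
      lemma = ℕSolver.solve-∀

    eval-cost : ∀ G n → eval (costᵖ G) n ≡ cost G n
    eval-cost nil            n = eval-constant 1 n
    eval-cost (emit ι)       n = eval-constant 1 n
    eval-cost (G ⨟ H)        n = trans (eval-⊕ (costᵖ G) (costᵖ H) n) (cong₂ _+_ (eval-cost G n) (eval-cost H n))
    eval-cost (branch a G H) n = trans (eval-⊕ (20 ∷ 4 ∷ []) (costᵖ G ⊕ costᵖ H) n)
      (cong₂ _+_ (linear n) (trans (eval-⊕ (costᵖ G) (costᵖ H) n) (cong₂ _+_ (eval-cost G n) (eval-cost H n))))
    eval-cost (for j G)      n = trans (eval-⊕ (constant 10) (variableᵖ ⊗ (costᵖ G ⊕ (20 ∷ 4 ∷ []))) n)
      (cong₂ _+_ (eval-constant 10 n) (trans (eval-⊗ variableᵖ (costᵖ G ⊕ (20 ∷ 4 ∷ [])) n)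
        (cong₂ _*_ (eval-variable n) (trans (eval-⊕ (costᵖ G) (20 ∷ 4 ∷ []) n) (cong₂ _+_ (eval-cost G n) (linear n))))))

    stageᵖ : Gen {h} → Poly
    stageᵖ G = constant 11 ⊕ (constant 6 ⊗ variableᵖ ⊕ constant 3 ⊗ costᵖ G)

    eval-stage : ∀ G n → eval (stageᵖ G) n ≡ stageCost G n
    eval-stage G n = trans (eval-⊕ (constant 11) (constant 6 ⊗ variableᵖ ⊕ constant 3 ⊗ costᵖ G) n) (cong₂ _+_ (eval-constant 11 n)
      (trans (eval-⊕ (constant 6 ⊗ variableᵖ) (constant 3 ⊗ costᵖ G) n) (cong₂ _+_
        (trans (eval-⊗ (constant 6) variableᵖ n) (cong₂ _*_ (eval-constant 6 n) (eval-variable n)))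
        (trans (eval-⊗ (constant 3) (costᵖ G) n) (cong₂ _*_ (eval-constant 3 n) (eval-cost G n))))))

    letterSym-bitLetter : ∀ b → (letterSym {h}) (bitLetter b) ≡ bit b
    letterSym-bitLetter false = refl
    letterSym-bitLetter true  = refl

    leadingBits-letters : ∀ bs → leadingBits (letters (map bitLetter bs) ++ blank ∷ []) ≡ bs
    leadingBits-letters []           = refl
    leadingBits-letters (false ∷ bs) = cong (false ∷_) (leadingBits-letters bs)
    leadingBits-letters (true  ∷ bs) = cong (true ∷_) (leadingBits-letters bs)

    inputTape-letters : ∀ x → inputTape x ≡ mkTape {h} (blanks 0) (letters (map bitLetter x) ++ trail false)
    inputTape-letters []       = refl
    inputTape-letters (b ∷ bs) = cong₂ (tape []) (sym (letterSym-bitLetter b)) (sym (go bs))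
      where
      go : ∀ bs → letters (map bitLetter bs) ++ [] ≡ map bit bs
      go []       = refl
      go (b ∷ bs) = cong₂ _∷_ (letterSym-bitLetter b) (go bs)

    twoStages : (G₁ G₂ : Gen {h}) (f : List Bool → List Bool) →
      (∀ u → Scoped G₁ (u ++ pad ∷ []) (ground (u ++ pad ∷ []))) →
      (∀ u → Scoped G₂ (u ++ pad ∷ []) (ground (u ++ pad ∷ []))) →
      (∀ x → output-of G₂ (output-of G₁ (map bitLetter x)) ≡ map bitLetter (f x)) → PolyTime f
    twoStages G₁ G₂ f sc₁ sc₂ computes = machine (stage G₁ ⨾ stage G₂) , p , run
      where
      s : Poly
      s = 1 ∷ 1 ∷ []
      p : Poly
      -- `s` accounts for the appended `pad`. The input of the second stage is bounded by the cost
      -- of the first, which also bounds what it prints.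
      p = (stageᵖ G₁ ∘ᵖ s) ⊕ (stageᵖ G₂ ∘ᵖ (s ∘ᵖ (costᵖ G₁ ∘ᵖ s)))
      eval-s : ∀ n → eval s n ≡ suc n
      eval-s = lemma
        where
        lemma : ∀ n → 1 + n * (1 + n * 0) ≡ suc n
        lemma = ℕSolver.solve-∀
      run : ∀ x → ∃[ n ] ∃[ c ] (n ≤ eval p (length x) × HaltsIn (machine (stage G₁ ⨾ stage G₂)) n (initial (machine (stage G₁ ⨾ stage G₂)) x) c × output {machine (stage G₁ ⨾ stage G₂)} c ≡ f x)
      run x with stage-run G₁ false 0 [] blank (map bitLetter x) (sc₁ (map bitLetter x))
      ... | k₁ , tl₁ , z₁ , r₁ with stage-run G₂ true k₁ tl₁ z₁ (output-of G₁ (map bitLetter x)) (sc₂ (output-of G₁ (map bitLetter x)))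
      ...   | k₂ , tl₂ , z₂ , r₂ with run-⨾ r₁ r₂
      ...     | n , le , r = n , _ , ℕₚ.≤-trans le bound ,
                subst (λ t → HaltsIn (machine (stage G₁ ⨾ stage G₂)) n (config (suc (encode (stage G₁ ⨾ stage G₂) (entry (stage G₁ ⨾ stage G₂)))) (t ∷ emptyTape ∷ emptyTape ∷ []))
                       (config zero (mkTape {h} (blanks k₂) (letters (output-of G₂ (output-of G₁ (map bitLetter x))) ++ trail true) ∷ tape tl₂ blank [] ∷ (reg {h}) z₂ ∷ [])))
                  (sym (inputTape-letters x)) (halts (stage G₁ ⨾ stage G₂) r) ,
                printedBits (output-of G₂ (output-of G₁ (map bitLetter x))) (computes x)
        where
        N₁ = suc (length (map bitLetter x))
        len₁ : N₁ ≡ eval s (length x)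
        len₁ = trans (cong suc (length-map bitLetter x)) (sym (eval-s (length x)))
        len₂ : suc (length (output-of G₁ (map bitLetter x))) ≤ eval (s ∘ᵖ (costᵖ G₁ ∘ᵖ s)) (length x)
        len₂ = ℕₚ.≤-trans (s≤s (length-gen G₁ (map bitLetter x ++ pad ∷ []) _)) (ℕₚ.≤-reflexive (sym (trans (eval-∘ s (costᵖ G₁ ∘ᵖ s) (length x))
          (trans (eval-s _) (cong suc (trans (eval-∘ (costᵖ G₁) s (length x)) (trans (eval-cost G₁ _)
            (cong (cost G₁) (trans (sym len₁) (sym (trans (length-++ (map bitLetter x)) (ℕₚ.+-comm _ 1)))))))))))) 
        bound : stageCost G₁ N₁ + stageCost G₂ (suc (length (output-of G₁ (map bitLetter x)))) ≤ eval p (length x)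
        bound = ℕₚ.≤-trans (ℕₚ.+-mono-≤
          (ℕₚ.≤-reflexive (trans (sym (eval-stage G₁ N₁)) (trans (cong (eval (stageᵖ G₁)) len₁) (sym (eval-∘ (stageᵖ G₁) s (length x))))))
          (ℕₚ.≤-trans (ℕₚ.≤-reflexive (sym (eval-stage G₂ (suc (length (output-of G₁ (map bitLetter x))))))) (ℕₚ.≤-trans (eval-mono (stageᵖ G₂) len₂)
            (ℕₚ.≤-reflexive (sym (eval-∘ (stageᵖ G₂) (s ∘ᵖ (costᵖ G₁ ∘ᵖ s)) (length x)))))))
          (ℕₚ.≤-reflexive (sym (eval-⊕ (stageᵖ G₁ ∘ᵖ s) (stageᵖ G₂ ∘ᵖ (s ∘ᵖ (costᵖ G₁ ∘ᵖ s))) (length x))))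
        printedBits : ∀ o → o ≡ map bitLetter (f x) →
          output {machine (stage G₁ ⨾ stage G₂)} (config zero (mkTape {h} (blanks k₂) (letters o ++ trail true) ∷ tape tl₂ blank [] ∷ (reg {h}) z₂ ∷ [])) ≡ f x
        printedBits o refl with f x
        ... | []           = refl
        ... | false ∷ bs = cong (false ∷_) (leadingBits-letters bs)
        ... | true  ∷ bs = cong (true ∷_) (leadingBits-letters bs)

-- The hypergraph of a binary constraint system, and its completeness.

module ConstraintHypergraph where

  open import Defs hiding (step)
  open KneserLemmas
  open AgreementGap
  open LoopPrograms
  open Packing
  open import Data.Bool.Base using (Bool; false; T)
  open import Data.Empty using (⊥-elim)
  open import Data.Fin.Base using (Fin; zero; suc; toℕ; combine; remQuot; punchOut)
  open import Data.Fin.Properties using (any?; all?; toℕ-injective; remQuot-combine; combine-remQuot; punchOut-injective; injective⇒≤) renaming (_≟_ to _≟ᶠ_)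
  open import Data.Fin.Subset as Subset using (Subset; ∣_∣; _∈_; _⊆_)
  open import Data.Fin.Subset.Properties using (_∈?_; p⊆q⇒∣p∣≤∣q∣)
  open import Data.List.Base as List using (List; []; _∷_; length; concatMap; cartesianProduct; cartesianProductWith; filter; allFin)
  open import Data.List.Membership.Propositional using () renaming (_∈_ to _∈ˡ_; _∉_ to _∉ˡ_)
  open import Data.List.Membership.Propositional.Properties using (∈-cartesianProductWith⁺; ∈-cartesianProduct⁺; ∈-allFin; ∈-filter⁺; ∈-filter⁻; ∈-lookup; ∈-concatMap⁺; ∈-concatMap⁻; ∈-map⁺; ∈-map⁻)
  open import Data.List.Properties using (length-map; length-tabulate)
  open import Data.List.Relation.Binary.Permutation.Propositional.Properties using (↭-length)
  open import Data.List.Membership.Propositional.Properties.WithK using (unique∧set⇒bag)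
  open import Data.List.Relation.Binary.BagAndSetEquality using (∼bag⇒↭)
  open import Data.List.Relation.Unary.All as All using (All; []; _∷_)
  import Data.List.Relation.Unary.All.Properties as Allₚ
  open import Data.List.Relation.Unary.Any as Any using (Any)
  import Data.List.Relation.Unary.Any.Properties as Anyₚ
  open import Data.List.Relation.Unary.AllPairs using ([]; _∷_)
  open import Data.List.Relation.Unary.Unique.Propositional using (Unique)
  import Data.List.Relation.Unary.Unique.Propositional.Properties as Uniqueₚ
  open import Data.Nat.Base as ℕ using (ℕ; zero; suc; _*_; _∸_; _^_; _≤_; _<_; _≡ᵇ_)
  open import Data.Nat.Properties using (_≤?_)
  import Data.Nat.Properties as ℕₚ
  open import Data.Product.Base using (Σ-syntax; ∃-syntax; _×_; _,_; proj₁; proj₂)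
  open import Data.Vec.Base as Vec using (Vec; []; _∷_; lookup; tabulate)
  open import Data.Vec.Properties using (lookup∘tabulate; tabulate∘lookup; tabulate-cong; lookup-map; lookup⇒[]=; []=⇒lookup) renaming (≡-dec to ≡-decᵛ)
  open import Function.Base using (_∘_; id)
  open import Function.Bundles using (mk⇔)
  open import Relation.Binary.PropositionalEquality
  open import Relation.Nullary using (¬_; Dec; yes; no; does)
  open import Relation.Nullary.Decidable using (_×-dec_; _→-dec_; T?; dec-true; ¬?)

  vecs : ∀ {A : Set} → List A → ∀ n → List (Vec A n)
  vecs xs zero    = [] ∷ []
  vecs xs (suc n) = cartesianProductWith _∷_ xs (vecs xs n)

  ∈-vecs : ∀ {A : Set} {xs : List A} → (∀ a → a ∈ˡ xs) → ∀ {n} (v : Vec A n) → v ∈ˡ vecs xs n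
  ∈-vecs all []      = Any.here refl
  ∈-vecs all (a ∷ v) = ∈-cartesianProductWith⁺ _∷_ (all a) (∈-vecs all v)

  vecs-unique : ∀ {A : Set} {xs : List A} → Unique xs → ∀ n → Unique (vecs xs n)
  vecs-unique uq zero    = [] ∷ []
  vecs-unique uq (suc n) = Uniqueₚ.cartesianProductWith⁺ _∷_ (λ { refl → refl , refl }) uq (vecs-unique uq n)

  unique-lookup : ∀ {A : Set} {xs : List A} → Unique xs → ∀ i j → List.lookup xs i ≡ List.lookup xs j → i ≡ j
  unique-lookup (_ ∷ _)  zero    zero    _  = refl
  unique-lookup (x ∷ _)  zero    (suc j) eq = ⊥-elim (All.lookup x (∈-lookup j) eq)
  unique-lookup (x ∷ _)  (suc i) zero    eq = ⊥-elim (All.lookup x (∈-lookup i) (sym eq))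
  unique-lookup (_ ∷ uq) (suc i) (suc j) eq = cong suc (unique-lookup uq i j eq)

  lookup-ext : ∀ {A : Set} {n} {v w : Vec A n} → (∀ i → lookup v i ≡ lookup w i) → v ≡ w
  lookup-ext {v = v} {w} eq = trans (sym (tabulate∘lookup v)) (trans (tabulate-cong eq) (tabulate∘lookup w))

  lookup-fromList : ∀ {A : Set} (xs : List A) i → lookup (Vec.fromList xs) i ≡ List.lookup xs i
  lookup-fromList (x ∷ xs) zero    = refl
  lookup-fromList (x ∷ xs) (suc i) = lookup-fromList xs i

  vecChoice : ∀ {a} n {P : Vec (Fin a) n → Set} → (∀ v → ¬ ¬ P v) → ¬ ¬ (∀ v → P v)
  vecChoice zero    h k = h [] λ p → k λ { [] → p }
  vecChoice (suc n) h k = finChoice _ (λ i → vecChoice n (λ v → h (i ∷ v))) λ f → k λ { (i ∷ v) → f i v }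

  allVec? : ∀ {n a} {P : Vec (Fin a) n → Set} → (∀ v → Dec (P v)) → Dec (∀ v → P v)
  allVec? P? with anyVec? (λ v → ¬? (P? v))
  ... | yes (v , ¬p) = no (λ h → ¬p (h v))
  ... | no  ¬∃       = yes (λ v → Relation.Nullary.Decidable.decidable-stable (P? v) (λ ¬p → ¬∃ (v , ¬p)))

  injective⇒onto : ∀ {n} (f : Fin n → Fin n) → (∀ i j → f i ≡ f j → i ≡ j) → ∀ k → ∃[ i ] f i ≡ k
  injective⇒onto {suc n} f inj k with any? (λ i → f i ≟ᶠ k)
  ... | yes h = h
  ... | no ¬h = ⊥-elim (ℕₚ.<⇒≱ (ℕₚ.n<1+n n) (injective⇒≤ {f = λ i → punchOut (avoids i)}
    (λ {i} {j} eq → inj i j (punchOut-injective (avoids i) (avoids j) eq))))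
    where
    avoids : ∀ i → k ≢ f i
    avoids i eq = ¬h (i , sym eq)

  missing : ∀ {n} (xs : List (Fin n)) → length xs < n → ∃[ i ] i ∉ˡ xs
  missing {n} xs lt with all? (λ i → Any.any? (i ≟ᶠ_) xs)
  ... | yes h = ⊥-elim (ℕₚ.<⇒≱ lt (injective⇒≤ {f = λ i → Any.index (h i)}
    (λ {i} {j} eq → trans (Anyₚ.lookup-index (h i)) (trans (cong (List.lookup xs) eq) (sym (Anyₚ.lookup-index (h j)))))))
  ... | no ¬h = Data.Fin.Properties.¬∀⟶∃¬ n _ (λ i → Any.any? (i ≟ᶠ_) xs) ¬h

  keep : ∀ {P A : Set} → Dec P → A → List A
  keep (yes _) a = a ∷ []
  keep (no _)  a = []

  keep⁺ : ∀ {P A : Set} (P? : Dec P) {a : A} → P → a ∈ˡ keep P? a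
  keep⁺ (yes _) p = Any.here refl
  keep⁺ (no ¬p) p = ⊥-elim (¬p p)

  keep⁻ : ∀ {P A : Set} (P? : Dec P) {a b : A} → b ∈ˡ keep P? a → P × b ≡ a
  keep⁻ (yes p) (Any.here eq) = p , eq

  keep-all : ∀ {P A : Set} {Q : A → Set} (P? : Dec P) {a : A} → (P → Q a) → All Q (keep P? a)
  keep-all (yes p) h = h p ∷ []
  keep-all (no _)  h = []

  letterAt : List Letter → ℕ → Letter → Bool
  letterAt []      _       _  = false
  letterAt (ι ∷ u) zero    ι′ = does (ι ≟ᶠ ι′)
  letterAt (ι ∷ u) (suc n) ι′ = letterAt u n ι′

  -- The meaning of atoms on positions. It may differ from `holds` when variables point beyond the
  -- word: two such equal variables are `same` here, while no column shows it.
  numeric : ∀ {n} → List Letter → (Fin n → ℕ) → Atom n → Bool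
  numeric u e (same i j)   = e i ≡ᵇ e j
  numeric u e (succ i j)   = suc (e i) ≡ᵇ e j
  numeric u e (first i)    = e i ≡ᵇ 0
  numeric u e (letter i ι) = letterAt u (e i) ι

  rename : ∀ {n n′} → (Fin n → Fin n′) → Atom n → Atom n′
  rename f (same i j)   = same (f i) (f j)
  rename f (succ i j)   = succ (f i) (f j)
  rename f (first i)    = first (f i)
  rename f (letter i ι) = letter (f i) ι

  numeric-rename : ∀ {n n′} u (f : Fin n → Fin n′) e a → numeric u e (rename f a) ≡ numeric u (e ∘ f) a
  numeric-rename u f e (same i j)   = refl
  numeric-rename u f e (succ i j)   = refl
  numeric-rename u f e (first i)    = refl
  numeric-rename u f e (letter i ι) = refl

  numeric-cong : ∀ {n} u {e e′ : Fin n → ℕ} → (∀ i → e i ≡ e′ i) → ∀ a → numeric u e a ≡ numeric u e′ a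
  numeric-cong u eq (same i j)   = cong₂ _≡ᵇ_ (eq i) (eq j)
  numeric-cong u eq (succ i j)   = cong₂ (λ x y → suc x ≡ᵇ y) (eq i) (eq j)
  numeric-cong u eq (first i)    = cong (_≡ᵇ 0) (eq i)
  numeric-cong u eq (letter i ι) = cong (λ x → letterAt u x ι) (eq i)

  -- A binary constraint sees the coordinates (τ , j) and (τ′ , j′) of its two
  -- variables only through the atoms on the slots 0, 1 and 2, 3.
  record Constraint (δ : ℕ) : Set where
    field
      rel : (Atom 4 → Bool) → Fin δ → Fin δ → Bool
      ext : ∀ {O O′} → (∀ a → O a ≡ O′ a) → ∀ x y → rel O x y ≡ rel O′ x y

  module Problem {δ} (C : Constraint δ) (u : List Letter) where
    open Constraint C

    V : Set
    V = Fin (length u) × Fin (length u)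

    coords : V → Fin 2 → ℕ
    coords (τ , j) zero    = toℕ τ
    coords (τ , j) (suc _) = toℕ j

    pairEnv : V → V → Fin 4 → ℕ
    pairEnv v w zero                   = coords v zero
    pairEnv v w (suc zero)             = coords v (suc zero)
    pairEnv v w (suc (suc zero))       = coords w zero
    pairEnv v w (suc (suc (suc zero))) = coords w (suc zero)

    Rel : V → V → Fin δ → Fin δ → Set
    Rel v w x y = T (rel (numeric u (pairEnv v w)) x y)

    Solution : Set
    Solution = Σ[ A ∈ (V → Fin δ) ] (∀ v w → Rel v w (A v) (A w))

  module Instance {δ} (C : Constraint δ) (q d t m : ℕ) where
    open Constraint C

    -- A column of a cloud is a joint assignment to its m variables, coded by `pack`; a cloud has 2m
    -- coordinates because a variable is a pair of positions.
    L S : ℕ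
    L = δ ^ m
    S = m * 2

    four : ∀ {n} → (Fin 2 → Fin n) → (Fin 2 → Fin n) → Fin 4 → Fin n
    four f g zero                   = f zero
    four f g (suc zero)             = f (suc zero)
    four f g (suc (suc zero))       = g zero
    four f g (suc (suc (suc zero))) = g (suc zero)

    slot : Fin t → Fin m → Fin 2 → Fin (t * S)
    slot j a b = combine j (combine a b)

    Matrix : Set
    Matrix = Vec (Vec (Vec (Fin q) L) d) t

    entry-of : Matrix → Fin t → Fin d → Vec (Fin q) L
    entry-of Y j g = lookup (lookup Y j) g

    label : Vec (Fin L) t → Fin t → Fin m → Fin δ
    label ℓ j a = lookup (unpack m (lookup ℓ j)) a

    module _ (O : Atom (t * S) → Bool) where

      Consistent : Vec (Fin L) t → Set
      Consistent ℓ =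
        (∀ j a b → T (rel (λ at → O (rename (four (slot j a) (slot j b)) at)) (label ℓ j a) (label ℓ j b))) ×
        (∀ j j′ a a′ → T (O (same (slot j a zero) (slot j′ a′ zero))) × T (O (same (slot j a (suc zero)) (slot j′ a′ (suc zero)))) →
          label ℓ j a ≡ label ℓ j′ a′)

      SameCloud : Fin t → Fin t → Set
      SameCloud j j′ = ∀ (r : Fin S) → T (O (same (combine j r) (combine j′ r)))

      -- Vertices are equal when cloud and filling are, so this is what gives an edge exactly t d
      -- members.
      Distinct : Matrix → Set
      Distinct Y = ∀ j g j′ g′ → SameCloud j j′ × entry-of Y j g ≡ entry-of Y j′ g′ → j ≡ j′ × g ≡ g′

      symbols : Matrix → Vec (Fin L) t → Subset q
      symbols Y ℓ = comprehension {P = λ b → ∃[ j ] ∃[ g ] lookup (entry-of Y j g) (lookup ℓ j) ≡ b}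
        (λ b → any? λ j → any? λ g → lookup (entry-of Y j g) (lookup ℓ j) ≟ᶠ b)

      -- The clouds enter only through the answers O to finitely many atoms. A printing program can
      -- therefore branch on these answers and have each test settled when the program is built.
      Passes : Matrix → Set
      Passes Y = Distinct Y × (∀ ℓ → Consistent ℓ → q ∸ d ≤ ∣ symbols Y ℓ ∣)

      abstract
        consistent? : ∀ ℓ → Dec (Consistent ℓ)
        consistent? ℓ = (all? λ j → all? λ a → all? λ b → T? _) ×-dec
          (all? λ j → all? λ j′ → all? λ a → all? λ a′ → (T? _ ×-dec T? _) →-dec (label ℓ j a ≟ᶠ label ℓ j′ a′))

        passes? : ∀ Y → Dec (Passes Y)
        passes? Y =
          (all? λ j → all? λ g → all? λ j′ → all? λ g′ →
            ((all? λ r → T? _) ×-dec ≡-decᵛ _≟ᶠ_ (entry-of Y j g) (entry-of Y j′ g′)) →-dec ((j ≟ᶠ j′) ×-dec (g ≟ᶠ g′)))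
          ×-dec allVec? (λ ℓ → consistent? ℓ →-dec (q ∸ d ≤? ∣ symbols Y ℓ ∣))

    passes-ext : ∀ {O O′} → (∀ a → O a ≡ O′ a) → ∀ {Y} → Passes O Y → Passes O′ Y
    passes-ext {O} {O′} eq {Y} (dist , cov) =
      (λ j g j′ g′ (sc , e) → dist j g j′ g′ ((λ r → subst T (sym (eq _)) (sc r)) , e)) ,
      (λ ℓ (good , comp) → cov ℓ ((λ j a b → subst T (sym (ext (λ _ → eq _) _ _)) (good j a b)) ,
        λ j j′ a a′ (e , e′) → comp j j′ a a′ (subst T (eq _) e , subst T (eq _) e′)))

    fills : List (Vec (Fin q) L)
    fills = vecs (allFin q) L

    matrices : List Matrix
    matrices = vecs (vecs fills d) t

    module _ (u : List Letter) where

      private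
        N = length u

      Cloud Vertex : Set
      Cloud  = Vec (Fin N) S
      Vertex = Cloud × Vec (Fin q) L

      cloudOf : Vec (Fin N) (t * S) → Fin t → Cloud
      cloudOf W j = tabulate (λ r → lookup W (combine j r))

      oracle : Vec (Fin N) (t * S) → Atom (t * S) → Bool
      oracle W = numeric u (toℕ ∘ lookup W)

      clouds : List Cloud
      clouds = vecs (allFin N) S

      vertexList : List Vertex
      vertexList = cartesianProduct clouds fills

      InEdge : Vec (Fin N) (t * S) → Matrix → Vertex → Set
      InEdge W Y (x , y) = ∃[ j ] ∃[ g ] (cloudOf W j ≡ x × entry-of Y j g ≡ y)

      abstract
        inEdge? : ∀ W Y v → Dec (InEdge W Y v)
        inEdge? W Y (x , y) = any? λ j → any? λ g → ≡-decᵛ _≟ᶠ_ (cloudOf W j) x ×-dec ≡-decᵛ _≟ᶠ_ (entry-of Y j g) y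

      edge : Vec (Fin N) (t * S) → Matrix → Subset (length vertexList)
      edge W Y = Vec.map (λ v → does (inEdge? W Y v)) (Vec.fromList vertexList)

      edgesAt : Vec (Fin N) (t * S) → Matrix → List (Subset (length vertexList))
      edgesAt W Y = keep (passes? (oracle W) Y) (edge W Y)

      edges : List (Subset (length vertexList))
      edges = concatMap (λ W → concatMap (edgesAt W) matrices) (vecs (allFin N) (t * S))

      clouds-complete : ∀ x → x ∈ˡ clouds
      clouds-complete = ∈-vecs ∈-allFin

      fills-complete : ∀ y → y ∈ˡ fills
      fills-complete = ∈-vecs ∈-allFin

      vertex∈ : ∀ v → v ∈ˡ vertexList
      vertex∈ (x , y) = ∈-cartesianProduct⁺ (clouds-complete x) (fills-complete y)

      vertexList-unique : Unique vertexList
      vertexList-unique = Uniqueₚ.cartesianProduct⁺ (vecs-unique (Uniqueₚ.allFin⁺ N) S) (vecs-unique (Uniqueₚ.allFin⁺ q) L)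

      vertex : Fin (length vertexList) → Vertex
      vertex = List.lookup vertexList

      index : Vertex → Fin (length vertexList)
      index v = Any.index (vertex∈ v)

      vertex-index : ∀ v → vertex (index v) ≡ v
      vertex-index v = sym (Anyₚ.lookup-index (vertex∈ v))

      index-vertex : ∀ i → index (vertex i) ≡ i
      index-vertex i = unique-lookup vertexList-unique _ _ (vertex-index (vertex i))

      lookup-edge : ∀ W Y i → lookup (edge W Y) i ≡ does (inEdge? W Y (vertex i))
      lookup-edge W Y i = trans (lookup-map i _ (Vec.fromList vertexList))
        (cong (λ v → does (inEdge? W Y v)) (lookup-fromList vertexList i))

      ∈-edge⁺ : ∀ W Y {i} → InEdge W Y (vertex i) → i ∈ edge W Y
      ∈-edge⁺ W Y {i} h = lookup⇒[]= i _ (trans (lookup-edge W Y i) (dec-true (inEdge? W Y (vertex i)) h))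

      ∈-edge⁻ : ∀ W Y {i} → i ∈ edge W Y → InEdge W Y (vertex i)
      ∈-edge⁻ W Y {i} h with inEdge? W Y (vertex i) | trans (sym (lookup-edge W Y i)) ([]=⇒lookup h)
      ... | yes p | _ = p
      ... | no  _ | ()

      numericT : ∀ {a b : Fin N} → a ≡ b → T (toℕ a ≡ᵇ toℕ b)
      numericT {a} refl = ℕₚ.≡⇒≡ᵇ (toℕ a) (toℕ a) refl

      numericT⁻ : ∀ {a b : Fin N} → T (toℕ a ≡ᵇ toℕ b) → a ≡ b
      numericT⁻ h = toℕ-injective (ℕₚ.≡ᵇ⇒≡ _ _ h)

      sameCloud⁺ : ∀ W {j j′} → cloudOf W j ≡ cloudOf W j′ → SameCloud (oracle W) j j′
      sameCloud⁺ W {j} {j′} eq r = numericT (trans (sym (lookup∘tabulate (λ r → lookup W (combine j r)) r))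
        (trans (cong (λ x → lookup x r) eq) (lookup∘tabulate (λ r → lookup W (combine j′ r)) r)))

      sameCloud⁻ : ∀ W {j j′} → SameCloud (oracle W) j j′ → cloudOf W j ≡ cloudOf W j′
      sameCloud⁻ W h = tabulate-cong (λ r → numericT⁻ (h r))

      count-filter : ∀ {A : Set} {P : A → Set} (P? : ∀ a → Dec (P a)) xs →
        ∣ Vec.map (λ a → does (P? a)) (Vec.fromList xs) ∣ ≡ length (filter P? xs)
      count-filter P? []       = refl
      count-filter P? (x ∷ xs) with P? x
      ... | yes _ = cong suc (count-filter P? xs)
      ... | no  _ = count-filter P? xs

      corner : Vec (Fin N) (t * S) → Matrix → Fin (t * d) → Vertex
      corner W Y i = cloudOf W (proj₁ (remQuot d i)) , entry-of Y (proj₁ (remQuot d i)) (proj₂ (remQuot {t} d i))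

      -- The filtered list of all vertices and the list of the t d corners are both free of
      -- repetitions and have the same members, so one is a permutation of the other.
      ∣edge∣ : ∀ W Y → Distinct (oracle W) Y → ∣ edge W Y ∣ ≡ t * d
      ∣edge∣ W Y dist = trans (count-filter (inEdge? W Y) vertexList) (trans (↭-length
        (∼bag⇒↭ (unique∧set⇒bag (Uniqueₚ.filter⁺ (inEdge? W Y) vertexList-unique) (Uniqueₚ.map⁺ (λ {i} {j} → corner-injective i j) (Uniqueₚ.allFin⁺ (t * d)))
          (mk⇔ to from))))
        (trans (length-map (corner W Y) (allFin (t * d))) (length-tabulate id)))
        where
        corner-injective : ∀ i j → corner W Y i ≡ corner W Y j → i ≡ j
        corner-injective i j eq =
          let (ej , eg) = dist _ _ _ _ (sameCloud⁺ W (cong proj₁ eq) , cong proj₂ eq)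
          in trans (sym (combine-remQuot {t} d i)) (trans (cong₂ combine ej eg) (combine-remQuot {t} d j))
        to : ∀ {v} → v ∈ˡ filter (inEdge? W Y) vertexList → v ∈ˡ List.map (corner W Y) (allFin (t * d))
        to {v} h with proj₂ (∈-filter⁻ (inEdge? W Y) {xs = vertexList} h)
        ... | j , g , refl , refl = subst (_∈ˡ List.map (corner W Y) (allFin (t * d)))
          (cong (λ jg → cloudOf W (proj₁ jg) , entry-of Y (proj₁ jg) (proj₂ jg)) (remQuot-combine {t} {d} j g))
          (∈-map⁺ (corner W Y) (∈-allFin (combine j g)))
        from : ∀ {v} → v ∈ˡ List.map (corner W Y) (allFin (t * d)) → v ∈ˡ filter (inEdge? W Y) vertexList
        from h with ∈-map⁻ (corner W Y) h
        ... | i , _ , refl = ∈-filter⁺ (inEdge? W Y) (vertex∈ _) (_ , _ , refl , refl)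

      uniform : All (λ e → ∣ e ∣ ≡ t * d) edges
      uniform = Allₚ.concat⁺ (Allₚ.map⁺ (All.universal (λ W → Allₚ.concat⁺ (Allₚ.map⁺ (All.universal (at W) matrices))) (vecs (allFin N) (t * S))))
        where
        at : ∀ W Y → All (λ e → ∣ e ∣ ≡ t * d) (edgesAt W Y)
        at W Y = keep-all (passes? (oracle W) Y) (λ (dist , _) → ∣edge∣ W Y dist)

      hypergraph : Hypergraph (t * d)
      hypergraph = record { vertices = length vertexList ; edges = edges ; uniform = uniform }

      ∈-edges⁺ : ∀ W Y → Passes (oracle W) Y → edge W Y ∈ˡ edges
      ∈-edges⁺ W Y h = ∈-concatMap⁺ (λ W → concatMap (edgesAt W) matrices) {xs = vecs (allFin N) (t * S)} (Any.map (λ { refl → ∈-concatMap⁺ (edgesAt W) {xs = matrices} (Any.map (λ { refl → keep⁺ (passes? (oracle W) Y) h }) (∈-vecs (∈-vecs fills-complete) Y)) })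
        (∈-vecs ∈-allFin W))

      ∈-edges⁻ : ∀ {e} → e ∈ˡ edges → ∃[ W ] ∃[ Y ] (Passes (oracle W) Y × e ≡ edge W Y)
      ∈-edges⁻ {e} h with Any.satisfied (∈-concatMap⁻ _ {xs = vecs (allFin N) (t * S)} h)
      ... | W , h₁ with Any.satisfied (∈-concatMap⁻ _ {xs = matrices} h₁)
      ...   | Y , h₂ = W , Y , keep⁻ (passes? (oracle W) Y) h₂

      open Problem C u public

      variable-of : Cloud → Fin m → V
      variable-of x a = lookup x (combine a zero) , lookup x (combine a (suc zero))

      rel-oracle : ∀ W j a b x y →
        rel (λ at → oracle W (rename (four (slot j a) (slot j b)) at)) x y ≡
        rel (numeric u (pairEnv (variable-of (cloudOf W j) a) (variable-of (cloudOf W j) b))) x y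
      rel-oracle W j a b x y = ext (λ at → trans (numeric-rename u (four (slot j a) (slot j b)) _ at) (numeric-cong u env at)) x y
        where
        at-slot : ∀ a b → toℕ (lookup W (slot j a b)) ≡ toℕ (lookup (cloudOf W j) (combine a b))
        at-slot a b = cong toℕ (sym (lookup∘tabulate (λ r → lookup W (combine j r)) (combine a b)))
        env : ∀ i → toℕ (lookup W (four (slot j a) (slot j b) i)) ≡ pairEnv (variable-of (cloudOf W j) a) (variable-of (cloudOf W j) b) i
        env zero                   = at-slot a zero
        env (suc zero)             = at-slot a (suc zero)
        env (suc (suc zero))       = at-slot b zero
        env (suc (suc (suc zero))) = at-slot b (suc zero)

      same-oracle⁻ : ∀ W j j′ a a′ → T (oracle W (same (slot j a zero) (slot j′ a′ zero))) × T (oracle W (same (slot j a (suc zero)) (slot j′ a′ (suc zero)))) →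
        variable-of (cloudOf W j) a ≡ variable-of (cloudOf W j′) a′
      same-oracle⁻ W j j′ a a′ (h , h′) = cong₂ _,_ (at h) (at h′)
        where
        at : ∀ {b} → T (oracle W (same (slot j a b) (slot j′ a′ b))) → lookup (cloudOf W j) (combine a b) ≡ lookup (cloudOf W j′) (combine a′ b)
        at {b} h = trans (lookup∘tabulate (λ r → lookup W (combine j r)) (combine a b))
          (trans (numericT⁻ h) (sym (lookup∘tabulate (λ r → lookup W (combine j′ r)) (combine a′ b))))

      same-oracle⁺ : ∀ W j j′ a a′ → variable-of (cloudOf W j) a ≡ variable-of (cloudOf W j′) a′ →
        T (oracle W (same (slot j a zero) (slot j′ a′ zero))) × T (oracle W (same (slot j a (suc zero)) (slot j′ a′ (suc zero))))
      same-oracle⁺ W j j′ a a′ eq = at (cong proj₁ eq) , at (cong proj₂ eq)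
        where
        at : ∀ {b} → lookup (cloudOf W j) (combine a b) ≡ lookup (cloudOf W j′) (combine a′ b) → T (oracle W (same (slot j a b) (slot j′ a′ b)))
        at {b} h = numericT (trans (sym (lookup∘tabulate (λ r → lookup W (combine j r)) (combine a b)))
          (trans h (lookup∘tabulate (λ r → lookup W (combine j′ r)) (combine a′ b))))

      -- A long-code coloring: (x , y) receives the symbol of y in the column that codes the values
      -- of the solution on x. The columns arising on an edge form a consistent ℓ, and the edge
      -- passed the test for every such ℓ.
      complete : Solution → RainbowColorable q (q ∸ d) hypergraph
      complete (A , sat) = χ , covered
        where
        labelOf : Cloud → Fin L
        labelOf x = pack (tabulate (λ a → A (variable-of x a)))
        lookup-label : ∀ x a → lookup (unpack m (labelOf x)) a ≡ A (variable-of x a)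
        lookup-label x a = trans (cong (λ v → lookup v a) (unpack-pack (tabulate (λ a → A (variable-of x a))))) (lookup∘tabulate _ a)
        χ : Fin (length vertexList) → Fin q
        χ i = lookup (proj₂ (vertex i)) (labelOf (proj₁ (vertex i)))
        covered : ∀ e → e ∈ˡ edges → q ∸ d ≤ ∣ image χ e ∣
        covered e e∈ with ∈-edges⁻ e∈
        ... | W , Y , (_ , cov) , refl = ℕₚ.≤-trans (cov ℓ (good , compat)) (p⊆q⇒∣p∣≤∣q∣ shown)
          where
          ℓ : Vec (Fin L) t
          ℓ = tabulate (λ j → labelOf (cloudOf W j))
          label-ℓ : ∀ j a → label ℓ j a ≡ A (variable-of (cloudOf W j) a)
          label-ℓ j a = trans (cong (λ l → lookup (unpack m l) a) (lookup∘tabulate (λ j → labelOf (cloudOf W j)) j)) (lookup-label (cloudOf W j) a)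
          good : ∀ j a b → T (rel (λ at → oracle W (rename (four (slot j a) (slot j b)) at)) (label ℓ j a) (label ℓ j b))
          good j a b = subst T (sym (trans (rel-oracle W j a b _ _) (cong₂ (rel _) (label-ℓ j a) (label-ℓ j b)))) (sat _ _)
          compat : ∀ j j′ a a′ → T (oracle W (same (slot j a zero) (slot j′ a′ zero))) × T (oracle W (same (slot j a (suc zero)) (slot j′ a′ (suc zero)))) →
            label ℓ j a ≡ label ℓ j′ a′
          compat j j′ a a′ h = trans (label-ℓ j a) (trans (cong A (same-oracle⁻ W j j′ a a′ h)) (sym (label-ℓ j′ a′)))
          shown : symbols (oracle W) Y ℓ ⊆ image χ (edge W Y)
          shown {b} h with ∈-comprehension⁻ (λ b → any? λ j → any? λ g → lookup (entry-of Y j g) (lookup ℓ j) ≟ᶠ b) h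
          ... | j , g , eq = ∈-comprehension⁺ (λ a → any? λ v → (v ∈? edge W Y) ×-dec (χ v ≟ᶠ a))
            (i , ∈-edge⁺ W Y (j , g , cong proj₁ (sym at-i) , cong proj₂ (sym at-i)) ,
             trans (cong (λ v → lookup (proj₂ v) (labelOf (proj₁ v))) at-i)
                   (trans (cong (lookup (entry-of Y j g)) (sym (lookup∘tabulate (λ j → labelOf (cloudOf W j)) j))) eq))
            where
            i = index (cloudOf W j , entry-of Y j g)
            at-i : vertex i ≡ (cloudOf W j , entry-of Y j g)
            at-i = vertex-index _

-- From a proper coloring of the hypergraph to a solution.

module Soundness where

  open import Defs hiding (step)
  open IndexTheorem using (double)
  open KneserLemmas
  open AgreementGap
  open LoopPrograms
  open Packing
  open ConstraintHypergraph
  open import Data.Bool.Base using (T)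
  open import Data.Empty using (⊥-elim)
  open import Data.Fin.Base using (Fin; zero; suc; combine; remQuot; toℕ)
  open import Data.Fin.Properties using (any?; remQuot-combine; combine-injectiveˡ; combine-injectiveʳ; injective⇒≤) renaming (_≟_ to _≟ᶠ_)
  open import Data.Fin.Subset using (Subset; ∣_∣; _∈_; ∁)
  open import Data.Fin.Subset.Properties using (∣∁p∣≡n∸∣p∣; x∈∁p⇒x∉p)
  open import Data.List.Base as List using (List; []; _∷_; length)
  open import Data.List.Membership.Propositional using () renaming (_∈_ to _∈ˡ_; _∉_ to _∉ˡ_)
  open import Data.List.Membership.Propositional.Properties using (∈-map⁺)
  open import Data.List.Properties using (length-map)
  import Data.List.Relation.Unary.Any as Any
  open import Data.Nat.Base as ℕ using (ℕ; zero; suc; _+_; _*_; _∸_; _^_; _≤_; _<_; s≤s)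
  open import Data.Nat.Primality using (Prime)
  import Data.Nat.Properties as ℕₚ
  open import Data.Product.Base using (∃-syntax; _×_; _,_; proj₁; proj₂)
  open import Data.Sum.Base using (_⊎_; inj₁; inj₂)
  open import Data.Vec.Base as Vec using (Vec; []; _∷_; lookup; tabulate; map)
  open import Data.Vec.Properties using (lookup∘tabulate; lookup-map)
  open import Function.Base using (_∘_)
  open import Relation.Binary.PropositionalEquality
  open import Relation.Nullary using (¬_; Dec; yes; no)
  open import Relation.Nullary.Decidable using (decidable-stable; T?)

  pack-injective : ∀ {a n} {v w : Vec (Fin a) n} → pack v ≡ pack w → v ≡ w
  pack-injective {n = n} {v} {w} eq = trans (sym (unpack-pack v)) (trans (cong (unpack n) eq) (unpack-pack w))

  map-injective : ∀ {A B : Set} {n} {f : A → B} → (∀ {x y} → f x ≡ f y → x ≡ y) → {v w : Vec A n} → map f v ≡ map f w → v ≡ w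
  map-injective inj {[]}    {[]}    _  = refl
  map-injective inj {x ∷ v} {y ∷ w} eq = cong₂ _∷_ (inj (cong Vec.head eq)) (map-injective inj (cong Vec.tail eq))

  nth : ∀ {A : Set} → A → List A → ℕ → A
  nth default []       _       = default
  nth default (x ∷ xs) zero    = x
  nth default (x ∷ xs) (suc n) = nth default xs n

  nth-index : ∀ {A : Set} {default x : A} {xs} (h : x ∈ˡ xs) → ∀ {n} → length xs ≤ n → ∃[ i ] nth default xs (toℕ {n} i) ≡ x
  nth-index (Any.here refl) (s≤s le) = zero , refl
  nth-index (Any.there h)   (s≤s le) with nth-index h le
  ... | i , eq = suc i , eq

  image-size : ∀ {n d} (e : Vec (Fin n) d) (s : Subset n) → (∀ {b} → b ∈ s → ∃[ i ] lookup e i ≡ b) → ∣ s ∣ ≤ d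
  image-size e s onto = injective⇒≤ {f = λ r → proj₁ (onto (member∈ r))}
    (λ {r} {r′} eq → enumerate-injective s r r′ (trans (sym (proj₂ (onto (member∈ r)))) (trans (cong (lookup e) eq) (proj₂ (onto (member∈ r′))))))
    where
    member∈ : ∀ r → lookup (enumerate s) r ∈ s
    member∈ = go s
      where
      open import Data.Bool.Base using (true; false)
      go : ∀ {n} (s : Subset n) r → lookup (enumerate s) r ∈ s
      go (true  ∷ s) zero    = Vec.here
      go (true  ∷ s) (suc r) = subst (_∈ (true ∷ s)) (sym (lookup-map r suc (enumerate s))) (Vec.there (go s r))
      go (false ∷ s) r       = subst (_∈ (false ∷ s)) (sym (lookup-map r suc (enumerate s))) (Vec.there (go s r))

  -- What the two topological lemmas say about a coloring of a cloud: t
  -- monochromatic blocks of d rows, block j showing the d symbols e j in every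
  -- column outside `bad j`, where the sets e j cover all q symbols.
  record Blocks {q L c} (d t N₀ : ℕ) (f : Vec (Fin q) L → Fin c) : Set where
    field
      color     : Fin c
      e         : Vec (Vec (Fin q) d) t
      injective : ∀ j → Injective (lookup e j)
      covers    : ∀ b → ∃[ j ] ∃[ i ] lookup (lookup e j) i ≡ b
      row       : Fin t → Fin d → Vec (Fin q) L
      bad       : Fin t → List (Fin L)
      few       : ∀ j → length (bad j) ≤ N₀
      colors    : ∀ j g → f (row j g) ≡ color
      shows     : ∀ j i → i ∈ˡ bad j ⊎ (∀ w → ∃[ g ] lookup (row j g) i ≡ lookup (lookup e j) w)

  -- The first lemma is applied to x ↦ f(e ∘ x) for every d-tuple e of symbols. The color it finds
  -- is then a coloring of these tuples, to which the second lemma applies.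
  blocks : ∀ {d′ t′ q c L} J₁ J₂ → Prime (suc d′) → 1 < suc d′ → Prime (suc t′) → 1 < suc t′ →
    c * d′ ≤ double J₁ → c * t′ ≡ double J₂ → suc d′ ≤ q → q + c * t′ < suc t′ * suc (suc d′) →
    (f : Vec (Fin q) L → Fin c) → ¬ ¬ Blocks (suc d′) (suc t′) (double J₁) f
  blocks {d′} {t′} {q} {c} {L} J₁ J₂ pd 1<d pt 1<t le₁ eq₂ d≤q bound f none =
    vecChoice (suc d′) (λ e → rows d′ pd 1<d J₁ le₁ (λ x → f (map (lookup e) x))) λ R →
    cover t′ pt 1<t J₂ eq₂ d≤q bound (λ e → Rows.color (R e)) λ K → none (assemble R K)
    where
    assemble : (R : ∀ e → Rows d′ (double J₁) (λ x → f (map (lookup e) x))) → Cover t′ pt 1<t {q} {suc d′} {c} (λ e → Rows.color (R e)) →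
               Blocks (suc d′) (suc t′) (double J₁) f
    assemble R K = record
      { color = K.color ; e = tabulate K.e
      ; injective = λ j → subst Injective (sym (e-at j)) (K.injective j)
      ; covers = λ b → let (j , i , eq) = K.covers b in j , i , trans (cong (λ v → lookup v i) (e-at j)) eq
      ; row = λ j g → map (lookup (K.e j)) (Rows.row (R (K.e j)) g)
      ; bad = λ j → Rows.bad (R (K.e j)) ; few = λ j → Rows.few (R (K.e j))
      ; colors = λ j g → trans (Rows.colors (R (K.e j)) g) (K.colors j)
      ; shows = shows }
      where
      module K = Cover K
      e-at : ∀ j → lookup (tabulate K.e) j ≡ K.e j
      e-at = lookup∘tabulate K.e
      shows : ∀ j i → i ∈ˡ Rows.bad (R (K.e j)) ⊎ (∀ w → ∃[ g ] lookup (map (lookup (K.e j)) (Rows.row (R (K.e j)) g)) i ≡ lookup (lookup (tabulate K.e) j) w)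
      shows j i with Rows.covers (R (K.e j)) i
      ... | inj₁ h = inj₁ h
      ... | inj₂ h = inj₂ λ w → let (g , eq) = h w in
        g , trans (lookup-map i (lookup (K.e j)) (Rows.row (R (K.e j)) g)) (trans (cong (lookup (K.e j)) eq) (cong (λ v → lookup v w) (sym (e-at j))))

  module _ {δ} (C : Constraint δ) (q d t m c : ℕ) (u : List Letter) (N₀ : ℕ) where
    open Constraint C
    open Instance C q d t m

    -- Both are independent of m, so m can be chosen as a function of them.
    types candidates : ℕ
    types      = c * ((q ^ d) ^ t)
    candidates = t * N₀

    side : Fin 2 → V u → Fin (length u)
    side zero    = proj₁
    side (suc _) = proj₂

    fromW : Vec (V u) m → Cloud u
    fromW w = tabulate (λ r → part w (remQuot {m} 2 r))
      where
      part : Vec (V u) m → Fin m × Fin 2 → Fin (length u)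
      part w (a , b) = side b (lookup w a)

    lookup-fromW : ∀ w a b → lookup (fromW w) (combine a b) ≡ side b (lookup w a)
    lookup-fromW w a b = trans (lookup∘tabulate _ (combine a b))
      (cong (λ r → side (proj₂ r) (lookup w (proj₁ r))) (remQuot-combine {m} {2} a b))

    variable-fromW : ∀ w a → variable-of u (fromW w) a ≡ lookup w a
    variable-fromW w a = cong₂ _,_ (lookup-fromW w a zero) (lookup-fromW w a (suc zero))

    fromW-injective : ∀ {w w′} → fromW w ≡ fromW w′ → w ≡ w′
    fromW-injective {w} {w′} eq = lookup-ext λ a →
      trans (sym (variable-fromW w a)) (trans (cong (λ x → variable-of u x a) eq) (variable-fromW w′ a))

    module _ (χ : Fin (length (vertexList u)) → Fin c)
             (proper : ∀ e → e ∈ˡ edges u → ¬ Monochromatic χ e)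
             (N₀<L : N₀ < L) (default : Fin L) (j₀ : Fin t)
             (B : ∀ x → Blocks d t N₀ (λ y → χ (index u (x , y)))) where

      -- The rows are left out: their number grows with m, and equal colors and tuples `e` are all
      -- that blocks of different clouds have to share.
      type : Vec (V u) m → Fin types
      type w = combine (Blocks.color (B (fromW w))) (pack (map pack (Blocks.e (B (fromW w)))))

      -- The exceptional columns of the t blocks, decoded to assignments; a list shorter than N₀ is
      -- filled up with `default`.
      candidate : Fin candidates → Vec (V u) m → Vec (Fin δ) m
      candidate r w = unpack m (nth default (Blocks.bad (B (fromW w)) (proj₁ (remQuot {t} N₀ r))) (toℕ (proj₂ (remQuot {t} N₀ r))))

      candidate-of : ∀ w j l → l ∈ˡ Blocks.bad (B (fromW w)) j → ∃[ r ] candidate r w ≡ unpack m l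
      candidate-of w j l h with nth-index {default = default} h (Blocks.few (B (fromW w)) j)
      ... | i , eq = combine j i , cong (unpack m) (trans
        (cong (λ r → nth default (Blocks.bad (B (fromW w)) (proj₁ r)) (toℕ (proj₂ r))) (remQuot-combine {t} {N₀} j i)) eq)

      choice : ∀ {P : V u → Set} → (∀ v → ¬ ¬ P v) → ¬ ¬ (∀ v → P v)
      choice h k = finChoice _ (λ i → finChoice _ (λ j → h (i , j))) (λ f → k (λ (i , j) → f i j))

      stable : ∀ {v w x y} → ¬ ¬ Rel u v w x y → Rel u v w x y
      stable = decidable-stable (T? _)

      Agreeing : Fin candidates → Fin candidates → Vec (V u) m → Vec (V u) m → Set
      Agreeing = Agree choice (Rel u) stable candidate

      -- Block j, taken in cloud w j, contributes d rows to a matrix of a single color. This matrix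
      -- passes the test: if a consistent ℓ met exceptional columns of two clouds, those columns
      -- would be agreeing candidates. So all blocks but one show their symbols, and only the d
      -- symbols of that one can be missing. The resulting edge is monochromatic.
      linked : (w : Fin t → Vec (V u) m) → (∀ i j → w i ≡ w j → i ≡ j) → (∀ i j → type (w i) ≡ type (w j)) →
               ¬ (∀ i j → i ≢ j → ∀ a b → ¬ Agreeing a b (w i) (w j))
      linked w inj sameType apart = proper (edge u W Y) (∈-edges⁺ u W Y (distinct , covering)) (Blocks.color (B (x j₀)) , colored)
        where
        x : Fin t → Cloud u
        x j = fromW (w j)
        module At (j : Fin t) = Blocks (B (x j))
        W : Vec (Fin (length u)) (t * S)
        W = tabulate (λ i → part (remQuot {t} S i))
          where
          part : Fin t × Fin S → Fin (length u)
          part (j , r) = lookup (x j) r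
        cloud-W : ∀ j → cloudOf u W j ≡ x j
        cloud-W j = lookup-ext λ r → trans (lookup∘tabulate (λ r → lookup W (combine j r)) r) (trans (lookup∘tabulate _ (combine j r))
          (cong (λ p → lookup (x (proj₁ p)) (proj₂ p)) (remQuot-combine {t} {S} j r)))
        Y : Matrix
        Y = tabulate (λ j → tabulate (At.row j j))
        entry-Y : ∀ j g → entry-of Y j g ≡ At.row j j g
        entry-Y j g = trans (cong (λ v → lookup v g) (lookup∘tabulate (λ j → tabulate (At.row j j)) j)) (lookup∘tabulate (At.row j j) g)
        color≡ : ∀ j → At.color j ≡ At.color j₀
        color≡ j = combine-injectiveˡ (At.color j) _ (At.color j₀) _ (sameType j j₀)
        e≡ : ∀ j → At.e j ≡ At.e j₀
        e≡ j = map-injective pack-injective (pack-injective (combine-injectiveʳ (At.color j) _ (At.color j₀) _ (sameType j j₀)))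
        e : Fin t → Vec (Fin q) d
        e = lookup (At.e j₀)
        shows : ∀ j i → i ∈ˡ At.bad j j ⊎ (∀ k → ∃[ g ] lookup (At.row j j g) i ≡ lookup (e j) k)
        shows j i with At.shows j j i
        ... | inj₁ h = inj₁ h
        ... | inj₂ h = inj₂ λ k → let (g , eq) = h k in g , trans eq (cong (λ v → lookup (lookup v j) k) (e≡ j))
        -- As N₀ < L, some column lies outside `bad j`; there the d rows show the d different
        -- symbols of e j, so equal rows have equal indices.
        rows-distinct : ∀ j g g′ → At.row j j g ≡ At.row j j g′ → g ≡ g′
        rows-distinct j g g′ eq with missing (At.bad j j) (ℕₚ.≤-<-trans (At.few j j) N₀<L)
        ... | i , i∉ with shows j i
        ...   | inj₁ h = ⊥-elim (i∉ h)
        ...   | inj₂ h with injective⇒onto (proj₁ ∘ h) section-injective g | injective⇒onto (proj₁ ∘ h) section-injective g′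
          where
          section-injective : ∀ k k′ → proj₁ (h k) ≡ proj₁ (h k′) → k ≡ k′
          section-injective k k′ eq = At.injective j₀ j k k′
            (trans (sym (proj₂ (h k))) (trans (cong (λ g → lookup (At.row j j g) i) eq) (proj₂ (h k′))))
        ...     | k , refl | k′ , refl = cong (proj₁ ∘ h) (At.injective j₀ j k k′
          (trans (sym (proj₂ (h k))) (trans (cong (λ r → lookup r i) eq) (proj₂ (h k′)))))
        distinct : Distinct (oracle u W) Y
        distinct j g j′ g′ (sc , eq) with inj j j′ (fromW-injective (trans (sym (cloud-W j)) (trans (sameCloud⁻ u W sc) (cloud-W j′))))
        ... | refl = refl , rows-distinct j g g′ (trans (sym (entry-Y j g)) (trans eq (entry-Y j g′)))
        covering : ∀ ℓ → Consistent (oracle u W) ℓ → q ∸ d ≤ ∣ symbols (oracle u W) Y ℓ ∣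
        covering ℓ (good , compat) = enough (exceptional (any? λ j → Any.any? (lookup ℓ j ≟ᶠ_) (At.bad j j)))
          where
          variable-W : ∀ j a → variable-of u (cloudOf u W j) a ≡ lookup (w j) a
          variable-W j a = trans (cong (λ x → variable-of u x a) (cloud-W j)) (variable-fromW (w j) a)
          clash : ∀ j j′ → j ≢ j′ → lookup ℓ j ∈ˡ At.bad j j → ¬ lookup ℓ j′ ∈ˡ At.bad j′ j′
          clash j j′ ne h h′ with candidate-of (w j) j _ h | candidate-of (w j′) j′ _ h′
          ... | r , eq | r′ , eq′ = apart j j′ ne r r′ (fine j r eq , fine j′ r′ eq′ , λ a b same →
              trans (cong (λ v → lookup v a) eq) (trans (compat j j′ a b (same-oracle⁺ u W j j′ a b
                (trans (variable-W j a) (trans same (sym (variable-W j′ b)))))) (cong (λ v → lookup v b) (sym eq′))))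
            where
            fine : ∀ j r → candidate r (w j) ≡ unpack m (lookup ℓ j) → ∀ a b → Rel u (lookup (w j) a) (lookup (w j) b) (lookup (candidate r (w j)) a) (lookup (candidate r (w j)) b)
            fine j r eq a b = subst₂ (λ v v′ → Rel u v v′ (lookup (candidate r (w j)) a) (lookup (candidate r (w j)) b)) (variable-W j a) (variable-W j b)
              (subst (λ z → Rel u (variable-of u (cloudOf u W j) a) (variable-of u (cloudOf u W j) b) (lookup z a) (lookup z b)) (sym eq)
                (subst T (rel-oracle u W j a b _ _) (good j a b)))
          exceptional : Dec (∃[ j ] lookup ℓ j ∈ˡ At.bad j j) → ∃[ j₁ ] (∀ j → j ≢ j₁ → ¬ lookup ℓ j ∈ˡ At.bad j j)
          exceptional (yes (j₁ , h)) = j₁ , λ j ne h′ → clash j₁ j (ne ∘ sym) h h′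
          exceptional (no ¬h)        = j₀ , λ j _ h′ → ¬h (j , h′)
          enough : ∃[ j₁ ] (∀ j → j ≢ j₁ → ¬ lookup ℓ j ∈ˡ At.bad j j) → q ∸ d ≤ ∣ symbols (oracle u W) Y ℓ ∣
          enough (j₁ , ok) = ℕₚ.m≤n+o⇒m∸n≤o q d (ℕₚ.≤-trans (ℕₚ.m≤n+m∸n q ∣ symbols (oracle u W) Y ℓ ∣)
            (subst (∣ symbols (oracle u W) Y ℓ ∣ + (q ∸ ∣ symbols (oracle u W) Y ℓ ∣) ≤_) (ℕₚ.+-comm ∣ symbols (oracle u W) Y ℓ ∣ d) (ℕₚ.+-monoʳ-≤ ∣ symbols (oracle u W) Y ℓ ∣
              (subst (_≤ d) (∣∁p∣≡n∸∣p∣ (symbols (oracle u W) Y ℓ)) (image-size (e j₁) (∁ (symbols (oracle u W) Y ℓ)) rest)))))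
            where
            rest : ∀ {b} → b ∈ ∁ (symbols (oracle u W) Y ℓ) → ∃[ i ] lookup (e j₁) i ≡ b
            rest {b} h with At.covers j₀ b
            ... | j , i , eq with j ≟ᶠ j₁
            ...   | yes refl = i , eq
            ...   | no ne with shows j (lookup ℓ j)
            ...     | inj₁ bd = ⊥-elim (ok j ne bd)
            ...     | inj₂ sh = ⊥-elim (x∈∁p⇒x∉p h (∈-comprehension⁺ (λ b → any? λ j → any? λ g → lookup (entry-of Y j g) (lookup ℓ j) ≟ᶠ b) (j , proj₁ (sh i) ,
                      trans (cong (λ r → lookup r (lookup ℓ j)) (entry-Y j _)) (trans (proj₂ (sh i)) eq))))
        colored : ∀ v → v ∈ edge u W Y → χ v ≡ Blocks.color (B (x j₀))
        colored v h with ∈-edge⁻ u W Y h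
        ... | j , g , ex , ey = trans (cong χ (trans (sym (index-vertex u v)) (cong (index u)
                (cong₂ _,_ (trans (sym ex) (cloud-W j)) (trans (sym ey) (entry-Y j g)))))) (trans (At.colors j j g) (color≡ j))

      sound : cloudSize δ candidates types t ≡ m → t * m < length u → ¬ ¬ Solution u
      sound size long = gap choice (Rel u) stable candidate {t = t} type size fresh linked
        where
        fresh : ∀ xs → length xs ≤ t * m → ∃[ v ] v ∉ˡ xs
        fresh xs le with missing (List.map proj₁ xs) (ℕₚ.≤-<-trans (ℕₚ.≤-trans (ℕₚ.≤-reflexive (length-map proj₁ xs)) le) long)
        -- A first coordinate that occurs in none of the listed variables makes the diagonal pair a
        -- new variable.
        ... | τ , τ∉ = (τ , τ) , λ h → τ∉ (∈-map⁺ proj₁ h)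

-- The computation tableau as a binary constraint system.

module Tableaux where

  open import Defs
  open LoopPrograms using (Letter; bit0; bit1; free; pad; Atom; same; succ; first; letter)
  open ConstraintHypergraph using (Constraint; numeric; letterAt; module Problem)
  open Packing
  open import Data.Bool.Base using (Bool; true; false; T)
  open import Data.Empty using (⊥; ⊥-elim)
  open import Data.Fin.Base using (Fin; zero; suc; toℕ; combine; remQuot; fromℕ<)
  open import Data.Fin.Properties using (remQuot-combine; all?; toℕ<n; toℕ-fromℕ<) renaming (_≟_ to _≟ᶠ_)
  open import Data.List.Base as List using (List; []; _∷_; length; replicate)
  open import Data.Maybe.Base as Maybe using (Maybe; just; nothing)
  open import Data.Nat.Base as ℕ using (ℕ; zero; suc; _+_; _*_; _^_; _≤_; _<_; z≤n; s≤s; pred)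
  import Data.Nat.Properties as ℕₚ
  open import Data.Product.Base using (_×_; _,_; proj₁; proj₂)
  open import Data.Sum.Base using (_⊎_; inj₁; inj₂; [_,_]′)
  open import Data.Unit.Base using (⊤; tt)
  open import Data.Vec.Base as Vec using (Vec; []; _∷_; lookup; tabulate)
  open import Data.Vec.Properties using (lookup∘tabulate; tabulate∘lookup; tabulate-cong; tabulate-∘; lookup-map; lookup-zipWith; lookup-replicate; map-∘; map-cong; map-id)
  open import Function.Base using (_∘_; id)
  open import Function.Bundles using (mk⇔)
  open import Relation.Binary.PropositionalEquality
  open import Relation.Nullary using (¬_; Dec; yes; no; does)
  open import Relation.Nullary.Decidable using (_×-dec_; _→-dec_; T?; map′; does-⇔; ¬?)

  does⁺ : ∀ {P : Set} (P? : Dec P) → P → T (does P?)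
  does⁺ (yes _) p = tt
  does⁺ (no ¬p) p = ¬p p

  does⁻ : ∀ {P : Set} (P? : Dec P) → T (does P?) → P
  does⁻ (yes p) _ = p

  -- A retraction rather than a bijection: labels outside the image of `to` still decode to
  -- elements, so every label of a solution is a tile.
  record Finite (A : Set) : Set where
    field
      card    : ℕ
      to      : A → Fin card
      from    : Fin card → A
      from-to : ∀ a → from (to a) ≡ a

    _≟_ : (a b : A) → Dec (a ≡ b)
    a ≟ b = map′ (λ eq → trans (sym (from-to a)) (trans (cong from eq) (from-to b))) (cong to) (to a ≟ᶠ to b)

  open Finite

  finFinite : ∀ n → Finite (Fin n)
  finFinite n = record { card = n ; to = id ; from = id ; from-to = λ _ → refl }

  infixr 4 _⊗ᶠ_
  _⊗ᶠ_ : ∀ {A B} → Finite A → Finite B → Finite (A × B)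
  F ⊗ᶠ G = record
    { card = card F * card G
    ; to = λ (a , b) → combine (to F a) (to G b)
    ; from = λ i → from F (proj₁ (remQuot (card G) i)) , from G (proj₂ (remQuot {card F} (card G) i))
    ; from-to = λ (a , b) → trans (cong (λ r → from F (proj₁ r) , from G (proj₂ r)) (remQuot-combine (to F a) (to G b)))
        (cong₂ _,_ (from-to F a) (from-to G b)) }

  vecFinite : ∀ {A} n → Finite A → Finite (Vec A n)
  vecFinite n F = record
    { card = card F ^ n
    ; to = λ v → pack (Vec.map (to F) v)
    ; from = λ i → Vec.map (from F) (unpack n i)
    ; from-to = λ v → trans (cong (Vec.map (from F)) (unpack-pack (Vec.map (to F) v)))
        (trans (sym (map-∘ (from F) (to F) v)) (trans (map-cong (from-to F) v) (map-id v))) }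

  symbolFinite : ∀ g → Finite (Symbol g)
  symbolFinite g = record
    { card = 3 + g
    ; to = λ { blank → zero ; (bit false) → suc zero ; (bit true) → suc (suc zero) ; (mark i) → suc (suc (suc i)) }
    ; from = λ { zero → blank ; (suc zero) → bit false ; (suc (suc zero)) → bit true ; (suc (suc (suc i))) → mark i }
    ; from-to = λ { blank → refl ; (bit false) → refl ; (bit true) → refl ; (mark i) → refl } }

  nthSym : ∀ {g} → List (Symbol g) → ℕ → Symbol g
  nthSym []       _       = blank
  nthSym (s ∷ ss) zero    = s
  nthSym (s ∷ ss) (suc j) = nthSym ss j

  -- The cells left of the head, and those from the head on, by distance.
  leftAt rightAt : ∀ {g} → Tape g → ℕ → Symbol g
  leftAt  (tape ls x rs) j = nthSym ls j
  rightAt (tape ls x rs) j = nthSym (x ∷ rs) j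

  IsBit : ∀ {g} → Symbol g → Set
  IsBit blank    = ⊥
  IsBit (bit _)  = ⊤
  IsBit (mark _) = ⊥

  isBit? : ∀ {g} (s : Symbol g) → Dec (IsBit s)
  isBit? blank    = no λ ()
  isBit? (bit _)  = yes tt
  isBit? (mark _) = no λ ()

  Allowed : ∀ {g} → Letter → Symbol g → Set
  Allowed bit0 s = s ≡ bit false
  Allowed bit1 s = s ≡ bit true
  Allowed free s = IsBit s ⊎ s ≡ blank
  Allowed pad s = s ≡ blank

  module Tableau (M : TM) where
    open TM M renaming (start to start-state)

    g k : ℕ
    g = marks
    k = suc workTapes

    Sym : Set
    Sym = Symbol g

    -- Tile (τ , j) holds the state and the scanned symbols at time τ, and the
    -- contents of the cells at distance j − 1, j and j + 1 on both sides of each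
    -- head; its `Fin 3` entry is min(j , 2).
    Global Cell Tile : Set
    Global = Fin states × Vec Sym k
    Cell   = Vec (Sym × Sym) k
    Tile   = Global × Fin 3 × Cell × Cell × Cell

    globalFinite : Finite Global
    globalFinite = finFinite states ⊗ᶠ vecFinite k (symbolFinite g)

    cellFinite : Finite Cell
    cellFinite = vecFinite k (symbolFinite g ⊗ᶠ symbolFinite g)

    tileFinite : Finite Tile
    tileFinite = globalFinite ⊗ᶠ (finFinite 3 ⊗ᶠ (cellFinite ⊗ᶠ (cellFinite ⊗ᶠ cellFinite)))

    global : Tile → Global
    global (G , _) = G
    pos : Tile → Fin 3
    pos (_ , p , _) = p
    leftCell ownCell rightCell : Tile → Cell
    leftCell  (_ , _ , a , _ , _) = a
    ownCell   (_ , _ , _ , b , _) = b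
    rightCell (_ , _ , _ , _ , c) = c

    position : ℕ → Fin 3
    position zero          = zero
    position (suc zero)    = suc zero
    position (suc (suc _)) = suc (suc zero)

    bump : Fin 3 → Fin 3
    bump zero    = suc zero
    bump (suc _) = suc (suc zero)

    position-suc : ∀ j → position (suc j) ≡ bump (position j)
    position-suc zero          = refl
    position-suc (suc zero)    = refl
    position-suc (suc (suc j)) = refl

    -- The contents of a cell after the head has written w and moved; the cells
    -- are indexed relative to the head, so it is the contents that move.
    newHead : Sym × Move → Sym × Sym → Sym × Sym → Sym
    newHead (w , stay)      b c = w
    newHead (w , moveLeft)  b c = proj₁ b
    newHead (w , moveRight) b c = proj₂ c

    -- On the left, distance 0 is the neighbor of the head; on the right it is the scanned cell.
    -- Hence the written symbol appears at distance 0 on the left after a right move, and at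
    -- distance 1 on the right after a left move.
    newSides : Sym × Move → Fin 3 → (a b c : Sym × Sym) → Sym × Sym
    newSides (w , stay)      zero          a b c = proj₁ b , w
    newSides (w , stay)      (suc _)       a b c = b
    newSides (w , moveLeft)  zero          a b c = proj₁ c , proj₁ b
    newSides (w , moveLeft)  (suc zero)    a b c = proj₁ c , w
    newSides (w , moveLeft)  (suc (suc _)) a b c = proj₁ c , proj₂ a
    newSides (w , moveRight) zero          a b c = w , proj₂ c
    newSides (w , moveRight) (suc _)       a b c = proj₁ a , proj₂ c

    nextGlobal : Global → Cell → Cell → Global
    nextGlobal G@(s , hs) b c = go (δ s hs)
      where
      go : Maybe (Fin states × Vec (Sym × Move) k) → Global
      go nothing          = G
      go (just (s′ , as)) = s′ , tabulate (λ i → newHead (lookup as i) (lookup b i) (lookup c i))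

    nextCell : Global → Fin 3 → (a b c : Cell) → Cell
    nextCell (s , hs) p a b c = go (δ s hs)
      where
      go : Maybe (Fin states × Vec (Sym × Move) k) → Cell
      go nothing          = b
      go (just (s′ , as)) = tabulate (λ i → newSides (lookup as i) p (lookup a i) (lookup b i) (lookup c i))

    Halted : Global → Set
    Halted (s , hs) = δ s hs ≡ nothing

    halted? : ∀ G → Dec (Halted G)
    halted? (s , hs) with δ s hs
    ... | nothing = yes refl
    ... | just _  = no λ ()

    input : Cell → Sym
    input (s ∷ _) = proj₂ s

    -- Each clause is guarded by atoms, so one relation serves all pairs of variables, and
    -- conditions on a single tile are imposed through pairs. The last part of `horizontal` spreads
    -- blanks to the right in the first row, so that its free cells spell a word.
    record Related (O : Atom 4 → Bool) (X Y : Tile) : Set where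
      constructor related
      field
        horizontal : T (O (same zero (suc (suc zero)))) × T (O (succ (suc zero) (suc (suc (suc zero))))) →
          global X ≡ global Y × ownCell X ≡ leftCell Y × rightCell X ≡ ownCell Y × pos Y ≡ bump (pos X) ×
          (T (O (first zero)) → input (ownCell X) ≡ blank → input (ownCell Y) ≡ blank)
        vertical : T (O (same (suc zero) (suc (suc (suc zero))))) × T (O (succ zero (suc (suc zero)))) →
          ownCell Y ≡ nextCell (global X) (pos X) (leftCell X) (ownCell X) (rightCell X) ×
          (pos X ≡ zero → global Y ≡ nextGlobal (global X) (ownCell X) (rightCell X))
        corner : T (O (first (suc zero))) →
          pos X ≡ zero × proj₂ (global X) ≡ Vec.map proj₂ (ownCell X) ×
          (Halted (global X) → input (ownCell X) ≡ bit true × ¬ IsBit (input (rightCell X)))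
        initially : T (O (first zero)) →
          proj₁ (global X) ≡ start-state × Vec.tail (ownCell X) ≡ Vec.replicate workTapes (blank , blank) ×
          proj₁ (Vec.head (ownCell X)) ≡ blank
        lettered : ∀ ι → T (O (first zero)) × T (O (letter (suc zero) ι)) → Allowed ι (input (ownCell X))

    allowed? : ∀ ι (s : Sym) → Dec (Allowed ι s)
    allowed? bit0 s = _≟_ (symbolFinite g) s (bit false)
    allowed? bit1 s = _≟_ (symbolFinite g) s (bit true)
    allowed? free s with isBit? s | _≟_ (symbolFinite g) s blank
    ... | yes b | _      = yes (inj₁ b)
    ... | no _  | yes e  = yes (inj₂ e)
    ... | no ¬b | no ¬e  = no [ ¬b , ¬e ]′
    allowed? pad s = _≟_ (symbolFinite g) s blank

    infix 4 _≟ᴳ_ _≟ᶜ_ _≟ˢ_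
    _≟ᴳ_ : (G G′ : Global) → Dec (G ≡ G′)
    _≟ᴳ_ = _≟_ globalFinite
    _≟ᶜ_ : (b b′ : Cell) → Dec (b ≡ b′)
    _≟ᶜ_ = _≟_ cellFinite
    _≟ˢ_ : (s s′ : Sym) → Dec (s ≡ s′)
    _≟ˢ_ = _≟_ (symbolFinite g)

    abstract
      related? : ∀ O X Y → Dec (Related O X Y)
      related? O X Y = map′ (λ (a , b , c , d , e) → related a b c d e) (λ (related a b c d e) → a , b , c , d , e)
        (((T? _ ×-dec T? _) →-dec (global X ≟ᴳ global Y ×-dec ownCell X ≟ᶜ leftCell Y ×-dec rightCell X ≟ᶜ ownCell Y ×-dec
            pos Y ≟ᶠ bump (pos X) ×-dec (T? _ →-dec (input (ownCell X) ≟ˢ blank →-dec input (ownCell Y) ≟ˢ blank)))) ×-dec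
        ((T? _ ×-dec T? _) →-dec (ownCell Y ≟ᶜ nextCell (global X) (pos X) (leftCell X) (ownCell X) (rightCell X) ×-dec
            (pos X ≟ᶠ zero →-dec global Y ≟ᴳ nextGlobal (global X) (ownCell X) (rightCell X)))) ×-dec
        (T? _ →-dec (pos X ≟ᶠ zero ×-dec _≟_ (vecFinite k (symbolFinite g)) (proj₂ (global X)) (Vec.map proj₂ (ownCell X)) ×-dec
            (halted? (global X) →-dec (input (ownCell X) ≟ˢ bit true ×-dec ¬? (isBit? (input (rightCell X))))))) ×-dec
        (T? _ →-dec (proj₁ (global X) ≟ᶠ start-state ×-dec
            _≟_ (vecFinite workTapes (symbolFinite g ⊗ᶠ symbolFinite g)) (Vec.tail (ownCell X)) (Vec.replicate workTapes (blank , blank)) ×-dec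
            proj₁ (Vec.head (ownCell X)) ≟ˢ blank)) ×-dec
        all? λ ι → (T? _ ×-dec T? _) →-dec allowed? ι (input (ownCell X)))

    related-ext : ∀ {O O′} → (∀ a → O a ≡ O′ a) → ∀ {X Y} → Related O X Y → Related O′ X Y
    related-ext {O} {O′} eq (related h v c i l) = related
      (λ (p , q) → let (a , b , c , d , e) = h (back p , back q) in a , b , c , d , e ∘ back)
      (λ (p , q) → v (back p , back q)) (c ∘ back) (i ∘ back) (λ ι (p , q) → l ι (back p , back q))
      where
      back : ∀ {a} → T (O′ a) → T (O a)
      back {a} = subst T (sym (eq a))

    constraint : Constraint (card tileFinite)
    constraint = record
      { rel = λ O x y → does (related? O (from tileFinite x) (from tileFinite y))
      ; ext = λ eq x y → does-⇔ (mk⇔ (related-ext eq) (related-ext (sym ∘ eq))) (related? _ _ _) (related? _ _ _) }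

    cellOf : Config M → ℕ → Cell
    cellOf c j = tabulate (λ i → leftAt (lookup (Config.tapes c) i) j , rightAt (lookup (Config.tapes c) i) j)

    globalOf : Config M → Global
    globalOf (config s ts) = s , Vec.map Tape.here ts

    advanceConfig : Config M → Config M
    advanceConfig c = Maybe.fromMaybe c (step M c)

    run : ℕ → Config M → Config M
    run zero    c = c
    run (suc n) c = run n (advanceConfig c)

    run-suc : ∀ n c → run (suc n) c ≡ advanceConfig (run n c)
    run-suc zero    c = refl
    run-suc (suc n) c = run-suc n (advanceConfig c)

    tileOf : Config M → ℕ → Tile
    tileOf c j = globalOf c , position j , cellOf c (pred j) , cellOf c j , cellOf c (suc j)

    act-sides : ∀ (a : Sym × Move) (t : Tape g) j →
      (leftAt (act a t) j , rightAt (act a t) j) ≡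
      newSides a (position j) (leftAt t (pred j) , rightAt t (pred j)) (leftAt t j , rightAt t j) (leftAt t (suc j) , rightAt t (suc j))
    act-sides (w , stay)      (tape ls x rs)        zero          = refl
    act-sides (w , stay)      (tape ls x rs)        (suc zero)    = refl
    act-sides (w , stay)      (tape ls x rs)        (suc (suc j)) = refl
    act-sides (w , moveLeft)  (tape [] x rs)        zero          = refl
    act-sides (w , moveLeft)  (tape (l ∷ ls) x rs)  zero          = refl
    act-sides (w , moveLeft)  (tape [] x rs)        (suc zero)    = refl
    act-sides (w , moveLeft)  (tape (l ∷ ls) x rs)  (suc zero)    = refl
    act-sides (w , moveLeft)  (tape [] x rs)        (suc (suc j)) = refl
    act-sides (w , moveLeft)  (tape (l ∷ ls) x rs)  (suc (suc j)) = refl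
    act-sides (w , moveRight) (tape ls x [])        zero          = refl
    act-sides (w , moveRight) (tape ls x (r ∷ rs))  zero          = refl
    act-sides (w , moveRight) (tape ls x [])        (suc zero)    = refl
    act-sides (w , moveRight) (tape ls x (r ∷ rs))  (suc zero)    = refl
    act-sides (w , moveRight) (tape ls x [])        (suc (suc j)) = refl
    act-sides (w , moveRight) (tape ls x (r ∷ rs))  (suc (suc j)) = refl

    act-head : ∀ (a : Sym × Move) (t : Tape g) → Tape.here (act a t) ≡ newHead a (leftAt t 0 , rightAt t 0) (leftAt t 1 , rightAt t 1)
    act-head (w , stay)      (tape ls x rs)       = refl
    act-head (w , moveLeft)  (tape [] x rs)       = refl
    act-head (w , moveLeft)  (tape (l ∷ ls) x rs) = refl
    act-head (w , moveRight) (tape ls x [])       = refl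
    act-head (w , moveRight) (tape ls x (r ∷ rs)) = refl

    lookup-cell : ∀ s (ts : Vec (Tape g) k) j i →
      lookup (cellOf (config s ts) j) i ≡ (leftAt (lookup ts i) j , rightAt (lookup ts i) j)
    lookup-cell s ts j = lookup∘tabulate (λ i → leftAt (lookup ts i) j , rightAt (lookup ts i) j)

    cell-advance : ∀ c j → cellOf (advanceConfig c) j ≡ nextCell (globalOf c) (position j) (cellOf c (pred j)) (cellOf c j) (cellOf c (suc j))
    cell-advance c@(config s ts) j with δ s (Vec.map Tape.here ts)
    ... | nothing         = refl
    ... | just (s′ , as) = tabulate-cong λ i → trans
      (cong (λ t → leftAt t j , rightAt t j) (lookup-zipWith act i as ts))
      (trans (act-sides (lookup as i) (lookup ts i) j)
        (sym (cong₃ (newSides (lookup as i) (position j)) (lookup-cell s ts (pred j) i) (lookup-cell s ts j i) (lookup-cell s ts (suc j) i))))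
      where
      cong₃ : ∀ {A B : Set} (f : A → A → A → B) {a a′ b b′ c c′} → a ≡ a′ → b ≡ b′ → c ≡ c′ → f a b c ≡ f a′ b′ c′
      cong₃ f refl refl refl = refl

    global-advance : ∀ c → globalOf (advanceConfig c) ≡ nextGlobal (globalOf c) (cellOf c 0) (cellOf c 1)
    global-advance c@(config s ts) with δ s (Vec.map Tape.here ts)
    ... | nothing         = refl
    ... | just (s′ , as) = cong (s′ ,_) (trans (sym (tabulate∘lookup _)) (tabulate-cong λ i →
      trans (lookup-map i Tape.here (Vec.zipWith act as ts)) (trans (cong Tape.here (lookup-zipWith act i as ts))
        (trans (act-head (lookup as i) (lookup ts i)) (sym (cong₂ (newHead (lookup as i)) (lookup-cell s ts 0 i) (lookup-cell s ts 1 i)))))))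

    step-halted : ∀ c → Halted (globalOf c) → step M c ≡ nothing
    step-halted (config s ts) h rewrite h = refl

    halted-step : ∀ c → step M c ≡ nothing → Halted (globalOf c)
    halted-step (config s ts) h with δ s (Vec.map Tape.here ts)
    ... | nothing = refl

    run-final : ∀ {n c z} → HaltsIn M n c z → ∀ τ → step M (run τ c) ≡ nothing → run τ c ≡ z
    run-final {c = c} (halted h) τ _ = stays τ
      where
      stays : ∀ τ → run τ c ≡ c
      stays zero    = refl
      stays (suc τ) = trans (cong (run τ) (cong (Maybe.fromMaybe c) h)) (stays τ)
    run-final (next e r) zero    h with () ← trans (sym e) h
    run-final {c = c} (next e r) (suc τ) h = trans (cong (run τ) (cong (Maybe.fromMaybe c) e))
      (run-final r τ (subst (λ c → step M (run τ c) ≡ nothing) (cong (Maybe.fromMaybe c) e) h))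

    run-halts : ∀ {n c z} → HaltsIn M n c z → run n c ≡ z × step M z ≡ nothing
    run-halts (halted h) = refl , h
    run-halts {suc n} {c = c} (next e r) with run-halts r
    ... | eq , h = trans (cong (run n) (cong (Maybe.fromMaybe c) e)) eq , h

    output-symbols : ∀ c → output c ≡ true ∷ [] → input (cellOf c 0) ≡ bit true × ¬ IsBit (input (cellOf c 1))
    output-symbols (config s (tape ls (bit true) []           ∷ ts)) eq = refl , λ ()
    output-symbols (config s (tape ls (bit true) (blank ∷ _)  ∷ ts)) eq = refl , λ ()
    output-symbols (config s (tape ls (bit true) (mark _ ∷ _) ∷ ts)) eq = refl , λ ()
    output-symbols (config s (tape ls (bit true) (bit _ ∷ _) ∷ ts)) ()

    symbols-output : ∀ c → input (cellOf c 0) ≡ bit true → ¬ IsBit (input (cellOf c 1)) → output c ≡ true ∷ []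
    symbols-output (config s (tape ls _ []           ∷ ts)) refl nb = refl
    symbols-output (config s (tape ls _ (blank ∷ _)  ∷ ts)) refl nb = refl
    symbols-output (config s (tape ls _ (mark _ ∷ _) ∷ ts)) refl nb = refl
    symbols-output (config s (tape ls _ (bit _ ∷ _)  ∷ ts)) refl nb = ⊥-elim (nb tt)

    initial-input : ∀ y j → rightAt (inputTape {g} y) j ≡ nthSym (List.map bit y) j
    initial-input []      zero    = refl
    initial-input []      (suc j) = refl
    initial-input (b ∷ y) j       = refl

    initial-left : ∀ y j → leftAt (inputTape {g} y) j ≡ blank
    initial-left []      j = refl
    initial-left (b ∷ y) j = refl

    initial-cell : ∀ y j → cellOf (initial M y) j ≡ (blank , nthSym (List.map bit y) j) ∷ Vec.replicate workTapes (blank , blank)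
    initial-cell y j = cong₂ _∷_ (cong₂ _,_ (initial-left y j) (initial-input y j))
      (trans (tabulate-cong λ i → cong (λ t → leftAt t j , rightAt t j) (lookup-replicate i emptyTape))
        (trans (tabulate-cong (λ i → trans (cong (blank ,_) (none j)) (sym (lookup-replicate i (blank , blank)))))
          (tabulate∘lookup _)))
      where
      none : ∀ j → nthSym {g} (blank ∷ []) j ≡ blank
      none zero    = refl
      none (suc j) = refl

    heads-cell : ∀ c → Vec.map proj₂ (cellOf c 0) ≡ proj₂ (globalOf c)
    heads-cell (config s ts) = trans (sym (tabulate-∘ proj₂ λ i → leftAt (lookup ts i) 0 , rightAt (lookup ts i) 0))
      (trans (tabulate-cong λ i → sym (lookup-map i Tape.here ts)) (tabulate∘lookup (Vec.map Tape.here ts)))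

    -- Distance 0 has no inner neighbor. In a given solution the corresponding entry of a tile is
    -- unconstrained, and here it is seen to be harmless.
    nextCell-zero : ∀ G a a′ b c → nextCell G zero a b c ≡ nextCell G zero a′ b c
    nextCell-zero (s , hs) a a′ b c with δ s hs
    ... | nothing         = refl
    ... | just (s′ , as) = tabulate-cong λ i → irrelevant {lookup a i} {lookup a′ i} {lookup b i} {lookup c i} (lookup as i)
      where
      irrelevant : ∀ {a a′ b c} x → newSides x zero a b c ≡ newSides x zero a′ b c
      irrelevant (w , stay)      = refl
      irrelevant (w , moveLeft)  = refl
      irrelevant (w , moveRight) = refl

    nth-blank : ∀ (y : List Bool) j → nthSym {g} (List.map bit y) j ≡ blank → nthSym {g} (List.map bit y) (suc j) ≡ blank
    nth-blank []          j       _  = refl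
    nth-blank (b ∷ y)     (suc j) eq = nth-blank y j eq

    module _ (u : List Letter) where
      open Problem constraint u

      holds-same : ∀ {n} (i : Fin n) → T (toℕ i ℕ.≡ᵇ toℕ i)
      holds-same i = ℕₚ.≡⇒≡ᵇ (toℕ i) (toℕ i) refl

      Fits : (ℕ → Sym) → Set
      Fits s = ∀ j ι → j < length u → T (letterAt u j ι) → Allowed ι (s j)

      -- The rows are the configurations of the run, the halted one being repeated forever; any
      -- halted row is therefore the final one, and `corner` sees the accepting output.
      complete : ∀ {n z} y → Fits (nthSym (List.map bit y)) → HaltsIn M n (initial M y) z → output z ≡ true ∷ [] → Solution
      complete {z = z} y fits hl acc = A , λ v w → does⁺ (related? _ _ _) (ok v w)
        where
        c : ℕ → Config M
        c τ = run τ (initial M y)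
        tile : V → Tile
        tile (τ , j) = tileOf (c (toℕ τ)) (toℕ j)
        A : V → Fin (card tileFinite)
        A v = to tileFinite (tile v)
        ok : ∀ v w → Related (numeric u (pairEnv v w)) (from tileFinite (A v)) (from tileFinite (A w))
        ok v@(τ , j) w@(τ′ , j′) = subst₂ (Related _) (sym (from-to tileFinite (tile v))) (sym (from-to tileFinite (tile w))) record
          { horizontal = λ (e , f) → hor {toℕ τ} {toℕ j} (ℕₚ.≡ᵇ⇒≡ (toℕ τ) (toℕ τ′) e) (ℕₚ.≡ᵇ⇒≡ (suc (toℕ j)) (toℕ j′) f)
          ; vertical   = λ (e , f) → ver {toℕ τ} {toℕ j} (ℕₚ.≡ᵇ⇒≡ (toℕ j) (toℕ j′) e) (ℕₚ.≡ᵇ⇒≡ (suc (toℕ τ)) (toℕ τ′) f)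
          ; corner     = λ e → cor {toℕ τ} (ℕₚ.≡ᵇ⇒≡ (toℕ j) 0 e)
          ; initially  = λ e → ini {toℕ τ} (toℕ j) (ℕₚ.≡ᵇ⇒≡ (toℕ τ) 0 e)
          ; lettered   = λ ι (e , f) → lettering ι (ℕₚ.≡ᵇ⇒≡ (toℕ τ) 0 e) f }
          where
          at0 : ∀ {τ} j → τ ≡ 0 → input (cellOf (c τ) j) ≡ nthSym (List.map bit y) j
          at0 j refl = cong input (initial-cell y j)
          hor : ∀ {τ j τ′ j′} → τ ≡ τ′ → suc j ≡ j′ →
            globalOf (c τ) ≡ globalOf (c τ′) × cellOf (c τ) j ≡ cellOf (c τ′) (pred j′) × cellOf (c τ) (suc j) ≡ cellOf (c τ′) j′ ×
            position j′ ≡ bump (position j) ×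
            (T (τ ℕ.≡ᵇ 0) → input (cellOf (c τ) j) ≡ blank → input (cellOf (c τ′) j′) ≡ blank)
          hor {τ} {j} refl refl = refl , refl , refl , position-suc j ,
            λ z b → trans (at0 {τ} (suc j) (ℕₚ.≡ᵇ⇒≡ τ 0 z)) (nth-blank y j (trans (sym (at0 {τ} j (ℕₚ.≡ᵇ⇒≡ τ 0 z))) b))
          ver : ∀ {τ j τ′ j′} → j ≡ j′ → suc τ ≡ τ′ →
            cellOf (c τ′) j′ ≡ nextCell (globalOf (c τ)) (position j) (cellOf (c τ) (pred j)) (cellOf (c τ) j) (cellOf (c τ) (suc j)) ×
            (position j ≡ zero → globalOf (c τ′) ≡ nextGlobal (globalOf (c τ)) (cellOf (c τ) j) (cellOf (c τ) (suc j)))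
          ver {τ} {j} refl refl =
            trans (cong (λ c → cellOf c j) (run-suc τ (initial M y))) (cell-advance (c τ) j) ,
            λ p → trans (cong globalOf (run-suc τ (initial M y))) (trans (global-advance (c τ))
              (cong (λ j → nextGlobal (globalOf (c τ)) (cellOf (c τ) j) (cellOf (c τ) (suc j))) (sym (zero-position j p))))
            where
            zero-position : ∀ j → position j ≡ zero → j ≡ 0
            zero-position zero          _ = refl
            zero-position (suc zero)    ()
            zero-position (suc (suc j)) ()
          cor : ∀ {τ j} → j ≡ 0 → position j ≡ zero × proj₂ (globalOf (c τ)) ≡ Vec.map proj₂ (cellOf (c τ) j) ×
            (Halted (globalOf (c τ)) → input (cellOf (c τ) j) ≡ bit true × ¬ IsBit (input (cellOf (c τ) (suc j))))
          cor {τ} refl = refl , sym (heads-cell (c τ)) , λ h →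
            output-symbols (c τ) (trans (cong output (run-final hl τ (step-halted (c τ) h))) acc)
          ini : ∀ {τ} j → τ ≡ 0 → proj₁ (globalOf (c τ)) ≡ start-state ×
            Vec.tail (cellOf (c τ) j) ≡ Vec.replicate workTapes (blank , blank) × proj₁ (Vec.head (cellOf (c τ) j)) ≡ blank
          ini j refl = refl , cong Vec.tail (initial-cell y j) , cong (proj₁ ∘ Vec.head) (initial-cell y j)
          lettering : ∀ ι → toℕ τ ≡ 0 → T (letterAt u (toℕ j) ι) → Allowed ι (input (cellOf (c (toℕ τ)) (toℕ j)))
          lettering ι e f = subst (Allowed ι) (sym (at0 {toℕ τ} (toℕ j) e)) (fits (toℕ j) ι (toℕ<n j) f)

      module _ (sol : Solution) where

        abstract
          tiles : V → Tile
          tiles v = from tileFinite (proj₁ sol v)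

          tiled : ∀ v w → Related (numeric u (pairEnv v w)) (tiles v) (tiles w)
          tiled v w = does⁻ (related? _ _ _) (proj₂ sol v w)

        tileAt : ∀ τ j → τ < length u → j < length u → Tile
        tileAt τ j p q = tiles (fromℕ< p , fromℕ< q)

        symbolAt : ∀ j → Dec (j < length u) → Sym
        symbolAt j (yes q) = input (ownCell (tileAt 0 j (ℕₚ.≤-<-trans z≤n q) q))
        symbolAt j (no  _) = blank

        firstRow : ℕ → Sym
        firstRow j = symbolAt j (j ℕₚ.<? length u)

        symbol-unique : ∀ j p q (j<? : Dec (j < length u)) → symbolAt j j<? ≡ input (ownCell (tileAt 0 j p q))
        symbol-unique j p q (yes q′) = cong₂ (λ p q → input (ownCell (tileAt 0 j p q))) (ℕₚ.<-irrelevant (ℕₚ.≤-<-trans z≤n q′) p) (ℕₚ.<-irrelevant q′ q)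
        symbol-unique j p q (no ¬q)  = ⊥-elim (¬q q)

        firstRow-at : ∀ j p q → firstRow j ≡ input (ownCell (tileAt 0 j p q))
        firstRow-at j p q = symbol-unique j p q (j ℕₚ.<? length u)

        is : ∀ {n x} (lt : x < n) → T (toℕ (fromℕ< lt) ℕ.≡ᵇ x)
        is lt = ℕₚ.≡⇒≡ᵇ _ _ (toℕ-fromℕ< lt)

        next-to : ∀ {n x} (lt : x < n) (lt′ : suc x < n) → T (suc (toℕ (fromℕ< lt)) ℕ.≡ᵇ toℕ (fromℕ< lt′))
        next-to lt lt′ = ℕₚ.≡⇒≡ᵇ _ _ (trans (cong suc (toℕ-fromℕ< lt)) (sym (toℕ-fromℕ< lt′)))

        firstRow-fits : Fits firstRow
        firstRow-fits j ι lt h = subst (Allowed ι) (sym (firstRow-at j p lt))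
          (Related.lettered (tiled v v) ι (is p , subst (λ n → T (letterAt u n ι)) (sym (toℕ-fromℕ< lt)) h))
          where
          p = ℕₚ.≤-<-trans z≤n lt
          v = fromℕ< p , fromℕ< lt

        firstRow-blank : ∀ j → suc j < length u → firstRow j ≡ blank → firstRow (suc j) ≡ blank
        firstRow-blank j lt b = trans (firstRow-at (suc j) p lt)
          (proj₂ (proj₂ (proj₂ (proj₂ (Related.horizontal (tiled (fromℕ< p , fromℕ< q) (fromℕ< p , fromℕ< lt)) (holds-same (fromℕ< p) , next-to q lt)))))
            (is p) (trans (sym (firstRow-at j p q)) b))
          where
          p = ℕₚ.≤-<-trans z≤n lt
          q = ℕₚ.<-trans (ℕₚ.n<1+n j) lt

        sound : ∀ {n z} y → (∀ j → j < length u → firstRow j ≡ nthSym (List.map bit y) j) →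
                suc n < length u → HaltsIn M n (initial M y) z → output z ≡ true ∷ []
        sound {n} {z} y row long hl = subst (λ c → output c ≡ true ∷ []) (proj₁ (run-halts hl))
          (symbols-output (c n) (trans (cong input (sym own-n)) (proj₁ accepting))
            (λ b → proj₂ accepting (subst (IsBit ∘ input) (sym right-n) b)))
          where
          c : ℕ → Config M
          c τ = run τ (initial M y)
          hor : ∀ τ j p q q′ → global (tileAt τ j p q) ≡ global (tileAt τ (suc j) p q′) ×
            ownCell (tileAt τ j p q) ≡ leftCell (tileAt τ (suc j) p q′) × rightCell (tileAt τ j p q) ≡ ownCell (tileAt τ (suc j) p q′) ×
            pos (tileAt τ (suc j) p q′) ≡ bump (pos (tileAt τ j p q))
          hor τ j p q q′ = let (a , b , c , d , _) = Related.horizontal (tiled (fromℕ< p , fromℕ< q) (fromℕ< p , fromℕ< q′)) (holds-same (fromℕ< p) , next-to q q′)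
            in a , b , c , d
          Right : ℕ → ℕ → Set
          Right τ j = ∀ p q → ownCell (tileAt τ j p q) ≡ cellOf (c τ) j
          smaller : ∀ {a b x} → a ≤ x → x < b → a < b
          smaller = ℕₚ.≤-<-trans
          -- Horizontal constraints carry the state, the scanned symbols and the position from the
          -- corner to the whole row.
          rows : ∀ τ → (∀ p q → global (tileAt τ 0 p q) ≡ globalOf (c τ)) → ∀ j p q →
                 global (tileAt τ j p q) ≡ globalOf (c τ) × pos (tileAt τ j p q) ≡ position j
          rows τ g0 zero    p q = g0 p q , proj₁ (Related.corner (tiled (fromℕ< p , fromℕ< q) (fromℕ< p , fromℕ< q)) (is q))
          rows τ g0 (suc j) p q =
            trans (sym (proj₁ (hor τ j p q′ q))) (proj₁ before) ,
            trans (proj₂ (proj₂ (proj₂ (hor τ j p q′ q)))) (trans (cong bump (proj₂ before)) (sym (position-suc j)))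
            where
            q′ = ℕₚ.<-trans (ℕₚ.n<1+n j) q
            before = rows τ g0 j p q′
          -- Tiles at the right border have no outer neighbor to check them, so the part of a row
          -- known to be correct shrinks by one cell at every step.
          cone : ∀ τ → (∀ p q → global (tileAt τ 0 p q) ≡ globalOf (c τ)) × (∀ j → τ + j < length u → Right τ j)
          cone zero = first-global , first-own
            where
            first-own : ∀ j → j < length u → Right 0 j
            first-own j lt p q = trans (rebuild (ownCell (tileAt 0 j p q)) (proj₁ (proj₂ ini)) (proj₂ (proj₂ ini)))
              (trans (cong (λ s → (blank , s) ∷ Vec.replicate workTapes (blank , blank)) (trans (sym (firstRow-at j p q)) (row j lt)))
                (sym (initial-cell y j)))
              where
              ini = Related.initially (tiled (fromℕ< p , fromℕ< q) (fromℕ< p , fromℕ< q)) (is p)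
              rebuild : ∀ (b : Cell) → Vec.tail b ≡ Vec.replicate workTapes (blank , blank) → proj₁ (Vec.head b) ≡ blank →
                        b ≡ (blank , input b) ∷ Vec.replicate workTapes (blank , blank)
              rebuild ((_ , s) ∷ b) refl refl = refl
            first-global : ∀ p q → global (tileAt 0 0 p q) ≡ globalOf (c 0)
            first-global p q = cong₂ _,_ (proj₁ (Related.initially (tiled v v) (is p)))
              (trans (proj₁ (proj₂ (Related.corner (tiled v v) (is q)))) (trans (cong (Vec.map proj₂) (first-own 0 q p q)) (heads-cell (c 0))))
              where
              v = fromℕ< p , fromℕ< q
          cone (suc τ) with cone τ
          ... | g0 , own = next-global , next-own
            where
            earlier : ∀ {j} → suc τ + j < length u → τ < length u
            earlier lt = ℕₚ.<-trans (ℕₚ.n<1+n τ) (smaller (ℕₚ.m≤m+n (suc τ) _) lt)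
            right : ∀ j p q → suc τ + j < length u → rightCell (tileAt τ j p q) ≡ cellOf (c τ) (suc j)
            right j p q lt = trans (proj₁ (proj₂ (proj₂ (hor τ j p q q′)))) (own (suc j) (subst (_< length u) (sym (ℕₚ.+-suc τ j)) lt) p q′)
              where
              q′ = smaller (s≤s (ℕₚ.m≤n+m j τ)) lt
            ver : ∀ j p p′ q → ownCell (tileAt (suc τ) j p′ q) ≡ nextCell (global (tileAt τ j p q)) (pos (tileAt τ j p q)) (leftCell (tileAt τ j p q)) (ownCell (tileAt τ j p q)) (rightCell (tileAt τ j p q)) ×
              (pos (tileAt τ j p q) ≡ zero → global (tileAt (suc τ) j p′ q) ≡ nextGlobal (global (tileAt τ j p q)) (ownCell (tileAt τ j p q)) (rightCell (tileAt τ j p q)))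
            ver j p p′ q = Related.vertical (tiled (fromℕ< {τ} p , fromℕ< {j} q) (fromℕ< {suc τ} p′ , fromℕ< q)) (holds-same (fromℕ< q) , next-to p p′)
            next-own : ∀ j → suc τ + j < length u → Right (suc τ) j
            next-own j lt p′ q = trans (proj₁ (ver j p p′ q)) (trans
              (cong₂ (λ G P → nextCell G P (leftCell (tileAt τ j p q)) (ownCell (tileAt τ j p q)) (rightCell (tileAt τ j p q)))
                (proj₁ (rows τ g0 j p q)) (proj₂ (rows τ g0 j p q)))
              (trans (cong₂ (nextCell (globalOf (c τ)) (position j) (leftCell (tileAt τ j p q))) (own j (ℕₚ.<-trans (ℕₚ.n<1+n _) lt) p q) (right j p q lt))
              (trans (lefts j p q lt) (sym (trans (cong (λ c → cellOf c j) (run-suc τ (initial M y))) (cell-advance (c τ) j))))))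
              where
              p = earlier lt
              lefts : ∀ j p q → suc τ + j < length u → nextCell (globalOf (c τ)) (position j) (leftCell (tileAt τ j p q)) (cellOf (c τ) j) (cellOf (c τ) (suc j)) ≡
                nextCell (globalOf (c τ)) (position j) (cellOf (c τ) (pred j)) (cellOf (c τ) j) (cellOf (c τ) (suc j))
              lefts zero    p q lt = nextCell-zero (globalOf (c τ)) _ _ _ _
              lefts (suc j) p q lt = cong (λ a → nextCell (globalOf (c τ)) (position (suc j)) a (cellOf (c τ) (suc j)) (cellOf (c τ) (suc (suc j))))
                (trans (sym (proj₁ (proj₂ (hor τ j p q″ q)))) (own j (ℕₚ.<-trans (ℕₚ.+-monoʳ-< τ (ℕₚ.n<1+n j)) (ℕₚ.<-trans (ℕₚ.n<1+n _) lt)) p q″))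
                where
                q″ = ℕₚ.<-trans (ℕₚ.n<1+n j) q
            next-global : ∀ p′ q → global (tileAt (suc τ) 0 p′ q) ≡ globalOf (c (suc τ))
            next-global p′ q = trans (proj₂ (ver 0 p p′ q) (proj₂ (rows τ g0 0 p q))) (trans
              (trans (cong (λ G → nextGlobal G (ownCell (tileAt τ 0 p q)) (rightCell (tileAt τ 0 p q))) (g0 p q))
                (cong₂ (nextGlobal (globalOf (c τ))) (own 0 (ℕₚ.<-trans (ℕₚ.n<1+n _) lt) p q) (right 0 p q lt)))
              (sym (trans (cong globalOf (run-suc τ (initial M y))) (global-advance (c τ)))))
              where
              lt : suc τ + 0 < length u
              lt = subst (_< length u) (sym (ℕₚ.+-identityʳ (suc τ))) p′
              p = earlier lt
          p = ℕₚ.<-trans (ℕₚ.n<1+n n) long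
          q0 = ℕₚ.≤-<-trans z≤n long
          q1 = ℕₚ.≤-<-trans (s≤s z≤n) long
          halted-n : Halted (global (tileAt n 0 p q0))
          halted-n = subst Halted (sym (proj₁ (cone n) p q0)) (halted-step (c n) (subst (λ c → step M c ≡ nothing) (sym (proj₁ (run-halts hl))) (proj₂ (run-halts hl))))
          accepting = proj₂ (proj₂ (Related.corner (tiled (fromℕ< p , fromℕ< q0) (fromℕ< p , fromℕ< q0)) (is q0))) halted-n
          own-n : ownCell (tileAt n 0 p q0) ≡ cellOf (c n) 0
          own-n = proj₂ (cone n) 0 (subst (_< length u) (sym (ℕₚ.+-identityʳ n)) p) p q0
          right-n : rightCell (tileAt n 0 p q0) ≡ cellOf (c n) 1
          right-n = trans (proj₁ (proj₂ (proj₂ (hor n 0 p q0 q1)))) (proj₂ (cone n) 1 (subst (_< length u) (sym (ℕₚ.+-comm n 1)) long) p q1)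

-- Certificates read off the first row of a tableau.

module Certificates where

  open import Defs
  open LoopPrograms using (Letter; bit0; bit1; free; pad)
  open Pipeline using (bitLetter)
  open ConstraintHypergraph using (letterAt)
  open Tableaux using (nthSym; IsBit; Allowed)
  open import Data.Bool.Base using (Bool; true; false; T)
  open import Data.Fin.Base using (zero; suc)
  open import Data.List.Base as List using (List; []; _∷_; _++_; length; replicate)
  open import Data.Nat.Base using (ℕ; zero; suc; _≤_; _<_; z≤n; s≤s)
  import Data.Nat.Properties as ℕₚ
  open import Data.Product.Base using (∃-syntax; _×_; _,_)
  open import Data.Sum.Base using (_⊎_; inj₁; inj₂)
  open import Data.Unit.Base using (tt)
  open import Relation.Binary.PropositionalEquality

  word : List Bool → ℕ → ℕ → List Letter
  word pre F P = List.map bitLetter pre ++ replicate F free ++ replicate P pad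

  Fitting : ∀ {g} → List Letter → (ℕ → Symbol g) → Set
  Fitting u s = ∀ j ι → j < length u → T (letterAt u j ι) → Allowed ι (s j)

  BlankClosed : ∀ {g} → List Letter → (ℕ → Symbol g) → Set
  BlankClosed u s = ∀ j → suc j < length u → s j ≡ blank → s (suc j) ≡ blank

  -- The free cells hold bits up to the first blank, after which `BlankClosed` forces blanks; these
  -- bits are the certificate.
  certificate : ∀ {g} pre F P (s : ℕ → Symbol g) → Fitting (word pre F P) s → BlankClosed (word pre F P) s →
    ∃[ w ] (length w ≤ F × (∀ j → j < length (word pre F P) → s j ≡ nthSym (List.map bit (pre ++ w)) j))
  certificate (b ∷ pre) F P s fit closed
    with certificate pre F P (λ j → s (suc j)) (λ j ι lt → fit (suc j) ι (s≤s lt)) (λ j lt → closed (suc j) (s≤s lt))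
  ... | w , short , eq = w , short , λ { zero lt → front b fit ; (suc j) (s≤s lt) → eq j lt }
    where
    front : ∀ b → Fitting (word (b ∷ pre) F P) s → s 0 ≡ bit b
    front false fit = fit 0 bit0 (s≤s z≤n) tt
    front true  fit = fit 0 bit1 (s≤s z≤n) tt
  certificate [] (suc F) P s fit closed = decide (fit 0 free (s≤s z≤n) tt)
    where
    decide : IsBit (s 0) ⊎ s 0 ≡ blank →
      ∃[ w ] (length w ≤ suc F × (∀ j → j < length (word [] (suc F) P) → s j ≡ nthSym (List.map bit w) j))
    decide (inj₂ b) = [] , z≤n , blanks
      where
      blanks : ∀ j → j < length (word [] (suc F) P) → s j ≡ blank
      blanks zero    lt = b
      blanks (suc j) lt = closed j lt (blanks j (ℕₚ.<-trans (ℕₚ.n<1+n j) lt))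
    decide (inj₁ h) with s 0 in at0
    ... | bit b with certificate [] F P (λ j → s (suc j)) (λ j ι lt → fit (suc j) ι (s≤s lt)) (λ j lt → closed (suc j) (s≤s lt))
    ...   | w , short , eq = b ∷ w , s≤s short , λ { zero lt → at0 ; (suc j) (s≤s lt) → eq j lt }
  certificate [] zero P s fit closed = [] , z≤n , λ j lt → fit j pad lt (padding P j lt)
    where
    padding : ∀ P j → j < length (replicate P pad) → T (letterAt (replicate P pad) j pad)
    padding (suc P) zero    _        = tt
    padding (suc P) (suc j) (s≤s lt) = padding P j lt

  certificate-fits : ∀ {g} pre w F P → length w ≤ F → Fitting {g} (word pre F P) (nthSym (List.map bit (pre ++ w)))
  certificate-fits (false ∷ pre) w F P le zero bit0 lt h = refl
  certificate-fits (true  ∷ pre) w F P le zero bit1 lt h = refl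
  certificate-fits (b ∷ pre) w F P le (suc j) ι (s≤s lt) h = certificate-fits pre w F P le j ι lt h
  certificate-fits [] []      (suc F) P le zero    free lt h = inj₂ refl
  certificate-fits [] (b ∷ w) (suc F) P le zero    free lt h = inj₁ tt
  certificate-fits [] []      (suc F) P le (suc j) ι (s≤s lt) h = certificate-fits [] [] F P z≤n j ι lt h
  certificate-fits [] (b ∷ w) (suc F) P (s≤s le) (suc j) ι (s≤s lt) h = certificate-fits [] w F P le j ι lt h
  certificate-fits [] []      zero (suc P) le zero    pad lt h = refl
  certificate-fits [] []      zero (suc P) le (suc j) ι (s≤s lt) h = certificate-fits [] [] zero P z≤n j ι lt h

-- The one-pass automata decide the atoms.

module Scanning where

  open LoopPrograms using (Letter; Atom; same; succ; first; letter; Mode; pending; off; on; isOn; columns; advance; holds)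
  open ConstraintHypergraph using (letterAt; numeric)
  open import Data.Bool.Base using (true; false; if_then_else_; T)
  open import Data.Bool.Properties using (¬-not)
  open import Data.Fin.Base using (Fin; zero; suc)
  open import Data.Fin.Properties using () renaming (_≟_ to _≟ᶠ_)
  open import Data.List.Base as List using (List; []; _∷_; length; foldl)
  open import Data.Nat.Base as ℕ using (ℕ; zero; suc; _+_; _<_; _≡ᵇ_; s≤s)
  import Data.Nat.Properties as ℕₚ
  open import Data.Product.Base using (_×_; _,_)
  open import Data.Vec.Base as Vec using (Vec; lookup)
  open import Data.Vec.Properties using (lookup-map)
  open import Relation.Binary.PropositionalEquality
  open import Relation.Nullary using (does)

  ≡ᵇ-refl : ∀ n → (n ≡ᵇ n) ≡ true
  ≡ᵇ-refl zero    = refl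
  ≡ᵇ-refl (suc n) = ≡ᵇ-refl n

  ≢⇒≡ᵇ-false : ∀ {m n} → m ≢ n → (m ≡ᵇ n) ≡ false
  ≢⇒≡ᵇ-false {m} {n} ne = ¬-not (λ eq → ne (ℕₚ.≡ᵇ⇒≡ m n (subst T (sym eq) _)))

  ≡ᵇ-comm : ∀ m n → (m ≡ᵇ n) ≡ (n ≡ᵇ m)
  ≡ᵇ-comm zero    zero    = refl
  ≡ᵇ-comm zero    (suc n) = refl
  ≡ᵇ-comm (suc m) zero    = refl
  ≡ᵇ-comm (suc m) (suc n) = ≡ᵇ-comm m n

  isOn-if : ∀ b → isOn (if b then on else off) ≡ b
  isOn-if true  = refl
  isOn-if false = refl

  module _ {h : ℕ} (ρ : Vec ℕ h) where

    scan : Atom h → Mode → ℕ → List Letter → Mode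
    scan a m n u = foldl (advance a) m (columns n u ρ)

    private
      value : Fin h → ℕ
      value = lookup ρ

      seen : ∀ {n i} b → (n ≡ᵇ value i) ≡ b → lookup (Vec.map (n ≡ᵇ_) ρ) i ≡ b
      seen {n} {i} b eq = trans (lookup-map i (n ≡ᵇ_) ρ) eq

      passed : ∀ {n i} → value i < n → lookup (Vec.map (n ≡ᵇ_) ρ) i ≡ false
      passed {n} {i} lt = seen {n} {i} false (≢⇒≡ᵇ-false (ℕₚ.>⇒≢ lt))

      reached : ∀ {n i} → value i ≡ n + 0 → lookup (Vec.map (n ≡ᵇ_) ρ) i ≡ true
      reached {n} {i} eq = seen {n} {i} true (trans (cong (n ≡ᵇ_) (trans eq (ℕₚ.+-identityʳ n))) (≡ᵇ-refl n))

      ahead : ∀ {n i k} → value i ≡ n + suc k → lookup (Vec.map (n ≡ᵇ_) ρ) i ≡ false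
      ahead {n} {i} {k} eq = seen {n} {i} false (≢⇒≡ᵇ-false (λ n≡ → ℕₚ.m≢1+m+n n (trans n≡ (trans eq (ℕₚ.+-suc n k)))))

      following : ∀ {n x k} → x ≡ n + suc k → x ≡ suc n + k
      following {n} {k = k} eq = trans eq (ℕₚ.+-suc n k)

      beyond : ∀ {n x} → x ≡ n + 0 → x < suc n
      beyond {n} eq = s≤s (ℕₚ.≤-reflexive (trans eq (ℕₚ.+-identityʳ n)))

    letter-past : ∀ {i ι} m n u → value i < n → scan (letter i ι) m n u ≡ m
    letter-past m n []      lt = refl
    letter-past {i} m n (_ ∷ u) lt rewrite passed {i = i} lt = letter-past m (suc n) u (ℕₚ.m<n⇒m<1+n lt)

    letter-scan : ∀ {i ι} m n u k → value i ≡ n + k → k < length u → isOn (scan (letter i ι) m n u) ≡ letterAt u k ι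
    letter-scan {i} {ι} m n (ι′ ∷ u) zero eq lt rewrite reached {i = i} eq =
      trans (cong isOn (letter-past (if does (ι′ ≟ᶠ ι) then on else off) (suc n) u (beyond eq))) (isOn-if (does (ι′ ≟ᶠ ι)))
    letter-scan {i} m n (_ ∷ u) (suc k) eq (s≤s lt) rewrite ahead {i = i} eq = letter-scan m (suc n) u k (following eq) lt

    same-past : ∀ {i j} m n u → value i < n → scan (same i j) m n u ≡ m
    same-past m n []      lt = refl
    same-past {i} m n (_ ∷ u) lt rewrite passed {i = i} lt = same-past m (suc n) u (ℕₚ.m<n⇒m<1+n lt)

    same-scan : ∀ {i j} n u k → value i ≡ n + k → k < length u → isOn (scan (same i j) off n u) ≡ (value i ≡ᵇ value j)
    same-scan {i} {j} n (_ ∷ u) zero eq lt rewrite reached {i = i} eq | lookup-map j (n ≡ᵇ_) ρ =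
      trans (cong isOn (same-past (if (n ≡ᵇ value j) then on else off) (suc n) u (beyond eq)))
        (trans (isOn-if (n ≡ᵇ value j)) (cong (_≡ᵇ value j) (sym (trans eq (ℕₚ.+-identityʳ n)))))
    same-scan {i} n (_ ∷ u) (suc k) eq (s≤s lt) rewrite ahead {i = i} eq = same-scan (suc n) u k (following eq) lt

    first-settled : ∀ {i} b n u → scan (first i) (if b then on else off) n u ≡ (if b then on else off)
    first-settled b     n []      = refl
    first-settled true  n (_ ∷ u) = first-settled true (suc n) u
    first-settled false n (_ ∷ u) = first-settled false (suc n) u

    succ-on : ∀ {i j} n u → scan (succ i j) on n u ≡ on
    succ-on n []      = refl
    succ-on n (_ ∷ u) = succ-on (suc n) u

    succ-past : ∀ {i j} n u → value i < n → scan (succ i j) off n u ≡ off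
    succ-past n []      lt = refl
    succ-past {i} n (_ ∷ u) lt rewrite passed {i = i} lt = succ-past (suc n) u (ℕₚ.m<n⇒m<1+n lt)

    -- The column right after i decides: without j on it the mode falls back to `off` for good. At
    -- the end of the word the bound on j rules out n ≡ j.
    succ-pending : ∀ {i j} n u → value i < n → value j < n + length u → isOn (scan (succ i j) pending n u) ≡ (n ≡ᵇ value j)
    succ-pending {j = j} n [] lt lt′ = sym (≢⇒≡ᵇ-false (ℕₚ.>⇒≢ (subst (value j <_) (ℕₚ.+-identityʳ n) lt′)))
    succ-pending {i} {j} n (_ ∷ u) lt lt′ rewrite lookup-map j (n ≡ᵇ_) ρ | passed {i = i} lt with n ≡ᵇ value j
    ... | true  = cong isOn (succ-on (suc n) u)
    ... | false = cong isOn (succ-past (suc n) u (ℕₚ.m<n⇒m<1+n lt))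

    succ-scan : ∀ {i j} n u k → value i ≡ n + k → k < length u → value j < n + length u →
      isOn (scan (succ i j) off n u) ≡ (suc (value i) ≡ᵇ value j)
    succ-scan {i} {j} n (_ ∷ u) zero eq lt lt′ rewrite reached {i = i} eq =
      trans (succ-pending (suc n) u (beyond eq) (subst (value j <_) (ℕₚ.+-suc n (length u)) lt′))
        (cong (λ x → suc x ≡ᵇ value j) (sym (trans eq (ℕₚ.+-identityʳ n))))
    succ-scan {i} {j} n (_ ∷ u) (suc k) eq (s≤s lt) lt′ rewrite ahead {i = i} eq =
      succ-scan (suc n) u k (following eq) lt (subst (value j <_) (ℕₚ.+-suc n (length u)) lt′)

    -- For `same` the bound on i suffices, as an equal j shares it. For `succ` both are bounded,
    -- since the last position is followed by the value of an inactive variable.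
    InRange : List Letter → Atom h → Set
    InRange u (same i j)   = value i < length u
    InRange u (succ i j)   = value i < length u × value j < length u
    InRange u (first i)    = value i < length u
    InRange u (letter i ι) = value i < length u

    holds-numeric : ∀ u a → InRange u a → holds a u ρ ≡ numeric u value a
    holds-numeric u (same i j)   lt         = same-scan 0 u (value i) refl lt
    holds-numeric u (succ i j)   (lt , lt′) = succ-scan 0 u (value i) refl lt lt′
    holds-numeric (ι ∷ u) (first i) lt      = trans (cong (λ b → isOn (scan (first i) (if b then on else off) 1 u)) (lookup-map i (0 ≡ᵇ_) ρ))
      (trans (cong isOn (first-settled (0 ≡ᵇ value i) 1 u)) (trans (isOn-if (0 ≡ᵇ value i)) (≡ᵇ-comm 0 (value i))))
    holds-numeric u (letter i ι) lt         = letter-scan off 0 u (value i) refl lt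

-- Loops over tuples of positions, and tables of atoms.

module LoopMacros where

  open LoopPrograms
  open Pipeline using (ground)
  open ConstraintHypergraph using (vecs; lookup-fromList; letterAt)
  open import Data.Bool.Base using (Bool; true; false)
  open import Data.Fin.Base using (Fin; zero; suc; toℕ)
  open import Data.Fin.Properties using (toℕ-injective; suc-injective; 0≢1+n) renaming (_≟_ to _≟ᶠ_)
  open import Data.List.Base as List using (List; []; _∷_; _++_; length; concatMap; cartesianProductWith; cartesianProduct; allFin; replicate; tabulate)
  open import Data.List.Membership.Propositional using (_∈_)
  import Data.List.Relation.Unary.Any as Any
  import Data.List.Relation.Unary.Any.Properties as Anyₚ
  open import Data.List.Membership.Propositional.Properties using (∈-++⁺ˡ; ∈-++⁺ʳ; ∈-map⁺; ∈-cartesianProductWith⁺; ∈-allFin)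
  open import Data.List.Properties using (concatMap-cong; concatMap-map; concatMap-++; tabulate-cong; map-∘; ++-identityʳ; map-tabulate; map-++)
  open import Data.Nat.Base as ℕ using (ℕ; zero; suc; _+_; _≤_; _<_; z≤n; s≤s)
  import Data.Nat.Properties as ℕₚ
  open import Data.Product.Base using (_×_; _,_)
  open import Data.Unit.Base using (⊤; tt)
  open import Data.Vec.Base as Vec using (Vec; []; _∷_; lookup; _[_]≔_)
  open import Data.Vec.Properties using (lookup∘update; lookup∘update′; lookup-replicate; lookup-map)
  open import Function.Base using (_∘_; id)
  open import Relation.Binary.PropositionalEquality
  open import Relation.Nullary using (Dec; yes; no; does)

  concatMap-concatMap : ∀ {A B C : Set} (g : B → List C) (f : A → List B) xs → concatMap g (concatMap f xs) ≡ concatMap (concatMap g ∘ f) xs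
  concatMap-concatMap g f []       = refl
  concatMap-concatMap g f (x ∷ xs) = trans (concatMap-++ g (f x) (concatMap f xs)) (cong (concatMap g (f x) ++_) (concatMap-concatMap g f xs))

  concatMap-product : ∀ {A B C D : Set} (g : C → List D) (f : A → B → C) xs ys →
    concatMap g (cartesianProductWith f xs ys) ≡ concatMap (λ x → concatMap (λ y → g (f x y)) ys) xs
  concatMap-product g f []       ys = refl
  concatMap-product g f (x ∷ xs) ys = trans (concatMap-++ g (List.map (f x) ys) _)
    (cong₂ _++_ (concatMap-map g (f x) ys) (concatMap-product g f xs ys))

  map-product : ∀ {A B C : Set} (f : A × B → C) xs ys → List.map f (cartesianProduct xs ys) ≡ concatMap (λ x → List.map (f ∘ (x ,_)) ys) xs
  map-product f []       ys = refl
  map-product f (x ∷ xs) ys = trans (map-++ f (List.map (x ,_) ys) _)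
    (cong₂ _++_ (sym (map-∘ ys)) (map-product f xs ys))

  loop-allFin : ∀ {A : Set} n (f : ℕ → List A) → loop n 0 f ≡ concatMap (f ∘ toℕ) (allFin n)
  loop-allFin n f = trans (go n 0 f) (cong List.concat (sym (map-tabulate {n = n} id (f ∘ toℕ))))
    where
    go : ∀ {A : Set} n i (f : ℕ → List A) → loop n i f ≡ List.concat (tabulate {n = n} (λ k → f (i + toℕ k)))
    go zero    i f = refl
    go (suc n) i f = cong₂ _++_ (cong f (sym (ℕₚ.+-identityʳ i)))
      (trans (go n (suc i) f) (cong List.concat (tabulate-cong {n = n} (λ k → cong f (sym (ℕₚ.+-suc i (toℕ k)))))))

  loop-letters : ∀ {A : Set} (F : Letter → List A) n u (f : ℕ → List A) →
    (∀ k ι → k < length u → (∀ ι′ → letterAt u k ι′ ≡ does (ι ≟ᶠ ι′)) → f (n + k) ≡ F ι) →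
    loop (length u) n f ≡ concatMap F u
  loop-letters F n []      f h = refl
  loop-letters F n (ι ∷ u) f h = cong₂ _++_ (trans (cong f (sym (ℕₚ.+-identityʳ n))) (h 0 ι (s≤s z≤n) λ _ → refl))
    (loop-letters F (suc n) u f λ k ι′ lt e → trans (cong f (sym (ℕₚ.+-suc n k))) (h (suc k) ι′ (s≤s lt) e))

  replicate-++ : ∀ {A : Set} m n {a : A} → replicate m a ++ replicate n a ≡ replicate (m + n) a
  replicate-++ zero    n = refl
  replicate-++ (suc m) n = cong (_ ∷_) (replicate-++ m n)

  module _ {h : ℕ} where

    -- Nested loops use strictly increasing variables from b on, so a loop variable is always
    -- inactive when its loop is entered; this gives `Scoped`.
    Closed : ℕ → Gen {h} → Set
    Closed b nil            = ⊤
    Closed b (emit _)       = ⊤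
    Closed b (G ⨟ H)        = Closed b G × Closed b H
    Closed b (branch _ G H) = Closed b G × Closed b H
    Closed b (for j G)      = b ≤ toℕ j × Closed (suc (toℕ j)) G

    closed-mono : ∀ {b b′} G → b ≤ b′ → Closed b′ G → Closed b G
    closed-mono nil            le c         = tt
    closed-mono (emit _)       le c         = tt
    closed-mono (G ⨟ H)        le (c , c′)  = closed-mono G le c , closed-mono H le c′
    closed-mono (branch _ G H) le (c , c′)  = closed-mono G le c , closed-mono H le c′
    closed-mono (for j G)      le (lt , c)  = ℕₚ.≤-trans le lt , c

    closed-scoped : ∀ {b} G u ρ → Closed b G → (∀ i → b ≤ toℕ i → lookup ρ i ≡ length u) → Scoped G u ρ
    closed-scoped nil            u ρ c        fresh = tt
    closed-scoped (emit _)       u ρ c        fresh = tt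
    closed-scoped (G ⨟ H)        u ρ (c , c′) fresh = closed-scoped G u ρ c fresh , closed-scoped H u ρ c′ fresh
    closed-scoped (branch _ G H) u ρ (c , c′) fresh = closed-scoped G u ρ c fresh , closed-scoped H u ρ c′ fresh
    closed-scoped (for j G)      u ρ (le , c) fresh = fresh j le , λ x → closed-scoped G u (ρ [ j ]≔ x) c λ i lt →
      trans (lookup∘update′ (λ i≡j → ℕₚ.<-irrefl (cong toℕ (sym i≡j)) lt) ρ x) (fresh i (ℕₚ.≤-trans le (ℕₚ.<⇒≤ lt)))

    closed-ground : ∀ G u → Closed 0 G → Scoped G u (ground u)
    closed-ground G u c = closed-scoped G u (ground u) c λ i _ → lookup-replicate i (length u)

    Block : ∀ {n} → ℕ → (Fin n → Fin h) → Set
    Block b σ = ∀ r → toℕ (σ r) ≡ b + toℕ r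

    block-suc : ∀ {n b} {σ : Fin (suc n) → Fin h} → Block b σ → Block (suc b) (σ ∘ suc)
    block-suc {b = b} B r = trans (B (suc r)) (ℕₚ.+-suc b (toℕ r))

    block-injective : ∀ {n b} {σ : Fin n → Fin h} → Block b σ → ∀ r s → σ r ≡ σ s → r ≡ s
    block-injective {b = b} B r s eq = toℕ-injective
      (ℕₚ.+-cancelˡ-≡ b _ _ (trans (sym (B r)) (trans (cong toℕ eq) (B s))))

    emitAll : List Letter → Gen {h}
    emitAll []      = nil
    emitAll (ι ∷ w) = emit ι ⨟ emitAll w

    emitAll-prints : ∀ w u ρ → ⟦ emitAll w ⟧ u ρ ≡ w
    emitAll-prints []      u ρ = refl
    emitAll-prints (ι ∷ w) u ρ = cong (ι ∷_) (emitAll-prints w u ρ)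

    emitAll-closed : ∀ {b} w → Closed b (emitAll w)
    emitAll-closed []      = tt
    emitAll-closed (ι ∷ w) = tt , emitAll-closed w

    -- Unrolled into the program, in contrast to `forEach`, so the list must not depend on the input
    -- word.
    forAll : {A : Set} → List A → (A → Gen {h}) → Gen {h}
    forAll []       G = nil
    forAll (x ∷ xs) G = G x ⨟ forAll xs G

    forAll-prints : ∀ {A : Set} (xs : List A) G u ρ → ⟦ forAll xs G ⟧ u ρ ≡ concatMap (λ x → ⟦ G x ⟧ u ρ) xs
    forAll-prints []       G u ρ = refl
    forAll-prints (x ∷ xs) G u ρ = cong (⟦ G x ⟧ u ρ ++_) (forAll-prints xs G u ρ)

    forAll-closed : ∀ {A : Set} {b} (xs : List A) G → (∀ x → Closed b (G x)) → Closed b (forAll xs G)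
    forAll-closed []       G c = tt
    forAll-closed (x ∷ xs) G c = c x , forAll-closed xs G c

    when : {P : Set} → Dec P → Gen {h} → Gen {h}
    when (yes _) G = G
    when (no  _) G = nil

    when-closed : ∀ {b} {P : Set} (P? : Dec P) G → Closed b G → Closed b (when P? G)
    when-closed (yes _) G c = c
    when-closed (no  _) G c = tt

    forEach : ∀ {n} → (Fin n → Fin h) → Gen {h} → Gen {h}
    forEach {zero}  σ G = G
    forEach {suc n} σ G = for (σ zero) (forEach (σ ∘ suc) G)

    assign : ∀ {n N} → (Fin n → Fin h) → Vec (Fin N) n → Vec ℕ h → Vec ℕ h
    assign σ []      ρ = ρ
    assign σ (x ∷ v) ρ = assign (σ ∘ suc) v (ρ [ σ zero ]≔ toℕ x)

    assign-outside : ∀ {n N} (σ : Fin n → Fin h) (v : Vec (Fin N) n) ρ i → (∀ r → σ r ≢ i) → lookup (assign σ v ρ) i ≡ lookup ρ i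
    assign-outside σ []      ρ i ne = refl
    assign-outside σ (x ∷ v) ρ i ne = trans (assign-outside (σ ∘ suc) v _ i (ne ∘ suc)) (lookup∘update′ (ne zero ∘ sym) ρ (toℕ x))

    assign-inside : ∀ {n N} (σ : Fin n → Fin h) (v : Vec (Fin N) n) ρ → (∀ r s → σ r ≡ σ s → r ≡ s) →
      ∀ r → lookup (assign σ v ρ) (σ r) ≡ toℕ (lookup v r)
    assign-inside σ (x ∷ v) ρ inj zero    = trans (assign-outside (σ ∘ suc) v _ (σ zero) (λ r eq → 0≢1+n (sym (inj (suc r) zero eq))))
      (lookup∘update (σ zero) ρ (toℕ x))
    assign-inside σ (x ∷ v) ρ inj (suc r) = assign-inside (σ ∘ suc) v _ (λ r s eq → suc-injective (inj (suc r) (suc s) eq)) r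

    forEach-prints : ∀ {n} (σ : Fin n → Fin h) G u ρ →
      ⟦ forEach σ G ⟧ u ρ ≡ concatMap (λ v → ⟦ G ⟧ u (assign σ v ρ)) (vecs (allFin (length u)) n)
    forEach-prints {zero}  σ G u ρ = sym (++-identityʳ _)
    forEach-prints {suc n} σ G u ρ = trans (loop-allFin (length u) (λ i → ⟦ forEach (σ ∘ suc) G ⟧ u (ρ [ σ zero ]≔ i)))
      (trans (concatMap-cong (λ x → forEach-prints (σ ∘ suc) G u (ρ [ σ zero ]≔ toℕ x)) (allFin (length u)))
        (sym (concatMap-product (λ v → ⟦ G ⟧ u (assign σ v ρ)) _∷_ (allFin (length u)) (vecs (allFin (length u)) n))))

    forEach-closed : ∀ {n b} {σ : Fin n → Fin h} G → Block b σ → Closed (b + n) G → Closed b (forEach σ G)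
    forEach-closed {zero}  {b} G B c = closed-mono G (ℕₚ.≤-reflexive (sym (ℕₚ.+-identityʳ b))) c
    forEach-closed {suc n} {b} {σ} G B c = ℕₚ.≤-reflexive (sym at-b) ,
      closed-mono (forEach (σ ∘ suc) G) (ℕₚ.≤-reflexive (cong suc at-b)) (forEach-closed G (block-suc B) (subst (λ b → Closed b G) (ℕₚ.+-suc b n) c))
      where
      at-b : toℕ (σ zero) ≡ b
      at-b = trans (B zero) (ℕₚ.+-identityʳ b)

    ask : ∀ {n} → Vec (Atom h) n → (Vec Bool n → Gen {h}) → Gen {h}
    ask []       k = k []
    ask (a ∷ as) k = branch a (ask as (k ∘ (true ∷_))) (ask as (k ∘ (false ∷_)))

    ask-prints : ∀ {n} (as : Vec (Atom h) n) k u ρ → ⟦ ask as k ⟧ u ρ ≡ ⟦ k (Vec.map (λ a → holds a u ρ) as) ⟧ u ρ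
    ask-prints []       k u ρ = refl
    ask-prints (a ∷ as) k u ρ with holds a u ρ
    ... | true  = ask-prints as (k ∘ (true ∷_)) u ρ
    ... | false = ask-prints as (k ∘ (false ∷_)) u ρ

    ask-closed : ∀ {n b} (as : Vec (Atom h) n) k → (∀ bs → Closed b (k bs)) → Closed b (ask as k)
    ask-closed []       k c = c []
    ask-closed (a ∷ as) k c = ask-closed as _ (c ∘ (true ∷_)) , ask-closed as _ (c ∘ (false ∷_))

    allAtoms : List (Atom h)
    allAtoms = cartesianProductWith same (allFin h) (allFin h) ++ cartesianProductWith succ (allFin h) (allFin h) ++
      List.map first (allFin h) ++ cartesianProductWith letter (allFin h) (allFin 4)

    ∈-allAtoms : ∀ a → a ∈ allAtoms
    ∈-allAtoms (same i j) = ∈-++⁺ˡ (∈-cartesianProductWith⁺ same (∈-allFin i) (∈-allFin j))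
    ∈-allAtoms (succ i j) = ∈-++⁺ʳ (cartesianProductWith same (allFin h) (allFin h))
      (∈-++⁺ˡ (∈-cartesianProductWith⁺ succ (∈-allFin i) (∈-allFin j)))
    ∈-allAtoms (first i) = ∈-++⁺ʳ (cartesianProductWith same (allFin h) (allFin h))
      (∈-++⁺ʳ (cartesianProductWith succ (allFin h) (allFin h)) (∈-++⁺ˡ (∈-map⁺ first (∈-allFin i))))
    ∈-allAtoms (letter i ι) = ∈-++⁺ʳ (cartesianProductWith same (allFin h) (allFin h))
      (∈-++⁺ʳ (cartesianProductWith succ (allFin h) (allFin h))
        (∈-++⁺ʳ (List.map first (allFin h)) (∈-cartesianProductWith⁺ letter (∈-allFin i) (∈-allFin ι))))

    answers : Vec Bool (length allAtoms) → Atom h → Bool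
    answers bs a = lookup bs (Any.index (∈-allAtoms a))

    -- All answers are collected before the continuation is selected. It may thus be any function of
    -- the oracle, and a search such as `passes?` takes place while the program is built, not while
    -- it runs.
    consult : ((Atom h → Bool) → Gen {h}) → Gen {h}
    consult k = ask (Vec.fromList allAtoms) (k ∘ answers)

    consult-prints : ∀ k u ρ {w} → (∀ O → (∀ a → O a ≡ holds a u ρ) → ⟦ k O ⟧ u ρ ≡ w) → ⟦ consult k ⟧ u ρ ≡ w
    consult-prints k u ρ h = trans (ask-prints (Vec.fromList allAtoms) (k ∘ answers) u ρ) (h _ correct)
      where
      correct : ∀ a → answers (Vec.map (λ a → holds a u ρ) (Vec.fromList allAtoms)) a ≡ holds a u ρ
      correct a = trans (lookup-map (Any.index (∈-allAtoms a)) _ (Vec.fromList allAtoms))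
        (cong (λ a → holds a u ρ) (trans (lookup-fromList allAtoms (Any.index (∈-allAtoms a))) (sym (Anyₚ.lookup-index (∈-allAtoms a)))))

    consult-closed : ∀ {b} k → (∀ O → Closed b (k O)) → Closed b (consult k)
    consult-closed k c = ask-closed (Vec.fromList allAtoms) (k ∘ answers) (c ∘ answers)

-- Printing the word that describes the constraint system.

module Translation where

  open import Defs using (Poly; eval; pair)
  open LoopPrograms
  open Pipeline using (bitLetter; ground; output-of)
  open ConstraintHypergraph using (letterAt)
  open Certificates using (word)
  open Scanning
  open LoopMacros
  open import Data.Bool.Base using (Bool; true; false; if_then_else_)
  open import Data.Fin.Base using (Fin; zero; suc; toℕ)
  open import Data.Fin.Properties using () renaming (_≟_ to _≟ᶠ_)
  open import Data.List.Base as List using (List; []; _∷_; _++_; length; concatMap; replicate)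
  open import Data.Nat.Base as ℕ using (ℕ; zero; suc; _+_; _*_; _<_; z≤n)
  import Data.Nat.Properties as ℕₚ
  open import Data.Product.Base using (_,_)
  open import Data.Unit.Base using (tt)
  open import Data.Vec.Base as Vec using (_[_]≔_)
  open import Data.Vec.Properties using (lookup∘update)
  open import Function.Base using (_∘_)
  open import Relation.Binary.PropositionalEquality
  open import Relation.Nullary using (does)

  pair-++ : ∀ x w → pair x w ≡ pair x [] ++ w
  pair-++ []      w = refl
  pair-++ (b ∷ x) w = cong (λ y → b ∷ b ∷ y) (pair-++ x w)

  length-pair : ∀ x w → length (pair x w) ≡ 2 + 2 * length x + length w
  length-pair []      w = refl
  length-pair (b ∷ x) w = cong (2 +_) (trans (length-pair x w) (cong (_+ length w) (sym (ℕₚ.+-suc (suc (length x)) (length x + 0)))))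

  module _ {h : ℕ} where

    letter-holds : ∀ (j : Fin h) ι′ u ρ k → k < length u → holds (letter j ι′) u (ρ [ j ]≔ k) ≡ letterAt u k ι′
    letter-holds j ι′ u ρ k lt = trans
      (holds-numeric (ρ [ j ]≔ k) u (letter j ι′) (subst (_< length u) (sym (lookup∘update j ρ k)) lt))
      (cong (λ x → letterAt u x ι′) (lookup∘update j ρ k))

    for-prints : ∀ (F : Letter → List Letter) (j : Fin h) G u ρ →
      (∀ k ι → (∀ ι′ → holds (letter j ι′) u (ρ [ j ]≔ k) ≡ does (ι ≟ᶠ ι′)) → ⟦ G ⟧ u (ρ [ j ]≔ k) ≡ F ι) →
      ⟦ for j G ⟧ u ρ ≡ concatMap F u
    for-prints F j G u ρ body = loop-letters F 0 u _ λ k ι lt at → body k ι λ ι′ → trans (letter-holds j ι′ u ρ k lt) (at ι′)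

    twice : Letter → List Letter
    twice bit0 = bit0 ∷ bit0 ∷ []
    twice bit1 = bit1 ∷ bit1 ∷ []
    twice _    = []

    doubler doubling : Fin h → Gen {h}
    doubler  j = branch (letter j bit0) (emitAll (bit0 ∷ bit0 ∷ []))
                (branch (letter j bit1) (emitAll (bit1 ∷ bit1 ∷ [])) nil)
    doubling j = for j (doubler j)

    doubling-prints : ∀ j u ρ → ⟦ doubling j ⟧ u ρ ≡ concatMap twice u
    doubling-prints j u ρ = for-prints twice j (doubler j) u ρ body
      where
      body : ∀ k ι → (∀ ι′ → holds (letter j ι′) u (ρ [ j ]≔ k) ≡ does (ι ≟ᶠ ι′)) →
        ⟦ doubler j ⟧ u (ρ [ j ]≔ k) ≡ twice ι
      body k ι at rewrite at bit0 | at bit1 = cases ι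
        where
        cases : ∀ ι → (if does (ι ≟ᶠ bit0) then bit0 ∷ bit0 ∷ [] else (if does (ι ≟ᶠ bit1) then bit1 ∷ bit1 ∷ [] else [])) ≡ twice ι
        cases bit0 = refl
        cases bit1 = refl
        cases free = refl
        cases pad  = refl

    -- Horner's scheme: one round of the loop for each letter but the final pad.
    copies : Letter → (p : Poly) → (Fin (length p) → Fin h) → Gen {h}
    copies ι []      η = nil
    copies ι (a ∷ p) η = emitAll (replicate a ι) ⨟
      for (η zero) (branch (letter (η zero) pad) nil (copies ι p (η ∘ suc)))

    unless-pad : List Letter → Letter → List Letter
    unless-pad w pad = []
    unless-pad w _   = w

    unless-pad-word : ∀ n {ι} (x : List Bool) → concatMap (unless-pad (replicate n ι)) (List.map bitLetter x ++ pad ∷ []) ≡ replicate (length x * n) ι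
    unless-pad-word n []          = refl
    unless-pad-word n (false ∷ x) = trans (cong (replicate n _ ++_) (unless-pad-word n x)) (replicate-++ n (length x * n))
    unless-pad-word n (true  ∷ x) = trans (cong (replicate n _ ++_) (unless-pad-word n x)) (replicate-++ n (length x * n))

    copies-prints : ∀ ι p η x ρ → ⟦ copies ι p η ⟧ (List.map bitLetter x ++ pad ∷ []) ρ ≡ replicate (eval p (length x)) ι
    copies-prints ι []      η x ρ = refl
    copies-prints ι (a ∷ p) η x ρ = trans (cong₂ _++_ (emitAll-prints (replicate a ι) u ρ)
      (trans (for-prints (unless-pad (replicate (eval p (length x)) ι)) (η zero) (branch (letter (η zero) pad) nil (copies ι p (η ∘ suc))) u ρ body) (unless-pad-word (eval p (length x)) x)))
      (replicate-++ a (length x * eval p (length x)))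
      where
      u = List.map bitLetter x ++ pad ∷ []
      body : ∀ k ι₁ → (∀ ι′ → holds (letter (η zero) ι′) u (ρ [ η zero ]≔ k) ≡ does (ι₁ ≟ᶠ ι′)) →
        ⟦ branch (letter (η zero) pad) nil (copies ι p (η ∘ suc)) ⟧ u (ρ [ η zero ]≔ k) ≡ unless-pad (replicate (eval p (length x)) ι) ι₁
      body k ι₁ at rewrite at pad | copies-prints ι p (η ∘ suc) x (ρ [ η zero ]≔ k) = cases ι₁
        where
        cases : ∀ ι₁ {w : List Letter} → (if does (ι₁ ≟ᶠ pad) then [] else w) ≡ unless-pad w ι₁
        cases bit0 = refl
        cases bit1 = refl
        cases free = refl
        cases pad  = refl

    copies-closed : ∀ {b} ι p {η} → Block b η → Closed b (copies ι p η)
    copies-closed ι []      B = tt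
    copies-closed {b} ι (a ∷ p) {η} B = emitAll-closed (replicate a ι) , ℕₚ.≤-reflexive (sym at-b) , tt ,
      closed-mono (copies ι p (η ∘ suc)) (ℕₚ.≤-reflexive (cong suc at-b)) (copies-closed ι p (block-suc B))
      where
      at-b : toℕ (η zero) ≡ b
      at-b = trans (B zero) (ℕₚ.+-identityʳ b)

    translator : (p p′ : Poly) → Fin h → (Fin (length p) → Fin h) → (Fin (length p′) → Fin h) → Gen {h}
    translator p p′ j η η′ = doubling j ⨟ emitAll (bit0 ∷ bit1 ∷ []) ⨟ copies free p η ⨟ copies pad p′ η′

    translator-prints : ∀ p p′ j η η′ x →
      output-of (translator p p′ j η η′) (List.map bitLetter x) ≡ word (pair x []) (eval p (length x)) (eval p′ (length x))
    translator-prints p p′ j η η′ x = trans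
      (cong₂ _++_ (doubling-prints j u (ground u)) (cong (λ w → bit0 ∷ bit1 ∷ w)
        (cong₂ _++_ (copies-prints free p η x (ground u)) (copies-prints pad p′ η′ x (ground u)))))
      (paired x)
      where
      u = List.map bitLetter x ++ pad ∷ []
      paired : ∀ x {w} → concatMap twice (List.map bitLetter x ++ pad ∷ []) ++ bit0 ∷ bit1 ∷ w ≡ List.map bitLetter (pair x []) ++ w
      paired []          = refl
      paired (false ∷ x) = cong (λ w → bit0 ∷ bit0 ∷ w) (paired x)
      paired (true  ∷ x) = cong (λ w → bit1 ∷ bit1 ∷ w) (paired x)

    translator-closed : ∀ p p′ j {η η′} {b b′} → Block b η → Block b′ η′ → Closed 0 (translator p p′ j η η′)
    translator-closed p p′ j {η} {η′} B B′ = (z≤n , (tt , tt , tt) , (tt , tt , tt) , tt) , (tt , tt , tt) ,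
      closed-mono (copies free p η) z≤n (copies-closed free p B) , closed-mono (copies pad p′ η′) z≤n (copies-closed pad p′ B′)

-- Printing the hypergraph.

module Printing where

  open import Defs using (encodeEdges; encodeHypergraph)
  open LoopPrograms
  open Pipeline using (bitLetter)
  open ConstraintHypergraph
  open Scanning
  open LoopMacros
  open import Data.Bool.Base using (Bool; true; false; T)
  open import Data.Fin.Base using (Fin; toℕ; combine)
  open import Data.Fin.Properties using (any?; all?; toℕ<n) renaming (_≟_ to _≟ᶠ_)
  open import Data.Fin.Subset using (Subset)
  open import Data.List.Base as List using (List; []; _∷_; _++_; length; concatMap; replicate; allFin; cartesianProduct)
  open import Data.List.Properties using (++-identityʳ; map-++; length-map; length-++; concatMap-cong; map-concatMap; map-∘; map-cong; map-replicate)
  open import Data.Nat.Base as ℕ using (_+_; _≤_; ℕ; _*_; _<_; _≡ᵇ_; z≤n)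
  import Data.Nat.Properties as ℕₚ
  open import Data.Product.Base using (∃-syntax; _×_; _,_)
  open import Data.Unit.Base using (tt)
  open import Data.Vec.Base as Vec using (Vec; lookup)
  open import Data.Vec.Properties using (lookup∘tabulate; toList-map; toList∘fromList) renaming (≡-dec to ≡-decᵛ)
  open import Function.Base using (_∘_)
  open import Function.Bundles using (mk⇔)
  open import Relation.Binary.PropositionalEquality
  open import Relation.Nullary using (Dec; yes; no; does; contradiction)
  open import Relation.Nullary.Decidable using (_×-dec_; T?; does-⇔)

  encodeEdges-concatMap : ∀ {n} (es : List (Subset n)) → encodeEdges es ≡ concatMap (λ e → true ∷ Vec.toList e) es
  encodeEdges-concatMap []       = refl
  encodeEdges-concatMap (e ∷ es) = cong (λ w → true ∷ Vec.toList e ++ w) (encodeEdges-concatMap es)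

  replicate-product : ∀ {A B C : Set} {c : C} (xs : List A) (ys : List B) →
    concatMap (λ _ → replicate (length ys) c) xs ≡ replicate (length (cartesianProduct xs ys)) c
  replicate-product []       ys = refl
  replicate-product {c = c} (x ∷ xs) ys = trans (cong (replicate (length ys) c ++_) (replicate-product xs ys))
    (trans (replicate-++ (length ys) (length (cartesianProduct xs ys)))
      (cong (λ n → replicate n c) (sym (trans (length-++ (List.map (x ,_) ys)) (cong (_+ length (cartesianProduct xs ys)) (length-map (x ,_) ys))))))

  when-prints : ∀ {h} {P Q A : Set} (P? : Dec P) (Q? : Dec Q) → (P → Q) → (Q → P) → ∀ (g : A → List Letter) (a : A) (G : Gen {h}) u ρ →
    ⟦ G ⟧ u ρ ≡ g a → ⟦ when P? G ⟧ u ρ ≡ concatMap g (keep Q? a)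
  when-prints (yes p) (yes q) to from g a G u ρ eq = trans eq (sym (++-identityʳ (g a)))
  when-prints (yes p) (no ¬q) to from g a G u ρ eq = contradiction (to p) ¬q
  when-prints (no ¬p) (yes q) to from g a G u ρ eq = contradiction (from q) ¬p
  when-prints (no ¬p) (no ¬q) to from g a G u ρ eq = refl

  module _ {δ} (C : Constraint δ) (q d t m : ℕ) where
    open Instance C q d t m

    -- The variables σ range over the tuple of clouds of an edge, the variables
    -- τ over the cloud of a vertex.
    module _ {h : ℕ} (σ : Fin (t * S) → Fin h) (τ : Fin S → Fin h) where

      -- The counterpart of `InEdge` in which clouds are compared by atoms, because the positions
      -- are known only to the running program.
      Shown : (Atom h → Bool) → Matrix → Vec (Fin q) L → Set
      Shown O Y y = ∃[ j ] ∃[ g ] ((∀ r → T (O (same (σ (combine j r)) (τ r)))) × entry-of Y j g ≡ y)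

      abstract
        shown? : ∀ O Y y → Dec (Shown O Y y)
        shown? O Y y = any? λ j → any? λ g → (all? λ r → T? _) ×-dec ≡-decᵛ _≟ᶠ_ (entry-of Y j g) y

      printRow : Matrix → (Atom h → Bool) → Gen {h}
      printRow Y O = emitAll (List.map (λ y → bitLetter (does (shown? O Y y))) fills)

      printEdge : Matrix → Gen {h}
      printEdge Y = emit bit1 ⨟ forEach τ (consult (printRow Y))

      printMatrix : (Atom h → Bool) → Matrix → Gen {h}
      printMatrix O Y = when (passes? (O ∘ rename σ) Y) (printEdge Y)

      printMatrices : (Atom h → Bool) → Gen {h}
      printMatrices O = forAll matrices (printMatrix O)

      -- The order is that of `vertexList` and `edges`: clouds in the outer loops, with fillings and
      -- matrices, whose number is constant, unrolled inside.
      printer : Gen {h}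
      printer = forEach τ (emitAll (replicate (length fills) bit1)) ⨟ emit bit0 ⨟ forEach σ (consult printMatrices)

      module _ (Bσ : Block 0 σ) (Bτ : Block (t * S) τ) (u : List Letter) where

        private
          N = length u
          letters : Subset (length (vertexList u)) → List Letter
          letters e = List.map bitLetter (true ∷ Vec.toList e)

        σ≢τ : ∀ r s → τ r ≢ σ s
        σ≢τ r s eq = ℕₚ.<⇒≱ (toℕ<n s) (subst (t * S ≤_) (trans (sym (Bτ r)) (trans (cong toℕ eq) (Bσ s))) (ℕₚ.m≤m+n (t * S) (toℕ r)))

        module _ (W : Vec (Fin N) (t * S)) (ρ : Vec ℕ h) where

          ρ₁ : Vec ℕ h
          ρ₁ = assign σ W ρ

          σ-value : ∀ i → lookup ρ₁ (σ i) ≡ toℕ (lookup W i)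
          σ-value = assign-inside σ W ρ (block-injective Bσ)

          small : ∀ {x} {i : Fin N} → x ≡ toℕ i → x < N
          small {i = i} eq = subst (_< N) (sym eq) (toℕ<n i)

          in-range : ∀ a → InRange ρ₁ u (rename σ a)
          in-range (same i j)   = small (σ-value i)
          in-range (succ i j)   = small (σ-value i) , small (σ-value j)
          in-range (first i)    = small (σ-value i)
          in-range (letter i ι) = small (σ-value i)

          oracle-agrees : ∀ a → holds (rename σ a) u ρ₁ ≡ oracle u W a
          oracle-agrees a = trans (holds-numeric ρ₁ u (rename σ a) (in-range a))
            (trans (numeric-rename u σ (lookup ρ₁) a) (numeric-cong u σ-value a))

          module _ (Y : Matrix) (x : Vec (Fin N) S) where

            ρ₂ : Vec ℕ h
            ρ₂ = assign τ x ρ₁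

            σ-value₂ : ∀ i → lookup ρ₂ (σ i) ≡ toℕ (lookup W i)
            σ-value₂ i = trans (assign-outside τ x ρ₁ (σ i) (λ r → σ≢τ r i)) (σ-value i)

            τ-value : ∀ r → lookup ρ₂ (τ r) ≡ toℕ (lookup x r)
            τ-value = assign-inside τ x ρ₁ (block-injective Bτ)

            same-value : ∀ i r → holds (same (σ i) (τ r)) u ρ₂ ≡ (toℕ (lookup W i) ≡ᵇ toℕ (lookup x r))
            same-value i r = trans (holds-numeric ρ₂ u (same (σ i) (τ r)) (small (σ-value₂ i))) (cong₂ _≡ᵇ_ (σ-value₂ i) (τ-value r))

            row-prints : ⟦ consult (printRow Y) ⟧ u ρ₂ ≡ List.map (λ y → bitLetter (does (inEdge? u W Y (x , y)))) fills
            row-prints = consult-prints (printRow Y) u ρ₂ λ O eq → trans (emitAll-prints _ u ρ₂)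
              (map-cong (λ y → cong bitLetter (does-⇔ (mk⇔
                (λ (j , g , sc , e) → j , g , lookup-ext (λ r → trans (lookup∘tabulate (λ r → lookup W (combine j r)) r)
                  (numericT⁻ u (subst T (trans (eq _) (same-value (combine j r) r)) (sc r)))) , e)
                (λ { (j , g , refl , e) → j , g , (λ r → subst T (sym (trans (eq _) (same-value (combine j r) r)))
                  (numericT u (sym (lookup∘tabulate (λ r → lookup W (combine j r)) r)))) , e }))
                (shown? O Y y) (inEdge? u W Y (x , y)))) fills)

          edge-prints : ∀ Y → ⟦ printEdge Y ⟧ u ρ₁ ≡ letters (edge u W Y)
          edge-prints Y = cong (bit1 ∷_) (trans (forEach-prints τ (consult (printRow Y)) u ρ₁)
            (trans (concatMap-cong (row-prints Y) (clouds u))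
            (trans (sym (map-product (λ v → bitLetter (does (inEdge? u W Y v))) (clouds u) fills))
            (trans (map-∘ (vertexList u)) (cong (List.map bitLetter)
              (sym (trans (toList-map (λ v → does (inEdge? u W Y v)) (Vec.fromList (vertexList u)))
                (cong (List.map _) (toList∘fromList (vertexList u))))))))))

          matrices-print : ⟦ consult printMatrices ⟧ u ρ₁ ≡ concatMap letters (concatMap (edgesAt u W) matrices)
          matrices-print = consult-prints printMatrices u ρ₁ λ O eq →
            trans (forAll-prints matrices (printMatrix O) u ρ₁)
            (trans (concatMap-cong (λ Y → when-prints (passes? (O ∘ rename σ) Y) (passes? (oracle u W) Y)
                (passes-ext (λ a → trans (eq _) (oracle-agrees a)) {Y}) (passes-ext (λ a → sym (trans (eq _) (oracle-agrees a))) {Y})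
                letters (edge u W Y) (printEdge Y) u ρ₁ (edge-prints Y)) matrices)
              (sym (concatMap-concatMap letters (edgesAt u W) matrices)))

        printer-prints : ∀ ρ → ⟦ printer ⟧ u ρ ≡ List.map bitLetter (encodeHypergraph (hypergraph u))
        printer-prints ρ = trans (cong₂ (λ v w → v ++ bit0 ∷ w) counted printed)
          (sym (map-++ bitLetter (replicate (length (vertexList u)) true) (false ∷ encodeEdges (edges u))))
          where
          counted : ⟦ forEach τ (emitAll (replicate (length fills) bit1)) ⟧ u ρ ≡ List.map bitLetter (replicate (length (vertexList u)) true)
          counted = trans (forEach-prints τ (emitAll (replicate (length fills) bit1)) u ρ)
            (trans (concatMap-cong (λ x → emitAll-prints (replicate (length fills) bit1) u (assign τ x ρ)) (clouds u))
            (trans (replicate-product (clouds u) fills) (sym (map-replicate bitLetter (length (vertexList u)) true))))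
          printed : ⟦ forEach σ (consult printMatrices) ⟧ u ρ ≡ List.map bitLetter (encodeEdges (edges u))
          printed = trans (forEach-prints σ (consult printMatrices) u ρ)
            (trans (concatMap-cong (λ W → matrices-print W ρ) (vecs (allFin N) (t * S)))
            (trans (sym (concatMap-concatMap letters (λ W → concatMap (edgesAt u W) matrices) (vecs (allFin N) (t * S))))
            (sym (trans (cong (List.map bitLetter) (encodeEdges-concatMap (edges u))) (map-concatMap bitLetter _ (edges u))))))

      printer-closed : Block 0 σ → Block (t * S) τ → Closed 0 printer
      printer-closed Bσ Bτ = closed-mono (forEach τ (emitAll (replicate (length fills) bit1))) z≤n (forEach-closed _ Bτ (emitAll-closed (replicate (length fills) bit1))) , tt ,
        forEach-closed (consult printMatrices) Bσ (consult-closed printMatrices λ O → forAll-closed matrices (printMatrix O) λ Y →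
          when-closed (passes? (O ∘ rename σ) Y) (printEdge Y) (tt , forEach-closed (consult (printRow Y)) Bτ
            (consult-closed (printRow Y) λ O → emitAll-closed _)))

-- Assembly of the reduction and its polynomial bounds.

module Reduction where

  open import Defs
  open IndexTheorem using (double)
  open AgreementGap using (cloudSize; families-≥)
  open LoopPrograms using (Letter; Gen; pad)
  open Polynomials
  open Pipeline using (bitLetter; ground; output-of; twoStages)
  open ConstraintHypergraph
  open Soundness using (blocks)
  open Tableaux using (Finite; module Tableau)
  open Certificates
  open LoopMacros
  open Translation
  open Printing
  open import Data.Bool.Base using (Bool; true)
  open import Data.Empty using (⊥-elim)
  open import Data.Fin.Base using (Fin; zero; suc; toℕ; fromℕ<; _↑ˡ_; _↑ʳ_)
  open import Data.Fin.Properties using (toℕ-↑ˡ; toℕ-↑ʳ)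
  open import Data.List.Base as List using (List; []; _∷_; _++_; length; replicate)
  open import Data.List.Properties using (++-assoc; length-++; length-replicate)
  open import Data.Nat.Base as ℕ using (ℕ; zero; suc; _+_; _*_; _∸_; _^_; _≤_; _<_; z≤n; s≤s; ⌊_/2⌋)
  open import Data.Nat.Divisibility using (_∣_; divides)
  open import Data.Nat.Primality using (Prime; prime⇒irreducible)
  import Data.Nat.Properties as ℕₚ
  open import Data.Nat.Tactic.RingSolver using (solve-∀)
  open import Data.Product.Base using (∃-syntax; _×_; _,_)
  open import Data.Sum.Base using (_⊎_; inj₁; inj₂)
  open import Data.Vec.Base as Vec using (Vec)
  open import Function.Base using (_∘_)
  open import Function.Bundles using (_⇔_; module Equivalence)
  open import Relation.Binary.PropositionalEquality
  open import Relation.Nullary using (¬_)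

  n<2^n : ∀ n → n < 2 ^ n
  n<2^n zero    = s≤s z≤n
  n<2^n (suc n) = ℕₚ.≤-trans (ℕₚ.+-mono-≤ (ℕₚ.≤-trans (s≤s z≤n) (n<2^n n)) (n<2^n n))
    (ℕₚ.≤-reflexive (cong (2 ^ n +_) (sym (ℕₚ.+-identityʳ (2 ^ n)))))

  card-≥2 : ∀ {A : Set} (F : Finite A) {a b : A} → a ≢ b → 2 ≤ Finite.card F
  card-≥2 F {a} {b} ne = distinct (Finite.to F a) (Finite.to F b) λ eq →
    ne (trans (sym (Finite.from-to F a)) (trans (cong (Finite.from F) eq) (Finite.from-to F b)))
    where
    distinct : ∀ {n} (i j : Fin n) → i ≢ j → 2 ≤ n
    distinct zero    zero    ne = ⊥-elim (ne refl)
    distinct {suc (suc n)} _ _ ne = s≤s (s≤s z≤n)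

  -- In `sound` the certificate comes before any running time: it is read from the first row alone,
  -- and the length of the word matters only for a given halting run.
  record Encoding (V : TM) : Set where
    field
      {δ}        : ℕ
      constraint : Constraint δ
      2≤δ        : 2 ≤ δ
      complete   : ∀ pre w F P {n z} → length w ≤ F → HaltsIn V n (initial V (pre ++ w)) z → output z ≡ true ∷ [] →
                   Problem.Solution constraint (word pre F P)
      sound      : ∀ pre F P → Problem.Solution constraint (word pre F P) →
                   ∃[ w ] (length w ≤ F × (∀ {n z} → suc n < length (word pre F P) → HaltsIn V n (initial V (pre ++ w)) z → output z ≡ true ∷ []))

  encoding : ∀ V → Encoding V
  encoding V = record
    { constraint = constraint
    ; 2≤δ        = card-≥2 tileFinite {G , zero , b , b , b} {G , suc zero , b , b , b} λ ()
    ; complete   = λ pre w F P short → complete (word pre F P) (pre ++ w) (certificate-fits pre w F P short)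
    ; sound      = λ pre F P sol →
        let (w , short , row) = certificate pre F P (firstRow (word pre F P) sol) (firstRow-fits (word pre F P) sol) (firstRow-blank (word pre F P) sol)
        in w , short , Tableau.sound V (word pre F P) sol (pre ++ w) row }
    where
    open Tableau V
    G : Global
    G = TM.start V , Vec.replicate _ blank
    b : Cell
    b = Vec.replicate _ (blank , blank)

  module _ {δ} (C : Constraint δ) (q d t m : ℕ) (p p′ : Poly) where
    open Instance C q d t m

    -- The successor is the `pad` that the second stage appends to the printed word.
    instance-word : List Bool → List Letter
    instance-word x = word (pair x []) (eval p (length x)) (suc (eval p′ (length x)))

    instance-polytime : PolyTime (λ x → encodeHypergraph (hypergraph (instance-word x)))
    instance-polytime = twoStages G₁ G₂ _
      (λ u → closed-ground G₁ (u ++ pad ∷ []) (translator-closed p p′ j {η} {η′} {b} {b + length p} η-block η′-block))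
      (λ u → closed-ground G₂ (u ++ pad ∷ []) (printer-closed C q d t m σ τ σ-block τ-block))
      computes
      where
      -- The variables in increasing order: t S for a tuple of clouds, S for the cloud of a vertex,
      -- one for doubling the bits, then two groups for the Horner loops. Both stages run on one
      -- machine and share h.
      a b E h : ℕ
      a = t * S + S
      b = a + 1
      E = length p + length p′
      h = a + suc E
      σ : Fin (t * S) → Fin h
      σ r = (r ↑ˡ S) ↑ˡ suc E
      τ : Fin S → Fin h
      τ r = (t * S ↑ʳ r) ↑ˡ suc E
      j : Fin h
      j = a ↑ʳ zero {E}
      η : Fin (length p) → Fin h
      η i = a ↑ʳ suc (i ↑ˡ length p′)
      η′ : Fin (length p′) → Fin h
      η′ i = a ↑ʳ suc (length p ↑ʳ i)
      σ-block : Block 0 σ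
      σ-block r = trans (toℕ-↑ˡ (r ↑ˡ S) (suc E)) (toℕ-↑ˡ r S)
      τ-block : Block (t * S) τ
      τ-block r = trans (toℕ-↑ˡ (t * S ↑ʳ r) (suc E)) (toℕ-↑ʳ (t * S) r)
      η-block : Block b η
      η-block i = trans (toℕ-↑ʳ a (suc (i ↑ˡ length p′))) (trans (cong (λ n → a + suc n) (toℕ-↑ˡ i (length p′))) (sym (ℕₚ.+-assoc a 1 (toℕ i))))
      η′-block : Block (b + length p) η′
      η′-block i = trans (toℕ-↑ʳ a (suc (length p ↑ʳ i))) (trans (cong (λ n → a + suc n) (toℕ-↑ʳ (length p) i))
        (trans (sym (ℕₚ.+-assoc a 1 (length p + toℕ i))) (sym (ℕₚ.+-assoc b (length p) (toℕ i)))))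
      G₁ G₂ : Gen {h}
      G₁ = translator p p′ j η η′
      G₂ = printer C q d t m σ τ
      padded : ∀ pre F P → word pre F P ++ pad ∷ [] ≡ word pre F (suc P)
      padded pre F P = trans (++-assoc (List.map bitLetter pre) _ _) (cong (List.map bitLetter pre ++_)
        (trans (++-assoc (replicate F _) _ _) (cong (replicate F _ ++_) (snoc P))))
        where
        snoc : ∀ P → replicate P pad ++ pad ∷ [] ≡ replicate (suc P) pad
        snoc zero    = refl
        snoc (suc P) = cong (pad ∷_) (snoc P)
      computes : ∀ x → output-of G₂ (output-of G₁ (List.map bitLetter x)) ≡ List.map bitLetter (encodeHypergraph (hypergraph (instance-word x)))
      computes x = trans (cong (λ u → ⟦ u ⟧₂) (trans (cong (_++ pad ∷ []) (translator-prints p p′ j η η′ x)) (padded (pair x []) _ _)))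
        (printer-prints C q d t m σ τ σ-block τ-block (instance-word x) (ground (instance-word x)))
        where
        ⟦_⟧₂ : List Letter → List Letter
        ⟦ u ⟧₂ = LoopPrograms.⟦_⟧ G₂ u (ground u)

    length-instance : ∀ x → eval p′ (length x) < length (instance-word x)
    length-instance x = ℕₚ.≤-trans (ℕₚ.≤-reflexive (sym (length-replicate (suc P))))
      (ℕₚ.≤-trans (ℕₚ.≤-trans (ℕₚ.m≤n+m (length (replicate (suc P) pad)) (length (replicate F LoopPrograms.free)))
        (ℕₚ.≤-reflexive (sym (length-++ (replicate F LoopPrograms.free)))))
      (ℕₚ.≤-trans (ℕₚ.m≤n+m _ (length (List.map bitLetter (pair x [])))) (ℕₚ.≤-reflexive (sym (length-++ (List.map bitLetter (pair x [])))))))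
      where
      F = eval p (length x)
      P = eval p′ (length x)

  module _ {d′ t′ q c} (J₁ J₂ : ℕ) (pd : Prime (suc d′)) (1<d : 1 < suc d′) (pt : Prime (suc t′)) (1<t : 1 < suc t′)
           (even₁ : c * d′ ≡ double J₁) (even₂ : c * t′ ≡ double J₂) (d≤q : suc d′ ≤ q)
           (bound : q + c * t′ < suc t′ * suc (suc d′)) (1≤c : 1 ≤ c) where

    private
      d = suc d′
      t = suc t′

    -- The value of m. It depends on the tile alphabet and the fixed parameters, but not on the
    -- input, so the number of clouds is polynomial.
    entries : ℕ → ℕ
    entries δ = cloudSize δ (t * double J₁) (c * ((q ^ d) ^ t)) t

    -- Two exponentials of slack: m ≥ 2^M > M for M candidates, and a cloud has δ^m ≥ 2^m > m
    -- columns.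
    candidates<labels : ∀ {δ} → 2 ≤ δ → double J₁ < δ ^ entries δ
    candidates<labels {δ} 2≤δ = begin-strict
      double J₁                  ≤⟨ ℕₚ.m≤m+n (double J₁) _ ⟩
      M                          <⟨ n<2^n M ⟩
      2 ^ M                      ≤⟨ ℕₚ.m≤m*n (2 ^ M) (AgreementGap.families δ M t) {{ℕ.>-nonZero (families-≥ δ M t)}} ⟩
      2 ^ M * AgreementGap.families δ M t ≤⟨ ℕₚ.m≤n*m _ (c * ((q ^ d) ^ t)) {{ℕ.>-nonZero types-positive}} ⟩
      entries δ                  <⟨ n<2^n (entries δ) ⟩
      2 ^ entries δ              ≤⟨ ℕₚ.^-monoˡ-≤ (entries δ) 2≤δ ⟩
      δ ^ entries δ              ∎
      where
      open ℕₚ.≤-Reasoning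
      M = t * double J₁
      types-positive : 1 ≤ c * ((q ^ d) ^ t)
      types-positive = ℕₚ.*-mono-≤ 1≤c (ℕₚ.m^n>0 (q ^ d) {{ℕ.>-nonZero (ℕₚ.m^n>0 q {{ℕ.>-nonZero (ℕₚ.≤-trans (s≤s z≤n) d≤q)}} d)}} t)

    colorable⇒solution : ∀ {δ} (C : Constraint δ) → 2 ≤ δ → ∀ u → t * entries δ < length u →
      Colorable c (Instance.hypergraph C q d t (entries δ) u) → ¬ ¬ Problem.Solution C u
    colorable⇒solution {δ} C 2≤δ u long (χ , proper) k =
      -- Blocks exist in each cloud under double negation; finite choice supplies them for all
      -- clouds at once.
      vecChoice (Instance.S C q d t (entries δ)) (λ x → blocks J₁ J₂ pd 1<d pt 1<t (ℕₚ.≤-reflexive even₁) even₂ d≤q bound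
          (λ y → χ (Instance.index C q d t (entries δ) u (x , y)))) λ B →
        Soundness.sound C q d t (entries δ) c u (double J₁) χ proper (candidates<labels 2≤δ) (fromℕ< (candidates<labels 2≤δ)) zero B refl long k

    module _ {L : Language} {verify : List Bool → List Bool} (p : Poly) {V : TM} (pv : Poly)
      (runs : ∀ x → ∃[ n ] ∃[ z ] (n ≤ eval pv (length x) × HaltsIn V n (initial V x) z × output z ≡ verify x))
      (correct : ∀ x → L x ⇔ (∃[ w ] (length w ≤ eval p (length x) × verify (pair x w) ≡ true ∷ [])))
      (enc : Encoding V) where

      private open module Enc = Encoding enc using (δ; constraint)

      -- Bounds the length of `pair x w` over all admissible certificates w.
      certified : Poly
      certified = constant 2 ⊕ constant 2 ⊗ variableᵖ ⊕ p
      -- Enough padding for the running time of the verifier and for more than t m positions, from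
      -- which fresh variables are drawn.
      p′ : Poly
      p′ = pv ∘ᵖ certified ⊕ constant (suc (t * entries δ))
      u : List Bool → List Letter
      u = instance-word constraint q d t (entries δ) p p′
      f : List Bool → Hypergraph (t * d)
      f x = Instance.hypergraph constraint q d t (entries δ) (u x)
      eval-certified : ∀ n → eval certified n ≡ 2 + 2 * n + eval p n
      eval-certified n = trans (eval-⊕ (constant 2 ⊕ constant 2 ⊗ variableᵖ) p n) (cong (_+ eval p n)
        (trans (eval-⊕ (constant 2) (constant 2 ⊗ variableᵖ) n) (cong₂ _+_ (eval-constant 2 n)
          (trans (eval-⊗ (constant 2) variableᵖ n) (cong₂ _*_ (eval-constant 2 n) (eval-variable n))))))
      eval-p′ : ∀ n → eval p′ n ≡ eval pv (2 + 2 * n + eval p n) + suc (t * entries δ)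
      eval-p′ n = trans (eval-⊕ (pv ∘ᵖ certified) (constant (suc (t * entries δ))) n)
        (cong₂ _+_ (trans (eval-∘ pv certified n) (cong (eval pv) (eval-certified n))) (eval-constant (suc (t * entries δ)) n))
      long-enough : ∀ x → eval pv (2 + 2 * length x + eval p (length x)) + suc (t * entries δ) < length (u x)
      long-enough x = subst (_< length (u x)) (eval-p′ (length x)) (length-instance constraint q d t (entries δ) p p′ x)
      yes-case : ∀ x → L x → RainbowColorable q (q ∸ d) (f x)
      yes-case x Lx with Equivalence.to (correct x) Lx
      ... | w , short , accepts with runs (pair x w)
      ...   | n , z , _ , hl , out = Instance.complete constraint q d t (entries δ) (u x)
        (Enc.complete (pair x []) w (eval p (length x)) _ short
          (subst (λ y → HaltsIn V n (initial V y) z) (pair-++ x w) hl) (trans out accepts))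
      no-case : ∀ x → ¬ L x → ¬ Colorable c (f x)
      no-case x ¬Lx col = colorable⇒solution constraint Enc.2≤δ (u x)
        (ℕₚ.<-trans (ℕₚ.≤-trans (ℕₚ.n<1+n _) (ℕₚ.m≤n+m _ _)) (long-enough x)) col (¬Lx ∘ member)
        where
        member : Problem.Solution constraint (u x) → L x
        member sol with Enc.sound (pair x []) (eval p (length x)) _ sol
        ... | w , short , accepting with runs (pair x w)
        ...   | n , z , le , hl , out = Equivalence.from (correct x) (w , short ,
          trans (sym out) (accepting in-time (subst (λ y → HaltsIn V n (initial V y) z) (pair-++ x w) hl)))
          where
          in-time : suc n < length (u x)
          in-time = ℕₚ.≤-<-trans (begin
            suc n                                                    ≡⟨ ℕₚ.+-comm 1 n ⟩
            n + 1                                                    ≤⟨ ℕₚ.+-mono-≤ (ℕₚ.≤-trans le (eval-mono pv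
              (ℕₚ.≤-trans (ℕₚ.≤-reflexive (length-pair x w)) (ℕₚ.+-monoʳ-≤ (2 + 2 * length x) short)))) (s≤s z≤n) ⟩
            eval pv (2 + 2 * length x + eval p (length x)) + suc (t * entries δ) ∎) (long-enough x)
            where open ℕₚ.≤-Reasoning

    hardness : NPHard (AlmostRainbow (t * d) q (q ∸ d) c)
    hardness L (verify , p , (V , pv , runs) , correct) =
      f p pv runs correct enc , instance-polytime (Encoding.constraint enc) q d t (entries (Encoding.δ enc)) p (p′ p pv runs correct enc) ,
      yes-case p pv runs correct enc , no-case p pv runs correct enc
      where
      enc = encoding V

  parity : ∀ n → (∃[ J ] n ≡ double J) ⊎ (∃[ J ] n ≡ suc (double J))
  parity zero    = inj₁ (zero , refl)
  parity (suc n) with parity n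
  ... | inj₁ (J , refl) = inj₂ (J , refl)
  ... | inj₂ (J , refl) = inj₁ (suc J , refl)

  double-* : ∀ J → double J ≡ J * 2
  double-* zero    = refl
  double-* (suc J) = cong (λ n → suc (suc n)) (double-* J)

  *-double : ∀ c J → c * double J ≡ double (c * J)
  *-double c J = trans (cong (c *_) (double-* J)) (trans (sym (ℕₚ.*-assoc c J 2)) (sym (double-* (c * J))))

  odd-pred : ∀ n → ¬ (2 ∣ suc n) → ∃[ J ] n ≡ double J
  odd-pred n odd with parity n
  ... | inj₁ h        = h
  ... | inj₂ (J , eq) = ⊥-elim (odd (divides (suc J) (trans (cong suc eq) (double-* (suc J)))))

-- The arithmetic of the parameters.

open import Defs
open import Data.Nat.Base using (ℕ; suc; _+_; _*_; _∸_; _≤_; _<_; s≤s; z≤n; ⌊_/2⌋)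
open import Data.Nat.Divisibility using (_∣_)
open import Data.Nat.Primality using (Prime; prime⇒irreducible)
import Data.Nat.Properties as ℕₚ
open import Data.Nat.Tactic.RingSolver using (solve-∀)
open import Data.Product.Base using (_,_)
open import Data.Sum.Base using (inj₂)
open import Relation.Binary.PropositionalEquality using (_≡_; refl; sym; trans; cong)
open import Relation.Nullary using (¬_)
open Reduction using (odd-pred; *-double; hardness)

theorem1p4 : (c d t q k : ℕ) →
    c ≤ d → 2 ≤ c → 2 ≤ t →
    Prime d → Prime t → ¬ (2 ∣ d) →
    q ≡ t * (d ∸ c + 1) + (c ∸ 1) →
    k ≡ t * d →
    d < ⌊ q /2⌋ →
    NPHard (AlmostRainbow k q (q ∸ d) c)
theorem1p4 c@(suc c′) d@(suc d′) t@(suc t′) q .(t * d) c≤d 2≤c 2≤t pd pt odd qe refl d<q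
  -- Both primes are odd, so c (d - 1) and c (t - 1) are even and can serve as the dimensions 2J.
  -- For t this matters exactly: the counting bound leaves no room to round c (t - 1) up.
  with odd-pred d′ odd | odd-pred t′ t-odd
  where
  open ℕₚ.≤-Reasoning
  -- For t = 2 the formula gives q = 2d - c + 1 ≤ 2d, whereas d < ⌊q/2⌋ gives 2d < q.
  t-odd : ¬ (2 ∣ t)
  t-odd 2∣t with prime⇒irreducible pt 2∣t
  ... | inj₂ 2≡t = ℕₚ.<-irrefl refl (begin-strict
    2 * d                            <⟨ ℕₚ.*-monoʳ-< 2 d<q ⟩
    2 * ⌊ q /2⌋                      ≤⟨ ℕₚ.≤-trans (ℕₚ.≤-reflexive (cong (⌊ q /2⌋ +_) (ℕₚ.+-identityʳ ⌊ q /2⌋)))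
                                          (ℕₚ.≤-trans (ℕₚ.+-monoʳ-≤ ⌊ q /2⌋ (ℕₚ.⌊n/2⌋≤⌈n/2⌉ q)) (ℕₚ.≤-reflexive (ℕₚ.⌊n/2⌋+⌈n/2⌉≡n q))) ⟩
    q                                ≡⟨ trans qe (cong (λ t → t * (d ∸ c + 1) + c′) (sym 2≡t)) ⟩
    2 * (d ∸ c + 1) + c′             ≤⟨ ℕₚ.m≤m+n _ c′ ⟩
    2 * (d ∸ c + 1) + c′ + c′        ≡⟨ lemma (d ∸ c) c′ ⟩
    2 * (d ∸ c + c)                  ≡⟨ cong (2 *_) (ℕₚ.m∸n+n≡m c≤d) ⟩
    2 * d                            ∎)
    where
    lemma : ∀ e c → 2 * (e + 1) + c + c ≡ 2 * (e + suc c)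
    lemma = solve-∀
... | J₁ , even₁ | J₂ , even₂ = hardness (c * J₁) (c * J₂) pd (ℕₚ.≤-trans 2≤c c≤d) pt 2≤t
  (trans (cong (c *_) even₁) (*-double c J₁)) (trans (cong (c *_) even₂) (*-double c J₂))
  (ℕₚ.≤-trans (ℕₚ.<⇒≤ d<q) (ℕₚ.⌊n/2⌋≤n q)) bound (s≤s z≤n)
  where
  -- The choice of q makes q + c (t - 1) equal to t (d + 1) - 1, so the inequality is tight.
  bound : q + c * t′ < t * suc d
  bound = ℕₚ.≤-reflexive (trans (cong (λ q → suc (q + c * t′)) qe) (trans (lemma (d ∸ c) c′ t′) (cong (λ d → t * suc d) (ℕₚ.m∸n+n≡m c≤d))))
    where
    lemma : ∀ e c t → suc (suc t * (e + 1) + c + suc c * t) ≡ suc t * suc (e + suc c)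
    lemma = solve-∀
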